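{- For all integers $i,j,k\ge 1$: one has both $\mathrm{C}_{\sharp\le i+1}\le_{\mathrm W}\mathrm{XC}_j$ and $\mathrm{XC}_j\le_{\mathrm W}\mathrm{Sort}_{k+1}$ if and only if $i\le j\le k$.
   Context: A represented space $\mathbf X$ is a set $X$ with a partial surjection $\delta_{\mathbf X}:\subseteq\mathbb N^{\mathbb N}\to X$ (a $p$ with $\delta_{\mathbf X}(p)=x$ is a name of $x$). A realizer of a (partial) multivalued function $f:\subseteq\mathbf X\rightrightarrows\mathbf Y$ is a partial $F:\subseteq\mathbb N^{\mathbb N}\to\mathbb N^{\mathbb N}$ with $\delta_{\mathbf Y}(F(p))\in f(\delta_{\mathbf X}(p))$ for all names $p$ of points of $\mathrm{dom}(f)$; write $F\vdash f$. Weihrauch reducibility: $f\le_{\mathrm W}g$ iff there are computable $H,K:\subseteq\mathbb N^{\mathbb N}\to\mathbb N^{\mathbb N}$ such that $(p\mapsto K\langle p,GH(p)\rangle)\vdash f$ for every $G\vdash g$. $\mathcal A(\mathbf X)$ is the represented space of closed subsets of $\mathbf X$ with negative information: a name of $A$ is a name of the open set $X\setminus A$ (its continuous characteristic function into Sierpiński space). Closed choice $\mathrm C_{\mathbf X}:\subseteq\mathcal A(\mathbf X)\rightrightarrows\mathbf X$ maps a non-empty closed set $A$ to an arbitrary point of $A$. $\mathrm C_{\sharp\le n}$ is the restriction of $\mathrm C_{\{0,1\}^{\mathbb N}}$ to closed sets $A$ with $1\le|A|\le n$ (up to Weihrauch equivalence one may use $[0,1]^d$, $d\geq 1$, instead of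 $\{0,1\}^{\mathbb N}$). $\mathrm{XC}_n$ is the restriction of $\mathrm C_{[0,1]^n}$ to (non-empty closed) convex sets. $\mathrm{Sort}_d:\{0,\dots,d-1\}^\omega\to\{0,\dots,d-1\}^\omega$ is defined by $\mathrm{Sort}_d(p)=0^{c_0}1^{c_1}\cdots(m-1)^{c_{m-1}}m^{\infty}$, where $m$ is the least symbol occurring infinitely often in $p$ and $c_l=|\{n: p(n)=l\}|$ for $l<m$. -}

module Defs where

import Algebra.Properties.Group as Group
open import Data.Bool.Base using (Bool; true; false; not)
open import Data.Fin.Base as Fin using (Fin; toℕ)
open import Data.Fin.Properties as Fin using (toℕ-injective; toℕ<n)
open import Data.Integer.Base as ℤ using (ℤ; +_; -[1+_])
import Data.Integer.Properties as ℤ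
open import Data.List.Base using (List; []; _∷_; applyUpTo; replicate; concatMap; filter; allFin)
open import Data.Nat.Base as ℕ using (ℕ; zero; suc; pred; _^_)
open import Data.Nat.DivMod using (_/_; _%_; _mod_; m<n⇒m%n≡m; m<n⇒m/n≡0; m*n/n≡m; [m+kn]%n≡m%n; +-distrib-/-∣ʳ)
open import Data.Nat.Divisibility using (n∣m*n)
import Data.Nat.Properties as ℕ
open import Data.Product.Base using (Σ; ∃; ∃₂; _×_; _,_; proj₁; proj₂)
open import Data.Rational.Base as ℚ using (ℚ; 0ℚ; 1ℚ; ½; mkℚ; ∣_∣; ↥_; ↧ₙ_; *<*; *≤*)
  renaming (_+_ to _+ℚ_; _*_ to _*ℚ_; _-_ to _-ℚ_; -_ to -ℚ_; _<_ to _<ℚ_; _≤_ to _≤ℚ_; _/_ to _/ℚ_; _⊔_ to _⊔ℚ_)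
import Data.Rational.Properties as ℚ
import Data.Rational.Unnormalised.Base as ℚᵘ
import Data.Rational.Unnormalised.Properties as ℚᵘ
open import Data.Sum.Base using (inj₁; inj₂)
open import Data.Vec.Base as Vec using (Vec; []; _∷_)
open import Data.Vec.Relation.Binary.Pointwise.Inductive using (Pointwise)
open import Function.Base using (const)
open import Function.Bundles using (Func; Bijection)
open import Level using (0ℓ)
open import Relation.Binary.Bundles using (Setoid)
import Relation.Binary.Construct.On as On
open import Relation.Binary.Definitions using (tri<; tri≈; tri>)
open import Relation.Binary.PropositionalEquality as ≡
  using (_≡_; _≢_; _≗_; refl; sym; trans; cong; cong₂; subst)
open import Relation.Nullary using (¬_; contradiction)
open import Relation.Nullary.Reflects using (Reflects; ofʸ; ofⁿ; det)
open import Relation.Unary using (Pred)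

open Group ℚ.+-0-group using (⁻¹-involutive)

Baire : Set
Baire = ℕ → ℕ

-- ⟨ p , q ⟩ = p 0, q 0, p 1, q 1, …
⟨_,_⟩ : Baire → Baire → Baire
⟨ p , q ⟩ zero    = p zero
⟨ p , q ⟩ (suc n) = ⟨ q , (λ k → p (suc k)) ⟩ n

⟨⟩-cong : ∀ {p p′ q q′} → p ≗ p′ → q ≗ q′ → ⟨ p , q ⟩ ≗ ⟨ p′ , q′ ⟩
⟨⟩-cong e d zero    = e zero
⟨⟩-cong e d (suc n) = ⟨⟩-cong d (λ k → e (suc k)) n

-- Baire space is a setoid under _≗_, so a partial function on it is a
-- single-valued relation compatible with _≗_; its domain need not be decidable.
record PartialFunction : Set₁ where
  field
    graph      : Baire → Baire → Set
    resp       : ∀ {p p′ q q′} → p ≗ p′ → q ≗ q′ → graph p q → graph p′ q′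
    functional : ∀ {p q q′} → graph p q → graph p q′ → q ≗ q′

open PartialFunction using (graph)

infixr 9 _∘ₚ_

_∘ₚ_ : PartialFunction → PartialFunction → PartialFunction
G ∘ₚ F = record
  { graph      = λ p r → ∃ λ q → graph F p q × graph G q r
  ; resp       = λ { e d (q , f , g) → q , F.resp e (λ _ → refl) f , G.resp (λ _ → refl) d g }
  ; functional = λ { (q , f , g) (q′ , f′ , g′) →
      G.functional g (G.resp (λ n → sym (F.functional f f′ n)) (λ _ → refl) g′) }
  }
  where
  module F = PartialFunction F
  module G = PartialFunction G

-- p ↦ ⟨ p , F p ⟩
⟨id,_⟩ : PartialFunction → PartialFunction
⟨id, F ⟩ = record
  { graph      = λ p r → ∃ λ q → graph F p q × r ≗ ⟨ p , q ⟩
  ; resp       = λ { e d (q , f , r≗) → q , F.resp e (λ _ → refl) f ,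
      λ n → trans (sym (d n)) (trans (r≗ n) (⟨⟩-cong e (λ _ → refl) n)) }
  ; functional = λ { (q , f , r≗) (q′ , f′ , r≗′) n →
      trans (r≗ n) (trans (⟨⟩-cong (λ _ → refl) (F.functional f f′) n) (sym (r≗′ n))) }
  }
  where module F = PartialFunction F

-- p ⊨ e [ xs ]⇓ y: the partial recursive function e, with oracle p and
-- arguments xs, is defined with value y.

data Rec : ℕ → Set where
  zero   : Rec 0
  suc    : Rec 1
  oracle : Rec 1
  proj   : ∀ {n} → Fin n → Rec n
  comp   : ∀ {m n} → Rec m → Vec (Rec n) m → Rec n
  prec   : ∀ {n} → Rec n → Rec (2 ℕ.+ n) → Rec (suc n)
  mu     : ∀ {n} → Rec (suc n) → Rec n

infix 4 _⊨_[_]⇓_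

data _⊨_[_]⇓_ (p : Baire) : ∀ {n} → Rec n → Vec ℕ n → ℕ → Set where
  zero   : p ⊨ zero [ [] ]⇓ 0
  suc    : ∀ {x} → p ⊨ suc [ x ∷ [] ]⇓ suc x
  oracle : ∀ {x} → p ⊨ oracle [ x ∷ [] ]⇓ p x
  proj   : ∀ {n} {i : Fin n} {xs} → p ⊨ proj i [ xs ]⇓ Vec.lookup xs i
  comp   : ∀ {m n} {f : Rec m} {gs : Vec (Rec n) m} {xs ys z} →
           Pointwise (λ g y → p ⊨ g [ xs ]⇓ y) gs ys →
           p ⊨ f [ ys ]⇓ z → p ⊨ comp f gs [ xs ]⇓ z
  prec₀  : ∀ {n} {f : Rec n} {g xs y} →
           p ⊨ f [ xs ]⇓ y → p ⊨ prec f g [ 0 ∷ xs ]⇓ y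
  precₛ  : ∀ {n} {f : Rec n} {g k xs y z} →
           p ⊨ prec f g [ k ∷ xs ]⇓ y → p ⊨ g [ k ∷ y ∷ xs ]⇓ z →
           p ⊨ prec f g [ suc k ∷ xs ]⇓ z
  mu     : ∀ {n} {f : Rec (suc n)} {xs y} →
           p ⊨ f [ y ∷ xs ]⇓ 0 →
           (∀ j → j ℕ.< y → ∃ λ z → p ⊨ f [ j ∷ xs ]⇓ suc z) →
           p ⊨ mu f [ xs ]⇓ y

-- A partial function on Baire space is computable when some oracle program
-- computes it on its domain; nothing is required outside the domain.
Computable : PartialFunction → Set
Computable F = ∃ λ (e : Rec 1) → ∀ p q → graph F p q → ∀ n → p ⊨ e [ n ∷ [] ]⇓ q n

record RepresentedSpace : Set₁ where
  field
    setoid : Setoid 0ℓ 0ℓ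

  open Setoid setoid public using (Carrier; _≈_)

  field
    Name             : Baire → Carrier → Set
    Name-resp        : ∀ {p q x y} → p ≗ q → x ≈ y → Name p x → Name q y
    Name-functional  : ∀ {p x y} → Name p x → Name p y → x ≈ y
    Name-surjective  : ∀ x → ∃ λ p → Name p x

open RepresentedSpace using (Carrier; Name)

infix 4 _⇉_

-- Partial multivalued functions; the domain is { x ∣ ∃ λ y → rel x y }.
record _⇉_ (X Y : RepresentedSpace) : Set₁ where
  constructor multi
  field rel : Carrier X → Carrier Y → Set

open _⇉_ using (rel)

infixl 5 _↾_

_↾_ : ∀ {X Y} → X ⇉ Y → Pred (Carrier X) 0ℓ → X ⇉ Y
f ↾ P = multi λ x y → P x × rel f x y

infix 4 _⊢_ _≤W_

_⊢_ : ∀ {X Y} → PartialFunction → X ⇉ Y → Set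
_⊢_ {X} {Y} F f = ∀ p x → Name X p x → ∃ (rel f x) →
  ∃ λ q → graph F p q × ∃ λ y → Name Y q y × rel f x y

_≤W_ : ∀ {X Y Z W} → X ⇉ Y → Z ⇉ W → Set₁
f ≤W g = ∃₂ λ (H K : PartialFunction) → Computable H × Computable K ×
  (∀ (G : PartialFunction) → G ⊢ g → K ∘ₚ ⟨id, G ∘ₚ H ⟩ ⊢ f)

-- Function spaces: a name of f is a Kleene associate of a realizer of f.

-- A bijection, since every positive number is uniquely 2ᵃ(2b+1).
code : List ℕ → ℕ
code []      = 0
code (a ∷ w) = 2 ^ a ℕ.* suc (2 ℕ.* code w)

-- q n is the first answer, shifted by one, that α gives on n and the finite
-- prefixes of p; the answer 0 asks for a longer prefix.
associate : Baire → PartialFunction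
associate α = record
  { graph      = λ p q → ∀ n → ∃ λ k → Answer p n k (q n)
  ; resp       = λ {p} {p′} e d h n → let (k , a , b) = h n in
      k , trans (cong (λ w → α (code (n ∷ w))) (sym (applyUpTo-cong e k))) (trans a (cong suc (d n)))
        , λ j j<k → trans (cong (λ w → α (code (n ∷ w))) (sym (applyUpTo-cong e j))) (b j j<k)
  ; functional = λ {p} h h′ n → unique {p} {n} (proj₂ (h n)) (proj₂ (h′ n))
  }
  where
  Answer : Baire → ℕ → ℕ → ℕ → Set
  Answer p n k y = α (code (n ∷ applyUpTo p k)) ≡ suc y ×
                   (∀ j → j ℕ.< k → α (code (n ∷ applyUpTo p j)) ≡ 0)

  applyUpTo-cong : ∀ {p p′ : Baire} → p ≗ p′ → ∀ k → applyUpTo p k ≡ applyUpTo p′ k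
  applyUpTo-cong e zero    = refl
  applyUpTo-cong e (suc k) = cong₂ _∷_ (e 0) (applyUpTo-cong (λ i → e (suc i)) k)

  unique : ∀ {p n k k′ y y′} → Answer p n k y → Answer p n k′ y′ → y ≡ y′
  unique {k = k} {k′} (a , b) (a′ , b′) with ℕ.<-cmp k k′
  ... | tri< k<k′ _ _ = contradiction (trans (sym (b′ k k<k′)) a) λ ()
  ... | tri≈ _ refl _ = ℕ.suc-injective (trans (sym a) a′)
  ... | tri> _ _ k′<k = contradiction (trans (sym (b k′ k′<k)) a′) λ ()

-- The space of continuous functions, i.e. those with an associate.
𝒞 : RepresentedSpace → RepresentedSpace → RepresentedSpace
𝒞 X Y = record
  { setoid = record
    { Carrier       = ∃ λ f → ∃ λ α → α Represents f
    ; _≈_           = λ (f , _) (g , _) → ∀ x → Func.to f x Y.≈ Func.to g x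
    ; isEquivalence = record
      { refl  = λ _ → YS.refl
      ; sym   = λ e x → YS.sym (e x)
      ; trans = λ e d x → YS.trans (e x) (d x)
      }
    }
  ; Name            = λ α (f , _) → α Represents f
  ; Name-resp       = λ {α} {β} e d r p x n → let (q , a , b) = r p x n in
      q , (λ m → let (k , u , v) = a m in
             k , trans (sym (e _)) u , λ j j<k → trans (sym (e _)) (v j j<k))
        , Y.Name-resp (λ _ → refl) (d x) b
  ; Name-functional = λ {α} {(f , _)} {(g , _)} r s x →
      let (p , n)      = X.Name-surjective x
          (q , a , b)  = r p x n
          (q′ , c , d) = s p x n
      in Y.Name-functional b
           (Y.Name-resp (PartialFunction.functional (associate α) c a) YS.refl d)
  ; Name-surjective = λ (_ , r) → r
  }
  where
  module X = RepresentedSpace X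
  module Y = RepresentedSpace Y
  module YS = Setoid Y.setoid

  _Represents_ : Baire → Func X.setoid Y.setoid → Set
  α Represents f = ∀ p x → X.Name p x →
    ∃ λ q → graph (associate α) p q × Y.Name q (Func.to f x)

-- Sierpiński space: 0^ω names false, every other sequence names true.
𝕊 : RepresentedSpace
𝕊 = record
  { setoid          = ≡.setoid Bool
  ; Name            = λ p b → Reflects (∃ λ n → p n ≢ 0) b
  ; Name-resp       = λ { e refl (ofʸ (n , z)) → ofʸ (n , λ w → z (trans (e n) w))
                        ; e refl (ofⁿ z)       → ofⁿ λ (n , w) → z (n , λ v → w (trans (sym (e n)) v)) }
  ; Name-functional = det
  ; Name-surjective = λ { true  → const 1 , ofʸ (0 , λ ())
                        ; false → const 0 , ofⁿ λ (_ , w) → w refl }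
  }

-- A closed set is given by the characteristic function of its open complement;
-- under excluded middle, Bool-valued functions account for all subsets.
𝒜 : RepresentedSpace → RepresentedSpace
𝒜 X = 𝒞 X 𝕊

infix 4 _∈_

_∈_ : ∀ {X} → Carrier X → Carrier (𝒜 X) → Set
x ∈ (χ , _) = Func.to χ x ≡ false

C : ∀ X → 𝒜 X ⇉ X
C X = multi λ A x → _∈_ {X} x A

-- {0,…,d-1}^ω
Seq : ℕ → RepresentedSpace
Seq d = record
  { setoid          = ℕ ≡.→-setoid Fin d
  ; Name            = λ p x → ∀ n → p n ≡ toℕ (x n)
  ; Name-resp       = λ e d h n → trans (sym (e n)) (trans (h n) (cong toℕ (d n)))
  ; Name-functional = λ h h′ n → toℕ-injective (trans (sym (h n)) (h′ n))
  ; Name-surjective = λ x → (λ n → toℕ (x n)) , λ _ → refl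
  }

HasCardinality : (S : Setoid 0ℓ 0ℓ) → Pred (Setoid.Carrier S) 0ℓ → ℕ → Set
HasCardinality S P n = Bijection (≡.setoid (Fin n)) (On.setoid S (proj₁ {B = P}))

C♯≤ : ℕ → 𝒜 (Seq 2) ⇉ Seq 2
C♯≤ n = C (Seq 2) ↾ λ A → ∃ λ m → 1 ℕ.≤ m × m ℕ.≤ n ×
  HasCardinality (RepresentedSpace.setoid (Seq 2)) (λ x → _∈_ {Seq 2} x A) m

InfinitelyOften : ∀ {A : Set} → (ℕ → A) → A → Set
InfinitelyOften p a = ∀ N → ∃ λ n → N ℕ.≤ n × p n ≡ a

_++ω_ : ∀ {A : Set} → List A → (ℕ → A) → (ℕ → A)
([]      ++ω p) n       = p n
((a ∷ w) ++ω p) zero    = a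
((a ∷ w) ++ω p) (suc n) = (w ++ω p) n

-- The values c l for l ≥ m are unconstrained and unused.
Sort : ∀ d → Seq d ⇉ Seq d
Sort d = multi λ p q → ∃₂ λ (m : Fin d) (c : Fin d → ℕ) →
  InfinitelyOften p m ×
  (∀ l → l Fin.< m → ¬ InfinitelyOften p l) ×
  (∀ l → l Fin.< m → HasCardinality (≡.setoid ℕ) (λ n → p n ≡ l) (c l)) ×
  q ≗ concatMap (λ l → replicate (c l) l) (filter (Fin._<? m) (allFin d)) ++ω const m

-- Real numbers are Cauchy sequences of rationals; x ≲ y is the order of the
-- reals, and makes sense for arbitrary sequences.

infix 4 _≲_

_≲_ : (ℕ → ℚ) → (ℕ → ℚ) → Set
x ≲ y = ∀ ε → 0ℚ <ℚ ε → ∃ λ N → ∀ n → N ℕ.≤ n → x n ≤ℚ y n +ℚ ε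

IsCauchy : (ℕ → ℚ) → Set
IsCauchy x = ∀ ε → 0ℚ <ℚ ε → ∃ λ N → ∀ m n → N ℕ.≤ m → N ℕ.≤ n → ∣ x m -ℚ x n ∣ <ℚ ε

infix 4 _≃_

-- The difference converges to 0.
_≃_ : (ℕ → ℚ) → (ℕ → ℚ) → Set
x ≃ y = (λ n → ∣ x n -ℚ y n ∣) ≲ const 0ℚ

record UnitReal : Set where
  field
    seq    : ℕ → ℚ
    cauchy : IsCauchy seq
    0≲seq  : const 0ℚ ≲ seq
    seq≲1  : seq ≲ const 1ℚ

open UnitReal using (seq)

2^-_ : ℕ → ℚ
2^- n = _/ℚ_ (+ 1) (2 ^ n) {{ℕ.m^n≢0 2 n}}

-- The n-th rational listed by p, as numerator and predecessor of denominator.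
ratio : Baire → ℕ → ℚ
ratio p n = + p (2 ℕ.* n) /ℚ suc (p (suc (2 ℕ.* n)))

private
  half : ∀ ε → 0ℚ <ℚ ε → 0ℚ <ℚ ½ *ℚ ε
  half ε 0<ε = ℚ.positive⁻¹ (½ *ℚ ε) {{ℚ.pos*pos⇒pos ½ ε {{ℚ.positive 0<ε}}}}

  half+half : ∀ ε → ½ *ℚ ε +ℚ ½ *ℚ ε ≡ ε
  half+half ε = trans (sym (ℚ.*-distribʳ-+ ε ½ ½)) (ℚ.*-identityˡ ε)

  interchange : ∀ a b c d → (a +ℚ b) +ℚ (c +ℚ d) ≡ (a +ℚ c) +ℚ (b +ℚ d)
  interchange a b c d = trans (ℚ.+-assoc a b (c +ℚ d)) (trans (cong (a +ℚ_)
    (trans (sym (ℚ.+-assoc b c d)) (trans (cong (_+ℚ d) (ℚ.+-comm b c)) (ℚ.+-assoc c b d))))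
    (sym (ℚ.+-assoc a c (b +ℚ d))))

  ≲-+ : ∀ {x y x′ y′ z} → x ≲ y → x′ ≲ y′ → (∀ n → z n ≤ℚ x n +ℚ x′ n) →
        z ≲ λ n → y n +ℚ y′ n
  ≲-+ {y = y} {y′ = y′} h h′ z≤ ε 0<ε =
    let (N , f) = h _ (half ε 0<ε) ; (N′ , f′) = h′ _ (half ε 0<ε) in
    N ℕ.⊔ N′ , λ n le → ℚ.≤-trans (z≤ n) (ℚ.≤-trans
      (ℚ.+-mono-≤ (f n (ℕ.≤-trans (ℕ.m≤m⊔n N N′) le)) (f′ n (ℕ.≤-trans (ℕ.m≤n⊔m N N′) le)))
      (ℚ.≤-reflexive (trans (interchange (y n) _ (y′ n) _) (cong ((y n +ℚ y′ n) +ℚ_) (half+half ε)))))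

  cancel : ∀ a b c → (a -ℚ b) +ℚ (b -ℚ c) ≡ a -ℚ c
  cancel a b c = trans (ℚ.+-assoc a (-ℚ b) (b -ℚ c)) (cong (a +ℚ_)
    (trans (sym (ℚ.+-assoc (-ℚ b) b (-ℚ c)))
      (trans (cong (_+ℚ (-ℚ c)) (ℚ.+-inverseˡ b)) (ℚ.+-identityˡ (-ℚ c)))))

  triangle : ∀ a b c → ∣ a -ℚ c ∣ ≤ℚ ∣ a -ℚ b ∣ +ℚ ∣ b -ℚ c ∣
  triangle a b c = subst (λ t → ∣ t ∣ ≤ℚ ∣ a -ℚ b ∣ +ℚ ∣ b -ℚ c ∣) (cancel a b c) (ℚ.∣p+q∣≤∣p∣+∣q∣ (a -ℚ b) (b -ℚ c))

  neg-sub : ∀ a b → -ℚ (a -ℚ b) ≡ b -ℚ a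
  neg-sub a b = trans (ℚ.neg-distrib-+ a (-ℚ b))
    (trans (cong ((-ℚ a) +ℚ_) (⁻¹-involutive b)) (ℚ.+-comm (-ℚ a) b))

  dist-sym : ∀ a b → ∣ a -ℚ b ∣ ≡ ∣ b -ℚ a ∣
  dist-sym a b = trans (sym (ℚ.∣-p∣≡∣p∣ (a -ℚ b))) (cong ∣_∣ (neg-sub a b))

  ≃-refl : ∀ {x} → x ≃ x
  ≃-refl {x} ε 0<ε = 0 , λ n _ → subst (λ t → ∣ t ∣ ≤ℚ 0ℚ +ℚ ε) (sym (ℚ.+-inverseʳ (x n)))
    (subst (0ℚ ≤ℚ_) (sym (ℚ.+-identityˡ ε)) (ℚ.<⇒≤ 0<ε))

  ≃-sym : ∀ {x y} → x ≃ y → y ≃ x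
  ≃-sym {x} {y} h ε 0<ε = let (N , f) = h ε 0<ε in
    N , λ n le → subst (_≤ℚ 0ℚ +ℚ ε) (dist-sym (x n) (y n)) (f n le)

  ≃-trans : ∀ {x y z} → x ≃ y → y ≃ z → x ≃ z
  ≃-trans {x} {y} {z} h k = ≲-+ {y = const 0ℚ} {y′ = const 0ℚ} h k (λ n → triangle (x n) (y n) (z n))

  n<2^n : ∀ n → n ℕ.< 2 ^ n
  n<2^n zero    = ℕ.s≤s ℕ.z≤n
  n<2^n (suc n) = ℕ.≤-trans (ℕ.s≤s (n<2^n n)) (ℕ.≤-trans
    (ℕ.+-monoˡ-≤ (2 ^ n) (ℕ.≤-trans (ℕ.s≤s ℕ.z≤n) (n<2^n n)))
    (ℕ.≤-reflexive (cong (2 ^ n ℕ.+_) (sym (ℕ.+-identityʳ (2 ^ n))))))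

  archimedes : ∀ ε → 0ℚ <ℚ ε → ∃ λ n → 2^- n ≤ℚ ε
  archimedes (mkℚ (+ zero) d _) (*<* (ℤ.+<+ ()))
  archimedes (mkℚ -[1+ _ ] d _) (*<* ())
  archimedes ε@(mkℚ (+ suc a) d _) _ = suc d , ℚ.toℚᵘ-cancel-≤
    (ℚᵘ.≤-respˡ-≃ (ℚᵘ.≃-sym eq) (ℚᵘ.*≤* (ℤ.+≤+ (ℕ.≤-trans (ℕ.≤-reflexive (ℕ.*-identityˡ (suc d)))
      (ℕ.≤-trans (ℕ.<⇒≤ (n<2^n (suc d))) (ℕ.≤-trans (ℕ.≤-reflexive (sym sp)) (ℕ.m≤m+n _ _)))))))
    where
    instance
      nz : ℕ.NonZero (2 ^ suc d)
      nz = ℕ.m^n≢0 2 (suc d)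
    sp : suc (pred (2 ^ suc d)) ≡ 2 ^ suc d
    sp = ℕ.suc-pred (2 ^ suc d)
    eq : ℚ.toℚᵘ (2^- suc d) ℚᵘ.≃ ℚᵘ.mkℚᵘ (+ 1) (pred (2 ^ suc d))
    eq = ℚᵘ.≃-trans (ℚᵘ.≃-reflexive (cong ℚ.toℚᵘ (ℚ./-cong {+ 1} refl (sym sp))))
           (ℚ.toℚᵘ-fromℚᵘ (ℚᵘ.mkℚᵘ (+ 1) (pred (2 ^ suc d))))

  2^-pos : ∀ n → 0ℚ <ℚ 2^- n
  2^-pos n = ℚ.positive⁻¹ (2^- n) {{ℚ.normalize-pos 1 (2 ^ n) {{ℕ.m^n≢0 2 n}}}}

  ≲-limit : ∀ {x} → (∀ n → x ≲ const (2^- n +ℚ 2^- n)) → x ≲ const 0ℚ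
  ≲-limit h ε 0<ε =
    let δ        = ½ *ℚ ε
        0<δ      = half ε 0<ε
        (k , le) = archimedes (½ *ℚ δ) (half δ 0<δ)
        (N , f)  = h k δ 0<δ
    in N , λ n N≤n → ℚ.≤-trans (f n N≤n) (ℚ.≤-trans
         (ℚ.+-monoˡ-≤ δ (ℚ.≤-trans (ℚ.+-mono-≤ le le) (ℚ.≤-reflexive (half+half δ))))
         (ℚ.≤-reflexive (trans (half+half ε) (sym (ℚ.+-identityˡ ε)))))

  ∣∣-bound : ∀ a b → a ≤ℚ b → -ℚ a ≤ℚ b → ∣ a ∣ ≤ℚ b
  ∣∣-bound a b h k with ℚ.∣p∣≡p∨∣p∣≡-p a
  ... | inj₁ e = ℚ.≤-trans (ℚ.≤-reflexive e) h
  ... | inj₂ e = ℚ.≤-trans (ℚ.≤-reflexive e) k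

  -a≤∣a∣ : ∀ a → -ℚ a ≤ℚ ∣ a ∣
  -a≤∣a∣ a with ℚ.≤-total 0ℚ a
  ... | inj₁ 0≤a = ℚ.≤-trans (ℚ.neg-antimono-≤ 0≤a) (ℚ.0≤∣p∣ a)
  ... | inj₂ a≤0 = ℚ.≤-reflexive (trans (sym (ℚ.0≤p⇒∣p∣≡p (ℚ.neg-antimono-≤ a≤0))) (ℚ.∣-p∣≡∣p∣ a))

  clamp : ∀ a b ε δ → 0ℚ ≤ℚ ε → 0ℚ ≤ℚ δ → ∣ a -ℚ b ∣ ≤ℚ δ → 0ℚ ≤ℚ b +ℚ ε →
          ∣ (a ⊔ℚ 0ℚ) -ℚ b ∣ ≤ℚ δ +ℚ ε
  clamp a b ε δ 0≤ε 0≤δ h 0≤b+ε with ℚ.≤-total 0ℚ a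
  ... | inj₁ 0≤a rewrite ℚ.p≥q⇒p⊔q≡p 0≤a =
    ℚ.≤-trans h (ℚ.≤-trans (ℚ.≤-reflexive (sym (ℚ.+-identityʳ δ))) (ℚ.+-monoʳ-≤ δ 0≤ε))
  ... | inj₂ a≤0 rewrite ℚ.p≤q⇒p⊔q≡q a≤0 = ∣∣-bound (0ℚ -ℚ b) (δ +ℚ ε)
    (ℚ.≤-trans (ℚ.≤-trans (ℚ.+-monoˡ-≤ (-ℚ b) 0≤b+ε) (ℚ.≤-reflexive
        (trans (cong (_+ℚ (-ℚ b)) (ℚ.+-comm b ε)) (trans (ℚ.+-assoc ε b (-ℚ b))
          (trans (cong (ε +ℚ_) (ℚ.+-inverseʳ b)) (ℚ.+-identityʳ ε))))))
      (ℚ.≤-trans (ℚ.≤-reflexive (sym (ℚ.+-identityˡ ε))) (ℚ.+-monoˡ-≤ ε 0≤δ)))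
    (ℚ.≤-trans (ℚ.≤-reflexive (trans (neg-sub 0ℚ b) (sym (cancel b a 0ℚ))))
      (ℚ.+-mono-≤
        (ℚ.≤-trans (ℚ.≤-reflexive (sym (neg-sub a b))) (ℚ.≤-trans (-a≤∣a∣ (a -ℚ b)) h))
        (ℚ.≤-trans (ℚ.≤-trans (ℚ.≤-reflexive (ℚ.+-identityʳ a)) a≤0) 0≤ε)))

  ⟨⟩-even : ∀ p q n → ⟨ p , q ⟩ (2 ℕ.* n) ≡ p n
  ⟨⟩-even p q zero    = refl
  ⟨⟩-even p q (suc n) rewrite ℕ.+-suc n (n ℕ.+ 0) = ⟨⟩-even (λ k → p (suc k)) (λ k → q (suc k)) n

  ⟨⟩-odd : ∀ p q n → ⟨ p , q ⟩ (suc (2 ℕ.* n)) ≡ q n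
  ⟨⟩-odd p q n = ⟨⟩-even q (λ k → p (suc k)) n

  ratio-onto : (r : ℕ → ℚ) → (∀ n → 0ℚ ≤ℚ r n) → ∃ λ p → ∀ n → ratio p n ≡ r n
  ratio-onto r 0≤r = p , λ n →
    trans (ℚ./-cong (cong +_ (⟨⟩-even num den n)) (cong suc (⟨⟩-odd num den n)))
      (trans (ℚ./-cong (ℤ.0≤i⇒+∣i∣≡i (nonneg n)) refl) (ℚ.↥p/↧p≡p (r n)))
    where
    num den : Baire
    num n = ℤ.∣ ↥ r n ∣
    den n = ℚ.denominator-1 (r n)
    p : Baire
    p = ⟨ num , den ⟩
    nonneg : ∀ n → ℤ.0ℤ ℤ.≤ ↥ r n
    nonneg n with r n | 0≤r n
    ... | mkℚ (+ _) _ _    | _      = ℤ.+≤+ ℕ.z≤n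
    ... | mkℚ -[1+ _ ] _ _ | *≤* ()

-- [0,1] with rational approximations of precision 2⁻ⁿ as names; nonnegative
-- rationals suffice.
𝕀 : RepresentedSpace
𝕀 = record
  { setoid = record
    { Carrier       = UnitReal
    ; _≈_           = λ x y → seq x ≃ seq y
    ; isEquivalence = record
      { refl  = λ {x} → ≃-refl {seq x}
      ; sym   = λ {x} {y} → ≃-sym {seq x} {seq y}
      ; trans = λ {x} {y} {z} → ≃-trans {seq x} {seq y} {seq z}
      }
    }
  ; Name            = λ p x → ∀ n → (λ m → ∣ ratio p n -ℚ seq x m ∣) ≲ const (2^- n)
  ; Name-resp       = λ {p} {q} {x} {y} e d h n →
      subst (λ r → (λ m → ∣ r -ℚ seq y m ∣) ≲ const (2^- n))
        (ℚ./-cong (cong +_ (e (2 ℕ.* n))) (cong suc (e (suc (2 ℕ.* n)))))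
        (subst (λ t → (λ m → ∣ ratio p n -ℚ seq y m ∣) ≲ const t) (ℚ.+-identityʳ (2^- n))
          (≲-+ {y = const (2^- n)} {y′ = const 0ℚ} (h n) d
            (λ m → triangle (ratio p n) (seq x m) (seq y m))))
  ; Name-functional = λ {p} {x} {y} h k → ≲-limit (λ n →
      ≲-+ {y = const (2^- n)} {y′ = const (2^- n)} (h n) (k n) (λ m →
        subst (λ t → ∣ seq x m -ℚ seq y m ∣ ≤ℚ t +ℚ ∣ ratio p n -ℚ seq y m ∣)
          (dist-sym (seq x m) (ratio p n)) (triangle (seq x m) (ratio p n) (seq y m))))
  ; Name-surjective = λ x →
      let N : ℕ → ℕ
          N n     = proj₁ (UnitReal.cauchy x (2^- n) (2^-pos n))
          (p , e) = ratio-onto (λ n → seq x (N n) ⊔ℚ 0ℚ) (λ n → ℚ.p≤q⊔p (seq x (N n)) 0ℚ)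
      in p , λ n ε 0<ε → let (M , f) = UnitReal.0≲seq x ε 0<ε in
           N n ℕ.⊔ M , λ m le →
             subst (λ t → ∣ t -ℚ seq x m ∣ ≤ℚ 2^- n +ℚ ε) (sym (e n))
               (clamp (seq x (N n)) (seq x m) ε (2^- n) (ℚ.<⇒≤ 0<ε) (ℚ.<⇒≤ (2^-pos n))
                 (ℚ.<⇒≤ (proj₂ (UnitReal.cauchy x (2^- n) (2^-pos n)) (N n) m ℕ.≤-refl
                   (ℕ.≤-trans (ℕ.m≤m⊔n (N n) M) le)))
                 (f m (ℕ.≤-trans (ℕ.m≤n⊔m (N n) M) le)))
  }

-- The i-th of d interleaved sequences.
component : ∀ {d} → Fin d → Baire → Baire
component {d} i p m = p (toℕ i ℕ.+ m ℕ.* d)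

private
  interleave : ∀ {d} → (Fin d → Baire) → Baire
  interleave {zero}  ps k = 0
  interleave {suc d} ps k = ps (k mod suc d) (k / suc d)

  component-interleave : ∀ {d} (ps : Fin d → Baire) i → component i (interleave ps) ≗ ps i
  component-interleave {suc d} ps i m = cong₂ ps
    (toℕ-injective (trans (Fin.toℕ-fromℕ< _)
      (trans ([m+kn]%n≡m%n (toℕ i) m (suc d)) (m<n⇒m%n≡m (toℕ<n i)))))
    (trans (+-distrib-/-∣ʳ (toℕ i) (n∣m*n m))
      (cong₂ ℕ._+_ (m<n⇒m/n≡0 (toℕ<n i)) (m*n/n≡m m (suc d))))

Power : RepresentedSpace → ℕ → RepresentedSpace
Power X d = record
  { setoid = record
    { Carrier       = Fin d → X.Carrier
    ; _≈_           = λ x y → ∀ i → x i X.≈ y i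
    ; isEquivalence = record
      { refl  = λ _ → XS.refl
      ; sym   = λ e i → XS.sym (e i)
      ; trans = λ e f i → XS.trans (e i) (f i)
      }
    }
  ; Name            = λ p x → ∀ i → X.Name (component i p) (x i)
  ; Name-resp       = λ e f h i → X.Name-resp (λ _ → e _) (f i) (h i)
  ; Name-functional = λ h k i → X.Name-functional (h i) (k i)
  ; Name-surjective = λ x →
      interleave (λ i → proj₁ (X.Name-surjective (x i))) ,
      λ i → X.Name-resp (λ m → sym (component-interleave _ i m)) XS.refl
              (proj₂ (X.Name-surjective (x i)))
  }
  where
  module X = RepresentedSpace X
  module XS = Setoid X.setoid

-- Arithmetic on Cauchy sequences is termwise, so the hypothesis on z says
-- z = (1 - t) x + t y.
Convex : ∀ {n} → Carrier (𝒜 (Power 𝕀 n)) → Set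
Convex {n} A = ∀ (x y z : Fin n → UnitReal) (t : UnitReal) →
  _∈_ {Power 𝕀 n} x A → _∈_ {Power 𝕀 n} y A →
  (∀ i → seq (z i) ≃ λ k → (1ℚ -ℚ seq t k) *ℚ seq (x i) k +ℚ seq t k *ℚ seq (y i) k) →
  _∈_ {Power 𝕀 n} z A

XC : ∀ n → 𝒜 (Power 𝕀 n) ⇉ Power 𝕀 n
XC n = C (Power 𝕀 n) ↾ Convex

{-# OPTIONS --safe #-}

-- Three facts, combined by transitivity of ≤W, give both directions.
--
-- C♯≤ (i + 1) ≤W XC j for i ≤ j.  Send a closed set of 0/1-sequences f, read as numbers x in base 4, to the
-- convex hull of the points (x, …, xʲ) of the moment curve. The hull is cut out by the polynomials of degree ≤ j
-- that are negative on all nodes x, so it is closed with negative information. From a point y of the hull, a word w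
-- is extended by a digit β once some polynomial is negative on all live nodes that do not extend wβ and yet has positive
-- value at y. Such a test exists, because at most j + 1 nodes admit a Lagrange basis of degree ≤ j.
--
-- XC j ≤W Sort (k + 1) for j ≤ k.  Enumerate guesses for hyperplanes x_c = a / 2ᵉ, keep j of them, one for each
-- letter below j, and print a letter l when the l-th guess is seen to be useless: it repeats a coordinate, or it misses the
-- flat cut out of the set by the earlier ones; the guess is then replaced, and so are the later ones. In the sorted
-- sequence the letter m printed infinitely often tells that m guesses are final and that no further hyperplane
-- with dyadic value meets the flat, which by convexity is then a single point.
--
-- C♯≤ n is not reducible to Sort d for d < n.  While the sorted sequence may still change below l, an adversary holding
-- l + 1 cylinders forces one more letter below l to be printed: otherwise the answer is decided by finitely many
-- letters, falls into one cylinder, and that cylinder can be removed after splitting another one. With l = 0 this is absurd.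

module Submission where

open import Defs
open import Axiom.ExcludedMiddle using (ExcludedMiddle)
open import Data.Bool.Base using (Bool; true; false)
open import Data.Empty using (⊥; ⊥-elim)
open import Data.Fin.Base as Fin using (Fin; toℕ; fromℕ<)
open import Data.Fin using (#_)
import Data.Fin.Properties as Fin
open import Data.Integer.Base as ℤ using (ℤ; -[1+_])
import Data.Integer.Properties as ℤ
open import Data.List.Base as List using (List; []; _∷_; applyUpTo; replicate; concatMap; filter; allFin)
open import Data.List.Membership.Propositional using () renaming (_∈_ to _∈ᴸ_)
open import Data.List.Membership.Propositional.Properties using (∈-filter⁺; ∈-allFin)
open import Data.List.Relation.Unary.All as All using (All; []; _∷_)
open import Data.List.Relation.Unary.All.Properties using (all-filter)
open import Data.List.Relation.Unary.AllPairs using (AllPairs; []; _∷_)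
import Data.List.Relation.Unary.AllPairs.Properties as AllPairs
open import Data.List.Relation.Unary.Any using (here; there)
open import Data.Nat.Base
open import Data.Nat.DivMod using (_/_; _%_; m%n<n; m≡m%n+[m/n]*n; m<n⇒m%n≡m; m<n⇒m/n≡0; m*n/n≡m; [m+kn]%n≡m%n; +-distrib-/-∣ʳ)
open import Data.Nat.Divisibility using (n∣m*n)
open import Data.Nat.Properties as ℕ using (_<?_; _≤?_)
open import Data.Nat.Tactic.RingSolver using (solve-∀)
open import Data.Product.Base using (Σ; ∃; ∃₂; _×_; _,_; proj₁; proj₂)
open import Data.Rational.Base as ℚ using (ℚ; 0ℚ; 1ℚ; ½; ∣_∣; *<*; *≤*)
  renaming (_+_ to _+ℚ_; _*_ to _*ℚ_; _-_ to _-ℚ_; -_ to -ℚ_; _<_ to _<ℚ_; _≤_ to _≤ℚ_; _/_ to _/ℚ_; _⊔_ to _⊔ℚ_)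
import Data.Rational.Properties as ℚ
import Data.Rational.Unnormalised.Base as ℚᵘ
import Data.Rational.Unnormalised.Properties as ℚᵘ
open import Data.Sum.Base using (_⊎_; inj₁; inj₂; [_,_]′)
open import Data.Vec.Base as Vec using (Vec; []; _∷_)
import Data.Vec.Properties as Vec
open import Data.Vec.Relation.Binary.Pointwise.Inductive using (Pointwise; []; _∷_)
open import Function.Base using (const; _∘_; id)
open import Function.Bundles using (Func; Bijection; _⇔_; mk⇔)
open import Level using (0ℓ)
open import Relation.Binary.Bundles using (Setoid)
open import Relation.Binary.Definitions using (tri<; tri≈; tri>)
open import Relation.Binary.PropositionalEquality as ≡
  using (_≡_; _≢_; _≗_; refl; sym; trans; cong; cong₂; subst)
open import Relation.Nullary using (¬_; Dec; yes; no; contradiction)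
open import Relation.Nullary.Decidable using (dec⇒maybe)
open import Relation.Nullary.Reflects using (Reflects; ofʸ; ofⁿ)
open import Tactic.RingSolver using () renaming (solve-∀ to ring-∀)
open import Tactic.RingSolver.Core.AlmostCommutativeRing using (AlmostCommutativeRing; fromCommutativeRing)

open PartialFunction using (graph; resp; functional)
open RepresentedSpace using (Carrier; Name; Name-resp)
open _⇉_ using (rel)
open UnitReal using (seq)

-- Neither the number of points of the set nor the dimension of the final flat can be computed. Both
-- positive reductions therefore search for evidence that is correct whenever it is found;
-- compactness and Lagrange interpolation, argued classically, serve to show that the search ends.
-- At most `j + 1` points on the moment curve span a simplex, and the descent follows, digit by
-- digit, nodes that carry weight at the given point. In the other reduction a guess is coded by the
-- number of letters printed up to its level: sorting preserves these counts, so the final guesses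
-- can be read off the sorted sequence. For the negative part: if the letter `l` is printed forever
-- and no smaller one, an initial part of the sorted sequence is settled as soon as enough letters
-- up to `l` have appeared, and the adversary learns in which cylinder the answer will lie before
-- the instance is complete. The induction on `l` runs downwards, because infinitely many letters up
-- to `l` come from repeating the statement for `l + 1`.

from-≤ : ∀ (Q : ℕ → Set) {s} → Q s → (∀ k → s ≤ k → Q k → Q (suc k)) → ∀ {k} → s ≤ k → Q k
from-≤ Q {zero}  z f {zero}  _ = z
from-≤ Q {s} z f {suc k} s≤1+k with ℕ.m≤n⇒m<n∨m≡n s≤1+k
... | inj₂ refl      = z
... | inj₁ (s≤s s≤k) = f k s≤k (from-≤ Q z f s≤k)

-- Agreement on initial segments

infix 4 _~[_]_

_~[_]_ : Baire → ℕ → Baire → Set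
f ~[ n ] g = ∀ i → i < n → f i ≡ g i

~-sym : ∀ {f g n} → f ~[ n ] g → g ~[ n ] f
~-sym e i i<n = sym (e i i<n)

~-trans : ∀ {f g h n} → f ~[ n ] g → g ~[ n ] h → f ~[ n ] h
~-trans e d i i<n = trans (e i i<n) (d i i<n)

~-mono : ∀ {f g m n} → m ≤ n → f ~[ n ] g → f ~[ m ] g
~-mono m≤n e i i<m = e i (ℕ.<-≤-trans i<m m≤n)

-- Finitely many thresholds have their maximum as a common one, because `P j` is closed upwards.
collect : (P : ℕ → ℕ → Set) → (∀ {j m n} → m ≤ n → P j m → P j n) →
          ∀ y → (∀ j → j < y → ∃ (P j)) → ∃ λ N → ∀ j → j < y → P j N
collect P mono zero    h = 0 , λ _ ()
collect P mono (suc y) h with collect P mono y (λ j lt → h j (ℕ.m<n⇒m<1+n lt)) | h y ℕ.≤-refl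
... | N , f | M , g = N ⊔ M , λ j j<1+y → case j j<1+y (ℕ.m<1+n⇒m<n∨m≡n j<1+y)
  where
  case : ∀ j → j < suc y → j < y ⊎ j ≡ y → P j (N ⊔ M)
  case j _ (inj₁ j<y)  = mono (ℕ.m≤m⊔n N M) (f j j<y)
  case j _ (inj₂ refl) = mono (ℕ.m≤n⊔m N M) g

-- Oracle programs

mutual
  ⇓-det : ∀ {p n} {e : Rec n} {xs y z} → p ⊨ e [ xs ]⇓ y → p ⊨ e [ xs ]⇓ z → y ≡ z
  ⇓-det zero zero = refl
  ⇓-det suc suc = refl
  ⇓-det oracle oracle = refl
  ⇓-det proj proj = refl
  ⇓-det (comp a b) (comp c d) with refl ← ⇓-dets a c = ⇓-det b d
  ⇓-det (prec₀ a) (prec₀ b) = ⇓-det a b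
  ⇓-det (precₛ a b) (precₛ c d) with refl ← ⇓-det a c = ⇓-det b d
  ⇓-det (mu {y = y} a b) (mu {y = z} c d) with ℕ.<-cmp y z
  ... | tri< y<z _ _ = contradiction (⇓-det a (proj₂ (d y y<z))) λ ()
  ... | tri≈ _ y≡z _ = y≡z
  ... | tri> _ _ z<y = contradiction (⇓-det c (proj₂ (b z z<y))) λ ()

  ⇓-dets : ∀ {p m n} {gs : Vec (Rec n) m} {xs ys zs} →
           Pointwise (λ g y → p ⊨ g [ xs ]⇓ y) gs ys →
           Pointwise (λ g y → p ⊨ g [ xs ]⇓ y) gs zs → ys ≡ zs
  ⇓-dets []       []       = refl
  ⇓-dets (a ∷ as) (b ∷ bs) = cong₂ _∷_ (⇓-det a b) (⇓-dets as bs)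

mutual
  -- A derivation is finite and consults the oracle finitely often, including the failed tests of a
  -- search. All continuity arguments about the functionals of a reduction rest on this.
  ⇓-use : ∀ {p n} {e : Rec n} {xs y} → p ⊨ e [ xs ]⇓ y →
          ∃ λ N → ∀ p′ → p ~[ N ] p′ → p′ ⊨ e [ xs ]⇓ y
  ⇓-use zero   = 0 , λ _ _ → zero
  ⇓-use suc    = 0 , λ _ _ → suc
  ⇓-use {p} (oracle {x}) = suc x , λ p′ e → subst (p′ ⊨ oracle [ x ∷ [] ]⇓_) (sym (e x ℕ.≤-refl)) oracle
  ⇓-use proj   = 0 , λ _ _ → proj
  ⇓-use (comp a b) =
    let (M , f) = ⇓-uses a ; (N , g) = ⇓-use b in
    M ⊔ N , λ p′ e → comp (f p′ (~-mono (ℕ.m≤m⊔n M N) e)) (g p′ (~-mono (ℕ.m≤n⊔m M N) e))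
  ⇓-use (prec₀ a) = let (N , f) = ⇓-use a in N , λ p′ e → prec₀ (f p′ e)
  ⇓-use (precₛ a b) =
    let (M , f) = ⇓-use a ; (N , g) = ⇓-use b in
    M ⊔ N , λ p′ e → precₛ (f p′ (~-mono (ℕ.m≤m⊔n M N) e)) (g p′ (~-mono (ℕ.m≤n⊔m M N) e))
  ⇓-use {p} (mu {f = f} {xs} {y} a b) =
    let (M , g) = ⇓-use a
        (N , h) = collect (λ j N → ∀ p′ → p ~[ N ] p′ → ∃ λ z → p′ ⊨ f [ j ∷ xs ]⇓ suc z)
                    (λ m≤n k p′ e → k p′ (~-mono m≤n e)) y
                    (λ j j<y → let (N , k) = ⇓-use (proj₂ (b j j<y)) in N , λ p′ e → _ , k p′ e)
    in M ⊔ N , λ p′ e → mu (g p′ (~-mono (ℕ.m≤m⊔n M N) e))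
                           (λ j j<y → h j j<y p′ (~-mono (ℕ.m≤n⊔m M N) e))

  ⇓-uses : ∀ {p m n} {gs : Vec (Rec n) m} {xs ys} →
           Pointwise (λ g y → p ⊨ g [ xs ]⇓ y) gs ys →
           ∃ λ N → ∀ p′ → p ~[ N ] p′ → Pointwise (λ g y → p′ ⊨ g [ xs ]⇓ y) gs ys
  ⇓-uses []       = 0 , λ _ _ → []
  ⇓-uses (a ∷ as) =
    let (M , f) = ⇓-use a ; (N , g) = ⇓-uses as in
    M ⊔ N , λ p′ e → f p′ (~-mono (ℕ.m≤m⊔n M N) e) ∷ g p′ (~-mono (ℕ.m≤n⊔m M N) e)

⇓-ext : ∀ {p p′ n} {e : Rec n} {xs y} → p ≗ p′ → p ⊨ e [ xs ]⇓ y → p′ ⊨ e [ xs ]⇓ y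
⇓-ext {p′ = p′} e d = proj₂ (⇓-use d) p′ (λ i _ → e i)

mutual
  -- Substitution of the program `d` for the oracle, that is, composition of computable functions on
  -- Baire space.
  relative : ∀ {n} → Rec 1 → Rec n → Rec n
  relative d zero        = zero
  relative d suc         = suc
  relative d oracle      = d
  relative d (proj i)    = proj i
  relative d (comp f gs) = comp (relative d f) (relatives d gs)
  relative d (prec f g)  = prec (relative d f) (relative d g)
  relative d (mu f)      = mu (relative d f)

  relatives : ∀ {m n} → Rec 1 → Vec (Rec n) m → Vec (Rec n) m
  relatives d []       = []
  relatives d (g ∷ gs) = relative d g ∷ relatives d gs

module _ {u h : Baire} {d : Rec 1} (ok : ∀ x → u ⊨ d [ x ∷ [] ]⇓ h x) where mutual

  relative-⇓ : ∀ {n} {e : Rec n} {xs y} → h ⊨ e [ xs ]⇓ y → u ⊨ relative d e [ xs ]⇓ y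
  relative-⇓ zero        = zero
  relative-⇓ suc         = suc
  relative-⇓ oracle      = ok _
  relative-⇓ proj        = proj
  relative-⇓ (comp a b)  = comp (relatives-⇓ a) (relative-⇓ b)
  relative-⇓ (prec₀ a)   = prec₀ (relative-⇓ a)
  relative-⇓ (precₛ a b) = precₛ (relative-⇓ a) (relative-⇓ b)
  relative-⇓ (mu a b)    = mu (relative-⇓ a) (λ j j<y → _ , relative-⇓ (proj₂ (b j j<y)))

  relatives-⇓ : ∀ {m n} {gs : Vec (Rec n) m} {xs ys} →
                Pointwise (λ g y → h ⊨ g [ xs ]⇓ y) gs ys →
                Pointwise (λ g y → u ⊨ g [ xs ]⇓ y) (relatives d gs) ys
  relatives-⇓ []       = []
  relatives-⇓ (a ∷ as) = relative-⇓ a ∷ relatives-⇓ as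

computes : Rec 1 → PartialFunction
computes e = record
  { graph      = λ p q → ∀ n → p ⊨ e [ n ∷ [] ]⇓ q n
  ; resp       = λ {_} {p′} e≗ d h n → subst (λ y → p′ ⊨ e [ n ∷ [] ]⇓ y) (d n) (⇓-ext e≗ (h n))
  ; functional = λ h k n → ⇓-det (h n) (k n)
  }

computes-computable : ∀ e → Computable (computes e)
computes-computable e = e , λ _ _ h → h

-- Total programs: fun is primitive recursive in the oracle.

record Fn (n : ℕ) : Set where
  field
    fun  : Baire → Vec ℕ n → ℕ
    prog : Rec n
    ok   : ∀ p xs → p ⊨ prog [ xs ]⇓ fun p xs

open Fn

-- Keeps the program but restates its meaning, so that later proofs meet ordinary arithmetic rather
-- than projections out of vectors.
as : ∀ {n} (F : Fn n) (g : Baire → Vec ℕ n → ℕ) → (∀ p xs → fun F p xs ≡ g p xs) → Fn n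
as F g e = record
  { fun  = g
  ; prog = prog F
  ; ok   = λ p xs → subst (p ⊨ prog F [ xs ]⇓_) (e p xs) (ok F p xs)
  }

Fns : ℕ → ℕ → Set
Fns n m = Vec (Fn n) m

oks : ∀ {n m} (as : Fns n m) p xs → Pointwise (λ g y → p ⊨ g [ xs ]⇓ y) (Vec.map prog as) (Vec.map (λ a → fun a p xs) as)
oks []       p xs = []
oks (a ∷ as) p xs = ok a p xs ∷ oks as p xs

call : ∀ {m n} → Fn m → Fns n m → Fn n
call F as = record
  { fun  = λ p xs → fun F p (Vec.map (λ a → fun a p xs) as)
  ; prog = comp (prog F) (Vec.map prog as)
  ; ok   = λ p xs → comp (oks as p xs) (ok F p _)
  }

var : ∀ {n} → Fin n → Fn n
var i = record { fun = λ _ xs → Vec.lookup xs i ; prog = proj i ; ok = λ _ _ → proj }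

vars : ∀ {m n} → (Fin m → Fin n) → Fns n m
vars ρ = Vec.tabulate (λ i → var (ρ i))

vars-lookup : ∀ {m n} (ρ : Fin m → Fin n) p xs (ys : Vec ℕ m) → (∀ i → Vec.lookup xs (ρ i) ≡ Vec.lookup ys i) →
              Vec.map (λ a → fun a p xs) (vars ρ) ≡ ys
vars-lookup ρ p xs []       h = refl
vars-lookup ρ p xs (y ∷ ys) h = cong₂ _∷_ (h Fin.zero) (vars-lookup (λ i → ρ (Fin.suc i)) p xs ys (λ i → h (Fin.suc i)))

wk : ∀ {n} → Fn n → Fn (suc n)
wk F = as (call F (vars Fin.suc)) (λ { p (_ ∷ xs) → fun F p xs })
  λ { p (x ∷ xs) → cong (fun F p) (vars-lookup Fin.suc p (x ∷ xs) xs (λ _ → refl)) }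

-- In the step of a recursion the second argument is the accumulated value; a body that does not
-- look at it is lifted this way.
skip : ∀ {n} → Fn (suc n) → Fn (2 + n)
skip F = as (call F (vars ρ)) (λ { p (k ∷ _ ∷ xs) → fun F p (k ∷ xs) })
  λ { p (k ∷ y ∷ xs) → cong (fun F p) (vars-lookup ρ p (k ∷ y ∷ xs) (k ∷ xs) (λ { Fin.zero → refl ; (Fin.suc _) → refl })) }
  where
  ρ : ∀ {n} → Fin (suc n) → Fin (2 + n)
  ρ Fin.zero    = Fin.zero
  ρ (Fin.suc i) = Fin.suc (Fin.suc i)

bind : ∀ {n} → Fn n → Fn (suc n) → Fn n
bind a F = as (call F (a ∷ vars id)) (λ p xs → fun F p (fun a p xs ∷ xs))
  λ p xs → cong (λ ys → fun F p (fun a p xs ∷ ys)) (vars-lookup id p xs xs (λ _ → refl))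

sucF : ∀ {n} → Fn n → Fn n
sucF a = call (record { fun = λ { _ (x ∷ []) → suc x } ; prog = suc ; ok = λ { _ (_ ∷ []) → suc } }) (a ∷ [])

at : ∀ {n} → Fn n → Fn n
at a = call (record { fun = λ { p (x ∷ []) → p x } ; prog = oracle ; ok = λ { _ (_ ∷ []) → oracle } }) (a ∷ [])

lit : ∀ {n} → ℕ → Fn n
lit {n} c = record { fun = λ _ _ → c ; prog = numeral c ; ok = λ p xs → numeral-ok c }
  where
  numeral : ℕ → Rec n
  numeral zero    = comp zero []
  numeral (suc c) = comp suc (numeral c ∷ [])
  numeral-ok : ∀ c {p xs} → p ⊨ numeral c [ xs ]⇓ c
  numeral-ok zero    = comp [] zero
  numeral-ok (suc c) = comp (numeral-ok c ∷ []) suc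

natrec : ℕ → (ℕ → ℕ → ℕ) → ℕ → ℕ
natrec b s zero    = b
natrec b s (suc k) = s k (natrec b s k)

prim : ∀ {n} → Fn n → Fn (2 + n) → Fn (suc n)
prim b s = record
  { fun  = λ { p (k ∷ xs) → natrec (fun b p xs) (λ k y → fun s p (k ∷ y ∷ xs)) k }
  ; prog = prec (prog b) (prog s)
  ; ok   = λ { p (k ∷ xs) → run p k xs }
  }
  where
  run : ∀ p k xs → p ⊨ prec (prog b) (prog s) [ k ∷ xs ]⇓ natrec (fun b p xs) (λ k y → fun s p (k ∷ y ∷ xs)) k
  run p zero    xs = prec₀ (ok b p xs)
  run p (suc k) xs = precₛ (run p k xs) (ok s p _)

rec : ∀ {n} → Fn n → Fn n → Fn (2 + n) → Fn n
rec t b s = bind t (prim b s)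

rel-to : ∀ {n} → Fn 1 → Fn n → Fn n
rel-to D F = record
  { fun  = λ p xs → fun F (λ x → fun D p (x ∷ [])) xs
  ; prog = relative (prog D) (prog F)
  ; ok   = λ p xs → relative-⇓ (λ x → ok D p (x ∷ [])) (ok F _ xs)
  }

natrec-≡ : ∀ {b s} (g : ℕ → ℕ) → g 0 ≡ b → (∀ k → g (suc k) ≡ s k (g k)) → ∀ k → natrec b s k ≡ g k
natrec-≡ g z h zero    = sym z
natrec-≡ {s = s} g z h (suc k) = trans (cong (s k) (natrec-≡ g z h k)) (sym (h k))

-- Arithmetic and bounded quantifiers as programs

infixl 6 _⊕_ _⊖_
infixl 7 _⊗_
infixr 8 _↑_

op : ∀ {n} → Fn 2 → Fn n → Fn n → Fn n
op F a b = call F (a ∷ b ∷ [])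

_⊕_ _⊗_ _⊖_ _↑_ : ∀ {n} → Fn n → Fn n → Fn n
_⊕_ = op (as (prim (var (# 0)) (sucF (var (# 1)))) (λ { _ (x ∷ y ∷ []) → x + y })
        λ { _ (x ∷ y ∷ []) → natrec-≡ (_+ y) refl (λ _ → refl) x })
_⊗_ = op (as (prim (lit 0) (var (# 2) ⊕ var (# 1))) (λ { _ (x ∷ y ∷ []) → x * y })
        λ { _ (x ∷ y ∷ []) → natrec-≡ (_* y) refl (λ _ → refl) x })
-- Subtraction recurs on the subtrahend and power on the exponent, hence the exchanged arguments.
a ⊖ b = op (as (prim (var (# 0)) predF) (λ { _ (y ∷ x ∷ []) → x ∸ y })
        λ { _ (y ∷ x ∷ []) → natrec-≡ (x ∸_) refl (λ k → sym (ℕ.pred[m∸n]≡m∸[1+n] x k)) y }) b a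
  where
  predF : ∀ {n} → Fn (2 + n)
  predF = as (call (prim (lit 0) (var (# 0))) (var (# 1) ∷ [])) (λ { _ (_ ∷ y ∷ _) → pred y })
    λ { _ (_ ∷ y ∷ _) → natrec-≡ pred refl (λ _ → refl) y }
a ↑ b = op (as (prim (lit 1) (var (# 2) ⊗ var (# 1))) (λ { _ (y ∷ x ∷ []) → x ^ y })
        λ { _ (y ∷ x ∷ []) → natrec-≡ (x ^_) refl (λ _ → refl) y }) b a

-- With 0 as truth, `∑` is bounded universal and `∏` bounded existential quantification; likewise
-- `+` is conjunction, `*` disjunction and `1 ∸_` negation.
∑ ∏ : ℕ → (ℕ → ℕ) → ℕ
∑ zero    f = 0
∑ (suc n) f = ∑ n f + f n
∏ zero    f = 1
∏ (suc n) f = ∏ n f * f n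

∑F ∏F : ∀ {n} → Fn n → Fn (suc n) → Fn n
∑F t F = as (rec t (lit 0) (var (# 1) ⊕ skip F)) (λ p xs → ∑ (fun t p xs) (λ i → fun F p (i ∷ xs)))
  λ p xs → natrec-≡ (λ k → ∑ k (λ i → fun F p (i ∷ xs))) refl (λ _ → refl) (fun t p xs)
∏F t F = as (rec t (lit 1) (var (# 1) ⊗ skip F)) (λ p xs → ∏ (fun t p xs) (λ i → fun F p (i ∷ xs)))
  λ p xs → natrec-≡ (λ k → ∏ k (λ i → fun F p (i ∷ xs))) refl (λ _ → refl) (fun t p xs)

-- Programs for decidable properties return 0 for truth.

∑-zero : ∀ n {f} → (∀ i → i < n → f i ≡ 0) → ∑ n f ≡ 0
∑-zero zero    h = refl
∑-zero (suc n) h = cong₂ _+_ (∑-zero n (λ i i<n → h i (ℕ.m<n⇒m<1+n i<n))) (h n ℕ.≤-refl)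

∑-zero⁻ : ∀ n {f} → ∑ n f ≡ 0 → ∀ i → i < n → f i ≡ 0
∑-zero⁻ (suc n) {f} e i i<1+n with ℕ.m<1+n⇒m<n∨m≡n i<1+n
... | inj₁ i<n  = ∑-zero⁻ n (ℕ.m+n≡0⇒m≡0 (∑ n f) e) i i<n
... | inj₂ refl = ℕ.m+n≡0⇒n≡0 (∑ n f) e

∑-cong : ∀ k {f g} → (∀ i → i < k → f i ≡ g i) → ∑ k f ≡ ∑ k g
∑-cong zero    h = refl
∑-cong (suc k) h = cong₂ _+_ (∑-cong k (λ i i<k → h i (ℕ.m<n⇒m<1+n i<k))) (h k ℕ.≤-refl)

∏-zero : ∀ n {f} i → i < n → f i ≡ 0 → ∏ n f ≡ 0
∏-zero (suc n) {f} i i<1+n e with ℕ.m<1+n⇒m<n∨m≡n i<1+n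
... | inj₁ i<n  = cong (_* f n) (∏-zero n i i<n e)
... | inj₂ refl = trans (cong (∏ n f *_) e) (ℕ.*-zeroʳ (∏ n f))

∏-zero⁻ : ∀ n {f} → ∏ n f ≡ 0 → ∃ λ i → i < n × f i ≡ 0
∏-zero⁻ (suc n) {f} e with ℕ.m*n≡0⇒m≡0∨n≡0 (∏ n f) e
... | inj₁ e′ = let (i , i<n , z) = ∏-zero⁻ n e′ in i , ℕ.m<n⇒m<1+n i<n , z
... | inj₂ e′ = n , ℕ.≤-refl , e′

*-zero⁻ : ∀ m {n} → m * n ≡ 0 → m ≡ 0 ⊎ n ≡ 0
*-zero⁻ m = ℕ.m*n≡0⇒m≡0∨n≡0 m

*-zero : ∀ {m n} → m ≡ 0 ⊎ n ≡ 0 → m * n ≡ 0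
*-zero     (inj₁ refl) = refl
*-zero {m} (inj₂ refl) = ℕ.*-zeroʳ m

not-zero : ∀ {m} → m ≢ 0 → 1 ∸ m ≡ 0
not-zero {zero}  m≢0 = contradiction refl m≢0
not-zero {suc m} _   = ℕ.0∸n≡0 m

not-zero⁻ : ∀ {m} → 1 ∸ m ≡ 0 → m ≢ 0
not-zero⁻ () refl

distance : ℕ → ℕ → ℕ
distance m n = (m ∸ n) + (n ∸ m)

distance-zero⁻ : ∀ m n → distance m n ≡ 0 → m ≡ n
distance-zero⁻ m n e = ℕ.≤-antisym (ℕ.m∸n≡0⇒m≤n (ℕ.m+n≡0⇒m≡0 (m ∸ n) e)) (ℕ.m∸n≡0⇒m≤n (ℕ.m+n≡0⇒n≡0 (m ∸ n) e))

distance-zero : ∀ {m n} → m ≡ n → distance m n ≡ 0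
distance-zero {m} refl = cong₂ _+_ (ℕ.n∸n≡0 m) (ℕ.n∸n≡0 m)

distF : ∀ {n} → Fn n → Fn n → Fn n
distF a b = (a ⊖ b) ⊕ (b ⊖ a)

∑-single : ∀ n {f} i → i < n → (∀ j → j < n → j ≢ i → f j ≡ 0) → ∑ n f ≡ f i
∑-single (suc n) {f} i i<1+n h with ℕ.m<1+n⇒m<n∨m≡n i<1+n
... | inj₁ i<n  = trans (cong₂ _+_ (∑-single n i i<n (λ j j<n → h j (ℕ.m<n⇒m<1+n j<n)))
                                   (h n ℕ.≤-refl λ { refl → ℕ.<-irrefl refl i<n })) (ℕ.+-identityʳ (f i))
... | inj₂ refl = cong (_+ f n) (∑-zero n (λ j j<n → h j (ℕ.m<n⇒m<1+n j<n) λ { refl → ℕ.<-irrefl refl j<n }))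

-- Definite description: if `P` has exactly one zero below the bound, all other summands vanish.
the : ℕ → (ℕ → ℕ) → ℕ
the n P = ∑ n (λ i → i * (1 ∸ P i))

theF : ∀ {n} → Fn n → Fn (suc n) → Fn n
theF t F = ∑F t (var (# 0) ⊗ (lit 1 ⊖ F))

the-unique : ∀ n {P} i → i < n → P i ≡ 0 → (∀ j → j < n → P j ≡ 0 → j ≡ i) → the n P ≡ i
the-unique n {P} i i<n z u = trans
  (∑-single n i i<n λ j j<n j≢i → trans (cong (j *_) (not-zero (λ e → j≢i (u j j<n e)))) (ℕ.*-zeroʳ j))
  (trans (cong (λ z → i * (1 ∸ z)) z) (ℕ.*-identityʳ i))

-- Lists coded by numbers

-- The step of `code`: `cons a (code w)` and `code (a ∷ w)` are the same by definition.
cons : ℕ → ℕ → ℕ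
cons a t = 2 ^ a * suc (2 * t)

even≢odd : ∀ m n → 2 * m ≢ suc (2 * n)
even≢odd (suc m) zero    e = contradiction (trans (sym (ℕ.+-suc m (m + 0))) (ℕ.suc-injective e)) λ ()
even≢odd (suc m) (suc n) e = even≢odd m n (ℕ.suc-injective (ℕ.suc-injective
  (trans (cong suc (sym (ℕ.+-suc m (m + 0)))) (trans e (cong (λ z → suc (suc z)) (ℕ.+-suc n (n + 0)))))))

cons-injective : ∀ a b t u → cons a t ≡ cons b u → a ≡ b × t ≡ u
cons-injective zero zero t u e = refl , ℕ.*-cancelˡ-≡ t u 2 (ℕ.suc-injective
  (trans (sym (ℕ.+-identityʳ (suc (2 * t)))) (trans e (ℕ.+-identityʳ (suc (2 * u))))))
cons-injective zero (suc b) t u e = ⊥-elim (even≢odd (2 ^ b * suc (2 * u)) t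
  (trans (sym (ℕ.*-assoc 2 (2 ^ b) _)) (trans (sym e) (ℕ.+-identityʳ _))))
cons-injective (suc a) zero t u e = ⊥-elim (even≢odd (2 ^ a * suc (2 * t)) u
  (trans (sym (ℕ.*-assoc 2 (2 ^ a) _)) (trans e (ℕ.+-identityʳ _))))
cons-injective (suc a) (suc b) t u e =
  let (p , q) = cons-injective a b t u (ℕ.*-cancelˡ-≡ (cons a t) (cons b u) 2
        (trans (sym (ℕ.*-assoc 2 (2 ^ a) _)) (trans e (ℕ.*-assoc 2 (2 ^ b) _))))
  in cong suc p , q

n<2^n : ∀ n → n < 2 ^ n
n<2^n zero    = s≤s z≤n
n<2^n (suc n) = ℕ.+-mono-≤ (ℕ.≤-trans (s≤s z≤n) (n<2^n n)) (ℕ.≤-trans (n<2^n n) (ℕ.m≤m+n _ 0))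

hd<cons : ∀ a t → a < cons a t
hd<cons a t = ℕ.<-≤-trans (n<2^n a) (ℕ.m≤m*n (2 ^ a) (suc (2 * t)))

tl<cons : ∀ a t → t < cons a t
tl<cons a t = ℕ.≤-trans (s≤s (ℕ.m≤m+n t (t + 0))) (ℕ.m≤n*m (suc (2 * t)) (2 ^ a) {{ℕ.m^n≢0 2 a}})

opaque
  -- Both parts of a pair are smaller than its code, so bounded search recovers them. At 0, the code
  -- of the empty list, both return 0, hence reading past the end of a list gives 0.
  hd tl : ℕ → ℕ
  hd x = the x (λ a → ∏ x (λ t → distance x (cons a t)))
  tl x = the x (λ t → ∏ x (λ a → distance x (cons a t)))

  hd-def : ∀ x → the x (λ a → ∏ x (λ t → distance x (cons a t))) ≡ hd x
  hd-def x = refl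

  tl-def : ∀ x → the x (λ t → ∏ x (λ a → distance x (cons a t))) ≡ tl x
  tl-def x = refl

  tl-zero : tl 0 ≡ 0
  tl-zero = refl

  hd-cons : ∀ a t → hd (cons a t) ≡ a
  hd-cons a t = the-unique (cons a t) a (hd<cons a t)
    (∏-zero (cons a t) t (tl<cons a t) (distance-zero {cons a t} refl))
    λ b _ z → let (u , _ , e) = ∏-zero⁻ (cons a t) z in
      sym (proj₁ (cons-injective a b t u (distance-zero⁻ _ (cons b u) e)))

  tl-cons : ∀ a t → tl (cons a t) ≡ t
  tl-cons a t = the-unique (cons a t) t (tl<cons a t)
    (∏-zero (cons a t) a (hd<cons a t) (distance-zero {cons a t} refl))
    λ u _ z → let (b , _ , e) = ∏-zero⁻ (cons a t) z in
      sym (proj₂ (cons-injective a b t u (distance-zero⁻ _ (cons b u) e)))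

consF : ∀ {n} → Fn n → Fn n → Fn n
consF a t = lit 2 ↑ a ⊗ sucF (lit 2 ⊗ t)

hdF tlF : ∀ {n} → Fn n → Fn n
hdF x = call (as (theF (var (# 0)) (∏F (var (# 1)) (distF (var (# 2)) (consF (var (# 1)) (var (# 0))))))
  (λ { _ (x ∷ []) → hd x }) λ { _ (x ∷ []) → hd-def x }) (x ∷ [])
tlF x = call (as (theF (var (# 0)) (∏F (var (# 1)) (distF (var (# 2)) (consF (var (# 0)) (var (# 1))))))
  (λ { _ (x ∷ []) → tl x }) λ { _ (x ∷ []) → tl-def x }) (x ∷ [])

drops : ℕ → ℕ → ℕ
drops i x = natrec x (λ _ y → tl y) i

nth : ℕ → ℕ → ℕ
nth i x = hd (drops i x)

dropsF nthF : ∀ {n} → Fn n → Fn n → Fn n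
dropsF i x = call (prim (var (# 0)) (tlF (var (# 1)))) (i ∷ x ∷ [])
nthF i x = call (as (hdF (dropsF (var (# 0)) (var (# 1)))) (λ { _ (i ∷ x ∷ []) → nth i x }) λ { _ (i ∷ x ∷ []) → refl })
  (i ∷ x ∷ [])

drops-tl : ∀ i x → drops i (tl x) ≡ tl (drops i x)
drops-tl zero    x = refl
drops-tl (suc i) x = cong tl (drops-tl i x)

drops-cons : ∀ i a t → drops (suc i) (cons a t) ≡ drops i t
drops-cons i a t = trans (sym (drops-tl i (cons a t))) (cong (drops i) (tl-cons a t))

drops-zero : ∀ i → drops i 0 ≡ 0
drops-zero zero    = refl
drops-zero (suc i) = trans (cong tl (drops-zero i)) tl-zero

-- Nonempty lists have positive codes; with `drops-long` this lets a program see from a code whether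
-- a prefix is long enough.
drops-short : ∀ (v : ℕ → ℕ) i k → k ≤ i → drops i (code (applyUpTo v k)) ≡ 0
drops-short v i       zero    _         = drops-zero i
drops-short v (suc i) (suc k) (s≤s k≤i) = trans (drops-cons i (v 0) (code (applyUpTo (λ j → v (suc j)) k))) (drops-short (λ j → v (suc j)) i k k≤i)

drops-long : ∀ (v : ℕ → ℕ) i k → i < k → drops i (code (applyUpTo v k)) ≢ 0
drops-long v zero    (suc k) _         = λ e → ℕ.<⇒≢ (ℕ.≤-<-trans z≤n (tl<cons (v 0) (code (applyUpTo (λ j → v (suc j)) k)))) (sym e)
drops-long v (suc i) (suc k) (s≤s i<k) = λ e → drops-long (λ j → v (suc j)) i k i<k
  (trans (sym (drops-cons i (v 0) (code (applyUpTo (λ j → v (suc j)) k)))) e)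

nth-code : ∀ (v : ℕ → ℕ) {k} i → i < k → nth i (code (applyUpTo v k)) ≡ v i
nth-code v {suc k} zero    _         = hd-cons (v 0) (code (applyUpTo (λ j → v (suc j)) k))
nth-code v {suc k} (suc i) (s≤s i<k) =
  trans (cong hd (drops-cons i (v 0) (code (applyUpTo (λ j → v (suc j)) k)))) (nth-code (λ j → v (suc j)) i i<k)

code-cong : ∀ {v w} k → v ~[ k ] w → code (applyUpTo v k) ≡ code (applyUpTo w k)
code-cong zero    e = refl
code-cong (suc k) e = cong₂ cons (e 0 (s≤s z≤n)) (code-cong k (λ i i<k → e (suc i) (s≤s i<k)))

-- Since `cons` adds at the front, the list is built from its end: round `j` prepends the entry with
-- index `t ∸ suc j`.
takeF : ∀ {n} → Fn n → Fn (suc n) → Fn n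
takeF t V = as
  (rec t (lit 0) (consF (bind (wk (wk t) ⊖ sucF (var (# 0))) (skip (skip V))) (var (# 1))))
  (λ p xs → code (applyUpTo (λ i → fun V p (i ∷ xs)) (fun t p xs)))
  λ p xs → let k = fun t p xs in
    trans (build (λ i → fun V p (i ∷ xs)) k k ℕ.≤-refl)
          (code-cong k λ i _ → cong (λ z → fun V p (z + i ∷ xs)) (ℕ.n∸n≡0 k))
  where
  build : ∀ (v : ℕ → ℕ) k j → j ≤ k →
          natrec 0 (λ j y → cons (v (k ∸ suc j)) y) j ≡ code (applyUpTo (λ i → v (k ∸ j + i)) j)
  build v k zero    _   = refl
  build v k (suc j) j<k = cong₂ cons (cong v (sym (ℕ.+-identityʳ _)))
    (trans (build v k j (ℕ.<⇒≤ j<k)) (code-cong j λ i _ → cong v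
      (trans (cong (_+ i) (ℕ.+-∸-assoc 1 j<k)) (sym (ℕ.+-suc _ i)))))

-- first n f is the least zero of f below n, or n.
first : ℕ → (ℕ → ℕ) → ℕ
-- The candidate `y` moves on exactly when it has kept pace with `k`, so that nothing was found
-- before, and is itself no zero.
first n f = natrec 0 (λ k y → y + ((1 ∸ (k ∸ y)) * (1 ∸ (1 ∸ f y)))) n

firstF : ∀ {n} → Fn n → Fn (suc n) → Fn n
firstF t F = rec t (lit 0) (var (# 1) ⊕ ((lit 1 ⊖ (var (# 0) ⊖ var (# 1))) ⊗ (lit 1 ⊖ (lit 1 ⊖ bind (var (# 1)) (skip (skip F))))))

first-spec : ∀ n f → (first n f ≡ n ⊎ (first n f < n × f (first n f) ≡ 0)) × (∀ i → i < first n f → f i ≢ 0)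
first-spec zero    f = inj₁ refl , λ _ ()
first-spec (suc n) f with first n f | first-spec n f
... | y | inj₂ (y<n , z) , h = inj₂ (s , trans (cong f e) z) , λ i lt → h i (subst (i <_) e lt)
  where
  e : y + (1 ∸ (n ∸ y)) * (1 ∸ (1 ∸ f y)) ≡ y
  e = trans (cong (y +_) (*-zero (inj₁ (not-zero (ℕ.m>n⇒m∸n≢0 y<n))))) (ℕ.+-identityʳ y)
  s : y + (1 ∸ (n ∸ y)) * (1 ∸ (1 ∸ f y)) < suc n
  s = subst (_< suc n) (sym e) (ℕ.m<n⇒m<1+n y<n)
... | .n | inj₁ refl , h rewrite ℕ.n∸n≡0 n with f n in eq
...   | zero   rewrite ℕ.+-identityʳ n = inj₂ (ℕ.≤-refl , eq) , h
...   | suc a  rewrite ℕ.0∸n≡0 a | ℕ.+-comm n 1 = inj₁ refl , new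
  where
  new : ∀ i → i < suc n → f i ≢ 0
  new i lt with ℕ.m<1+n⇒m<n∨m≡n lt
  ... | inj₁ i<n  = h i i<n
  ... | inj₂ refl = λ z → contradiction (trans (sym eq) z) λ ()

least : (f : ℕ → ℕ) → ∀ m → f m ≡ 0 → ∃ λ m₀ → f m₀ ≡ 0 × (∀ j → j < m₀ → ∃ λ z → f j ≡ suc z)
least f m z with first-spec m f
... | inj₁ e , h       = m , z , λ j j<m → pos j (h j (subst (j <_) (sym e) j<m))
  where
  pos : ∀ j → f j ≢ 0 → ∃ λ z → f j ≡ suc z
  pos j ne with f j
  ... | zero  = contradiction refl ne
  ... | suc z = z , refl
... | inj₂ (_ , e) , h = first m f , e , λ j j<y → pos j (h j j<y)
  where
  pos : ∀ j → f j ≢ 0 → ∃ λ z → f j ≡ suc z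
  pos j ne with f j
  ... | zero  = contradiction refl ne
  ... | suc z = z , refl

search : ∀ {n} → Fn (suc n) → Fn (suc n) → Rec n
search T F = comp (prog F) (mu (prog T) ∷ Vec.map prog (vars id))

-- The search stops at the least zero of the test, which may differ from the witness supplied; later
-- proofs use only that it passes the test.
search-⇓ : ∀ {n} (T F : Fn (suc n)) p xs → (∃ λ m → fun T p (m ∷ xs) ≡ 0) →
           ∃ λ m → fun T p (m ∷ xs) ≡ 0 × p ⊨ search T F [ xs ]⇓ fun F p (m ∷ xs)
search-⇓ T F p xs (m , z) = let (m₀ , z₀ , h) = least (λ m → fun T p (m ∷ xs)) m z in
  m₀ , z₀ , comp (mu (subst (p ⊨ prog T [ m₀ ∷ xs ]⇓_) z₀ (ok T p _))
                     (λ j j<m₀ → let (y , e) = h j j<m₀ in y , subst (p ⊨ prog T [ j ∷ xs ]⇓_) e (ok T p _)) ∷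
                  subst (Pointwise _ _) (vars-lookup id p xs xs (λ _ → refl)) (oks (vars id) p xs))
                 (ok F p _)

-- Pairing of sequences and transitivity of reducibility

⟨⟩-even : ∀ p q n → ⟨ p , q ⟩ (2 * n) ≡ p n
⟨⟩-even p q zero    = refl
⟨⟩-even p q (suc n) rewrite ℕ.+-suc n (n + 0) = ⟨⟩-even (λ k → p (suc k)) (λ k → q (suc k)) n

⟨⟩-odd : ∀ p q n → ⟨ p , q ⟩ (suc (2 * n)) ≡ q n
⟨⟩-odd p q n = ⟨⟩-even q (λ k → p (suc k)) n

halve : ∀ n → ∃ λ k → n ≡ 2 * k ⊎ n ≡ suc (2 * k)
halve zero    = 0 , inj₁ refl
halve (suc n) with halve n
... | k , inj₁ e = k , inj₂ (cong suc e)
... | k , inj₂ e = suc k , inj₁ (trans (cong suc e) (cong suc (sym (ℕ.+-suc k (k + 0)))))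

opaque
  half : ℕ → ℕ
  half n = the (suc n) (λ k → distance n (2 * k) * distance n (suc (2 * k)))

  half-def : ∀ n → the (suc n) (λ k → distance n (2 * k) * distance n (suc (2 * k))) ≡ half n
  half-def n = refl

  half-unique : ∀ n k → n ≡ 2 * k ⊎ n ≡ suc (2 * k) → half n ≡ k
  half-unique n k h = the-unique (suc n) k (s≤s (bound h)) (*-zero (zero⁺ h)) λ j _ z → unique j h (*-zero⁻ _ z)
    where
    bound : n ≡ 2 * k ⊎ n ≡ suc (2 * k) → k ≤ n
    bound (inj₁ refl) = ℕ.m≤m+n k (k + 0)
    bound (inj₂ refl) = ℕ.m≤n⇒m≤1+n (ℕ.m≤m+n k (k + 0))
    zero⁺ : n ≡ 2 * k ⊎ n ≡ suc (2 * k) → distance n (2 * k) ≡ 0 ⊎ distance n (suc (2 * k)) ≡ 0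
    zero⁺ (inj₁ e) = inj₁ (distance-zero e)
    zero⁺ (inj₂ e) = inj₂ (distance-zero e)
    unique : ∀ j → n ≡ 2 * k ⊎ n ≡ suc (2 * k) → distance n (2 * j) ≡ 0 ⊎ distance n (suc (2 * j)) ≡ 0 → j ≡ k
    unique j (inj₁ e) (inj₁ d) = ℕ.*-cancelˡ-≡ j k 2 (trans (sym (distance-zero⁻ n _ d)) e)
    unique j (inj₁ e) (inj₂ d) = ⊥-elim (even≢odd k j (trans (sym e) (distance-zero⁻ n _ d)))
    unique j (inj₂ e) (inj₁ d) = ⊥-elim (even≢odd j k (trans (sym (distance-zero⁻ n _ d)) e))
    unique j (inj₂ e) (inj₂ d) = ℕ.*-cancelˡ-≡ j k 2 (ℕ.suc-injective (trans (sym (distance-zero⁻ n _ d)) e))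

halfF : ∀ {n} → Fn n → Fn n
halfF x = call (as (theF (sucF (var (# 0))) (distF (var (# 1)) (lit 2 ⊗ var (# 0)) ⊗ distF (var (# 1)) (sucF (lit 2 ⊗ var (# 0)))))
  (λ { _ (x ∷ []) → half x }) λ { _ (x ∷ []) → half-def x }) (x ∷ [])

-- The factor `n ∸ 2 * half n` is the parity of `n`.
select : ℕ → ℕ → ℕ → ℕ
select n a b = (1 ∸ (n ∸ 2 * half n)) * a + (n ∸ 2 * half n) * b

select-even : ∀ k a b → select (2 * k) a b ≡ a
select-even k a b rewrite half-unique (2 * k) k (inj₁ refl) | ℕ.n∸n≡0 (2 * k) =
  trans (ℕ.+-identityʳ _) (ℕ.+-identityʳ a)

select-odd : ∀ k a b → select (suc (2 * k)) a b ≡ b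
select-odd k a b rewrite half-unique (suc (2 * k)) k (inj₂ refl) | ℕ.m+n∸n≡m 1 (2 * k) = ℕ.+-identityʳ b

selectF : ∀ {n} → Fn n → Fn n → Fn n → Fn n
selectF n a b = call (as
  ((lit 1 ⊖ (var (# 0) ⊖ lit 2 ⊗ halfF (var (# 0)))) ⊗ var (# 1) ⊕ (var (# 0) ⊖ lit 2 ⊗ halfF (var (# 0))) ⊗ var (# 2))
  (λ { _ (n ∷ a ∷ b ∷ []) → select n a b }) λ { _ (n ∷ a ∷ b ∷ []) → refl }) (n ∷ a ∷ b ∷ [])

evens odds : Baire → Baire
evens u n = u (2 * n)
odds  u n = u (suc (2 * n))

evensF oddsF : Fn 1
evensF = as (at (lit 2 ⊗ var (# 0))) (λ { u (n ∷ []) → evens u n }) λ { u (n ∷ []) → refl }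
oddsF  = as (at (sucF (lit 2 ⊗ var (# 0)))) (λ { u (n ∷ []) → odds u n }) λ { u (n ∷ []) → refl }

pairing : Rec 1 → Rec 1 → Rec 1
pairing d e = comp (prog (selectF (var (# 0)) (var (# 1)) (var (# 2))))
  (proj (# 0) ∷ comp d (prog (halfF (var (# 0))) ∷ []) ∷ comp e (prog (halfF (var (# 0))) ∷ []) ∷ [])

pairing-⇓ : ∀ {u d e h q} → (∀ x → u ⊨ d [ x ∷ [] ]⇓ h x) → (∀ x → u ⊨ e [ x ∷ [] ]⇓ q x) →
            ∀ n → u ⊨ pairing d e [ n ∷ [] ]⇓ ⟨ h , q ⟩ n
pairing-⇓ {u} {d} {e} {h} {q} a b n = subst (u ⊨ pairing d e [ n ∷ [] ]⇓_) (sel (halve n))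
  (comp (proj ∷ comp (ok (halfF (var (# 0))) u _ ∷ []) (a (half n)) ∷ comp (ok (halfF (var (# 0))) u _ ∷ []) (b (half n)) ∷ [])
        (ok (selectF (var (# 0)) (var (# 1)) (var (# 2))) u _))
  where
  sel : (∃ λ k → n ≡ 2 * k ⊎ n ≡ suc (2 * k)) → select n (h (half n)) (q (half n)) ≡ ⟨ h , q ⟩ n
  sel (k , inj₁ refl) = trans (select-even k _ _) (trans (cong h (half-unique n k (inj₁ refl))) (sym (⟨⟩-even h q k)))
  sel (k , inj₂ refl) = trans (select-odd k _ _) (trans (cong q (half-unique n k (inj₂ refl))) (sym (⟨⟩-odd h q k)))

module _ {X Y Z W U V} {f : X ⇉ Y} {g : Z ⇉ W} {h : U ⇉ V} where

  -- The composed outer functional computes `H₁ p` afresh from the original name `p`: `K₂` needs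
  -- this intermediate name besides the answer, and its result goes to `K₁` together with `p`.
  ≤W-trans : f ≤W g → g ≤W h → f ≤W h
  ≤W-trans (H₁ , K₁ , (h₁ , h₁-ok) , (k₁ , k₁-ok) , r₁) (H₂ , K₂ , (h₂ , h₂-ok) , (k₂ , k₂-ok) , r₂) =
    H₂ ∘ₚ H₁ , K
    , (relative h₁ h₂ , λ { p q (v , a , b) n → relative-⇓ (h₁-ok p v a) (h₂-ok v q b n) })
    , (relative (pairing (prog evensF) z) k₁
      , λ { u r (v , a , w , b , c) n → relative-⇓ (pairing-⇓ (λ x → ok evensF u _)
              (λ x → relative-⇓ (pairing-⇓ (λ x → relative-⇓ (λ y → ok evensF u _) (h₁-ok _ v a x)) (λ x → ok oddsF u _))
                       (k₂-ok _ w b x))) (k₁-ok _ r c n) })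
    , λ G G⊢h p x px fx →
        let (r , (u , (v , (s , p↦s , (t , (q , (s′ , s↦s′ , s′↦q) , t≗) , t↦v)) , u≗) , u↦r) , rest) =
              r₁ (K₂ ∘ₚ ⟨id, G ∘ₚ H₂ ⟩) (r₂ G G⊢h) p x px fx
            e : ∀ n → evens ⟨ p , q ⟩ n ≡ p n
            e = ⟨⟩-even p q
            o : ∀ n → odds ⟨ p , q ⟩ n ≡ q n
            o = ⟨⟩-odd p q
        in r , (⟨ p , q ⟩ , (q , (s′ , (s , p↦s , s↦s′) , s′↦q) , λ _ → refl) ,
             s , resp H₁ (λ n → sym (e n)) (λ _ → refl) p↦s ,
             v , resp K₂ (λ n → trans (t≗ n) (⟨⟩-cong (λ _ → refl) (λ n → sym (o n)) n)) (λ _ → refl) t↦v ,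
             resp K₁ (λ n → trans (u≗ n) (⟨⟩-cong (λ n → sym (e n)) (λ _ → refl) n)) (λ _ → refl) u↦r) , rest
    where
    z : Rec 1
    z = relative (pairing (relative (prog evensF) h₁) (prog oddsF)) k₂
    K : PartialFunction
    K = record
      { graph = λ u r → ∃ λ v → graph H₁ (evens u) v × ∃ λ w → graph K₂ ⟨ v , odds u ⟩ w × graph K₁ ⟨ evens u , w ⟩ r
      ; resp  = λ { e d (v , a , w , b , c) →
          v , resp H₁ (λ n → e (2 * n)) (λ _ → refl) a ,
          w , resp K₂ (⟨⟩-cong (λ _ → refl) (λ n → e (suc (2 * n)))) (λ _ → refl) b ,
          resp K₁ (⟨⟩-cong (λ n → e (2 * n)) (λ _ → refl)) d c }
      ; functional = λ { {u} {r} {r′} (v , a , w , b , c) (v′ , a′ , w′ , b′ , c′) →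
          functional K₁ (resp K₁ (⟨⟩-cong (λ _ → refl)
            (functional K₂ (resp K₂ (⟨⟩-cong (functional H₁ a a′) (λ _ → refl)) (λ _ → refl) b) b′)) (λ _ → refl) c) c′ }
      }

-- Sorting

below? : ℕ → ℕ → ℕ
below? x l = 1 ∸ (suc x ∸ l)

below?-yes : ∀ {x l} → x < l → below? x l ≡ 1
below?-yes x<l rewrite ℕ.m≤n⇒m∸n≡0 x<l = refl

below?-no : ∀ {x l} → l ≤ x → below? x l ≡ 0
below?-no l≤x = not-zero (ℕ.m>n⇒m∸n≢0 (s≤s l≤x))

below : Baire → ℕ → ℕ → ℕ
below g l N = ∑ N (λ i → below? (g i) l)

below-mono : ∀ g l {M N} → M ≤ N → below g l M ≤ below g l N
below-mono g l {M} = from-≤ (λ N → below g l M ≤ below g l N) ℕ.≤-refl λ _ _ h → ℕ.≤-trans h (ℕ.m≤m+n _ _)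

below-cong : ∀ {g h} l N → g ~[ N ] h → below g l N ≡ below h l N
below-cong l zero    e = refl
below-cong l (suc N) e = cong₂ _+_ (below-cong l N (~-mono (ℕ.n≤1+n N) e)) (cong (λ x → below? x l) (e N ℕ.≤-refl))

below-const : ∀ g l {M N} → M ≤ N → (∀ n → M ≤ n → n < N → l ≤ g n) → below g l N ≡ below g l M
below-const g l {M} {N} M≤N h with ℕ.m≤n⇒m<n∨m≡n M≤N
... | inj₂ refl = refl
below-const g l {M} {suc N} _ h | inj₁ (s≤s M≤N) = trans (cong₂ _+_
  (below-const g l M≤N λ n M≤n n<N → h n M≤n (ℕ.m<n⇒m<1+n n<N)) (below?-no (h N M≤N ℕ.≤-refl)))
  (ℕ.+-identityʳ _)

below-unbounded : ∀ g l → (∀ N → ∃ λ n → N ≤ n × g n < l) → ∀ b → ∃ λ N → b < below g l N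
below-unbounded g l h zero    = let (n , _ , lt) = h 0 in
  suc n , ℕ.≤-trans (ℕ.≤-reflexive (sym (below?-yes lt))) (ℕ.m≤n+m _ _)
below-unbounded g l h (suc b) = let (N , b<) = below-unbounded g l h b ; (n , N≤n , lt) = h N in
  suc n , ℕ.≤-trans (s≤s (ℕ.≤-trans b< (below-mono g l N≤n)))
    (ℕ.≤-reflexive (trans (ℕ.+-comm 1 (below g l n)) (cong (below g l n +_) (sym (below?-yes lt)))))

-- Characterises the sorted sequence by counting, without naming the limit letter or the multiplicities.
Sorts : Baire → Baire → Set
Sorts g q = ∀ n l → (q n < l → ∃ λ N → n < below g l N) × (∀ N → n < below g l N → q n < l)

Sorts-functional : ∀ {g h q r} → g ≗ h → Sorts g q → Sorts h r → q ≗ r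
Sorts-functional {g} {h} {q} {r} e s t n = ℕ.≤-antisym (le s t (λ i → sym (e i))) (le t s e)
  where
  le : ∀ {g h q r} → Sorts g q → Sorts h r → (∀ i → h i ≡ g i) → q n ≤ r n
  le {r = r} s t e = let (N , n<) = proj₁ (t n (suc (r n))) ℕ.≤-refl in
    s≤s⁻¹ (proj₂ (s n (suc (r n))) N (subst (n <_) (below-cong (suc (r n)) N (λ i _ → e i)) n<))

-- Mediates between counting by sums on initial segments and the bijections in `HasCardinality`.
record Enum (P : ℕ → Set) (N c : ℕ) : Set where
  field
    elem        : Fin c → ℕ
    inj         : ∀ {i j} → elem i ≡ elem j → i ≡ j
    satisfies   : ∀ i → P (elem i)
    below-bound : ∀ i → elem i < N
    exhaustive  : ∀ n → n < N → P n → ∃ λ i → elem i ≡ n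

open Enum

enum-zero : ∀ {P} → Enum P 0 0
enum-zero = record { elem = λ () ; inj = λ { {()} } ; satisfies = λ () ; below-bound = λ () ; exhaustive = λ _ () }

enum-no : ∀ {P N c} → ¬ P N → Enum P N c → Enum P (suc N) c
enum-no ¬p E = record
  { elem = elem E ; inj = inj E ; satisfies = satisfies E ; below-bound = λ i → ℕ.m<n⇒m<1+n (below-bound E i)
  ; exhaustive = λ n n<1+N p → [ n , n<1+N , p ]
  }
  where
  [_,_,_] : ∀ n → n < suc _ → _ → _
  [ n , n<1+N , p ] with ℕ.m<1+n⇒m<n∨m≡n n<1+N
  ... | inj₁ n<N  = exhaustive E n n<N p
  ... | inj₂ refl = contradiction p ¬p

enum-yes : ∀ {P N c} → P N → Enum P N c → Enum P (suc N) (suc c)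
enum-yes {P} {N} {c} p E = record
  { elem     = el
  ; inj      = λ {i} {j} → el-inj i j
  ; satisfies      = λ { Fin.zero → p ; (Fin.suc i) → satisfies E i }
  ; below-bound  = λ { Fin.zero → ℕ.≤-refl ; (Fin.suc i) → ℕ.m<n⇒m<1+n (below-bound E i) }
  ; exhaustive = comp′
  }
  where
  el : Fin (suc c) → ℕ
  el Fin.zero    = N
  el (Fin.suc i) = elem E i
  el-inj : ∀ i j → el i ≡ el j → i ≡ j
  el-inj Fin.zero    Fin.zero    _ = refl
  el-inj Fin.zero    (Fin.suc j) e = contradiction (below-bound E j) (ℕ.<-irrefl (sym e))
  el-inj (Fin.suc i) Fin.zero    e = contradiction (below-bound E i) (ℕ.<-irrefl e)
  el-inj (Fin.suc i) (Fin.suc j) e = cong Fin.suc (inj E e)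
  comp′ : ∀ n → n < suc N → P n → ∃ λ i → el i ≡ n
  comp′ n n<1+N q with ℕ.m<1+n⇒m<n∨m≡n n<1+N
  ... | inj₁ n<N  = let (i , e) = exhaustive E n n<N q in Fin.suc i , e
  ... | inj₂ refl = Fin.zero , refl

occurs : ∀ {d} → Fin d → Fin d → ℕ
occurs l x with x Fin.≟ l
... | yes _ = 1
... | no  _ = 0

count : ∀ {d} → (ℕ → Fin d) → Fin d → ℕ → ℕ
count x l N = ∑ N (λ i → occurs l (x i))

enum : ∀ {d} (x : ℕ → Fin d) l N → Enum (λ n → x n ≡ l) N (count x l N)
enum x l zero = enum-zero
enum x l (suc N) with x N Fin.≟ l
... | yes e = subst (Enum _ _) (sym (ℕ.+-comm (count x l N) 1)) (enum-yes e (enum x l N))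
... | no ¬e = subst (Enum _ _) (sym (ℕ.+-identityʳ _)) (enum-no ¬e (enum x l N))

enum-cardinality : ∀ {P N c} → (∀ n → P n → n < N) → Enum P N c → HasCardinality (≡.setoid ℕ) P c
enum-cardinality h E = record
  { to        = λ i → elem E i , satisfies E i
  ; cong      = cong (elem E)
  ; bijective = inj E , λ (n , p) → let (i , e) = exhaustive E n (h n p) p in i , λ { refl → e }
  }

cardinality-below-bound : ∀ {P c} → HasCardinality (≡.setoid ℕ) P c → ∃ λ N → ∀ n → P n → n < N
cardinality-below-bound {P} {c} B = let (N , h) = bound c (λ i → proj₁ (to i)) in
  N , λ n p → let (i , e) = surjective (n , p) in subst (_< N) (e refl) (h i)
  where
  open Bijection B using (to; injective; surjective)
  bound : ∀ c (f : Fin c → ℕ) → ∃ λ N → ∀ i → f i < N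
  bound zero    f = 0 , λ ()
  bound (suc c) f = let (N , h) = bound c (λ i → f (Fin.suc i)) in
    suc (f Fin.zero) ⊔ N , λ { Fin.zero    → ℕ.m≤m⊔n _ N
                             ; (Fin.suc i) → ℕ.≤-trans (h i) (ℕ.m≤n⊔m (suc (f Fin.zero)) N) }

-- Two injections in opposite directions compare the enumeration with the bijection.
cardinality-enum : ∀ {P N c k} → (∀ n → P n → n < N) → HasCardinality (≡.setoid ℕ) P c → Enum P N k → k ≡ c
cardinality-enum {N = N} h B E = ℕ.≤-antisym
  (Fin.injective⇒≤ {f = λ i → proj₁ (surjective (elem E i , satisfies E i))}
    λ {i} {j} e → inj E (trans (sym (proj₂ (surjective (elem E i , satisfies E i)) refl))
      (trans (cong (λ k → proj₁ (to k)) e) (proj₂ (surjective (elem E j , satisfies E j)) refl))))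
  (Fin.injective⇒≤ {f = λ i → proj₁ (ix i)}
    λ {i} {j} e → injective (trans (sym (proj₂ (ix i))) (trans (cong (elem E) e) (proj₂ (ix j)))))
  where
  open Bijection B using (to; injective; surjective)
  ix : ∀ i → ∃ λ k → elem E k ≡ proj₁ (to i)
  ix i = exhaustive E _ (h _ (proj₂ (to i))) (proj₂ (to i))

module _ {d : ℕ} (l : ℕ) where

  -- The number of letters below `l` in the word that repeats each letter `a` of the list `h a`
  -- times.
  weight : (Fin d → ℕ) → List (Fin d) → ℕ
  weight h []       = 0
  weight h (a ∷ as) = below? (toℕ a) l * h a + weight h as

  weight-0 : ∀ {h} as → All (λ a → toℕ a < l → h a ≡ 0) as → weight h as ≡ 0
  weight-0 [] [] = refl
  weight-0 {h} (a ∷ as) (z ∷ zs) with toℕ a <? l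
  ... | yes a<l = cong₂ _+_ (trans (cong (below? (toℕ a) l *_) (z a<l)) (ℕ.*-zeroʳ (below? (toℕ a) l))) (weight-0 as zs)
  ... | no  a≮l = cong₂ _+_ (cong (_* h a) (below?-no (ℕ.≮⇒≥ a≮l))) (weight-0 as zs)

  weight-+ : ∀ f g as → weight (λ a → f a + g a) as ≡ weight f as + weight g as
  weight-+ f g [] = refl
  weight-+ f g (a ∷ as) = trans (cong (_ +_) (weight-+ f g as))
    (lemma (below? (toℕ a) l) (f a) (g a) (weight f as) (weight g as))
    where
    lemma : ∀ b x y u v → b * (x + y) + (u + v) ≡ b * x + u + (b * y + v)
    lemma = solve-∀

  weight-cong : ∀ {f g} as → All (λ a → toℕ a < l → f a ≡ g a) as → weight f as ≡ weight g as
  weight-cong [] [] = refl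
  weight-cong {f} {g} (a ∷ as) (e ∷ es) with toℕ a <? l
  ... | yes a<l = cong₂ _+_ (cong (below? (toℕ a) l *_) (e a<l)) (weight-cong as es)
  ... | no  a≮l rewrite below?-no {toℕ a} (ℕ.≮⇒≥ a≮l) = weight-cong as es

  -- A strictly ascending list contains `x` at most once, so at most one summand survives.
  weight-occurs : ∀ x as → AllPairs Fin._<_ as → (toℕ x < l → x ∈ᴸ as) →
                  weight (λ a → occurs a x) as ≡ below? (toℕ x) l
  weight-occurs x as ord mem with toℕ x <? l
  ... | no x≮l = trans (weight-0 as (All.universal (λ a a<l → off a a<l) as)) (sym (below?-no (ℕ.≮⇒≥ x≮l)))
    where
    off : ∀ a → toℕ a < l → occurs a x ≡ 0
    off a a<l with x Fin.≟ a
    ... | yes refl = contradiction a<l x≮l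
    ... | no  _    = refl
  ... | yes x<l = trans (go as ord (mem x<l)) (sym (below?-yes x<l))
    where
    off : ∀ a → x Fin.< a → occurs a x ≡ 0
    off a x<a with x Fin.≟ a
    ... | yes refl = contradiction x<a (ℕ.<-irrefl refl)
    ... | no  _    = refl
    off′ : ∀ a → a Fin.< x → occurs a x ≡ 0
    off′ a a<x with x Fin.≟ a
    ... | yes refl = contradiction a<x (ℕ.<-irrefl refl)
    ... | no  _    = refl
    on : occurs x x ≡ 1
    on with x Fin.≟ x
    ... | yes _ = refl
    ... | no ¬e = contradiction refl ¬e
    go : ∀ as → AllPairs Fin._<_ as → x ∈ᴸ as → weight (λ a → occurs a x) as ≡ 1
    go (a ∷ as) (lts ∷ ord) (here refl) = trans (cong₂ _+_ (cong₂ _*_ (below?-yes x<l) on)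
      (weight-0 as (All.map (λ x<a _ → off _ x<a) lts))) refl
    go (a ∷ as) (lts ∷ ord) (there x∈) = trans (cong₂ _+_
      (trans (cong (below? (toℕ a) l *_) (off′ a (All.lookup lts x∈))) (ℕ.*-zeroʳ (below? (toℕ a) l)))
      (go as ord x∈)) refl

  -- The blocks ascend and `l ≤ m`, so the letters below `l` fill an initial segment, whose length
  -- is the weight.
  sorted-below : ∀ (c : Fin d → ℕ) m as → AllPairs Fin._<_ as → All (λ a → a Fin.< m) as → l ≤ toℕ m → ∀ n →
                 (toℕ ((concatMap (λ a → replicate (c a) a) as ++ω const m) n) < l → n < weight c as) ×
                 (n < weight c as → toℕ ((concatMap (λ a → replicate (c a) a) as ++ω const m) n) < l)
  sorted-below c m [] _ _ l≤m n = (λ m<l → contradiction l≤m (ℕ.<⇒≱ m<l)) , λ ()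
  sorted-below c m (a ∷ as) (lts ∷ ord) (_ ∷ <m) l≤m n with toℕ a <? l
  ... | yes a<l rewrite below?-yes a<l | ℕ.+-identityʳ (c a) = go (c a) n
    where
    go : ∀ k n → (toℕ (((replicate k a List.++ concatMap (λ a → replicate (c a) a) as) ++ω const m) n) < l → n < k + weight c as) ×
                 (n < k + weight c as → toℕ (((replicate k a List.++ concatMap (λ a → replicate (c a) a) as) ++ω const m) n) < l)
    go zero    n       = sorted-below c m as ord <m l≤m n
    go (suc k) zero    = (λ _ → s≤s z≤n) , λ _ → a<l
    go (suc k) (suc n) = (λ h → s≤s (proj₁ (go k n) h)) , λ h → proj₂ (go k n) (s≤s⁻¹ h)
  ... | no a≮l rewrite below?-no {toℕ a} (ℕ.≮⇒≥ a≮l) = go (c a) n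
    where
    none : weight c as ≡ 0
    none = weight-0 as (All.map (λ a<b b<l → contradiction (ℕ.<-trans a<b b<l) a≮l) lts)
    go : ∀ k n → (toℕ (((replicate k a List.++ concatMap (λ a → replicate (c a) a) as) ++ω const m) n) < l → n < weight c as) ×
                 (n < weight c as → toℕ (((replicate k a List.++ concatMap (λ a → replicate (c a) a) as) ++ω const m) n) < l)
    go zero    n       = sorted-below c m as ord <m l≤m n
    go (suc k) zero    = (λ h → contradiction h a≮l) , λ h → contradiction (subst (0 <_) none h) λ ()
    go (suc k) (suc n) = (λ h → contradiction (subst (n <_) none (proj₁ (go k n) h)) λ ()) ,
                         λ h → contradiction (subst (suc n <_) none h) λ ()

sorted-≤ : ∀ {d} (c : Fin d → ℕ) m as → All (λ a → a Fin.< m) as → ∀ n →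
           toℕ ((concatMap (λ a → replicate (c a) a) as ++ω const m) n) ≤ toℕ m
sorted-≤ c m [] _ n = ℕ.≤-refl
sorted-≤ c m (a ∷ as) (a<m ∷ <m) = go (c a)
  where
  go : ∀ k n → toℕ (((replicate k a List.++ concatMap (λ a → replicate (c a) a) as) ++ω const m) n) ≤ toℕ m
  go zero    n       = sorted-≤ c m as <m n
  go (suc k) zero    = ℕ.<⇒≤ a<m
  go (suc k) (suc n) = go k n

-- If `l` exceeds the limit letter `m`, infinitely many letters are below `l`, and so are all sorted
-- ones. Otherwise each letter below `l` occurs finitely often, and past the last occurrence `below`
-- equals the sum of the multiplicities.
Sort-sorts : ∀ {d} x y → rel (Sort d) x y → Sorts (λ n → toℕ (x n)) (λ n → toℕ (y n))
Sort-sorts {d} x y (m , c , inf , _ , card , y≗) n l with l ≤? toℕ m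
... | no l≰m =
  (λ _ → below-unbounded g l (λ N → let (k , N≤k , e) = inf N in k , N≤k , subst (_< l) (sym (cong toℕ e)) (ℕ.≰⇒> l≰m)) n) ,
  λ _ _ → ℕ.≤-<-trans (subst (λ z → toℕ z ≤ toℕ m) (sym (y≗ n)) (sorted-≤ c m ls <m n)) (ℕ.≰⇒> l≰m)
  where
  g : Baire
  g n = toℕ (x n)
  ls : List (Fin d)
  ls = filter (Fin._<? m) (allFin d)
  <m : All (λ a → a Fin.< m) ls
  <m = all-filter (Fin._<? m) (allFin d)
... | yes l≤m =
  (λ lt → N₀ , subst (n <_) (sym final) (proj₁ s (subst (λ z → toℕ z < l) (y≗ n) lt))) ,
  λ N n<b → subst (λ z → toℕ z < l) (sym (y≗ n)) (proj₂ s (ℕ.<-≤-trans n<b (total N)))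
  where
  g : Baire
  g n = toℕ (x n)
  ls : List (Fin d)
  ls = filter (Fin._<? m) (allFin d)
  <m : All (λ a → a Fin.< m) ls
  <m = all-filter (Fin._<? m) (allFin d)
  ord : AllPairs Fin._<_ ls
  ord = AllPairs.filter⁺ (Fin._<? m) (AllPairs.tabulate⁺-< id)
  s = sorted-below l c m ls ord <m l≤m n
  split : ∀ N → below g l N ≡ weight l (λ a → count x a N) ls
  split zero    = sym (weight-0 l ls (All.universal (λ _ _ → refl) ls))
  split (suc N) = trans (cong₂ _+_ (split N) (sym (weight-occurs l (x N) ls ord
      λ lt → ∈-filter⁺ (Fin._<? m) (∈-allFin (x N)) (ℕ.<-≤-trans lt l≤m))))
    (sym (weight-+ l (λ a → count x a N) (λ a → occurs a (x N)) ls))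
  bounds : ∀ ls → All (λ a → a Fin.< m) ls → ∃ λ N → All (λ a → ∀ n → x n ≡ a → n < N) ls
  bounds [] [] = 0 , []
  bounds (a ∷ ls) (a<m ∷ <m) =
    let (N , h) = cardinality-below-bound (card a a<m) ; (M , hs) = bounds ls <m in
    N ⊔ M , (λ n e → ℕ.≤-trans (h n e) (ℕ.m≤m⊔n N M)) ∷ All.map (λ h n e → ℕ.≤-trans (h n e) (ℕ.m≤n⊔m N M)) hs
  N₀ = proj₁ (bounds ls <m)
  eventually : ∀ {N} → N₀ ≤ N → below g l N ≡ weight l c ls
  eventually {N} N₀≤N = trans (split N) (weight-cong l ls (All.zipWith
    (λ {a} (a<m , h) _ → cardinality-enum (λ n e → ℕ.≤-trans (h n e) N₀≤N) (card a a<m) (enum x a N)) (<m , proj₂ (bounds ls <m))))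
  final : below g l N₀ ≡ weight l c ls
  final = eventually ℕ.≤-refl
  total : ∀ N → below g l N ≤ weight l c ls
  total N = ℕ.≤-trans (below-mono g l (ℕ.m≤m⊔n N N₀)) (ℕ.≤-reflexive (eventually (ℕ.m≤n⊔m N N₀)))

-- Classical logic, recurrent letters and totality of sorting

module _ (em : ExcludedMiddle 0ℓ) where

  dne : {A : Set} → ¬ ¬ A → A
  dne {A} h with em {A}
  ... | yes a = a
  ... | no ¬a = contradiction ¬a h

  ¬∀ : {A : Set} {P : A → Set} → ¬ (∀ a → P a) → ∃ λ a → ¬ P a
  ¬∀ h = dne λ k → h λ a → dne λ np → k (a , np)

  ¬→ : {A B : Set} → ¬ (A → B) → A × ¬ B
  ¬→ h = dne (λ na → h λ a → contradiction a na) , λ b → h (λ _ → b)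

  least-witness : (P : ℕ → Set) → ∃ P → ∃ λ m → P m × (∀ j → j < m → ¬ P j)
  least-witness P (n , p) = go n 0 (ℕ.+-identityʳ n) λ _ ()
    where
    go : ∀ k i → k + i ≡ n → (∀ j → j < i → ¬ P j) → ∃ λ m → P m × (∀ j → j < m → ¬ P j)
    go zero    i e h = i , subst P (sym e) p , h
    go (suc k) i e h with em {P i}
    ... | yes pi = i , pi , h
    ... | no ¬pi = go k (suc i) (trans (ℕ.+-suc k i) e) λ j j<1+i → case j (ℕ.m<1+n⇒m<n∨m≡n j<1+i)
      where
      case : ∀ j → j < i ⊎ j ≡ i → ¬ P j
      case j (inj₁ j<i)  = h j j<i
      case j (inj₂ refl) = ¬pi

  finitely-often : {A : Set} (x : ℕ → A) (a : A) → ¬ InfinitelyOften x a → ∃ λ N → ∀ n → x n ≡ a → n < N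
  finitely-often x a h = let (N , k) = ¬∀ h in N , λ n e → ℕ.≰⇒> λ N≤n → k (n , N≤n , e)

  -- Pigeonhole: if all letters stopped before a common `N`, the letter at place `N` could not
  -- exist.
  recurrent : ∀ {d} (x : ℕ → Fin d) → ∃ λ l → InfinitelyOften x l
  recurrent {d} x = dne λ none →
    let (N , h) = bound d (λ l N → ∀ n → x n ≡ l → n < N) (λ m≤n k n e → ℕ.≤-trans (k n e) m≤n)
                    (λ l → finitely-often x l λ i → none (l , i))
    in ℕ.<-irrefl refl (h (x N) N refl)
    where
    bound : ∀ c (P : Fin c → ℕ → Set) → (∀ {l m n} → m ≤ n → P l m → P l n) → (∀ l → ∃ (P l)) → ∃ λ N → ∀ l → P l N
    bound zero    P mono h = 0 , λ ()
    bound (suc c) P mono h = let (M , p) = h Fin.zero ; (N , q) = bound c (λ l → P (Fin.suc l)) mono (λ l → h (Fin.suc l)) in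
      M ⊔ N , λ { Fin.zero → mono (ℕ.m≤m⊔n M N) p ; (Fin.suc l) → mono (ℕ.m≤n⊔m M N) (q l) }

  least-recurrent : ∀ {d} (x : ℕ → Fin d) →
    ∃ λ m → InfinitelyOften x m × (∀ l → l Fin.< m → ¬ InfinitelyOften x l)
  least-recurrent x with recurrent x
  ... | l , i with least-witness (λ n → ∃ λ l → toℕ l ≡ n × InfinitelyOften x l) (toℕ l , l , refl , i)
  ...   | _ , (m , refl , inf) , min = m , inf , λ l l<m i → min (toℕ l) l<m (l , refl , i)

  -- A realizer owes an answer only on the domain, so the instances handed to it must be shown to
  -- have a solution.
  Sort-total : ∀ {d} (x : ℕ → Fin d) → ∃ (rel (Sort d) x)
  Sort-total {d} x =
    let (m , inf , min) = least-recurrent x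
        c : Fin d → ℕ
        c l = size l
    in (concatMap (λ l → replicate (c l) l) (filter (Fin._<? m) (allFin d)) ++ω const m) ,
       m , c , inf , min , (λ l l<m → size-card l (min l l<m)) , λ _ → refl
    where
    size : Fin d → ℕ
    size l with em {InfinitelyOften x l}
    ... | yes _ = 0
    ... | no  h = count x l (proj₁ (finitely-often x l h))
    size-card : ∀ l → ¬ InfinitelyOften x l → HasCardinality (≡.setoid ℕ) (λ n → x n ≡ l) (size l)
    size-card l ¬i with em {InfinitelyOften x l}
    ... | yes i = contradiction i ¬i
    ... | no  h = let (N , b) = finitely-often x l h in enum-cardinality b (enum x l N)

-- Closed sets from their names

module _ (em : ExcludedMiddle 0ℓ) (X : RepresentedSpace) where

  -- A semidecision procedure for the complement `O` becomes a name of a closed set; excluded middle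
  -- supplies the Boolean characteristic function.
  closed : (O : Carrier X → Set) → (∀ {x y} → RepresentedSpace._≈_ X x y → O x → O y) → (α : Baire) →
           (∀ q x → Name X q x → ∃ λ z → graph (associate α) q z × ((∃ λ n → z n ≢ 0) → O x) × (O x → ∃ λ n → z n ≢ 0)) →
           ∃ λ A → Name (𝒜 X) α A × (∀ x → _∈_ {X} x A → ¬ O x) × (∀ x → ¬ O x → _∈_ {X} x A)
  closed O O-resp α h = (χ , α , represents) , represents , out , in′
    where
    χ₀ : Carrier X → Bool
    χ₀ x with em {O x}
    ... | yes _ = true
    ... | no  _ = false
    χ-cong : ∀ {x y} → RepresentedSpace._≈_ X x y → χ₀ x ≡ χ₀ y
    χ-cong {x} {y} e with em {O x} | em {O y}
    ... | yes _ | yes _ = refl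
    ... | no  _ | no  _ = refl
    ... | yes o | no ¬o = contradiction (O-resp e o) ¬o
    ... | no ¬o | yes o = contradiction (O-resp (Setoid.sym (RepresentedSpace.setoid X) e) o) ¬o
    χ : Func (RepresentedSpace.setoid X) (≡.setoid Bool)
    χ = record { to = χ₀ ; cong = χ-cong }
    represents : ∀ q x → Name X q x → ∃ λ z → graph (associate α) q z × Reflects (∃ λ n → z n ≢ 0) (χ₀ x)
    represents q x qx with h q x qx | em {O x}
    ... | z , a , b , c | yes o = z , a , ofʸ (c o)
    ... | z , a , b , c | no ¬o = z , a , ofⁿ (λ k → ¬o (b k))
    out : ∀ x → χ₀ x ≡ false → ¬ O x
    out x e with em {O x}
    ... | no ¬o = ¬o
    out x () | yes _
    in′ : ∀ x → ¬ O x → χ₀ x ≡ false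
    in′ x ¬o with em {O x}
    ... | no _  = refl
    ... | yes o = contradiction o ¬o

code-injective : ∀ (f g : Baire) k l → code (applyUpTo f k) ≡ code (applyUpTo g l) → k ≡ l × f ~[ k ] g
code-injective f g zero zero e = refl , λ _ ()
code-injective f g zero (suc l) e = contradiction (tl<cons (g 0) (code (applyUpTo (λ i → g (suc i)) l)))
  (ℕ.≤⇒≯ (subst (_≤ code (applyUpTo (λ i → g (suc i)) l)) e z≤n))
code-injective f g (suc k) zero e = contradiction (tl<cons (f 0) (code (applyUpTo (λ i → f (suc i)) k)))
  (ℕ.≤⇒≯ (subst (_≤ code (applyUpTo (λ i → f (suc i)) k)) (sym e) z≤n))
code-injective f g (suc k) (suc l) e with cons-injective (f 0) (g 0) _ _ e
... | e₀ , e₁ with code-injective (λ i → f (suc i)) (λ i → g (suc i)) k l e₁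
...   | refl , h = refl , λ { zero _ → e₀ ; (suc i) (s≤s i<k) → h i i<k }

Binary : Baire → Set
Binary f = ∀ n → f n < 2

toSeq : ∀ {d} (f : Baire) → (∀ n → f n < d) → ℕ → Fin d
toSeq f b n = fromℕ< (b n)

-- Strategies of the adversary

⟨⟩-~ : ∀ {p p′ q q′ n} → p ~[ n ] p′ → q ~[ n ] q′ → ⟨ p , q ⟩ ~[ n ] ⟨ p′ , q′ ⟩
⟨⟩-~ e d zero    0<n = e 0 0<n
⟨⟩-~ {n = suc n} e d (suc i) (s≤s i<n) =
  ⟨⟩-~ {n = n} (λ j j<n → d j (ℕ.m<n⇒m<1+n j<n)) (λ j j<n → e (suc j) (s≤s j<n)) i i<n

-- A clopen set, the union of the cylinders of length `dep` around `pt i` for `i < num`. The closed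
-- set of the adversary is the intersection of a sequence of stages, of which finitely many are
-- fixed at any time.
record Stage : Set where
  constructor stage
  field
    num : ℕ
    pt  : ℕ → Baire
    dep : ℕ

open Stage

infix 4 _inside_ _≈[_]_

_inside_ : Baire → Stage → Set
f inside c = ∃ λ i → i < num c × f ~[ dep c ] pt c i

inside-resp : ∀ {f g} c → f ~[ dep c ] g → f inside c → g inside c
inside-resp c e (i , i< , d) = i , i< , ~-trans (~-sym e) d

_≈[_]_ : (ℕ → Stage) → ℕ → (ℕ → Stage) → Set
S ≈[ N ] T = ∀ s → s < N → S s ≡ T s

≈-trans : ∀ {S T U N} → S ≈[ N ] T → T ≈[ N ] U → S ≈[ N ] U
≈-trans e d s lt = trans (e s lt) (d s lt)

≈-sym : ∀ {S T N} → S ≈[ N ] T → T ≈[ N ] S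
≈-sym e s lt = sym (e s lt)

≈-mono : ∀ {S T M N} → M ≤ N → S ≈[ N ] T → S ≈[ M ] T
≈-mono M≤N e s lt = e s (ℕ.<-≤-trans lt M≤N)

glue : (ℕ → Stage) → ℕ → (ℕ → Stage) → ℕ → Stage
glue S N T s with s <? N
... | yes _ = S s
... | no  _ = T s

glue-< : ∀ S N T → glue S N T ≈[ N ] S
glue-< S N T s s<N with s <? N
... | yes _   = refl
... | no  s≮N = contradiction s<N s≮N

glue-≥ : ∀ S N T s → N ≤ s → glue S N T s ≡ T s
glue-≥ S N T s N≤s with s <? N
... | yes s<N = contradiction N≤s (ℕ.<⇒≱ s<N)
... | no  _   = refl

-- A legal move after `N` stages: the cylinders are pairwise different and lie in all earlier
-- stages, so each of them can still hold a point of the intersection.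
record Good (N : ℕ) (S : ℕ → Stage) (c : Stage) : Set where
  field
    deeper   : ∀ s → s < N → dep (S s) ≤ dep c
    within   : ∀ s → s < N → ∀ i → i < num c → pt c i inside S s
    distinct : ∀ i j → i < num c → j < num c → pt c i ~[ dep c ] pt c j → i ≡ j
    binary   : ∀ i → Binary (pt c i)

Good-resp : ∀ {N S T c} → S ≈[ N ] T → Good N S c → Good N T c
Good-resp {c = c} e g = record
  { deeper   = λ s s<N → subst (λ z → dep z ≤ dep c) (e s s<N) (deeper s s<N)
  ; within   = λ s s<N i i< → subst (pt c i inside_) (e s s<N) (within s s<N i i<)
  ; distinct = distinct
  ; binary   = binary
  }
  where open Good g

Good-add : ∀ {N S c} → Good N S c → S N ≡ c → Good (suc N) S c
Good-add {N} {S} {c} g e = record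
  { deeper   = λ s s<1+N → dp s (ℕ.m<1+n⇒m<n∨m≡n s<1+N)
  ; within   = λ s s<1+N → ins s (ℕ.m<1+n⇒m<n∨m≡n s<1+N)
  ; distinct = distinct
  ; binary   = binary
  }
  where
  open Good g
  dp : ∀ s → s < N ⊎ s ≡ N → dep (S s) ≤ dep c
  dp s (inj₁ s<N)  = deeper s s<N
  dp s (inj₂ refl) = ℕ.≤-reflexive (cong dep e)
  ins : ∀ s → s < N ⊎ s ≡ N → ∀ i → i < num c → pt c i inside S s
  ins s (inj₁ s<N)  i i< = within s s<N i i<
  ins s (inj₂ refl) i i< = subst (pt c i inside_) (sym e) (i , i< , λ _ _ → refl)

-- Legality survives the loss of cylinders and an increase in depth; this is how the adversary
-- removes a cylinder.
reindex : ∀ {N S c} r (ρ : ℕ → ℕ) D → dep c ≤ D → Good N S c → (∀ i → i < r → ρ i < num c) →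
          (∀ i j → i < r → j < r → ρ i ≡ ρ j → i ≡ j) → Good N S (stage r (λ i → pt c (ρ i)) D)
reindex r ρ D ≤D g lt inj = record
  { deeper   = λ s s<N → ℕ.≤-trans (deeper s s<N) ≤D
  ; within   = λ s s<N i i<r → within s s<N (ρ i) (lt i i<r)
  ; distinct = λ i j i< j< e → inj i j i< j< (distinct (ρ i) (ρ j) (lt i i<) (lt j j<) (~-mono ≤D e))
  ; binary   = λ i → binary (ρ i)
  }
  where open Good g

-- A sequence of stages in which r cylinders shrink to r points.
record Play (S : ℕ → Stage) (r : ℕ) : Set where
  field
    time     : ℕ → ℕ
    clusters : ℕ → Stage
    time<    : ∀ k → time k < time (suc k)
    good     : ∀ k → Good (time k) S (clusters k)
    num≡     : ∀ k → num (clusters k) ≡ r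
    hit      : ∀ k → S (time k) ≡ clusters k
    dep<     : ∀ k → dep (clusters k) < dep (clusters (suc k))
    refines  : ∀ k i → i < r → pt (clusters (suc k)) i ~[ dep (clusters k) ] pt (clusters k) i

  limit : ℕ → Baire
  -- Digit `m` is final here, because `clusters (suc m)` has depth at least `suc m`.
  limit i m = pt (clusters (suc m)) i m

  ≤time : ∀ k → k ≤ time k
  ≤time zero    = z≤n
  ≤time (suc k) = ℕ.≤-trans (s≤s (≤time k)) (time< k)

  ≤dep : ∀ k → k ≤ dep (clusters k)
  ≤dep zero    = z≤n
  ≤dep (suc k) = ℕ.≤-trans (s≤s (≤dep k)) (dep< k)

  dep-mono : ∀ {j k} → j ≤ k → dep (clusters j) ≤ dep (clusters k)
  dep-mono {j} = from-≤ (λ k → dep (clusters j) ≤ dep (clusters k)) ℕ.≤-refl λ k _ h → ℕ.≤-trans h (ℕ.<⇒≤ (dep< k))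

  refines* : ∀ {j k} → j ≤ k → ∀ i → i < r → pt (clusters k) i ~[ dep (clusters j) ] pt (clusters j) i
  refines* {j} = from-≤ (λ k → ∀ i → i < r → pt (clusters k) i ~[ dep (clusters j) ] pt (clusters j) i) (λ _ _ _ _ → refl)
    λ k j≤k h i i<r → ~-trans (~-mono (dep-mono j≤k) (refines k i i<r)) (h i i<r)

  limit~ : ∀ k i → i < r → limit i ~[ dep (clusters k) ] pt (clusters k) i
  limit~ k i i<r m m<dep with ℕ.≤-total k (suc m)
  ... | inj₁ k≤ = refines* k≤ i i<r m m<dep
  ... | inj₂ ≤k = sym (refines* ≤k i i<r m (≤dep (suc m)))

  limit-inside : ∀ i → i < r → ∀ s → limit i inside S s
  limit-inside i i<r s = inside-resp (S s)
    (~-mono (Good.deeper (good (suc s)) s (≤time (suc s))) (~-sym (limit~ (suc s) i i<r)))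
    (Good.within (good (suc s)) s (≤time (suc s)) i (subst (i <_) (sym (num≡ (suc s))) i<r))

  limit-distinct : ∀ k i j → i < r → j < r → limit i ~[ dep (clusters k) ] limit j → i ≡ j
  limit-distinct k i j i<r j<r e = Good.distinct (good k) i j
    (subst (i <_) (sym (num≡ k)) i<r) (subst (j <_) (sym (num≡ k)) j<r)
    (~-trans (~-sym (limit~ k i i<r)) (~-trans e (limit~ k j j<r)))

  -- For each `k` some cylinder of `clusters k` contains `f`. Its index cannot vary with `k`, since
  -- different limits already differ at the depth of `clusters 0`.
  limit-complete : ∀ f → (∀ s → f inside S s) → ∃ λ i → i < r × f ≗ limit i
  limit-complete f ins = i₀ , proj₁ (proj₂ (at′ 0)) , λ m →
    let (i , i<r , e) = at′ (suc m)
        i≡i₀ = limit-distinct 0 i i₀ i<r (proj₁ (proj₂ (at′ 0)))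
                 (~-trans (~-mono (dep-mono z≤n) (~-sym e)) (proj₂ (proj₂ (at′ 0))))
    in subst (λ z → f m ≡ limit z m) i≡i₀ (e m (≤dep (suc m)))
    where
    at′ : ∀ k → ∃ λ i → i < r × f ~[ dep (clusters k) ] limit i
    at′ k = let (i , i< , e) = subst (f inside_) (hit k) (ins (time k))
                i<r = subst (i <_) (num≡ k) i<
            in i , i<r , ~-trans e (~-sym (limit~ k i i<r))
    i₀ = proj₁ (at′ 0)

opaque
  -- The adversary may stop at any time and let each cylinder shrink to its centre, so that exactly
  -- `num c` points are left.
  complete : ∀ {S N c} → Good N S c → ∃ λ T → T ≈[ N ] S × Σ (Play T (num c)) λ P →
             N ≤ Play.time P 0 × Play.clusters P 0 ≡ stage (num c) (pt c) (dep c + 0)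
  complete {S} {N} {c} g = T , glue-< S N _ , record
    { time     = λ k → N + k
    ; clusters = cl
    ; time<    = λ k → ℕ.+-monoʳ-< N ℕ.≤-refl
    ; good     = gd
    ; num≡     = λ _ → refl
    ; hit      = hits
    ; dep<     = λ k → ℕ.+-monoʳ-< (dep c) ℕ.≤-refl
    ; refines  = λ _ _ _ _ _ → refl
    } , ℕ.m≤m+n N 0 , refl
    where
    cl : ℕ → Stage
    cl k = stage (num c) (pt c) (dep c + k)
    T : ℕ → Stage
    T = glue S N (λ s → cl (s ∸ N))
    hits : ∀ k → T (N + k) ≡ cl k
    hits k = trans (glue-≥ S N _ (N + k) (ℕ.m≤m+n N k)) (cong cl (ℕ.m+n∸m≡n N k))
    gd : ∀ k → Good (N + k) T (cl k)
    gd zero    = subst (λ z → Good z T (cl 0)) (sym (ℕ.+-identityʳ N))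
      (reindex (num c) id _ (ℕ.m≤m+n (dep c) 0) (Good-resp (≈-sym (glue-< S N _)) g) (λ _ i< → i<) (λ _ _ _ _ e → e))
    gd (suc k) = subst (λ z → Good z T (cl (suc k))) (sym (ℕ.+-suc N k))
      (reindex (num c) id _ (ℕ.+-monoʳ-≤ (dep c) (ℕ.n≤1+n k)) (Good-add (gd k) (hits k)) (λ _ i< → i<) (λ _ _ _ _ e → e))

module _ (em : ExcludedMiddle 0ℓ) where

  -- Replies of an associate: 0 asks for more digits, 1 and 2 are the shifted symbols 0 and 1 of a
  -- Sierpiński name, 2 meaning that the word is excluded.
  answer : Stage → ℕ → ℕ
  answer c w with em {∃ λ f → w ≡ code (applyUpTo f (dep c))}
  ... | no _ = 0
  ... | yes (f , _) with em {f inside c}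
  ...   | yes _ = 1
  ...   | no  _ = 2

  answer-short : ∀ c f k → k < dep c → answer c (code (applyUpTo f k)) ≡ 0
  answer-short c f k k<dep with em {∃ λ g → code (applyUpTo f k) ≡ code (applyUpTo g (dep c))}
  ... | no _ = refl
  ... | yes (g , e) = contradiction k<dep (ℕ.<-irrefl (proj₁ (code-injective f g k (dep c) e)))

  answer-in : ∀ c f → f inside c → answer c (code (applyUpTo f (dep c))) ≡ 1
  answer-in c f ins with em {∃ λ g → code (applyUpTo f (dep c)) ≡ code (applyUpTo g (dep c))}
  ... | no h = contradiction (f , refl) h
  ... | yes (g , e) with em {g inside c}
  ...   | yes _ = refl
  ...   | no h  = contradiction (inside-resp c (proj₂ (code-injective f g (dep c) (dep c) e)) ins) h

  answer-out : ∀ c f → ¬ f inside c → answer c (code (applyUpTo f (dep c))) ≡ 2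
  answer-out c f out with em {∃ λ g → code (applyUpTo f (dep c)) ≡ code (applyUpTo g (dep c))}
  ... | no h = contradiction (f , refl) h
  ... | yes (g , e) with em {g inside c}
  ...   | no _  = refl
  ...   | yes h = contradiction (inside-resp c (~-sym (proj₂ (code-injective f g (dep c) (dep c) e))) h) out

  -- The minimum with x makes name S below N depend on S below N only.
  name : (ℕ → Stage) → Baire
  name S x = answer (S (hd x ⊓ x)) (tl x)

  name-cons : ∀ S s w → name S (cons s w) ≡ answer (S s) w
  name-cons S s w = cong₂ (λ s w → answer (S s) w)
    (trans (cong (_⊓ cons s w) (hd-cons s w)) (ℕ.m≤n⇒m⊓n≡m (ℕ.<⇒≤ (hd<cons s w)))) (tl-cons s w)

  name-~ : ∀ {S T N} → S ≈[ N ] T → name S ~[ N ] name T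
  name-~ e x x<N = cong (λ c → answer c (tl x)) (e _ (ℕ.≤-<-trans (ℕ.m⊓n≤n (hd x) x) x<N))

  intersection : (S : ℕ → Stage) → ∃ λ A → Name (𝒜 (Seq 2)) (name S) A ×
    (∀ x → _∈_ {Seq 2} x A → ∀ s → (λ n → toℕ (x n)) inside S s) ×
    (∀ x → (∀ s → (λ n → toℕ (x n)) inside S s) → _∈_ {Seq 2} x A)
  intersection S =
    let (A , nm , out , in′) = closed em (Seq 2) O
          (λ e (s , o) → s , λ ins → o (inside-resp (S s) (λ i _ → cong toℕ (sym (e i))) ins))
          (name S) λ q x qx → z q , (λ n → dep (S n) , correct q n) ,
            (λ (n , ne) → n , λ ins → ne (z-in q n (inside-resp (S n) (λ i _ → sym (qx i)) ins))) ,
            λ (n , o) → n , z-out q n λ ins → o (inside-resp (S n) (λ i _ → qx i) ins)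
    in A , nm , (λ x x∈ s → dne em λ no → out x x∈ (s , no)) , λ x h → in′ x λ (s , o) → o (h s)
    where
    O : (ℕ → Fin 2) → Set
    O x = ∃ λ s → ¬ ((λ n → toℕ (x n)) inside S s)
    z : Baire → Baire
    z q n with em {q inside S n}
    ... | yes _ = 0
    ... | no  _ = 1
    z-in : ∀ q n → q inside S n → z q n ≡ 0
    z-in q n ins with em {q inside S n}
    ... | yes _ = refl
    ... | no h  = contradiction ins h
    z-out : ∀ q n → ¬ q inside S n → z q n ≢ 0
    z-out q n out with em {q inside S n}
    ... | yes h = contradiction h out
    ... | no _  = λ ()
    correct : ∀ q n → name S (code (n ∷ applyUpTo q (dep (S n)))) ≡ suc (z q n) ×
                      (∀ j → j < dep (S n) → name S (code (n ∷ applyUpTo q j)) ≡ 0)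
    correct q n with em {q inside S n}
    ... | yes h = trans (name-cons S n _) (answer-in (S n) q h) , λ j lt → trans (name-cons S n _) (answer-short (S n) q j lt)
    ... | no h  = trans (name-cons S n _) (answer-out (S n) q h) , λ j lt → trans (name-cons S n _) (answer-short (S n) q j lt)

-- At such a place `q m ≤ l`; and if `q′ m` is below some `l′ ≤ l`, the letters responsible were
-- printed by `h′` before `M`, where `h` agrees. Used in both directions, this shows that these
-- places of the sorted sequence are settled at time `M`.
sorts-≤ : ∀ {h h′ q q′ l M} → Sorts h q → Sorts h′ q′ → h′ ~[ M ] h → (∀ t → M ≤ t → l ≤ h′ t) →
          ∀ m → m < below h (suc l) M → q m ≤ q′ m
sorts-≤ {h} {h′} {q} {q′} {l} {M} s s′ e hi m m< = s≤s⁻¹ (lemma (suc (q′ m)) ℕ.≤-refl)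
  where
  lemma : ∀ l′ → q′ m < l′ → q m < l′
  lemma l′ lt with l′ ≤? l
  ... | no l′≰l = ℕ.<-≤-trans (proj₂ (s m (suc l)) M m<) (ℕ.≰⇒> l′≰l)
  ... | yes l′≤l = let (L , m<L) = proj₁ (s′ m l′) lt in
    proj₂ (s m l′) M (subst (m <_) (below-cong l′ M e) (ℕ.<-≤-trans m<L
      (ℕ.≤-trans (below-mono h′ l′ (ℕ.m≤m⊔n L M)) (ℕ.≤-reflexive
        (below-const h′ l′ (ℕ.m≤n⊔m L M) λ i M≤i _ → ℕ.≤-trans l′≤l (hi i M≤i))))))

module _ (em : ExcludedMiddle 0ℓ) where

  sorting : ∀ d → PartialFunction
  sorting d = record
    { graph      = λ p q → (∀ n → p n < d) × Sorts p q
    ; resp       = λ e f (b , s) → (λ n → subst (_< d) (e n) (b n)) , λ n l →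
        (λ lt → let (N , k) = proj₁ (s n l) (subst (_< l) (sym (f n)) lt) in N , subst (n <_) (below-cong l N (λ i _ → e i)) k) ,
        λ N k → subst (_< l) (f n) (proj₂ (s n l) N (subst (n <_) (sym (below-cong l N (λ i _ → e i))) k))
    ; functional = λ (_ , s) (_ , t) → Sorts-functional (λ _ → refl) s t
    }

  sorting-⊢ : ∀ d → sorting d ⊢ Sort d
  sorting-⊢ d p x px (y , xy) = (λ n → toℕ (y n)) ,
    resp (sorting d) (λ n → sym (px n)) (λ _ → refl) ((λ n → Fin.toℕ<n (x n)) , Sort-sorts x y xy) ,
    y , (λ _ → refl) , xy

-- Choice on `n` points against sorting of fewer letters

module _ (em : ExcludedMiddle 0ℓ) {d n} (d<n : d < n) (R : C♯≤ n ≤W Sort d) where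

  private
    K : PartialFunction
    K = proj₁ (proj₂ R)
    eH eK : Rec 1
    eH = proj₁ (proj₁ (proj₂ (proj₂ R)))
    eK = proj₁ (proj₁ (proj₂ (proj₂ (proj₂ R))))

    nm : (ℕ → Stage) → Baire
    nm = name em

  -- The assumed reduction on the instance of a play: `h` is what is printed, `q` is `h` sorted, and
  -- the answer `o` has to be one of the limits.
  record Run {S r} (P : Play S r) : Set where
    open Play P
    field
      h q o  : Baire
      h-ok   : ∀ t → nm S ⊨ eH [ t ∷ [] ]⇓ h t
      h<d    : ∀ t → h t < d
      sorts  : Sorts h q
      o-ok   : ∀ t → ⟨ nm S , q ⟩ ⊨ eK [ t ∷ [] ]⇓ o t
      idx    : ℕ
      idx<r  : idx < r
      o≗     : o ≗ limit idx

  opaque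
    run : ∀ {S r} (P : Play S r) → 0 < r → r ≤ n → Run P
    run {S} {r} P 0<r r≤n =
      let (A , pA , out , in′) = intersection em S
          x : ∀ i → ℕ → Fin 2
          x i = toSeq (limit i) (λ m → Good.binary (good (suc m)) i m)
          toℕ-x : ∀ i m → toℕ (x i m) ≡ limit i m
          toℕ-x i m = Fin.toℕ-fromℕ< (Good.binary (good (suc m)) i m)
          x∈A : ∀ i → i < r → _∈_ {Seq 2} (x i) A
          x∈A i i<r = in′ (x i) (λ s → inside-resp (S s) (λ m _ → sym (toℕ-x i m)) (limit-inside i i<r s))
          found : ∀ y → _∈_ {Seq 2} y A → ∃ λ i → i < r × (∀ m → toℕ (y m) ≡ limit i m)
          found y y∈A = limit-complete (λ m → toℕ (y m)) (out y y∈A)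
          card : HasCardinality (RepresentedSpace.setoid (Seq 2)) (λ x → _∈_ {Seq 2} x A) r
          card = record
            { to        = λ i → x (toℕ i) , x∈A (toℕ i) (Fin.toℕ<n i)
            ; cong      = λ { refl _ → refl }
            ; bijective = (λ {i} {j} e → Fin.toℕ-injective (limit-distinct 0 _ _ (Fin.toℕ<n i) (Fin.toℕ<n j)
                  (λ m _ → trans (sym (toℕ-x (toℕ i) m)) (trans (cong toℕ (e m)) (toℕ-x (toℕ j) m))))) ,
                λ (y , y∈A) → let (i , i<r , e) = found y y∈A in
                  fromℕ< i<r , λ { refl m → Fin.toℕ-injective (trans (toℕ-x _ m)
                    (trans (cong (λ z → limit z m) (Fin.toℕ-fromℕ< i<r)) (sym (e m)))) }
            }
          (o , (u , (q , (h , p↦h , b , srt) , u≗) , u↦o) , y , oy , (_ , y∈A)) =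
            proj₂ (proj₂ (proj₂ (proj₂ R))) (sorting em d) (sorting-⊢ em d) (nm S) A pA
              (x 0 , (r , 0<r , r≤n , card) , x∈A 0 0<r)
          (i , i<r , e) = found y y∈A
      in record
        { h = h ; q = q ; o = o
        ; h-ok  = proj₂ (proj₁ (proj₂ (proj₂ R))) _ _ p↦h
        ; h<d   = b
        ; sorts = srt
        ; o-ok  = proj₂ (proj₁ (proj₂ (proj₂ (proj₂ R)))) _ _ (resp K u≗ (λ _ → refl) u↦o)
        ; idx   = i ; idx<r = i<r
        ; o≗    = λ m → trans (oy m) (e m)
        }
      where open Play P

  Prints : (ℕ → Stage) → ℕ → ℕ → ℕ → Set
  Prints S N t a = ∀ T → T ≈[ N ] S → nm T ⊨ eH [ t ∷ [] ]⇓ a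

  -- A state (S, N, c): the stages below N are decided and c is what is left.
  record Extends (S : ℕ → Stage) (N : ℕ) (c : Stage) (S′ : ℕ → Stage) (N′ : ℕ) (c′ : Stage) : Set where
    field
      later   : N ≤ N′
      agree   : S′ ≈[ N ] S
      good    : Good N′ S′ c′
      num≡    : num c′ ≡ num c
      deeper  : dep c ≤ dep c′
      refines : ∀ i → i < num c → pt c′ i ~[ dep c ] pt c i

  -- The extension keeps every cylinder, up to refinement, so that forcing can be repeated from the
  -- new state.
  Low : ℕ → (ℕ → Stage) → ℕ → Stage → ℕ → Set
  Low l S N c t = ∃ λ S′ → ∃ λ N′ → ∃ λ c′ → Extends S N c S′ N′ c′ ×
    ∃ λ t′ → t ≤ t′ × ∃ λ a → a < l × Prints S′ N′ t′ a

  -- From every state with l + 1 cylinders, H can be made to print one more letter below l.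
  Forces : ℕ → Set
  Forces l = ∀ S N c t → Good N S c → num c ≡ suc l → Low l S N c t

  play-prints : ∀ {S r} (P : Play S r) (X : Run P) t → ∃ λ k₀ → ∀ k → k₀ ≤ k → Prints S (Play.time P k) t (Run.h X t)
  play-prints P X t = let (B , f) = ⇓-use (Run.h-ok X t) in
    B , λ k B≤k T e → f _ (~-sym (~-mono (ℕ.≤-trans B≤k (Play.≤time P k)) (name-~ em e)))

  -- All letters are below `d`, so it is enough to let the `d + 1` cylinders shrink to points; this
  -- instance is legal because `d + 1 ≤ n`.
  forces-top : Forces d
  forces-top S N c t g refl =
    let (T , T≈ , P , N≤ , e) = complete g
        X = run P (s≤s z≤n) d<n
        (k , pr) = play-prints P X t
        open Play P
    in T , time k , clusters k , record
      { later   = ℕ.≤-trans N≤ (time-mono P z≤n)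
      ; agree   = T≈
      ; good    = good k
      ; num≡    = num≡ k
      ; deeper  = ℕ.≤-trans (ℕ.≤-trans (ℕ.m≤m+n _ 0) (ℕ.≤-reflexive (sym (cong dep e)))) (dep-mono {0} {k} z≤n)
      ; refines = λ i i< → ~-mono (ℕ.≤-trans (ℕ.m≤m+n _ 0) (ℕ.≤-reflexive (sym (cong dep e))))
          (subst (λ z → pt (clusters k) i ~[ dep (clusters 0) ] pt z i) e (refines* {0} {k} z≤n i i<))
      } , t , ℕ.≤-refl , Run.h X t , Run.h<d X t , pr k ℕ.≤-refl
    where
    time-mono : ∀ {S r} (P : Play S r) {j k} → j ≤ k → Play.time P j ≤ Play.time P k
    time-mono P {j} = from-≤ (λ k → Play.time P j ≤ Play.time P k) ℕ.≤-refl λ k _ h → ℕ.≤-trans h (ℕ.<⇒≤ (Play.time< P k))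

  -- The induction step from `suc l` to `l`, by contradiction: while the original `l + 1` cylinders
  -- survive, only letters from `l` upwards can be printed after time `t`.
  module Step (l : ℕ) (l<n : suc (suc l) ≤ n) (force : Forces (suc l))
              (S : ℕ → Stage) (N : ℕ) (c : Stage) (t : ℕ) (g : Good N S c) (num-c : num c ≡ suc l)
              (stuck : ¬ Low l S N c t) where

    -- The cylinders of `c′` outside the image of `ρ` are expendable: dropping them leaves a
    -- continuation of the initial state.
    Covers : Stage → (ℕ → ℕ) → Set
    Covers c′ ρ = ∀ i → i < suc l → ρ i < num c′ × pt c′ (ρ i) ~[ dep c ] pt c i

    covers-injective : ∀ {c′ ρ} → Covers c′ ρ → ∀ i j → i < suc l → j < suc l → ρ i ≡ ρ j → i ≡ j
    covers-injective {c′} cov i j i< j< e = Good.distinct g i j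
      (subst (i <_) (sym num-c) i<) (subst (j <_) (sym num-c) j<)
      (~-trans (~-sym (proj₂ (cov i i<))) (subst (λ z → pt c′ z ~[ dep c ] pt c j) (sym e) (proj₂ (cov j j<))))

    no-low : ∀ {S′ N′ c′ ρ t′ a} → N ≤ N′ → S′ ≈[ N ] S → Good N′ S′ c′ → dep c ≤ dep c′ → Covers c′ ρ →
             t ≤ t′ → a < l → ¬ Prints S′ N′ t′ a
    no-low {S′} {N′} {c′} {ρ} {t′} {a} N≤ S≈ g′ dep≤ cov t≤ a<l pr = stuck (S′ , N′ , _ , record
      { later   = N≤
      ; agree   = S≈
      ; good    = reindex (suc l) ρ (dep c′) ℕ.≤-refl g′ (λ i i< → proj₁ (cov i i<)) (covers-injective {c′} {ρ} cov)
      ; num≡    = sym num-c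
      ; deeper  = dep≤
      ; refines = λ i i< → proj₂ (cov i (subst (i <_) num-c i<))
      } , t′ , t≤ , a , a<l , pr)

    -- A letter below `l` would be printed after finitely many stages; dropping the surplus
    -- cylinders there gives the extension that `stuck` excludes.
    high : ∀ {T r} (P : Play T r) (X : Run P) {ρ} → N ≤ Play.time P 0 → T ≈[ N ] S →
           dep c ≤ dep (Play.clusters P 0) → Covers (Play.clusters P 0) ρ → ∀ t′ → t ≤ t′ → l ≤ Run.h X t′
    high P X {ρ} N≤ T≈ dep≤ cov t′ t≤ = ℕ.≮⇒≥ λ a<l →
      let (k , pr) = play-prints P X t′ in
      no-low {ρ = ρ} (ℕ.≤-trans N≤ (time-mono k)) T≈ (good k) (ℕ.≤-trans dep≤ (dep-mono {0} {k} z≤n))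
        (λ i i< → let (lt , e) = cov i i< in subst (ρ i <_) (trans (num≡ 0) (sym (num≡ k))) lt ,
          ~-trans (~-mono dep≤ (refines* {0} {k} z≤n (ρ i) (subst (ρ i <_) (num≡ 0) lt))) e)
        t≤ a<l (pr k ℕ.≤-refl)
      where
      open Play P
      time-mono : ∀ k → time 0 ≤ time k
      time-mono zero    = ℕ.≤-refl
      time-mono (suc k) = ℕ.≤-trans (time-mono k) (ℕ.<⇒≤ (time< k))

    -- A state with one surplus cylinder, so that the induction hypothesis for `suc l` applies to
    -- it.
    record Base (S₁ : ℕ → Stage) (N₁ : ℕ) (c₁ : Stage) : Set where
      field
        later  : N ≤ N₁
        agree  : S₁ ≈[ N ] S
        good   : Good N₁ S₁ c₁
        num≡   : num c₁ ≡ suc (suc l)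
        deeper : dep c ≤ dep c₁
        covers : Covers c₁ id

    -- As long as H prints no letter below l, K answers in the j-th cylinder.
    record Commits (S₁ : ℕ → Stage) (N₁ : ℕ) (c₁ : Stage) : Set where
      field
        S′      : ℕ → Stage
        N′      : ℕ
        c′      : Stage
        extends : Extends S₁ N₁ c₁ S′ N′ c′
        j       : ℕ
        j<      : j < suc (suc l)
        commits : ∀ {T r} (P : Play T r) (X : Run P) → T ≈[ N′ ] S′ → (∀ t′ → t ≤ t′ → l ≤ Run.h X t′) →
                  Run.o X ~[ dep c₁ ] pt c₁ j

    -- Forcing is repeated forever. The resulting run has infinitely many letters up to `l` and,
    -- from time `t` on, none below `l`; so its sorted sequence ends in letters `l`, and every
    -- initial part of it is settled at a finite time.
    module Pass {S₁ N₁ c₁} (B : Base S₁ N₁ c₁) where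

      record State : Set where
        field
          stages : ℕ → Stage
          now    : ℕ
          left   : Stage
          clock  : ℕ
          good   : Good now stages left
          num≡   : num left ≡ suc (suc l)

      open State

      record Next (s s′ : State) : Set where
        field
          later   : now s < now s′
          agree   : stages s′ ≈[ now s ] stages s
          hit     : stages s′ (now s) ≡ left s
          deeper  : dep (left s) < dep (left s′)
          refines : ∀ i → i < suc (suc l) → pt (left s′) i ~[ dep (left s) ] pt (left s) i
          tick    : ℕ
          tick≥   : clock s ≤ tick
          clock≡  : clock s′ ≡ suc tick
          letter  : ℕ
          letter< : letter < suc l
          prints  : Prints (stages s′) (now s′) tick letter

      next : ∀ s → Σ State (Next s)
      next s =
        -- The remaining cylinders are announced as a stage of their own, which keeps other points
        -- out of the intersection.
        let T  = glue (stages s) (now s) (λ _ → left s)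
            T≈ = glue-< (stages s) (now s) (λ _ → left s)
            T≡ = glue-≥ (stages s) (now s) (λ _ → left s) (now s) ℕ.≤-refl
            (S′ , N′ , c′ , E , t′ , t≤ , a , a< , pr) =
              force T (suc (now s)) (left s) (clock s) (Good-add (Good-resp (≈-sym T≈) (good s)) T≡) (num≡ s)
            open Extends E renaming (good to good′; num≡ to num≡′)
        -- The extra unit of depth makes the cylinders shrink strictly, and `suc t′` makes the next
        -- forced letter a later one.
        in record { stages = S′ ; now = N′ ; left = stage (num c′) (pt c′) (suc (dep c′)) ; clock = suc t′
                  ; good = reindex (num c′) id _ (ℕ.n≤1+n _) good′ (λ _ i< → i<) (λ _ _ _ _ e → e)
                  ; num≡ = trans num≡′ (num≡ s) } ,
           record { later = later
                  ; agree = ≈-trans (≈-mono (ℕ.n≤1+n _) agree) T≈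
                  ; hit = trans (agree (now s) ℕ.≤-refl) T≡
                  ; deeper = s≤s deeper
                  ; refines = λ i i< → refines i (subst (i <_) (sym (num≡ s)) i<)
                  ; tick = t′ ; tick≥ = t≤ ; clock≡ = refl ; letter = a ; letter< = a< ; prints = pr }

      state : ℕ → State
      state zero    = record { stages = S₁ ; now = N₁ ; left = c₁ ; clock = t ; good = Base.good B ; num≡ = Base.num≡ B }
      state (suc k) = proj₁ (next (state k))

      step : ∀ k → Next (state k) (state (suc k))
      step k = proj₂ (next (state k))

      now-mono : ∀ {j k} → j ≤ k → now (state j) ≤ now (state k)
      now-mono {j} = from-≤ (λ k → now (state j) ≤ now (state k)) ℕ.≤-refl λ k _ h → ℕ.≤-trans h (ℕ.<⇒≤ (Next.later (step k)))

      ≤now : ∀ k → k ≤ now (state k)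
      ≤now zero    = z≤n
      ≤now (suc k) = ℕ.≤-trans (s≤s (≤now k)) (Next.later (step k))

      stable : ∀ {j k} → j ≤ k → stages (state k) ≈[ now (state j) ] stages (state j)
      stable {j} = from-≤ (λ k → stages (state k) ≈[ now (state j) ] stages (state j)) (λ _ _ → refl)
        λ k j≤k → ≈-trans (≈-mono (now-mono j≤k) (Next.agree (step k)))

      S∞ : ℕ → Stage
      -- Stage `s` is fixed by then, since `s < now (state (suc s))`.
      S∞ s = stages (state (suc s)) s

      S∞≈ : ∀ k → S∞ ≈[ now (state k) ] stages (state k)
      S∞≈ k s s<N = [ (λ k≤ → stable k≤ s s<N) , (λ ≤k → sym (stable ≤k s (≤now (suc s)))) ]′ (ℕ.≤-total k (suc s))

      P : Play S∞ (suc (suc l))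
      P = record
        { time     = λ k → now (state k)
        ; clusters = λ k → left (state k)
        ; time<    = λ k → Next.later (step k)
        ; good     = λ k → Good-resp (≈-sym (S∞≈ k)) (good (state k))
        ; num≡     = λ k → num≡ (state k)
        ; hit      = λ k → trans (S∞≈ (suc k) _ (Next.later (step k))) (Next.hit (step k))
        ; dep<     = λ k → Next.deeper (step k)
        ; refines  = λ k → Next.refines (step k)
        }

      X : Run P
      X = run P (s≤s z≤n) l<n

      open Run X

      clock≥ : ∀ k → k + t ≤ clock (state k)
      clock≥ zero    = ℕ.≤-refl
      clock≥ (suc k) = ℕ.≤-trans (s≤s (ℕ.≤-trans (clock≥ k) (Next.tick≥ (step k)))) (ℕ.≤-reflexive (sym (Next.clock≡ (step k))))

      opaque
        often : ∀ M → ∃ λ m → M ≤ m × h m < suc l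
        often M = tick , ℕ.≤-trans (ℕ.≤-trans (ℕ.m≤m+n M t) (clock≥ M)) tick≥ ,
          subst (_< suc l) (⇓-det (prints S∞ (S∞≈ (suc M))) (h-ok tick)) letter<
          where open Next (step M)

      h-high : ∀ t′ → t ≤ t′ → l ≤ h t′
      h-high = high P X {id} (Base.later B) (≈-trans (≈-mono (Base.later B) (S∞≈ 0)) (Base.agree B)) (Base.deeper B) (Base.covers B)

      E : ℕ
      E = dep c₁

      opaque
        -- `b` bounds what `K` reads, of the name and of the sorted sequence alike, to produce the
        -- first `E` digits.
        useK : ∃ λ b → ∀ i → i < E → ∀ u → ⟨ nm S∞ , q ⟩ ~[ b ] u → u ⊨ eK [ i ∷ [] ]⇓ o i
        useK = collect (λ i b → ∀ u → ⟨ nm S∞ , q ⟩ ~[ b ] u → u ⊨ eK [ i ∷ [] ]⇓ o i)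
                 (λ m≤n f u e → f u (~-mono m≤n e)) E (λ i _ → ⇓-use (o-ok i))

      b = proj₁ useK

      opaque
        many : ∃ λ M → b < below h (suc l) M
        many = below-unbounded h (suc l) often b

      M = proj₁ many ⊔ t

      opaque
        useH : ∃ λ b′ → ∀ i → i < M → ∀ u → nm S∞ ~[ b′ ] u → u ⊨ eH [ i ∷ [] ]⇓ h i
        useH = collect (λ i b → ∀ u → nm S∞ ~[ b ] u → u ⊨ eH [ i ∷ [] ]⇓ h i)
                 (λ m≤n f u e → f u (~-mono m≤n e)) M (λ i _ → ⇓-use (h-ok i))

      -- Enough rounds to freeze both the part of the name read by `K` and the part that determines
      -- the first `M` letters.
      k = b ⊔ proj₁ useH

      opaque
        result : Commits S₁ N₁ c₁
        result = record
          { S′ = S∞ ; N′ = now (state k) ; c′ = left (state k)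
          ; extends = record
            { later   = now-mono {0} {k} z≤n
            ; agree   = S∞≈ 0
            ; good    = Play.good P k
            ; num≡    = trans (num≡ (state k)) (sym (Base.num≡ B))
            ; deeper  = Play.dep-mono P {0} {k} z≤n
            ; refines = λ i i< → Play.refines* P {0} {k} z≤n i (subst (i <_) (Base.num≡ B) i<)
            }
          ; j = idx ; j< = idx<r
          ; commits = λ Q Y T≈ hi → ~-trans (o~ Q Y T≈ hi) (~-trans (λ i _ → o≗ i) (Play.limit~ P 0 idx idx<r))
          }
          where
          b≤N : b ≤ now (state k)
          b≤N = ℕ.≤-trans (ℕ.m≤m⊔n b (proj₁ useH)) (≤now k)
          o~ : ∀ {T r} (Q : Play T r) (Y : Run Q) → T ≈[ now (state k) ] S∞ → (∀ t′ → t ≤ t′ → l ≤ Run.h Y t′) → Run.o Y ~[ E ] o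
          o~ {T} Q Y T≈ hi i i<E = ⇓-det (Run.o-ok Y i) (proj₂ useK i i<E _ (⟨⟩-~ (~-mono b≤N p~) q~))
            where
            p~ : nm S∞ ~[ now (state k) ] nm T
            p~ = name-~ em (≈-sym T≈)
            h~ : h ~[ M ] Run.h Y
            h~ m m<M = ⇓-det (proj₂ useH m m<M _ (~-mono (ℕ.≤-trans (ℕ.m≤n⊔m b (proj₁ useH)) (≤now k)) p~)) (Run.h-ok Y m)
            m<′ : ∀ {m} → m < b → m < below h (suc l) M
            m<′ m<b = ℕ.<-trans m<b (ℕ.<-≤-trans (proj₂ many) (below-mono h (suc l) (ℕ.m≤m⊔n (proj₁ many) t)))
            t≤M : t ≤ M
            t≤M = ℕ.m≤n⊔m (proj₁ many) t
            q~ : q ~[ b ] Run.q Y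
            q~ m m<b = ℕ.≤-antisym
              (sorts-≤ sorts (Run.sorts Y) (~-sym h~) (λ i M≤i → hi i (ℕ.≤-trans t≤M M≤i)) m (m<′ m<b))
              (sorts-≤ (Run.sorts Y) sorts h~ (λ i M≤i → h-high i (ℕ.≤-trans t≤M M≤i)) m
                (subst (m <_) (below-cong (suc l) M h~) (m<′ m<b)))

    -- Otherwise play on with the cylinders `ρ i` alone: no letter below `l` appears, so `K` answers
    -- in cylinder `j`, which is not among those left.
    drop : ∀ {S₁ N₁ c₁} (B : Base S₁ N₁ c₁) (C : Commits S₁ N₁ c₁) ρ →
           ¬ (∀ i → i < suc l → ρ i < suc (suc l) × ρ i ≢ Commits.j C × pt c₁ (ρ i) ~[ dep c ] pt c i)
    drop {S₁} {N₁} {c₁} B C ρ h =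
      let g″ = reindex (suc l) ρ (dep c′) ℕ.≤-refl good
                 (λ i i< → subst (ρ i <_) (sym (trans num≡ (Base.num≡ B))) (proj₁ (h i i<)))
                 (covers-injective {c₁} cov)
          (T , T≈ , P , N≤ , e) = complete g″
          X = run P (s≤s z≤n) (ℕ.<⇒≤ l<n)
          open Run X using (idx; idx<r; o≗)
          dep≤ : dep c₁ ≤ dep (Play.clusters P 0)
          dep≤ = ℕ.≤-trans deeper (ℕ.≤-trans (ℕ.m≤m+n _ 0) (ℕ.≤-reflexive (sym (cong dep e))))
          refine : ∀ i → i < suc l → pt (Play.clusters P 0) i ~[ dep c₁ ] pt c₁ (ρ i)
          refine i i< = subst (λ z → pt z i ~[ dep c₁ ] pt c₁ (ρ i)) (sym e) (refines (ρ i) (ρ< i i<))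
          hi = high P X {id} (ℕ.≤-trans (ℕ.≤-trans (Base.later B) later) N≤)
                 (≈-trans (≈-mono (ℕ.≤-trans (Base.later B) later) T≈)
                   (≈-trans (≈-mono (Base.later B) agree) (Base.agree B)))
                 (ℕ.≤-trans (Base.deeper B) dep≤)
                 (λ i i< → subst (i <_) (sym (Play.num≡ P 0)) i< ,
                   ~-trans (~-mono (Base.deeper B) (refine i i<)) (proj₂ (proj₂ (h i i<))))
      in proj₁ (proj₂ (h idx idx<r)) (Good.distinct (Base.good B) (ρ idx) j (ρ< idx idx<r)
           (subst (j <_) (sym (Base.num≡ B)) j<)
           (~-trans (~-sym (refine idx idx<r)) (~-trans (~-sym (~-mono dep≤ (Play.limit~ P 0 idx idx<r)))
             (~-trans (λ i _ → sym (o≗ i)) (commits P X T≈ hi)))))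
      where
      open Commits C
      open Extends extends
      ρ< : ∀ i → i < suc l → ρ i < num c₁
      ρ< i i< = subst (ρ i <_) (sym (Base.num≡ B)) (proj₁ (h i i<))
      cov : Covers c₁ ρ
      cov i i< = ρ< i i< , proj₂ (proj₂ (h i i<))

    record SplitAt (S₁ : ℕ → Stage) (N₁ : ℕ) (c₁ : Stage) (i₀ : ℕ) : Set where
      field
        point     : ℕ → Baire
        point-old : ∀ i → i < suc l → point i ≡ pt c₁ i
        base      : Base S₁ N₁ (stage (suc (suc l)) point (suc (dep c₁)))
        commit    : Commits S₁ N₁ (stage (suc (suc l)) point (suc (dep c₁)))
        not-new   : Commits.j commit ≢ suc l
        not-old   : Commits.j commit ≢ i₀

    -- Cylinder `i₀` is halved, and the new half gets the index `suc l`. Each half can stand for the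
    -- whole, so by `drop` the answer is committed to neither.
    module Split {S₁ N₁ c₁} (g₁ : Good N₁ S₁ c₁) (num≥ : suc l ≤ num c₁) (N≤ : N ≤ N₁) (S≈ : S₁ ≈[ N ] S)
                 (dep≤ : dep c ≤ dep c₁) (cov : Covers c₁ id) (i₀ : ℕ) (i₀< : i₀ < suc l) where

      flip : Baire
      flip m with m <? dep c₁
      ... | yes _ = pt c₁ i₀ m
      ... | no  _ = 1 ∸ pt c₁ i₀ m

      flip~ : flip ~[ dep c₁ ] pt c₁ i₀
      flip~ m m< with m <? dep c₁
      ... | yes _ = refl
      ... | no ¬m = contradiction m< ¬m

      flip≢ : flip (dep c₁) ≢ pt c₁ i₀ (dep c₁)
      flip≢ e with dep c₁ <? dep c₁
      ... | yes lt = ℕ.<-irrefl refl lt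
      ... | no  _  = 1∸ (pt c₁ i₀ (dep c₁)) e
        where
        1∸ : ∀ x → 1 ∸ x ≢ x
        1∸ zero          ()
        1∸ (suc zero)    ()
        1∸ (suc (suc x)) ()

      point : ℕ → Baire
      point i with i ℕ.≟ suc l
      ... | yes _ = flip
      ... | no  _ = pt c₁ i

      c₂ : Stage
      c₂ = stage (suc (suc l)) point (suc (dep c₁))

      point-old : ∀ i → i < suc l → point i ≡ pt c₁ i
      point-old i i< with i ℕ.≟ suc l
      ... | yes refl = contradiction i< (ℕ.<-irrefl refl)
      ... | no _     = refl

      point-new : point (suc l) ≡ flip
      point-new with suc l ℕ.≟ suc l
      ... | yes _ = refl
      ... | no ¬e = contradiction refl ¬e

      origin : ℕ → ℕ
      origin i with i ℕ.≟ suc l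
      ... | yes _ = i₀
      ... | no  _ = i

      origin~ : ∀ i → i < suc (suc l) → origin i < suc l × point i ~[ dep c₁ ] pt c₁ (origin i)
      origin~ i i< with i ℕ.≟ suc l
      ... | yes _ = i₀< , flip~
      ... | no ¬e = ℕ.≤∧≢⇒< (s≤s⁻¹ i<) ¬e , λ _ _ → refl

      base : Base S₁ N₁ c₂
      base = record
        { later  = N≤
        ; agree  = S≈
        ; good   = record
          { deeper   = λ s s< → ℕ.m≤n⇒m≤1+n (Good.deeper g₁ s s<)
          ; within   = λ s s< i i< → let (o< , e) = origin~ i i< in
              inside-resp (S₁ s) (~-mono (Good.deeper g₁ s s<) (~-sym e)) (Good.within g₁ s s< (origin i) (ℕ.<-≤-trans o< num≥))
          ; distinct = distinct
          ; binary   = bin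
          }
        ; num≡   = refl
        ; deeper = ℕ.m≤n⇒m≤1+n dep≤
        ; covers = λ i i< → ℕ.m<n⇒m<1+n i< , subst (λ z → z ~[ dep c ] pt c i) (sym (point-old i i<)) (proj₂ (cov i i<))
        }
        where
        old : ∀ i j → i < suc l → j < suc l → pt c₁ i ~[ dep c₁ ] pt c₁ j → i ≡ j
        old i j i< j< = Good.distinct g₁ i j (ℕ.<-≤-trans i< num≥) (ℕ.<-≤-trans j< num≥)
        distinct : ∀ i j → i < suc (suc l) → j < suc (suc l) → point i ~[ suc (dep c₁) ] point j → i ≡ j
        distinct i j i< j< e with i ℕ.≟ suc l | j ℕ.≟ suc l
        ... | yes refl | yes refl = refl
        ... | no  i≢   | no  j≢   = old i j (ℕ.≤∧≢⇒< (s≤s⁻¹ i<) i≢) (ℕ.≤∧≢⇒< (s≤s⁻¹ j<) j≢) (~-mono (ℕ.n≤1+n _) e)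
        ... | yes refl | no  j≢   = ⊥-elim (flip≢ (trans (e (dep c₁) ℕ.≤-refl) (cong (λ z → pt c₁ z (dep c₁))
              (old j i₀ (ℕ.≤∧≢⇒< (s≤s⁻¹ j<) j≢) i₀< (~-trans (~-sym (~-mono (ℕ.n≤1+n _) e)) flip~)))))
        ... | no  i≢   | yes refl = ⊥-elim (flip≢ (trans (sym (e (dep c₁) ℕ.≤-refl)) (cong (λ z → pt c₁ z (dep c₁))
              (old i i₀ (ℕ.≤∧≢⇒< (s≤s⁻¹ i<) i≢) i₀< (~-trans (~-mono (ℕ.n≤1+n _) e) flip~)))))
        flip-bin : Binary flip
        flip-bin m with m <? dep c₁
        ... | yes _ = Good.binary g₁ i₀ m
        ... | no  _ = s≤s (ℕ.m∸n≤m 1 (pt c₁ i₀ m))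
        bin : ∀ i → Binary (point i)
        bin i with i ℕ.≟ suc l
        ... | yes _ = flip-bin
        ... | no  _ = Good.binary g₁ i

      commit : Commits S₁ N₁ c₂
      commit = Pass.result base

      not-new : Commits.j commit ≢ suc l
      not-new e = drop base commit id λ i i< → ℕ.m<n⇒m<1+n i< , (λ i≡j → ℕ.<-irrefl (trans i≡j e) i<) ,
        proj₂ (Base.covers base i i<)

      not-old : Commits.j commit ≢ i₀
      not-old e = drop base commit swap λ i i< → sw i i<
        where
        swap : ℕ → ℕ
        swap i with i ℕ.≟ i₀
        ... | yes _ = suc l
        ... | no  _ = i
        sw : ∀ i → i < suc l → swap i < suc (suc l) × swap i ≢ Commits.j commit × point (swap i) ~[ dep c ] pt c i
        sw i i< with i ℕ.≟ i₀
        ... | yes refl = ℕ.≤-refl , (λ e′ → ℕ.<-irrefl (sym (trans e′ e)) i<) ,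
          subst (λ z → z ~[ dep c ] pt c i) (sym point-new) (~-trans (~-mono dep≤ flip~) (proj₂ (cov i i<)))
        ... | no i≢ = ℕ.m<n⇒m<1+n i< , (λ e′ → i≢ (trans e′ e)) , proj₂ (Base.covers base i i<)

      result : SplitAt S₁ N₁ c₁ i₀
      result = record { point = point ; point-old = point-old ; base = base ; commit = commit ; not-new = not-new ; not-old = not-old }

    -- A second split, of the cylinder K is committed to, leaves K no answer.
    absurd : ⊥
    absurd = unmoved (Split.result g (ℕ.≤-reflexive (sym num-c)) ℕ.≤-refl (λ _ _ → refl) ℕ.≤-refl
                     (λ i i< → subst (i <_) (sym num-c) i< , λ _ _ → refl) 0 (s≤s z≤n))
      where
      unmoved : SplitAt S N c 0 → ⊥
      -- The first split serves to find a commitment to a cylinder of old index; its surplus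
      -- cylinder is overwritten by the second split.
      unmoved A = second (Split.result EA.good (subst (suc l ≤_) (sym EA.num≡) (ℕ.n≤1+n _)) EA.later EA.agree
                         (ℕ.≤-trans (ℕ.n≤1+n _) EA.deeper) cov CA.j j<)
        where
        module A = SplitAt A
        module CA = Commits A.commit
        module EA = Extends CA.extends
        j< : CA.j < suc l
        j< = ℕ.≤∧≢⇒< (s≤s⁻¹ CA.j<) A.not-new
        c₁ : Stage
        c₁ = CA.c′
        cov : Covers c₁ id
        cov i i< = subst (i <_) (sym EA.num≡) (ℕ.m<n⇒m<1+n i<) ,
          ~-trans (~-mono (ℕ.n≤1+n _) (EA.refines i (ℕ.m<n⇒m<1+n i<))) (proj₂ (Base.covers A.base i i<))
        second : SplitAt CA.S′ CA.N′ c₁ CA.j → ⊥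
        second D = played (complete ED.good)
          where
          module D = SplitAt D
          module CD = Commits D.commit
          module ED = Extends CD.extends
          played : (∃ λ T → T ≈[ CD.N′ ] CD.S′ × Σ (Play T (num CD.c′)) λ P →
                      CD.N′ ≤ Play.time P 0 × Play.clusters P 0 ≡ stage (num CD.c′) (pt CD.c′) (dep CD.c′ + 0)) → ⊥
          -- Both commitments bind this run: the answer lies in the old cylinders `CD.j` and `CA.j`,
          -- so the two indices coincide.
          played (T , T≈ , P , N≤ , e) = D.not-old (Good.distinct (Base.good A.base) CD.j CA.j (ℕ.m<n⇒m<1+n old) (ℕ.m<n⇒m<1+n j<)
              (~-trans (~-sym (EA.refines CD.j (ℕ.m<n⇒m<1+n old)))
                (~-trans (subst (λ z → z ~[ suc (dep c) ] Run.o X) (D.point-old CD.j old)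
                           (~-sym (~-mono (ℕ.≤-trans EA.deeper (ℕ.n≤1+n _)) o-D)))
                  o-A)))
            where
            X : Run P
            X = run P (subst (0 <_) (sym ED.num≡) (s≤s z≤n)) (subst (_≤ n) (sym ED.num≡) l<n)
            refine : ∀ i → i < suc (suc l) → pt (Play.clusters P 0) i ~[ suc (dep c₁) ] D.point i
            refine i i< = subst (λ z → pt z i ~[ suc (dep c₁) ] D.point i) (sym e) (ED.refines i i<)
            hi : ∀ t′ → t ≤ t′ → l ≤ Run.h X t′
            hi = high P X {id} (ℕ.≤-trans (ℕ.≤-trans EA.later ED.later) N≤)
                   (≈-trans (≈-mono (ℕ.≤-trans EA.later ED.later) T≈) (≈-trans (≈-mono EA.later ED.agree) EA.agree))
                   (ℕ.≤-trans (Base.deeper D.base) (ℕ.≤-trans ED.deeper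
                     (ℕ.≤-trans (ℕ.m≤m+n _ 0) (ℕ.≤-reflexive (sym (cong dep e))))))
                   (λ i i< → subst (i <_) (sym (trans (Play.num≡ P 0) ED.num≡)) (ℕ.m<n⇒m<1+n i<) ,
                     ~-trans (~-mono (Base.deeper D.base) (refine i (ℕ.m<n⇒m<1+n i<))) (proj₂ (Base.covers D.base i i<)))
            o-A : Run.o X ~[ suc (dep c) ] A.point CA.j
            o-A = CA.commits P X (≈-trans (≈-mono ED.later T≈) ED.agree) hi
            o-D : Run.o X ~[ suc (dep c₁) ] D.point CD.j
            o-D = CD.commits P X T≈ hi
            old : CD.j < suc l
            old = ℕ.≤∧≢⇒< (s≤s⁻¹ CD.j<) D.not-new

  forces : ∀ k l → k + l ≡ d → Forces l
  forces zero    l refl = forces-top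
  forces (suc k) l e S N c t g num-c = dne em λ stuck →
    Step.absurd l (ℕ.≤-trans (s≤s (ℕ.≤-trans (s≤s (ℕ.m≤n+m l k)) (ℕ.≤-reflexive e))) d<n)
      (forces k (suc l) (trans (ℕ.+-suc k l) e)) S N c t g num-c stuck

  C♯≰Sort : ⊥
  C♯≰Sort with forces d 0 (ℕ.+-identityʳ d) (λ _ → whole) 0 whole 0
    (record { deeper = λ _ () ; within = λ _ () ; distinct = only ; binary = λ _ _ → s≤s z≤n }) refl
    where
    whole : Stage
    whole = stage 1 (λ _ _ → 0) 0
    only : ∀ i j → i < 1 → j < 1 → (λ (_ : ℕ) → 0) ~[ 0 ] (λ _ → 0) → i ≡ j
    only zero zero _ _ _ = refl
    only (suc _) _ (s≤s ()) _ _
    only zero (suc _) _ (s≤s ()) _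
  ... | _ , _ , _ , _ , _ , _ , _ , () , _

-- Rational arithmetic

ℚ-ring : AlmostCommutativeRing 0ℓ 0ℓ
ℚ-ring = fromCommutativeRing ℚ.+-*-commutativeRing λ x → dec⇒maybe (0ℚ ℚ.≟ x)

0≤-+ : ∀ {p q} → 0ℚ ≤ℚ p → 0ℚ ≤ℚ q → 0ℚ ≤ℚ p +ℚ q
0≤-+ {p} {q} h k = ℚ.nonNegative⁻¹ (p +ℚ q) {{ℚ.nonNeg+nonNeg⇒nonNeg p {{ℚ.nonNegative h}} q {{ℚ.nonNegative k}}}}

0≤-* : ∀ {p q} → 0ℚ ≤ℚ p → 0ℚ ≤ℚ q → 0ℚ ≤ℚ p *ℚ q
0≤-* {p} {q} h k = ℚ.nonNegative⁻¹ (p *ℚ q) {{ℚ.nonNeg*nonNeg⇒nonNeg p {{ℚ.nonNegative h}} q {{ℚ.nonNegative k}}}}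

0<-* : ∀ {p q} → 0ℚ <ℚ p → 0ℚ <ℚ q → 0ℚ <ℚ p *ℚ q
0<-* {p} {q} h k = ℚ.positive⁻¹ (p *ℚ q) {{ℚ.pos*pos⇒pos p {{ℚ.positive h}} q {{ℚ.positive k}}}}

gap : ∀ {p q} → p ≤ℚ q → 0ℚ ≤ℚ q -ℚ p
gap {p} {q} h = subst (_≤ℚ q -ℚ p) (ℚ.+-inverseʳ p) (ℚ.+-monoˡ-≤ (-ℚ p) h)

-- Inequalities are proved by exhibiting the difference as a nonnegative expression.
by-gap : ∀ {p q} d → 0ℚ ≤ℚ d → q ≡ p +ℚ d → p ≤ℚ q
by-gap {p} d h e = ℚ.≤-trans (ℚ.≤-reflexive (sym (ℚ.+-identityʳ p))) (ℚ.≤-trans (ℚ.+-monoʳ-≤ p h) (ℚ.≤-reflexive (sym e)))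

∣∣≤ : ∀ {a b} → a ≤ℚ b → -ℚ a ≤ℚ b → ∣ a ∣ ≤ℚ b
∣∣≤ {a} h k with ℚ.∣p∣≡p∨∣p∣≡-p a
... | inj₁ e = ℚ.≤-trans (ℚ.≤-reflexive e) h
... | inj₂ e = ℚ.≤-trans (ℚ.≤-reflexive e) k

≤∣∣ : ∀ a → a ≤ℚ ∣ a ∣
≤∣∣ a with ℚ.≤-total 0ℚ a
... | inj₁ 0≤a = ℚ.≤-reflexive (sym (ℚ.0≤p⇒∣p∣≡p 0≤a))
... | inj₂ a≤0 = ℚ.≤-trans a≤0 (ℚ.0≤∣p∣ a)

-≤∣∣ : ∀ a → -ℚ a ≤ℚ ∣ a ∣
-≤∣∣ a = ℚ.≤-trans (≤∣∣ (-ℚ a)) (ℚ.≤-reflexive (ℚ.∣-p∣≡∣p∣ a))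

∣-∣-sym : ∀ a b → ∣ a -ℚ b ∣ ≡ ∣ b -ℚ a ∣
∣-∣-sym a b = trans (sym (ℚ.∣-p∣≡∣p∣ (a -ℚ b))) (cong ∣_∣ (lemma a b))
  where
  lemma : ∀ a b → -ℚ (a -ℚ b) ≡ b -ℚ a
  lemma = ring-∀ ℚ-ring

triangle : ∀ a b c → ∣ a -ℚ c ∣ ≤ℚ ∣ a -ℚ b ∣ +ℚ ∣ b -ℚ c ∣
triangle a b c = ℚ.≤-trans (ℚ.≤-reflexive (cong ∣_∣ (lemma a b c))) (ℚ.∣p+q∣≤∣p∣+∣q∣ (a -ℚ b) (b -ℚ c))
  where
  lemma : ∀ a b c → a -ℚ c ≡ (a -ℚ b) +ℚ (b -ℚ c)
  lemma = ring-∀ ℚ-ring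

between : ∀ {l u x y} → l ≤ℚ x → x ≤ℚ u → l ≤ℚ y → y ≤ℚ u → ∣ x -ℚ y ∣ ≤ℚ u -ℚ l
between {l} {u} {x} {y} lx xu ly yu = ∣∣≤
  (by-gap ((u -ℚ x) +ℚ (y -ℚ l)) (0≤-+ (gap xu) (gap ly)) (e₁ l u x y))
  (by-gap ((u -ℚ y) +ℚ (x -ℚ l)) (0≤-+ (gap yu) (gap lx)) (e₂ l u x y))
  where
  e₁ : ∀ l u x y → u -ℚ l ≡ (x -ℚ y) +ℚ ((u -ℚ x) +ℚ (y -ℚ l))
  e₁ = ring-∀ ℚ-ring
  e₂ : ∀ l u x y → u -ℚ l ≡ -ℚ (x -ℚ y) +ℚ ((u -ℚ y) +ℚ (x -ℚ l))
  e₂ = ring-∀ ℚ-ring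

private
  toᵘ : ∀ a d → ℚ.toℚᵘ ((ℤ.+ a) /ℚ suc d) ℚᵘ.≃ ℚᵘ.mkℚᵘ (ℤ.+ a) d
  toᵘ a d = ℚ.toℚᵘ-fromℚᵘ (ℚᵘ.mkℚᵘ (ℤ.+ a) d)

opaque
  ι : ℕ → ℚ
  ι n = (ℤ.+ n) /ℚ 1

  ι-0 : ι 0 ≡ 0ℚ
  ι-0 = refl

  ι-1 : ι 1 ≡ 1ℚ
  ι-1 = refl

  ι-+ : ∀ a b → ι (a + b) ≡ ι a +ℚ ι b
  ι-+ a b = ℚ.toℚᵘ-injective (ℚᵘ.≃-trans (toᵘ (a + b) 0) (ℚᵘ.≃-sym (ℚᵘ.≃-trans (ℚ.toℚᵘ-homo-+ (ι a) (ι b))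
    (ℚᵘ.≃-trans (ℚᵘ.+-cong (toᵘ a 0) (toᵘ b 0)) (ℚᵘ.*≡* (cong (ℤ._* ℤ.+ 1)
      (trans (cong₂ ℤ._+_ (ℤ.*-identityʳ (ℤ.+ a)) (ℤ.*-identityʳ (ℤ.+ b))) (sym (ℤ.pos-+ a b)))))))))

  ι-* : ∀ a b → ι (a * b) ≡ ι a *ℚ ι b
  ι-* a b = ℚ.toℚᵘ-injective (ℚᵘ.≃-trans (toᵘ (a * b) 0) (ℚᵘ.≃-sym (ℚᵘ.≃-trans (ℚ.toℚᵘ-homo-* (ι a) (ι b))
    (ℚᵘ.≃-trans (ℚᵘ.*-cong (toᵘ a 0) (toᵘ b 0)) (ℚᵘ.*≡* (cong (ℤ._* ℤ.+ 1) (sym (ℤ.pos-* a b))))))))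

  ι-mono : ∀ {a b} → a ≤ b → ι a ≤ℚ ι b
  ι-mono {a} {b} a≤b = ℚ.toℚᵘ-cancel-≤ (ℚᵘ.≤-respˡ-≃ (ℚᵘ.≃-sym (toᵘ a 0)) (ℚᵘ.≤-respʳ-≃ (ℚᵘ.≃-sym (toᵘ b 0))
    (ℚᵘ.*≤* (ℤ.*-monoʳ-≤-nonNeg (ℤ.+ 1) (ℤ.+≤+ a≤b)))))

  ι-cancel : ∀ {a b} → ι a ≤ℚ ι b → a ≤ b
  ι-cancel {a} {b} h with ℚᵘ.≤-respˡ-≃ (toᵘ a 0) (ℚᵘ.≤-respʳ-≃ (toᵘ b 0) (ℚ.toℚᵘ-mono-≤ h))
  ... | ℚᵘ.*≤* e = ℤ.drop‿+≤+ (ℤ.*-cancelʳ-≤-pos (ℤ.+ a) (ℤ.+ b) (ℤ.+ 1) e)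

  /-ι : ∀ a d → ((ℤ.+ a) /ℚ suc d) *ℚ ι (suc d) ≡ ι a
  /-ι a d = ℚ.toℚᵘ-injective (ℚᵘ.≃-trans (ℚ.toℚᵘ-homo-* ((ℤ.+ a) /ℚ suc d) (ι (suc d)))
    (ℚᵘ.≃-trans (ℚᵘ.*-cong (toᵘ a d) (toᵘ (suc d) 0)) (ℚᵘ.≃-trans
      (ℚᵘ.*≡* (trans (ℤ.*-identityʳ _) (cong (λ z → ℤ.+ a ℤ.* z) (cong ℤ.+_ (sym (ℕ.*-identityʳ (suc d)))))))
      (ℚᵘ.≃-sym (toᵘ a 0)))))

ι-suc : ∀ a → ι (suc a) ≡ 1ℚ +ℚ ι a
ι-suc a = trans (ι-+ 1 a) (cong (_+ℚ ι a) ι-1)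

ι-2* : ∀ a → ι (2 * a) ≡ ι a +ℚ ι a
ι-2* a = trans (cong ι (cong (a +_) (ℕ.+-identityʳ a))) (ι-+ a a)

0≤ι : ∀ a → 0ℚ ≤ℚ ι a
0≤ι a = subst (_≤ℚ ι a) ι-0 (ι-mono z≤n)

ι-mono-< : ∀ {a b} → a < b → ι a <ℚ ι b
ι-mono-< {a} {b} a<b = ℚ.≰⇒> λ h → ℕ.<⇒≱ a<b (ι-cancel h)

0<ι : ∀ a → 0ℚ <ℚ ι (suc a)
0<ι a = subst (_<ℚ ι (suc a)) ι-0 (ι-mono-< (s≤s z≤n))

0<ι2^ : ∀ n → 0ℚ <ℚ ι (2 ^ n)
0<ι2^ n = subst (λ z → 0ℚ <ℚ ι z) (ℕ.suc-pred (2 ^ n) {{ℕ.m^n≢0 2 n}}) (0<ι (pred (2 ^ n)))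

*-cancel-≤ : ∀ {p q} r → 0ℚ <ℚ r → p *ℚ r ≤ℚ q *ℚ r → p ≤ℚ q
*-cancel-≤ r 0<r = ℚ.*-cancelʳ-≤-pos r {{ℚ.positive 0<r}}

*-cancel-< : ∀ {p q} r → 0ℚ <ℚ r → p *ℚ r <ℚ q *ℚ r → p <ℚ q
*-cancel-< r 0<r = ℚ.*-cancelʳ-<-nonNeg r {{ℚ.nonNegative (ℚ.<⇒≤ 0<r)}}

*-cancel-≡ : ∀ {p q} r → 0ℚ <ℚ r → p *ℚ r ≡ q *ℚ r → p ≡ q
*-cancel-≡ r 0<r e = ℚ.≤-antisym (*-cancel-≤ r 0<r (ℚ.≤-reflexive e)) (*-cancel-≤ r 0<r (ℚ.≤-reflexive (sym e)))

*-mono-≤ : ∀ {p q} r → 0ℚ ≤ℚ r → p ≤ℚ q → p *ℚ r ≤ℚ q *ℚ r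
*-mono-≤ r 0≤r = ℚ.*-monoʳ-≤-nonNeg r {{ℚ.nonNegative 0≤r}}

2^-ι : ∀ n → 2^- n *ℚ ι (2 ^ n) ≡ 1ℚ
2^-ι n = trans (cong₂ _*ℚ_ (ℚ./-cong {ℤ.+ 1} {_} {ℤ.+ 1} {_} {{ℕ.m^n≢0 2 n}} refl (sym eq)) (cong ι (sym eq)))
  (trans (/-ι 1 (pred (2 ^ n))) ι-1)
  where
  eq : suc (pred (2 ^ n)) ≡ 2 ^ n
  eq = ℕ.suc-pred (2 ^ n) {{ℕ.m^n≢0 2 n}}

0<2^- : ∀ n → 0ℚ <ℚ 2^- n
0<2^- n = *-cancel-< (ι (2 ^ n)) (0<ι2^ n) (ℚ.≤-<-trans (ℚ.≤-reflexive (ℚ.*-zeroˡ (ι (2 ^ n))))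
  (subst (0ℚ <ℚ_) (trans ι-1 (sym (2^-ι n))) (0<ι 0)))

2^-suc : ∀ n → 2^- n ≡ 2^- suc n +ℚ 2^- suc n
2^-suc n = *-cancel-≡ (ι (2 ^ suc n)) (0<ι2^ (suc n)) (trans (cong (2^- n *ℚ_) (ι-2* (2 ^ n)))
  (trans (ℚ.*-distribˡ-+ (2^- n) (ι (2 ^ n)) (ι (2 ^ n))) (trans (cong₂ _+ℚ_ (2^-ι n) (2^-ι n))
    (sym (trans (ℚ.*-distribʳ-+ (ι (2 ^ suc n)) (2^- suc n) (2^- suc n)) (cong₂ _+ℚ_ (2^-ι (suc n)) (2^-ι (suc n))))))))

-- A positive fraction times its denominator is a positive integer.
1≤*↧ : ∀ ε → 0ℚ <ℚ ε → 1ℚ ≤ℚ ε *ℚ ι (suc (ℚ.denominator-1 ε))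
1≤*↧ (ℚ.mkℚ (ℤ.+ zero) d _) (*<* (ℤ.+<+ ()))
1≤*↧ (ℚ.mkℚ -[1+ _ ] d _) (*<* ())
1≤*↧ ε@(ℚ.mkℚ (ℤ.+ suc a) d _) _ = ℚ.≤-trans (subst (_≤ℚ ι (suc a)) ι-1 (ι-mono (s≤s z≤n)))
  (ℚ.≤-reflexive (sym (trans (cong (_*ℚ ι (suc d)) (sym (ℚ.↥p/↧p≡p ε))) (/-ι (suc a) d))))

archimedes : ∀ ε → 0ℚ <ℚ ε → ∃ λ n → 2^- n <ℚ ε
archimedes ε 0<ε = n , *-cancel-< (ι (2 ^ n)) (0<ι2^ n)
  (ℚ.≤-<-trans (ℚ.≤-reflexive (2^-ι n)) (ℚ.≤-<-trans (1≤*↧ ε 0<ε) lt))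
  where
  n = suc (ℚ.denominator-1 ε)
  lt : ε *ℚ ι n <ℚ ε *ℚ ι (2 ^ n)
  lt = ℚ.*-monoʳ-<-pos ε {{ℚ.positive 0<ε}} (ι-mono-< (n<2^n n))

infix 8 _/2^_

_/2^_ : ℕ → ℕ → ℚ
a /2^ s = ι a *ℚ 2^- s

0≤/2^ : ∀ a s → 0ℚ ≤ℚ a /2^ s
0≤/2^ a s = 0≤-* (0≤ι a) (ℚ.<⇒≤ (0<2^- s))

/2^-mono : ∀ {a b} s → a ≤ b → a /2^ s ≤ℚ b /2^ s
/2^-mono s a≤b = *-mono-≤ (2^- s) (ℚ.<⇒≤ (0<2^- s)) (ι-mono a≤b)

/2^-suc : ∀ a s → suc a /2^ s ≡ a /2^ s +ℚ 2^- s
/2^-suc a s = trans (cong (_*ℚ 2^- s) (ι-suc a)) (lemma (ι a) (2^- s))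
  where
  lemma : ∀ a t → (1ℚ +ℚ a) *ℚ t ≡ a *ℚ t +ℚ t
  lemma = ring-∀ ℚ-ring

/2^-double : ∀ a s → (2 * a) /2^ suc s ≡ a /2^ s
/2^-double a s = trans (cong (_*ℚ 2^- suc s) (ι-2* a)) (trans (lemma (ι a) (2^- suc s)) (cong (ι a *ℚ_) (sym (2^-suc s))))
  where
  lemma : ∀ a t → (a +ℚ a) *ℚ t ≡ a *ℚ (t +ℚ t)
  lemma = ring-∀ ℚ-ring

private
  /2^-scale : ∀ a s d → a /2^ s *ℚ (ι (2 ^ s) *ℚ ι (2 ^ d)) ≡ ι (a * 2 ^ d)
  /2^-scale a s d = trans (lemma (ι a) (2^- s) (ι (2 ^ s)) (ι (2 ^ d))) (trans (cong (λ z → z *ℚ ι a *ℚ ι (2 ^ d)) (2^-ι s))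
    (trans (cong (_*ℚ ι (2 ^ d)) (ℚ.*-identityˡ (ι a))) (sym (ι-* a (2 ^ d)))))
    where
    lemma : ∀ a h x y → a *ℚ h *ℚ (x *ℚ y) ≡ (h *ℚ x) *ℚ a *ℚ y
    lemma = ring-∀ ℚ-ring

  /2^-scale′ : ∀ a s d → a /2^ d *ℚ (ι (2 ^ s) *ℚ ι (2 ^ d)) ≡ ι (a * 2 ^ s)
  /2^-scale′ a s d = trans (cong (a /2^ d *ℚ_) (ℚ.*-comm (ι (2 ^ s)) (ι (2 ^ d)))) (/2^-scale a d s)

  scale-pos : ∀ s d → 0ℚ <ℚ ι (2 ^ s) *ℚ ι (2 ^ d)
  scale-pos s d = 0<-* (0<ι2^ s) (0<ι2^ d)

/2^-≤ : ∀ {a b} s d → a * 2 ^ d ≤ b * 2 ^ s → a /2^ s ≤ℚ b /2^ d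
/2^-≤ {a} {b} s d h = *-cancel-≤ (ι (2 ^ s) *ℚ ι (2 ^ d)) (scale-pos s d)
  (ℚ.≤-trans (ℚ.≤-reflexive (/2^-scale a s d)) (ℚ.≤-trans (ι-mono h) (ℚ.≤-reflexive (sym (/2^-scale′ b s d)))))

/2^-≤⁻ : ∀ {a b} s d → a /2^ s ≤ℚ b /2^ d → a * 2 ^ d ≤ b * 2 ^ s
/2^-≤⁻ {a} {b} s d h = ι-cancel (ℚ.≤-trans (ℚ.≤-reflexive (sym (/2^-scale a s d)))
  (ℚ.≤-trans (*-mono-≤ (ι (2 ^ s) *ℚ ι (2 ^ d)) (ℚ.<⇒≤ (scale-pos s d)) h) (ℚ.≤-reflexive (/2^-scale′ b s d))))

-- Names store the predecessor of a denominator, hence `pred (2 ^ s)`.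
/2^-/ : ∀ a s → (ℤ.+ a) /ℚ suc (pred (2 ^ s)) ≡ a /2^ s
/2^-/ a s = *-cancel-≡ (ι (2 ^ s)) (0<ι2^ s) eq
  where
  lemma : ∀ a h x → a *ℚ h *ℚ x ≡ a *ℚ (h *ℚ x)
  lemma = ring-∀ ℚ-ring
  eq : ((ℤ.+ a) /ℚ suc (pred (2 ^ s))) *ℚ ι (2 ^ s) ≡ a /2^ s *ℚ ι (2 ^ s)
  eq = trans (cong (λ z → ((ℤ.+ a) /ℚ suc (pred (2 ^ s))) *ℚ ι z) (sym (ℕ.suc-pred (2 ^ s) {{ℕ.m^n≢0 2 s}})))
    (trans (/-ι a (pred (2 ^ s))) (sym (trans (lemma (ι a) (2^- s) (ι (2 ^ s)))
      (trans (cong (ι a *ℚ_) (2^-ι s)) (ℚ.*-identityʳ (ι a))))))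

-- Real numbers

≲-≤ : ∀ x y N → (∀ n → N ≤ n → x n ≤ℚ y n) → x ≲ y
≲-≤ x y N h ε 0<ε = N , λ n N≤n → ℚ.≤-trans (h n N≤n)
  (ℚ.≤-trans (ℚ.≤-reflexive (sym (ℚ.+-identityʳ (y n)))) (ℚ.+-monoʳ-≤ (y n) (ℚ.<⇒≤ 0<ε)))

halve-ε : ∀ ε → 0ℚ <ℚ ε → ∃ λ δ → 0ℚ <ℚ δ × δ +ℚ δ ≡ ε
halve-ε ε 0<ε = ½ *ℚ ε , 0<-* (ℚ.positive⁻¹ ½) 0<ε , trans (sym (ℚ.*-distribʳ-+ ε ½ ½)) (ℚ.*-identityˡ ε)

≲-sum : ∀ x y z a b → x ≲ const a → y ≲ const b → (∀ t → z t ≡ x t +ℚ y t) → z ≲ const (a +ℚ b)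
≲-sum x y z a b h k e ε 0<ε = halved (halve-ε ε 0<ε)
  where
  halved : (∃ λ δ → 0ℚ <ℚ δ × δ +ℚ δ ≡ ε) → ∃ λ N → ∀ n → N ≤ n → z n ≤ℚ a +ℚ b +ℚ ε
  halved (δ , 0<δ , eq) = let (M , p) = h δ 0<δ ; (N , q) = k δ 0<δ in
    M ⊔ N , λ n le → ℚ.≤-trans (ℚ.≤-reflexive (e n)) (ℚ.≤-trans (ℚ.+-mono-≤ (p n (ℕ.m⊔n≤o⇒m≤o M N le)) (q n (ℕ.m⊔n≤o⇒n≤o M N le)))
      (ℚ.≤-reflexive (trans (lemma a b δ) (cong (a +ℚ b +ℚ_) eq))))
    where
    lemma : ∀ a b d → (a +ℚ d) +ℚ (b +ℚ d) ≡ (a +ℚ b) +ℚ (d +ℚ d)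
    lemma = ring-∀ ℚ-ring

≲-trans : ∀ x y z → x ≲ y → y ≲ z → x ≲ z
≲-trans x y z h k ε 0<ε =
  let (δ , 0<δ , e) = halve-ε ε 0<ε ; (M , p) = h δ 0<δ ; (N , q) = k δ 0<δ in
  M ⊔ N , λ n le → ℚ.≤-trans (p n (ℕ.≤-trans (ℕ.m≤m⊔n M N) le))
    (ℚ.≤-trans (ℚ.+-monoˡ-≤ δ (q n (ℕ.≤-trans (ℕ.m≤n⊔m M N) le)))
      (ℚ.≤-reflexive (trans (ℚ.+-assoc (z n) δ δ) (cong (z n +ℚ_) e))))

const-≲ : ∀ a b → const a ≲ const b → a ≤ℚ b
const-≲ a b h = ℚ.≮⇒≥ λ b<a →
  let (δ , 0<δ , e) = halve-ε (a -ℚ b) (ℚ.≤-<-trans (ℚ.≤-reflexive (sym (ℚ.+-inverseʳ b))) (ℚ.+-monoˡ-< (-ℚ b) b<a))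
      (N , p) = h δ 0<δ
  in ℚ.<-irrefl refl (ℚ.<-≤-trans (ℚ.≤-<-trans (p N ℕ.≤-refl) (subst (λ z → b +ℚ δ <ℚ b +ℚ z) e
       (ℚ.+-monoʳ-< b (subst (_<ℚ δ +ℚ δ) (ℚ.+-identityʳ δ) (ℚ.+-monoʳ-< δ 0<δ))))) (ℚ.≤-reflexive (lemma a b)))
  where
  lemma : ∀ a b → b +ℚ (a -ℚ b) ≡ a
  lemma = ring-∀ ℚ-ring

≃-≲ : ∀ x y → x ≃ y → x ≲ y
≃-≲ x y h ε 0<ε = let (N , p) = h ε 0<ε in N , λ n N≤n →
  by-gap ((0ℚ +ℚ ε) -ℚ (x n -ℚ y n)) (gap (ℚ.≤-trans (≤∣∣ (x n -ℚ y n)) (p n N≤n))) (lemma (x n) (y n) ε)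
  where
  lemma : ∀ x y ε → y +ℚ ε ≡ x +ℚ ((0ℚ +ℚ ε) -ℚ (x -ℚ y))
  lemma = ring-∀ ℚ-ring

≃-sym : ∀ x y → x ≃ y → y ≃ x
≃-sym x y h ε 0<ε = let (N , p) = h ε 0<ε in N , λ n N≤n → subst (_≤ℚ 0ℚ +ℚ ε) (∣-∣-sym (x n) (y n)) (p n N≤n)

≃-squeeze : ∀ (x y l : ℕ → ℚ) →
            (∀ s → const (l s) ≲ x) → (∀ s → x ≲ const (l s +ℚ 2^- s)) →
            (∀ s → const (l s) ≲ y) → (∀ s → y ≲ const (l s +ℚ 2^- s)) → x ≃ y
≃-squeeze x y l lx xu ly yu ε 0<ε =
  let (δ , 0<δ , e) = halve-ε ε 0<ε
      (δ′ , 0<δ′ , e′) = halve-ε δ 0<δ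
      (s , 2^-s<) = archimedes δ 0<δ
      (N₁ , p₁) = lx s δ′ 0<δ′ ; (N₂ , p₂) = xu s δ′ 0<δ′ ; (N₃ , p₃) = ly s δ′ 0<δ′ ; (N₄ , p₄) = yu s δ′ 0<δ′
  in (N₁ ⊔ N₂) ⊔ (N₃ ⊔ N₄) , λ n le →
    let le₁ = ℕ.≤-trans (ℕ.m≤m⊔n (N₁ ⊔ N₂) (N₃ ⊔ N₄)) le ; le₂ = ℕ.≤-trans (ℕ.m≤n⊔m (N₁ ⊔ N₂) (N₃ ⊔ N₄)) le in
    ℚ.≤-trans (between {l s -ℚ δ′} {l s +ℚ 2^- s +ℚ δ′}
        (down (p₁ n (ℕ.≤-trans (ℕ.m≤m⊔n N₁ N₂) le₁))) (p₂ n (ℕ.≤-trans (ℕ.m≤n⊔m N₁ N₂) le₁))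
        (down (p₃ n (ℕ.≤-trans (ℕ.m≤m⊔n N₃ N₄) le₂))) (p₄ n (ℕ.≤-trans (ℕ.m≤n⊔m N₃ N₄) le₂)))
      (by-gap (δ -ℚ 2^- s) (gap (ℚ.<⇒≤ 2^-s<)) (trans (cong (0ℚ +ℚ_) (sym e)) (trans (cong (λ z → 0ℚ +ℚ (δ +ℚ z)) (sym e′)) (lemma (l s) (2^- s) δ δ′))))
  where
  down : ∀ {l x δ} → l ≤ℚ x +ℚ δ → l -ℚ δ ≤ℚ x
  down {l} {x} {δ} h = by-gap ((x +ℚ δ) -ℚ l) (gap h) (lem l x δ)
    where
    lem : ∀ l x δ → x ≡ (l -ℚ δ) +ℚ ((x +ℚ δ) -ℚ l)
    lem = ring-∀ ℚ-ring
  lemma : ∀ l t δ δ′ → 0ℚ +ℚ (δ +ℚ (δ′ +ℚ δ′)) ≡ (l +ℚ t +ℚ δ′) -ℚ (l -ℚ δ′) +ℚ (δ -ℚ t)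
  lemma = ring-∀ ℚ-ring

module _ (em : ExcludedMiddle 0ℓ) where

  ≲-fails : ∀ x y → ¬ x ≲ y → ∃ λ ε → 0ℚ <ℚ ε × (∀ N → ∃ λ n → N ≤ n × y n +ℚ ε <ℚ x n)
  ≲-fails x y h =
    let (ε , k) = ¬∀ em h ; (0<ε , k′) = ¬→ em k in
    ε , 0<ε , λ N → let (n , k″) = ¬∀ em (λ f → k′ (N , f)) ; (N≤n , k‴) = ¬→ em k″ in n , N≤n , ℚ.≰⇒> k‴

  -- If `x` exceeds `y` by a fixed `ε` at arbitrarily late places, the Cauchy property makes it
  -- exceed `y` at all late places.
  ≲-total : ∀ x y → IsCauchy x → IsCauchy y → ¬ x ≲ y → y ≲ x
  ≲-total x y cx cy h =
    let (ε , 0<ε , f) = ≲-fails x y h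
        (δ , 0<δ , e) = halve-ε ε 0<ε
        (M , p) = cx δ 0<δ ; (N , q) = cy δ 0<δ
        (k , le , y<x) = f (M ⊔ N)
        M≤k = ℕ.≤-trans (ℕ.m≤m⊔n M N) le
        N≤k = ℕ.≤-trans (ℕ.m≤n⊔m M N) le
    in ≲-≤ y x (M ⊔ N) λ n le → by-gap _
         (0≤-+ (0≤-+ (gap (ℚ.≤-trans (≤∣∣ (x k -ℚ x n)) (ℚ.<⇒≤ (p k n M≤k (ℕ.≤-trans (ℕ.m≤m⊔n M N) le)))))
                     (gap (ℚ.≤-trans (≤∣∣ (y n -ℚ y k)) (ℚ.<⇒≤ (q n k (ℕ.≤-trans (ℕ.m≤n⊔m M N) le) N≤k)))))
               (gap (subst (λ z → y k +ℚ z ≤ℚ x k) (sym e) (ℚ.<⇒≤ y<x))))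
         (lemma (x n) (x k) (y n) (y k) δ)
    where
    lemma : ∀ xn xk yn yk δ → xn ≡ yn +ℚ ((δ -ℚ (xk -ℚ xn)) +ℚ (δ -ℚ (yn -ℚ yk)) +ℚ (xk -ℚ (yk +ℚ (δ +ℚ δ))))
    lemma = ring-∀ ℚ-ring

const-cauchy : ∀ a → IsCauchy (const a)
const-cauchy a ε 0<ε = 0 , λ _ _ _ _ → subst (λ z → ∣ z ∣ <ℚ ε) (sym (ℚ.+-inverseʳ a)) 0<ε

-- A `UnitReal` is confined to the unit interval only in the limit; termwise bounds let termwise
-- products and mixtures stay there and remain Cauchy.
record Tame : Set where
  field
    seqᵗ    : ℕ → ℚ
    cauchyᵗ : IsCauchy seqᵗ
    0≤seq   : ∀ k → 0ℚ ≤ℚ seqᵗ k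
    seq≤1   : ∀ k → seqᵗ k ≤ℚ 1ℚ

  real : UnitReal
  real = record { seq = seqᵗ ; cauchy = cauchyᵗ ; 0≲seq = ≲-≤ (const 0ℚ) seqᵗ 0 (λ k _ → 0≤seq k) ; seq≲1 = ≲-≤ seqᵗ (const 1ℚ) 0 (λ k _ → seq≤1 k) }

open Tame

mix : ℚ → ℚ → ℚ → ℚ
mix t x y = (1ℚ -ℚ t) *ℚ x +ℚ t *ℚ y

mix-bounds : ∀ {t x y l u} → 0ℚ ≤ℚ t → t ≤ℚ 1ℚ → l ≤ℚ x → x ≤ℚ u → l ≤ℚ y → y ≤ℚ u → l ≤ℚ mix t x y × mix t x y ≤ℚ u
mix-bounds {t} {x} {y} {l} {u} 0≤t t≤1 lx xu ly yu =
  by-gap _ (0≤-+ (0≤-* (gap t≤1) (gap lx)) (0≤-* 0≤t (gap ly))) (e₁ t x y l) ,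
  by-gap _ (0≤-+ (0≤-* (gap t≤1) (gap xu)) (0≤-* 0≤t (gap yu))) (e₂ t x y u)
  where
  e₁ : ∀ t x y l → (1ℚ -ℚ t) *ℚ x +ℚ t *ℚ y ≡ l +ℚ ((1ℚ -ℚ t) *ℚ (x -ℚ l) +ℚ t *ℚ (y -ℚ l))
  e₁ = ring-∀ ℚ-ring
  e₂ : ∀ t x y u → u ≡ (1ℚ -ℚ t) *ℚ x +ℚ t *ℚ y +ℚ ((1ℚ -ℚ t) *ℚ (u -ℚ x) +ℚ t *ℚ (u -ℚ y))
  e₂ = ring-∀ ℚ-ring

∣*∣≤ : ∀ {s a δ} → 0ℚ ≤ℚ δ → ∣ s ∣ ≤ℚ 1ℚ → ∣ a ∣ ≤ℚ δ → ∣ s *ℚ a ∣ ≤ℚ δ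
∣*∣≤ {s} {a} {δ} 0≤δ hs ha = ℚ.≤-trans (ℚ.≤-reflexive (ℚ.∣p*q∣≡∣p∣*∣q∣ s a))
  (by-gap ((1ℚ -ℚ ∣ s ∣) *ℚ δ +ℚ ∣ s ∣ *ℚ (δ -ℚ ∣ a ∣)) (0≤-+ (0≤-* (gap hs) 0≤δ) (0≤-* (ℚ.0≤∣p∣ s) (gap ha)))
    (lemma ∣ s ∣ ∣ a ∣ δ))
  where
  lemma : ∀ s a δ → δ ≡ s *ℚ a +ℚ ((1ℚ -ℚ s) *ℚ δ +ℚ s *ℚ (δ -ℚ a))
  lemma = ring-∀ ℚ-ring

unit-∣∣ : ∀ {a} → 0ℚ ≤ℚ a → a ≤ℚ 1ℚ → ∣ a ∣ ≤ℚ 1ℚ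
unit-∣∣ 0≤a a≤1 = ℚ.≤-trans (ℚ.≤-reflexive (ℚ.0≤p⇒∣p∣≡p 0≤a)) a≤1

mix-close : ∀ {t t′ x x′ y y′ δ} → 0ℚ ≤ℚ δ → 0ℚ ≤ℚ t → t ≤ℚ 1ℚ → 0ℚ ≤ℚ x′ → x′ ≤ℚ 1ℚ → 0ℚ ≤ℚ y′ → y′ ≤ℚ 1ℚ →
            ∣ t -ℚ t′ ∣ ≤ℚ δ → ∣ x -ℚ x′ ∣ ≤ℚ δ → ∣ y -ℚ y′ ∣ ≤ℚ δ → ∣ mix t x y -ℚ mix t′ x′ y′ ∣ ≤ℚ δ +ℚ δ +ℚ δ
mix-close {t} {t′} {x} {x′} {y} {y′} {δ} 0≤δ 0≤t t≤1 0≤x x≤1 0≤y y≤1 ht hx hy =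
  ℚ.≤-trans (ℚ.≤-reflexive (cong ∣_∣ (lemma t t′ x x′ y y′)))
  (ℚ.≤-trans (ℚ.∣p+q∣≤∣p∣+∣q∣ ((1ℚ -ℚ t) *ℚ (x -ℚ x′) +ℚ t *ℚ (y -ℚ y′)) ((y′ -ℚ x′) *ℚ (t -ℚ t′))) (ℚ.+-mono-≤
    (ℚ.≤-trans (ℚ.∣p+q∣≤∣p∣+∣q∣ ((1ℚ -ℚ t) *ℚ (x -ℚ x′)) (t *ℚ (y -ℚ y′)))
      (ℚ.+-mono-≤ (∣*∣≤ {1ℚ -ℚ t} 0≤δ (unit-∣∣ (gap t≤1) (by-gap t 0≤t (lem t))) hx) (∣*∣≤ {t} 0≤δ (unit-∣∣ 0≤t t≤1) hy)))
    (∣*∣≤ {y′ -ℚ x′} 0≤δ (ℚ.≤-trans (between 0≤y y≤1 0≤x x≤1) (ℚ.≤-reflexive refl)) ht)))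
  where
  lemma : ∀ t t′ x x′ y y′ → ((1ℚ -ℚ t) *ℚ x +ℚ t *ℚ y) -ℚ ((1ℚ -ℚ t′) *ℚ x′ +ℚ t′ *ℚ y′) ≡
          ((1ℚ -ℚ t) *ℚ (x -ℚ x′) +ℚ t *ℚ (y -ℚ y′)) +ℚ (y′ -ℚ x′) *ℚ (t -ℚ t′)
  lemma = ring-∀ ℚ-ring
  lem : ∀ t → 1ℚ ≡ (1ℚ -ℚ t) +ℚ t
  lem = ring-∀ ℚ-ring

mixᵗ : Tame → Tame → Tame → Tame
mixᵗ t x y = record
  { seqᵗ    = λ k → mix (seqᵗ t k) (seqᵗ x k) (seqᵗ y k)
  ; cauchyᵗ = cauchy
  ; 0≤seq   = λ k → proj₁ (bounds k)
  ; seq≤1   = λ k → proj₂ (bounds k)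
  }
  where
  bounds : ∀ k → 0ℚ ≤ℚ mix (seqᵗ t k) (seqᵗ x k) (seqᵗ y k) × mix (seqᵗ t k) (seqᵗ x k) (seqᵗ y k) ≤ℚ 1ℚ
  bounds k = mix-bounds (0≤seq t k) (seq≤1 t k) (0≤seq x k) (seq≤1 x k) (0≤seq y k) (seq≤1 y k)
  cauchy : IsCauchy (λ k → mix (seqᵗ t k) (seqᵗ x k) (seqᵗ y k))
  cauchy ε 0<ε =
    let (γ , 0<γ , e) = halve-ε ε 0<ε ; (δ , 0<δ , e′) = halve-ε γ 0<γ
        (N₁ , p₁) = cauchyᵗ t δ 0<δ ; (N₂ , p₂) = cauchyᵗ x δ 0<δ ; (N₃ , p₃) = cauchyᵗ y δ 0<δ
        3δ<ε : δ +ℚ δ +ℚ δ <ℚ ε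
        3δ<ε = subst₃ {δ} {γ} {ε} e e′ (ℚ.+-monoʳ-< (δ +ℚ δ) (subst (_<ℚ δ +ℚ δ) (ℚ.+-identityʳ δ) (ℚ.+-monoʳ-< δ 0<δ)))
    in N₁ ⊔ (N₂ ⊔ N₃) , λ m n le le′ → ℚ.≤-<-trans
      (mix-close (ℚ.<⇒≤ 0<δ) (0≤seq t m) (seq≤1 t m) (0≤seq x n) (seq≤1 x n) (0≤seq y n) (seq≤1 y n)
        (ℚ.<⇒≤ (p₁ m n (ℕ.≤-trans (ℕ.m≤m⊔n N₁ (N₂ ⊔ N₃)) le) (ℕ.≤-trans (ℕ.m≤m⊔n N₁ (N₂ ⊔ N₃)) le′)))
        (ℚ.<⇒≤ (p₂ m n (l₂ N₁ N₂ N₃ le) (l₂ N₁ N₂ N₃ le′)))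
        (ℚ.<⇒≤ (p₃ m n (l₃ N₁ N₂ N₃ le) (l₃ N₁ N₂ N₃ le′)))) 3δ<ε
    where
    subst₃ : ∀ {δ γ ε} → γ +ℚ γ ≡ ε → δ +ℚ δ ≡ γ → (δ +ℚ δ) +ℚ δ <ℚ (δ +ℚ δ) +ℚ (δ +ℚ δ) → δ +ℚ δ +ℚ δ <ℚ ε
    subst₃ refl refl h = h
    l₂ : ∀ a b c {n} → a ⊔ (b ⊔ c) ≤ n → b ≤ n
    l₂ a b c h = ℕ.≤-trans (ℕ.≤-trans (ℕ.m≤m⊔n b c) (ℕ.m≤n⊔m a (b ⊔ c))) h
    l₃ : ∀ a b c {n} → a ⊔ (b ⊔ c) ≤ n → c ≤ n
    l₃ a b c h = ℕ.≤-trans (ℕ.≤-trans (ℕ.m≤n⊔m b c) (ℕ.m≤n⊔m a (b ⊔ c))) h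

constᵗ : ∀ a → 0ℚ ≤ℚ a → a ≤ℚ 1ℚ → Tame
constᵗ a 0≤a a≤1 = record { seqᵗ = const a ; cauchyᵗ = const-cauchy a ; 0≤seq = λ _ → 0≤a ; seq≤1 = λ _ → a≤1 }

-- Binary expansions and bisection

val : Baire → ℕ → ℕ
val d zero    = 0
val d (suc s) = 2 * val d s + d s

module _ {d : Baire} (bin : Binary d) where

  lower : ℕ → ℚ
  lower s = val d s /2^ s

  lower-suc : ∀ s → lower s ≤ℚ lower (suc s)
  lower-suc s = ℚ.≤-trans (ℚ.≤-reflexive (sym (/2^-double (val d s) s))) (/2^-mono (suc s) (ℕ.m≤m+n _ (d s)))

  upper-suc : ∀ s → lower (suc s) +ℚ 2^- suc s ≤ℚ lower s +ℚ 2^- s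
  upper-suc s = ℚ.≤-trans (ℚ.≤-reflexive (sym (/2^-suc (val d (suc s)) (suc s))))
    (ℚ.≤-trans (/2^-mono (suc s) le) (ℚ.≤-reflexive (trans (/2^-double (suc (val d s)) s) (/2^-suc (val d s) s))))
    where
    le : suc (val d (suc s)) ≤ 2 * suc (val d s)
    le = ℕ.≤-trans (ℕ.≤-reflexive (sym (ℕ.+-suc (2 * val d s) (d s))))
      (ℕ.≤-trans (ℕ.+-monoʳ-≤ (2 * val d s) (bin s)) (ℕ.≤-reflexive (lemma (val d s))))
      where
      lemma : ∀ v → 2 * v + 2 ≡ 2 * suc v
      lemma = solve-∀

  lower-mono : ∀ {s k} → s ≤ k → lower s ≤ℚ lower k
  lower-mono {s} = from-≤ (λ k → lower s ≤ℚ lower k) ℚ.≤-refl λ k _ h → ℚ.≤-trans h (lower-suc k)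

  upper-anti : ∀ {s k} → s ≤ k → lower k +ℚ 2^- k ≤ℚ lower s +ℚ 2^- s
  upper-anti {s} = from-≤ (λ k → lower k +ℚ 2^- k ≤ℚ lower s +ℚ 2^- s) ℚ.≤-refl λ k _ → ℚ.≤-trans (upper-suc k)

  ≤upper : ∀ {s k} → s ≤ k → lower k ≤ℚ lower s +ℚ 2^- s
  ≤upper {s} {k} s≤k = ℚ.≤-trans (by-gap (2^- k) (ℚ.<⇒≤ (0<2^- k)) refl) (upper-anti s≤k)

  expansion : Tame
  expansion = record
    { seqᵗ    = lower
    ; cauchyᵗ = λ ε 0<ε → let (N , 2^-N<ε) = archimedes ε 0<ε in N , λ m n N≤m N≤n → ℚ.≤-<-trans
        (ℚ.≤-trans (between (lower-mono N≤m) (≤upper N≤m) (lower-mono N≤n) (≤upper N≤n)) (ℚ.≤-reflexive (lemma (lower N) (2^- N)))) 2^-N<ε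
    ; 0≤seq   = λ k → 0≤/2^ (val d k) k
    ; seq≤1   = λ k → ℚ.≤-trans (≤upper (z≤n {k})) (ℚ.≤-reflexive unit)
    }
    where
    lemma : ∀ l t → (l +ℚ t) -ℚ l ≡ t
    lemma = ring-∀ ℚ-ring
    unit : lower 0 +ℚ 2^- 0 ≡ 1ℚ
    unit = trans (cong (λ z → z *ℚ 2^- 0 +ℚ 2^- 0) ι-0) refl

-- Closed intervals admit both expansions of a dyadic number.
Expands : Baire → UnitReal → Set
Expands d x = ∀ s → const (val d s /2^ s) ≲ seq x × seq x ≲ const (val d s /2^ s +ℚ 2^- s)

expansion-expands : ∀ {d} (bin : Binary d) → Expands d (real (expansion bin))
expansion-expands {d} bin s = ≲-≤ (const (lower bin s)) (lower bin) s (λ k s≤k → lower-mono bin s≤k) ,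
  ≲-≤ (lower bin) (const (lower bin s +ℚ 2^- s)) s (λ k s≤k → ≤upper bin s≤k)

expands-unique : ∀ d x y → Expands d x → Expands d y → seq x ≃ seq y
expands-unique d x y h k = ≃-squeeze (seq x) (seq y) (λ s → val d s /2^ s) (λ s → proj₁ (h s)) (λ s → proj₂ (h s)) (λ s → proj₁ (k s)) (λ s → proj₂ (k s))

module _ (em : ExcludedMiddle 0ℓ) where

  -- Bisection: dyadic intervals shrinking to a point where the monotone predicate changes.
  bisection : (P Q : ℕ → ℕ → Set) → (∀ a s → P a s → P (2 * a) (suc s)) → (∀ a s → Q a s → Q (2 * a) (suc s)) →
              (∀ a s → a < 2 ^ s → ¬ P a s → Q a s) → P 0 0 → Q 1 0 →
              ∃ λ d → Binary d × (∀ s → P (val d s) s × Q (suc (val d s)) s)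
  bisection P Q P2 Q2 total p₀ q₀ = digit , digit< , λ s → subst (λ z → P z s × Q (suc z) s) (sym (val-state s)) (sat s)
    where
    bit : ℕ → ℕ → ℕ
    bit b s with em {P (suc (2 * b)) (suc s)}
    ... | yes _ = 1
    ... | no  _ = 0
    state : ℕ → ℕ
    state zero    = 0
    state (suc s) = 2 * state s + bit (state s) s
    digit : Baire
    digit s = bit (state s) s
    bit< : ∀ b s → bit b s < 2
    bit< b s with em {P (suc (2 * b)) (suc s)}
    ... | yes _ = s≤s (s≤s z≤n)
    ... | no  _ = s≤s z≤n
    digit< : Binary digit
    digit< s = bit< (state s) s
    val-state : ∀ s → val digit s ≡ state s
    val-state zero    = refl
    val-state (suc s) = cong (λ z → 2 * z + digit s) (val-state s)
    state< : ∀ s → state s < 2 ^ s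
    state< zero    = s≤s z≤n
    state< (suc s) = ℕ.≤-trans (ℕ.≤-reflexive (sym (ℕ.+-suc (2 * state s) (digit s))))
      (ℕ.≤-trans (ℕ.+-monoʳ-≤ (2 * state s) (digit< s)) (ℕ.≤-trans (ℕ.≤-reflexive (lemma (state s))) (ℕ.*-monoʳ-≤ 2 (state< s))))
      where
      lemma : ∀ v → 2 * v + 2 ≡ 2 * suc v
      lemma = solve-∀
    step : ∀ b s → b < 2 ^ s → P b s → Q (suc b) s → P (2 * b + bit b s) (suc s) × Q (suc (2 * b + bit b s)) (suc s)
    step b s b< p q with em {P (suc (2 * b)) (suc s)}
    ... | yes p′ = subst (λ z → P z (suc s)) (ℕ.+-comm 1 (2 * b)) p′ , subst (λ z → Q z (suc s)) (lemma b) (Q2 (suc b) s q)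
      where
      lemma : ∀ b → 2 * suc b ≡ suc (2 * b + 1)
      lemma = solve-∀
    ... | no ¬p = subst (λ z → P z (suc s)) (sym (ℕ.+-identityʳ (2 * b))) (P2 b s p) ,
      subst (λ z → Q (suc z) (suc s)) (sym (ℕ.+-identityʳ (2 * b)))
        (total (suc (2 * b)) (suc s) (ℕ.≤-trans (ℕ.≤-reflexive (lemma b)) (ℕ.*-monoʳ-≤ 2 b<)) ¬p)
      where
      lemma : ∀ b → suc (suc (2 * b)) ≡ 2 * suc b
      lemma = solve-∀
    sat : ∀ s → P (state s) s × Q (suc (state s)) s
    sat zero    = p₀ , q₀
    sat (suc s) = let (p , q) = sat s in step (state s) s (state< s) p q

  opaque
    expand : ∀ x → ∃ λ d → Binary d × Expands d x
    expand x =
      let (d , bin , h) = bisection (λ a s → const (a /2^ s) ≲ seq x) (λ a s → seq x ≲ const (a /2^ s))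
            (λ a s → subst (λ z → const z ≲ seq x) (sym (/2^-double a s)))
            (λ a s → subst (λ z → seq x ≲ const z) (sym (/2^-double a s)))
            (λ a s _ → ≲-total em (const (a /2^ s)) (seq x) (const-cauchy (a /2^ s)) (UnitReal.cauchy x))
            (subst (λ z → const z ≲ seq x) (sym (cong (_*ℚ 2^- 0) ι-0)) (UnitReal.0≲seq x))
            (subst (λ z → seq x ≲ const z) (sym (cong (_*ℚ 2^- 0) ι-1)) (UnitReal.seq≲1 x))
      in d , bin , λ s → proj₁ (h s) , subst (λ z → seq x ≲ const z) (/2^-suc (val d s) s) (proj₂ (h s))

  opaque
    -- Intermediate value theorem on a segment. Bisection of the parameter avoids dividing by the
    -- difference of `y` and `x`.
    hit-value : ∀ (x y : Tame) c → 0ℚ ≤ℚ c → c ≤ℚ 1ℚ → ∀ N → (∀ k → N ≤ k → seqᵗ x k ≤ℚ c × c ≤ℚ seqᵗ y k) →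
                ∃ λ t → (λ k → mix (seqᵗ t k) (seqᵗ x k) (seqᵗ y k)) ≃ const c
    hit-value x y c 0≤c c≤1 N h =
      let (d , bin , sat) = bisection
            (λ a s → a ≤ 2 ^ s × along (a /2^ s) ≲ const c)
            (λ a s → const c ≲ along (a /2^ s))
            (λ a s (a≤ , p) → ℕ.*-monoʳ-≤ 2 a≤ , subst (λ z → along z ≲ const c) (sym (/2^-double a s)) p)
            (λ a s → subst (λ z → const c ≲ along z) (sym (/2^-double a s)))
            (λ a s a< ¬p → ≲-total em (along (a /2^ s)) (const c)
               (cauchyᵗ (mixᵗ (constᵗ (a /2^ s) (0≤/2^ a s) (≤1 a s (ℕ.<⇒≤ a<))) x y)) (const-cauchy c)
               (λ p → ¬p (ℕ.<⇒≤ a< , p)))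
            (z≤n , ≲-≤ (along (0 /2^ 0)) (const c) N λ k N≤k → ℚ.≤-trans (ℚ.≤-reflexive (at0 (seqᵗ x k) (seqᵗ y k))) (proj₁ (h k N≤k)))
            (≲-≤ (const c) (along (1 /2^ 0)) N λ k N≤k → ℚ.≤-trans (proj₂ (h k N≤k)) (ℚ.≤-reflexive (sym (at1 (seqᵗ x k) (seqᵗ y k)))))
      -- The intervals of radius `2^- suc s` around `c` have length `2^- s`, as `≃-squeeze`
      -- requires.
      in expansion bin , ≃-squeeze (λ k → mix (lower bin k) (seqᵗ x k) (seqᵗ y k)) (const c) (λ s → c -ℚ 2^- suc s)
           (λ s → below-mix d bin (suc s) (proj₂ (sat (suc s))))
           (λ s → subst (λ z → (λ k → mix (lower bin k) (seqᵗ x k) (seqᵗ y k)) ≲ const z) (e₃ s) (above-mix d bin (suc s) (proj₂ (proj₁ (sat (suc s))))))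
           (λ s → ≲-≤ (const (c -ℚ 2^- suc s)) (const c) 0 λ _ _ → by-gap (2^- suc s) (ℚ.<⇒≤ (0<2^- (suc s))) (e₂ c (2^- suc s)))
           (λ s → ≲-≤ (const c) (const ((c -ℚ 2^- suc s) +ℚ 2^- s)) 0 λ _ _ → by-gap (2^- suc s) (ℚ.<⇒≤ (0<2^- (suc s))) (sym (e₃ s)))
      where
      along : ℚ → ℕ → ℚ
      along τ k = mix τ (seqᵗ x k) (seqᵗ y k)
      ≤1 : ∀ a s → a ≤ 2 ^ s → a /2^ s ≤ℚ 1ℚ
      ≤1 a s a≤ = ℚ.≤-trans (/2^-≤ s 0 (ℕ.≤-trans (ℕ.≤-reflexive (ℕ.*-identityʳ a)) (ℕ.≤-trans a≤ (ℕ.≤-reflexive (sym (ℕ.*-identityˡ (2 ^ s)))))))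
        (ℚ.≤-reflexive (trans (cong (_*ℚ 2^- 0) ι-1) refl))
      at0 : ∀ x y → mix (0 /2^ 0) x y ≡ x
      at0 x y = trans (cong (λ z → mix z x y) (cong (_*ℚ 2^- 0) ι-0)) (lem x y)
        where
        lem : ∀ x y → (1ℚ -ℚ 0ℚ) *ℚ x +ℚ 0ℚ *ℚ y ≡ x
        lem = ring-∀ ℚ-ring
      at1 : ∀ x y → mix (1 /2^ 0) x y ≡ y
      at1 x y = trans (cong (λ z → mix z x y) (cong (_*ℚ 2^- 0) ι-1)) (lem x y)
        where
        lem : ∀ x y → (1ℚ -ℚ 1ℚ) *ℚ x +ℚ 1ℚ *ℚ y ≡ y
        lem = ring-∀ ℚ-ring
      e₂ : ∀ c t → c ≡ (c -ℚ t) +ℚ t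
      e₂ = ring-∀ ℚ-ring
      e₃ : ∀ s → c +ℚ 2^- suc s ≡ (c -ℚ 2^- suc s) +ℚ 2^- s
      e₃ s = trans (lem c (2^- suc s)) (cong ((c -ℚ 2^- suc s) +ℚ_) (sym (2^-suc s)))
        where
        lem : ∀ c t → c +ℚ t ≡ (c -ℚ t) +ℚ (t +ℚ t)
        lem = ring-∀ ℚ-ring
      moved : ∀ {t t′ x y δ} → ∣ t -ℚ t′ ∣ ≤ℚ δ → ∣ y -ℚ x ∣ ≤ℚ 1ℚ → mix t x y ≤ℚ mix t′ x y +ℚ δ
      moved {t} {t′} {x} {y} {δ} ht hxy = by-gap (δ -ℚ (y -ℚ x) *ℚ (t -ℚ t′))
        (gap (ℚ.≤-trans (≤∣∣ _) (∣*∣≤ {y -ℚ x} (ℚ.≤-trans (ℚ.0≤∣p∣ _) ht) hxy ht))) (lem t t′ x y δ)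
        where
        lem : ∀ t t′ x y δ → ((1ℚ -ℚ t′) *ℚ x +ℚ t′ *ℚ y) +ℚ δ ≡ ((1ℚ -ℚ t) *ℚ x +ℚ t *ℚ y) +ℚ (δ -ℚ (y -ℚ x) *ℚ (t -ℚ t′))
        lem = ring-∀ ℚ-ring
      span : ∀ k → ∣ seqᵗ y k -ℚ seqᵗ x k ∣ ≤ℚ 1ℚ
      span k = between (0≤seq y k) (seq≤1 y k) (0≤seq x k) (seq≤1 x k)
      near : ∀ {d} (bin : Binary d) s k → s ≤ k → ∣ lower bin k -ℚ lower bin s ∣ ≤ℚ 2^- s
      near bin s k s≤k = ℚ.≤-trans (between (lower-mono bin s≤k) (≤upper bin s≤k) ℚ.≤-refl (≤upper bin {s} {s} ℕ.≤-refl)) (ℚ.≤-reflexive (lem (lower bin s) (2^- s)))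
        where
        lem : ∀ l t → (l +ℚ t) -ℚ l ≡ t
        lem = ring-∀ ℚ-ring
      above-mix : ∀ d (bin : Binary d) s → along (val d s /2^ s) ≲ const c →
              (λ k → mix (lower bin k) (seqᵗ x k) (seqᵗ y k)) ≲ const (c +ℚ 2^- s)
      above-mix d bin s p ε 0<ε = let (M , q) = p ε 0<ε in M ⊔ s , λ k le →
        ℚ.≤-trans (moved {lower bin k} {lower bin s} {seqᵗ x k} {seqᵗ y k} (near bin s k (ℕ.≤-trans (ℕ.m≤n⊔m M s) le)) (span k))
          (ℚ.≤-trans (ℚ.+-monoˡ-≤ (2^- s) (q k (ℕ.≤-trans (ℕ.m≤m⊔n M s) le))) (ℚ.≤-reflexive (lem c ε (2^- s))))
        where
        lem : ∀ c ε t → c +ℚ ε +ℚ t ≡ c +ℚ t +ℚ ε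
        lem = ring-∀ ℚ-ring
      below-mix : ∀ d (bin : Binary d) s → const c ≲ along (suc (val d s) /2^ s) →
                const (c -ℚ 2^- s) ≲ (λ k → mix (lower bin k) (seqᵗ x k) (seqᵗ y k))
      below-mix d bin s p ε 0<ε = let (M , q) = p ε 0<ε in M ⊔ s , λ k le →
        let r = moved {suc (val d s) /2^ s} {lower bin k} {seqᵗ x k} {seqᵗ y k} (near′ k (ℕ.≤-trans (ℕ.m≤n⊔m M s) le)) (span k)
            u = q k (ℕ.≤-trans (ℕ.m≤m⊔n M s) le)
        in by-gap _ (0≤-+ (gap r) (gap u)) (lem c ε (2^- s) (mix (lower bin k) (seqᵗ x k) (seqᵗ y k)) (mix (suc (val d s) /2^ s) (seqᵗ x k) (seqᵗ y k)))
        where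
        lem : ∀ c ε t m m′ → m +ℚ ε ≡ (c -ℚ t) +ℚ (((m +ℚ t) -ℚ m′) +ℚ ((m′ +ℚ ε) -ℚ c))
        lem = ring-∀ ℚ-ring
        near′ : ∀ k → s ≤ k → ∣ suc (val d s) /2^ s -ℚ lower bin k ∣ ≤ℚ 2^- s
        near′ k s≤k = ℚ.≤-trans (between {lower bin s} {lower bin s +ℚ 2^- s}
            (ℚ.≤-trans (≤upper bin {s} {s} ℕ.≤-refl) (ℚ.≤-reflexive (sym (/2^-suc (val d s) s)))) (ℚ.≤-reflexive (/2^-suc (val d s) s))
            (lower-mono bin s≤k) (≤upper bin s≤k)) (ℚ.≤-reflexive (lem′ (lower bin s) (2^- s)))
          where
          lem′ : ∀ l t → (l +ℚ t) -ℚ l ≡ t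
          lem′ = ring-∀ ℚ-ring

-- Binary trees

module _ (em : ExcludedMiddle 0ℓ) where

  -- A prefix that extends to all levels has a digit with the same property: if both digits failed,
  -- at levels `s₀` and `s₁`, there would be no extension at level `s₀ ⊔ s₁`.
  kőnig : (T : ℕ → Baire → Set) (ℓ : ℕ → ℕ) → (∀ {s f} → Binary f → T (suc s) f → T s f) →
          (∀ {s f g} → f ~[ ℓ s ] g → T s f → T s g) → (∀ s → ∃ λ f → Binary f × T s f) →
          ∃ λ f → Binary f × (∀ s → T s f)
  kőnig T ℓ parent local inh = limit , (λ m → proj₁ (proj₂ (path (suc m))) m) , λ s →
    let (g , _ , e , t) = proj₂ (proj₂ (path (ℓ s))) s in local (~-trans e (~-sym (limit~ (ℓ s)))) t
    where
    mono : ∀ {s s′ f} → Binary f → s ≤ s′ → T s′ f → T s f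
    mono {s} {f = f} b = from-≤ (λ s′ → T s′ f → T s f) id λ _ _ h t → h (parent b t)
    Extends∞ : ℕ → Baire → Set
    Extends∞ u f = ∀ s → ∃ λ g → Binary g × g ~[ u ] f × T s g
    step : ∀ u f → Extends∞ u f → ∃ λ g → (Binary g × Extends∞ (suc u) g) × g ~[ u ] f
    step u f h = dne em λ none →
      let stops : ∀ b → ∃ λ s → ¬ (∃ λ g → Binary g × g ~[ u ] f × g u ≡ b × T s g)
          stops b = ¬∀ em λ k → let (g , bg , e , gu , _) = k 0 in
            none (g , (bg , λ s → let (g′ , bg′ , e′ , gu′ , t) = k s in
              g′ , bg′ , (λ i i<1+u → near bg e e′ (trans gu′ (sym gu)) i (ℕ.m<1+n⇒m<n∨m≡n i<1+u)) , t) , e)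
          (s₀ , k₀) = stops 0 ; (s₁ , k₁) = stops 1
          (g , bg , e , t) = h (s₀ ⊔ s₁)
      in bit (g u) refl (bg u) (λ e₀ → k₀ (g , bg , e , e₀ , mono bg (ℕ.m≤m⊔n s₀ s₁) t)) (λ e₁ → k₁ (g , bg , e , e₁ , mono bg (ℕ.m≤n⊔m s₀ s₁) t))
      where
      near : ∀ {g g′} → Binary g → g ~[ u ] f → g′ ~[ u ] f → g′ u ≡ g u → ∀ i → i < u ⊎ i ≡ u → g′ i ≡ g i
      near _ e e′ _ i (inj₁ i<u)  = trans (e′ i i<u) (sym (e i i<u))
      near _ _ _  d i (inj₂ refl) = d
      bit : ∀ b {x} → x ≡ b → b < 2 → ¬ x ≡ 0 → ¬ x ≡ 1 → ⊥
      bit zero          e _ n₀ _  = n₀ e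
      bit (suc zero)    e _ _  n₁ = n₁ e
      bit (suc (suc b)) e (s≤s (s≤s ())) _ _
    path : ∀ u → ∃ λ f → Binary f × Extends∞ u f
    path zero = let (f , b , _) = inh 0 in f , b , λ s → let (g , bg , t) = inh s in g , bg , (λ _ ()) , t
    path (suc u) = let (f , _ , h) = path u ; (g , bh , _) = step u f h in g , bh
    path~ : ∀ u → proj₁ (path (suc u)) ~[ u ] proj₁ (path u)
    path~ u = let (f , _ , h) = path u in proj₂ (proj₂ (step u f h))
    path~* : ∀ {u k} → u ≤ k → proj₁ (path k) ~[ u ] proj₁ (path u)
    path~* {u} = from-≤ (λ k → proj₁ (path k) ~[ u ] proj₁ (path u)) (λ _ _ → refl) λ k u≤k → ~-trans (~-mono u≤k (path~ k))
    limit : Baire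
    limit m = proj₁ (path (suc m)) m
    limit~ : ∀ u → limit ~[ u ] proj₁ (path u)
    limit~ u m m<u = sym (path~* m<u m ℕ.≤-refl)

-- By stage `s` the associate `p` has rejected `v`: its first reply for some digit `N` is at least
-- 2, a nonzero symbol after the shift.
Dead : Baire → ℕ → Baire → Set
Dead p s v = ∃ λ N → N < s × ∃ λ k → k < suc s × 2 ≤ p (code (N ∷ applyUpTo v k)) ×
             (∀ j → j < k → p (code (N ∷ applyUpTo v j)) ≡ 0)

Dead-mono : ∀ {p v s s′} → s ≤ s′ → Dead p s v → Dead p s′ v
Dead-mono s≤s′ (N , N< , k , k≤ , rest) = N , ℕ.<-≤-trans N< s≤s′ , k , ℕ.≤-trans k≤ (s≤s s≤s′) , rest

Dead-local : ∀ {p v w s} → v ~[ s ] w → Dead p s v → Dead p s w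
Dead-local {p} {v} {w} {s} e (N , N< , k , k≤ , ans , nil) = N , N< , k , k≤ ,
  subst (λ z → 2 ≤ p (cons N z)) (code-cong k (~-mono (s≤s⁻¹ k≤) e)) ans ,
  λ j j<k → trans (cong (λ z → p (cons N z)) (sym (code-cong j (~-mono (ℕ.<⇒≤ (ℕ.<-≤-trans j<k (s≤s⁻¹ k≤))) e)))) (nil j j<k)

module _ {X : RepresentedSpace} {p A} (pA : Name (𝒜 X) p A) {v x} (vx : Name X v x) where

  member-alive : _∈_ {X} x A → ∀ s → ¬ Dead p s v
  member-alive x∈A s (N , _ , k , _ , ans , nil) with pA v x vx
  ... | z , a , r with Func.to (proj₁ A) x
  member-alive refl s (N , _ , k , _ , ans , nil) | z , a , ofⁿ none | .false =
    none (N , λ zN → ℕ.<⇒≱ ans (ℕ.≤-reflexive (trans (same (ℕ.<-cmp k (proj₁ (a N)))) (cong suc zN))))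
    where
    same : _ → p (code (N ∷ applyUpTo v k)) ≡ suc (z N)
    same (tri< k<k′ _ _) = contradiction (subst (2 ≤_) (proj₂ (proj₂ (a N)) k k<k′) ans) λ ()
    same (tri≈ _ refl _) = proj₁ (proj₂ (a N))
    same (tri> _ _ k′<k) = contradiction (trans (sym (nil _ k′<k)) (proj₁ (proj₂ (a N)))) λ ()

  nonmember-dead : ¬ _∈_ {X} x A → ∃ λ s → Dead p s v
  nonmember-dead x∉A with pA v x vx
  ... | z , a , r with Func.to (proj₁ A) x
  nonmember-dead x∉A | z , a , ofⁿ _ | .false = contradiction refl x∉A
  nonmember-dead x∉A | z , a , ofʸ (N , zN) | .true = let (k , e , nil) = a N in
    suc N ⊔ k , N , ℕ.m≤m⊔n (suc N) k , k , s≤s (ℕ.m≤n⊔m (suc N) k) ,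
    subst (2 ≤_) (sym e) (s≤s (ℕ.n≢0⇒n>0 zN)) , nil

-- Points of the cube as binary sequences

strand : ℕ → ℕ → Baire → Baire
strand n i f m = f (i + m * n)

val-cong : ∀ {d e} s → d ~[ s ] e → val d s ≡ val e s
val-cong zero    h = refl
val-cong (suc s) h = cong₂ (λ a b → 2 * a + b) (val-cong s (~-mono (ℕ.n≤1+n s) h)) (h s ℕ.≤-refl)

half≤ : ∀ n → half n ≤ n
half≤ n with halve n
... | k , h rewrite half-unique n k h with h
...   | inj₁ refl = ℕ.m≤m+n k (k + 0)
...   | inj₂ refl = ℕ.m≤n⇒m≤1+n (ℕ.m≤m+n k (k + 0))

module Cube (n′ : ℕ) where

  n : ℕ
  n = suc n′

  cells : ℕ → Baire → ℕ → ℕ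
  cells i f s = val (strand n i f) s

  cells-local : ∀ {f g i} s → i < n → f ~[ s * n ] g → cells i f s ≡ cells i g s
  cells-local {i = i} s i<n e = val-cong s λ m m<s → e (i + m * n) (ℕ.<-≤-trans (ℕ.+-monoˡ-< (m * n) i<n) (ℕ.*-monoˡ-≤ n m<s))

  quot-rem : ∀ i q → i < n → (i + q * n) % n ≡ i × (i + q * n) / n ≡ q
  quot-rem i q i<n = trans ([m+kn]%n≡m%n i q n) (m<n⇒m%n≡m i<n) ,
    trans (+-distrib-/-∣ʳ i (n∣m*n q)) (cong₂ _+_ (m<n⇒m/n≡0 i<n) (m*n/n≡m q n))

  weave : (ℕ → Baire) → Baire
  weave d N = d (N % n) (N / n)

  strand-weave : ∀ d i → i < n → strand n i (weave d) ≗ d i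
  strand-weave d i i<n m = let (r , q) = quot-rem i m i<n in cong₂ d r q

  -- The name of a point made from the lower ends of its dyadic cells: entries `2r` and `2r + 1` of
  -- a coordinate are the numerator and the predecessor of the denominator `2 ^ r`. With these names
  -- the closed set becomes a tree of binary words.
  canonical : Baire → Baire
  canonical f N = select (N / n) (cells (N % n) f (half (N / n))) (pred (2 ^ half (N / n)))

  -- Entry `N` uses an expansion only to depth `half (N / n)`, hence only digits at places up to
  -- `N`.
  canonical-local : ∀ {f g} s → f ~[ s ] g → canonical f ~[ s ] canonical g
  canonical-local {f} {g} s e N N<s = cong (λ z → select (N / n) z (pred (2 ^ half (N / n)))) (val-cong (half (N / n))
    λ m m< → e (N % n + m * n) (ℕ.≤-<-trans (ℕ.+-monoʳ-≤ (N % n) (ℕ.*-monoˡ-≤ n (ℕ.<⇒≤ (ℕ.<-≤-trans m< (half≤ (N / n))))))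
      (ℕ.≤-<-trans (ℕ.≤-reflexive (sym (m≡m%n+[m/n]*n N n))) N<s)))

  canonical-at : ∀ f i r → i < n →
    canonical f (i + (2 * r) * n) ≡ cells i f r × canonical f (i + suc (2 * r) * n) ≡ pred (2 ^ r)
  canonical-at f i r i<n =
    trans (entry (2 * r)) (trans (select-even r _ _) (cong (cells i f) (half-unique (2 * r) r (inj₁ refl)))) ,
    trans (entry (suc (2 * r))) (trans (select-odd r _ _) (cong (λ z → pred (2 ^ z)) (half-unique (suc (2 * r)) r (inj₂ refl))))
    where
    entry : ∀ q → canonical f (i + q * n) ≡ select q (cells i f (half q)) (pred (2 ^ half q))
    entry q = let (e , d) = quot-rem i q i<n in cong₂ (λ i q → select q (cells i f (half q)) (pred (2 ^ half q))) e d

  coord : (f : Baire) → Binary f → Fin n → Tame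
  coord f b i = expansion {component i f} (λ m → b _)

  point : (f : Baire) → Binary f → Fin n → UnitReal
  point f b i = real (coord f b i)

  canonical-names : ∀ f b → Name (Power 𝕀 n) (canonical f) (point f b)
  canonical-names f b i r ε 0<ε = r , λ m r≤m → ℚ.≤-trans
    (subst (λ z → ∣ z -ℚ lower bin m ∣ ≤ℚ 2^- r) (sym ratio≡)
      (ℚ.≤-trans (between ℚ.≤-refl (≤upper bin {r} {r} ℕ.≤-refl) (lower-mono bin r≤m) (≤upper bin r≤m)) (ℚ.≤-reflexive (lemma (lower bin r) (2^- r)))))
    (by-gap ε (ℚ.<⇒≤ 0<ε) refl)
    where
    bin : Binary (component i f)
    bin m = b _
    lemma : ∀ l t → (l +ℚ t) -ℚ l ≡ t
    lemma = ring-∀ ℚ-ring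
    at-r = canonical-at f (toℕ i) r (Fin.toℕ<n i)
    ratio≡ : ratio (component i (canonical f)) r ≡ lower bin r
    ratio≡ = trans (ℚ./-cong (cong ℤ.+_ (proj₁ at-r)) (cong suc (proj₂ at-r))) (/2^-/ (val (component i f) r) r)

  module _ (em : ExcludedMiddle 0ℓ) where

    expand-point : (x : Fin n → UnitReal) → ∃ λ f → Binary f × (∀ i → Expands (component i f) (x i))
    expand-point x = weave d , (λ N → bin (N % n) (N / n)) , λ i s →
      let (a , b) = proj₂ (proj₂ (expansions i)) s in
      subst (λ z → const (z /2^ s) ≲ seq (x i)) (sym (same i s)) a ,
      subst (λ z → seq (x i) ≲ const (z /2^ s +ℚ 2^- s)) (sym (same i s)) b
      where
      opaque
        expansions : ∀ i → ∃ λ d → Binary d × Expands d (x i)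
        expansions i = expand em (x i)
      d : ℕ → Baire
      d i with i <? n
      ... | yes i<n = proj₁ (expansions (fromℕ< i<n))
      ... | no _    = λ _ → 0
      bin : ∀ i → Binary (d i)
      bin i with i <? n
      ... | yes i<n = proj₁ (proj₂ (expansions (fromℕ< i<n)))
      ... | no _    = λ _ → s≤s z≤n
      d-toℕ : ∀ i → d (toℕ i) ≗ proj₁ (expansions i)
      d-toℕ i m with toℕ i <? n
      ... | yes i<n = cong (λ z → proj₁ (expansions z) m) (Fin.fromℕ<-toℕ i i<n)
      ... | no i≮n  = contradiction (Fin.toℕ<n i) i≮n

      same : ∀ i s → val (component i (weave d)) s ≡ val (proj₁ (expansions i)) s
      same i s = val-cong {component i (weave d)} {proj₁ (expansions i)} s
        λ m _ → trans (strand-weave d (toℕ i) (Fin.toℕ<n i) m) (d-toℕ i m)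

    expand-≈ : ∀ x f b → (∀ i → Expands (component i f) (x i)) → RepresentedSpace._≈_ (Power 𝕀 n) x (point f b)
    expand-≈ x f b h i = expands-unique (component i f) (x i) (point f b i) (h i) (expansion-expands (λ m → b _))

-- `suc (distance u v)` bounds the distance of points in two cells, in cell widths, and at most
-- doubles when the cells are halved. So being far apart passes from subcells to their parents.
distance-double : ∀ u v x y → x < 2 → y < 2 → suc (distance (2 * u + x) (2 * v + y)) ≤ 2 * suc (distance u v)
distance-double u v x y x<2 y<2 = go (ℕ.≤-total u v)
  where
  lem : ∀ u k x → 2 * (u + k) + x ≡ 2 * u + (2 * k + x)
  lem = solve-∀
  up : ∀ k x → x < 2 → suc (2 * k + x) ≤ 2 * suc k
  up k x x<2 = ℕ.≤-trans (ℕ.≤-reflexive (sym (ℕ.+-suc (2 * k) x))) (ℕ.≤-trans (ℕ.+-monoʳ-≤ (2 * k) x<2) (ℕ.≤-reflexive (lem₂ k)))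
    where
    lem₂ : ∀ k → 2 * k + 2 ≡ 2 * suc k
    lem₂ = solve-∀
  core : ∀ u k x y → x < 2 → y < 2 → suc (distance (2 * u + x) (2 * (u + k) + y)) ≤ 2 * suc k
  core u k x y x<2 y<2 rewrite lem u k y | ℕ.[m+n]∸[m+o]≡n∸o (2 * u) x (2 * k + y) | ℕ.[m+n]∸[m+o]≡n∸o (2 * u) (2 * k + y) x with ℕ.≤-total x (2 * k + y)
  ... | inj₁ le rewrite ℕ.m≤n⇒m∸n≡0 le = ℕ.≤-trans (s≤s (ℕ.m∸n≤m (2 * k + y) x)) (up k y y<2)
  ... | inj₂ ge rewrite ℕ.m≤n⇒m∸n≡0 ge | ℕ.+-identityʳ (x ∸ (2 * k + y)) =
    ℕ.≤-trans (s≤s (ℕ.≤-trans (ℕ.m∸n≤m x (2 * k + y)) (s≤s⁻¹ x<2))) (ℕ.*-monoʳ-≤ 2 (s≤s z≤n))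
  swap : ∀ a b → distance a b ≡ distance b a
  swap a b = ℕ.+-comm (a ∸ b) (b ∸ a)
  gap≡ : ∀ u k → distance u (u + k) ≡ k
  gap≡ u k = trans (cong₂ _+_ (ℕ.m≤n⇒m∸n≡0 (ℕ.m≤m+n u k)) (ℕ.m+n∸m≡n u k)) refl
  go : u ≤ v ⊎ v ≤ u → suc (distance (2 * u + x) (2 * v + y)) ≤ 2 * suc (distance u v)
  go (inj₁ u≤v) = subst (λ z → suc (distance (2 * u + x) (2 * z + y)) ≤ 2 * suc (distance u z)) (ℕ.m+[n∸m]≡n u≤v)
    (subst (λ z → suc (distance (2 * u + x) (2 * (u + (v ∸ u)) + y)) ≤ 2 * suc z) (sym (gap≡ u (v ∸ u))) (core u (v ∸ u) x y x<2 y<2))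
  go (inj₂ v≤u) = subst (λ z → suc (distance (2 * z + x) (2 * v + y)) ≤ 2 * suc (distance z v)) (ℕ.m+[n∸m]≡n v≤u)
    (subst (λ z → suc (distance (2 * (v + (u ∸ v)) + x) (2 * v + y)) ≤ 2 * suc z) (sym (trans (swap (v + (u ∸ v)) v) (gap≡ v (u ∸ v))))
      (subst (λ z → suc z ≤ 2 * suc (u ∸ v)) (swap (2 * v + y) (2 * (v + (u ∸ v)) + x)) (core v (u ∸ v) y x y<2 x<2)))

distance≤1 : ∀ {u v} → u ≤ suc v → v ≤ suc u → distance u v ≤ 1
distance≤1 {u} {v} h k with ℕ.≤-total u v
... | inj₁ le rewrite ℕ.m≤n⇒m∸n≡0 le = ℕ.m≤n+o⇒m∸n≤o v u (ℕ.≤-trans k (ℕ.≤-reflexive (ℕ.+-comm 1 u)))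
... | inj₂ ge rewrite ℕ.m≤n⇒m∸n≡0 ge | ℕ.+-identityʳ (u ∸ v) = ℕ.m≤n+o⇒m∸n≤o u v (ℕ.≤-trans h (ℕ.≤-reflexive (ℕ.+-comm 1 v)))

-- The dyadic number a / 2ᵉ lies in the s-th interval of the expansion d.
Near : Baire → ℕ → ℕ → ℕ → Set
Near d a e s = val d s * 2 ^ e ≤ a * 2 ^ s × a * 2 ^ s ≤ suc (val d s) * 2 ^ e

near-bounds : ∀ d a e s → Near d a e s → val d s /2^ s ≤ℚ a /2^ e × a /2^ e ≤ℚ val d s /2^ s +ℚ 2^- s
near-bounds d a e s (h , k) = /2^-≤ s e h , ℚ.≤-trans (/2^-≤ e s k) (ℚ.≤-reflexive (/2^-suc (val d s) s))

near-parent : ∀ {d a e s} → Binary d → Near d a e (suc s) → Near d a e s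
near-parent {d} {a} {e} {s} bin (h , k) =
  ℕ.*-cancelˡ-≤ 2 (ℕ.≤-trans (ℕ.≤-trans (ℕ.≤-reflexive (sym (ℕ.*-assoc 2 (val d s) (2 ^ e)))) (ℕ.*-monoˡ-≤ (2 ^ e) (ℕ.m≤m+n (2 * val d s) (d s))))
    (ℕ.≤-trans h (ℕ.≤-reflexive (lemma a (2 ^ s))))) ,
  ℕ.*-cancelˡ-≤ 2 (ℕ.≤-trans (ℕ.≤-reflexive (sym (lemma a (2 ^ s)))) (ℕ.≤-trans k
    (ℕ.≤-trans (ℕ.*-monoˡ-≤ (2 ^ e) (ℕ.≤-trans (ℕ.≤-reflexive (sym (ℕ.+-suc (2 * val d s) (d s)))) (ℕ.+-monoʳ-≤ (2 * val d s) (bin s))))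
      (ℕ.≤-reflexive (lemma′ (val d s) (2 ^ e))))))
  where
  lemma : ∀ a x → a * (2 * x) ≡ 2 * (a * x)
  lemma = solve-∀
  lemma′ : ∀ v x → (2 * v + 2) * x ≡ 2 * (suc v * x)
  lemma′ = solve-∀

expands-near : ∀ d (z : UnitReal) a e → Expands d z → seq z ≃ const (a /2^ e) → ∀ s → Near d a e s
expands-near d z a e ex eq s =
  /2^-≤⁻ s e (const-≲ _ _ (≲-trans (const (val d s /2^ s)) (seq z) (const (a /2^ e)) (proj₁ (ex s)) (≃-≲ (seq z) (const (a /2^ e)) eq))) ,
  /2^-≤⁻ e s (ℚ.≤-trans (const-≲ _ _ (≲-trans (const (a /2^ e)) (seq z) (const (val d s /2^ s +ℚ 2^- s))
    (≃-≲ (const (a /2^ e)) (seq z) (≃-sym (seq z) (const (a /2^ e)) eq)) (proj₂ (ex s)))) (ℚ.≤-reflexive (sym (/2^-suc (val d s) s))))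

-- Both numbers equal `a / 2ᵉ`, and so does each mixture of them: hyperplanes are convex.
mix-near : ∀ {d d′} (b : Binary d) (b′ : Binary d′) t a e → (∀ s → Near d a e s) → (∀ s → Near d′ a e s) →
           seq (real (mixᵗ t (expansion b) (expansion b′))) ≃ const (a /2^ e)
mix-near {d} {d′} b b′ t a e h h′ = ≃-squeeze (seqᵗ z) (const c) (λ s → c -ℚ 2^- suc s)
  (λ s → ≲-≤ (const (c -ℚ 2^- suc s)) (seqᵗ z) (suc s) λ k le → proj₁ (bounds s k le))
  (λ s → ≲-≤ (seqᵗ z) (const ((c -ℚ 2^- suc s) +ℚ 2^- s)) (suc s) λ k le → ℚ.≤-trans (proj₂ (bounds s k le)) (ℚ.≤-reflexive (e₃ s)))
  (λ s → ≲-≤ (const (c -ℚ 2^- suc s)) (const c) 0 λ _ _ → by-gap (2^- suc s) (ℚ.<⇒≤ (0<2^- (suc s))) (e₂ c (2^- suc s)))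
  (λ s → ≲-≤ (const c) (const ((c -ℚ 2^- suc s) +ℚ 2^- s)) 0 λ _ _ → by-gap (2^- suc s) (ℚ.<⇒≤ (0<2^- (suc s))) (sym (e₃ s)))
  where
  c = a /2^ e
  z = mixᵗ t (expansion b) (expansion b′)
  e₂ : ∀ c t → c ≡ (c -ℚ t) +ℚ t
  e₂ = ring-∀ ℚ-ring
  e₃ : ∀ s → c +ℚ 2^- suc s ≡ (c -ℚ 2^- suc s) +ℚ 2^- s
  e₃ s = trans (lem c (2^- suc s)) (cong ((c -ℚ 2^- suc s) +ℚ_) (sym (2^-suc s)))
    where
    lem : ∀ c t → c +ℚ t ≡ (c -ℚ t) +ℚ (t +ℚ t)
    lem = ring-∀ ℚ-ring
  about : ∀ {l x t} → l ≤ℚ x → x ≤ℚ l +ℚ t → l ≤ℚ c → c ≤ℚ l +ℚ t → c -ℚ t ≤ℚ x × x ≤ℚ c +ℚ t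
  about {l} {x} {t} lx xu lc cu =
    by-gap _ (0≤-+ (gap lx) (gap cu)) (e₄ l x t c) , by-gap _ (0≤-+ (gap xu) (gap lc)) (e₅ l x t c)
    where
    e₄ : ∀ l x t c → x ≡ (c -ℚ t) +ℚ ((x -ℚ l) +ℚ ((l +ℚ t) -ℚ c))
    e₄ = ring-∀ ℚ-ring
    e₅ : ∀ l x t c → c +ℚ t ≡ x +ℚ (((l +ℚ t) -ℚ x) +ℚ (c -ℚ l))
    e₅ = ring-∀ ℚ-ring
  strip : ∀ {d} (b : Binary d) → (∀ s → Near d a e s) → ∀ s k → s ≤ k → c -ℚ 2^- s ≤ℚ lower b k × lower b k ≤ℚ c +ℚ 2^- s
  strip {d} b h s k s≤k = let (p , q) = near-bounds d a e s (h s) in about {lower b s} {lower b k} {2^- s} (lower-mono b s≤k) (≤upper b s≤k) p q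
  bounds : ∀ s k → suc s ≤ k → c -ℚ 2^- suc s ≤ℚ seqᵗ z k × seqᵗ z k ≤ℚ c +ℚ 2^- suc s
  bounds s k le = let (p , q) = strip b h (suc s) k le ; (p′ , q′) = strip b′ h′ (suc s) k le in
    mix-bounds (0≤seq t k) (seq≤1 t k) p q p′ q′

-- Flats of a convex set

module Flats (em : ExcludedMiddle 0ℓ) (n′ : ℕ) {p : Baire} {A : Carrier (𝒜 (Power 𝕀 (suc n′)))}
             (pA : Name (𝒜 (Power 𝕀 (suc n′))) p A) (convex : Convex A) where

  open Cube n′

  -- A number codes a hyperplane x_i = a / 2ᵉ.
  axis : ℕ → Fin n
  axis c = fromℕ< (m%n<n (nth 0 c) n)

  Meets : ℕ → ℕ → Baire → Set
  Meets s c f = Near (component (axis c) f) (nth 1 c) (nth 2 c) s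

  Flat : ℕ → (ℕ → ℕ) → ℕ → Baire → Set
  Flat l E s f = ∀ j → j < l → Meets s (E j) f

  Alive : ℕ → Baire → Set
  Alive s f = ¬ Dead p s (canonical f)

  alive-in : ∀ f b → (∀ s → Alive s f) → _∈_ {Power 𝕀 n} (point f b) A
  alive-in f b h = dne em λ ∉ → let (s , dead) = nonmember-dead {Power 𝕀 n} {p} {A} pA {canonical f} {point f b} (canonical-names f b) ∉ in h s dead

  in-alive : ∀ f b → _∈_ {Power 𝕀 n} (point f b) A → ∀ s → Alive s f
  in-alive f b = member-alive {Power 𝕀 n} {p} {A} pA {canonical f} {point f b} (canonical-names f b)

  ∈-resp : ∀ {x y} → RepresentedSpace._≈_ (Power 𝕀 n) x y → _∈_ {Power 𝕀 n} x A → _∈_ {Power 𝕀 n} y A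
  ∈-resp e x∈ = trans (sym (Func.cong (proj₁ A) e)) x∈

  OnFlat : ℕ → (ℕ → ℕ) → Baire → Set
  OnFlat l E f = Binary f × (∀ s → Alive s f) × (∀ s → Flat l E s f)

  -- Compactness: conditions on finite stages that can be met at every stage are met together by one
  -- point.
  compact : ∀ l E (Q : ℕ → Baire → Set) →
            (∀ {s f} → Binary f → Q (suc s) f → Q s f) → (∀ {s f g} → f ~[ s * n ] g → Q s f → Q s g) →
            (∀ s → ∃ λ f → Binary f × Alive s f × Flat l E s f × Q s f) → ∃ λ f → OnFlat l E f × (∀ s → Q s f)
  compact l E Q parent local inh =
    let (f , b , t) = kőnig em T (λ s → s * n) parent′ local′ inh in
    f , (b , (λ s → proj₁ (t s)) , λ s → proj₁ (proj₂ (t s))) , λ s → proj₂ (proj₂ (t s))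
    where
    T : ℕ → Baire → Set
    T s f = Alive s f × Flat l E s f × Q s f
    parent′ : ∀ {s f} → Binary f → T (suc s) f → T s f
    parent′ {s} {f} b (al , fl , q) = (λ d → al (Dead-mono {p} {canonical f} (ℕ.n≤1+n s) d)) ,
      (λ j j<l → near-parent {component (axis (E j)) f} {nth 1 (E j)} {nth 2 (E j)} {s} (λ m → b _) (fl j j<l)) , parent b q
    local′ : ∀ {s f g} → f ~[ s * n ] g → T s f → T s g
    local′ {s} {f} {g} e (al , fl , q) =
      (λ d → al (Dead-local {p} {canonical g} {canonical f} {s} (canonical-local s (~-mono (ℕ.m≤m*n s n) (~-sym e))) d)) ,
      (λ j j<l → subst (λ v → v * 2 ^ nth 2 (E j) ≤ nth 1 (E j) * 2 ^ s × nth 1 (E j) * 2 ^ s ≤ suc v * 2 ^ nth 2 (E j))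
        (cells-local {f} {g} {toℕ (axis (E j))} s (Fin.toℕ<n (axis (E j))) e) (fl j j<l)) , local e q

  -- The lower end of the cell of `g` lies between the two coordinates. The segment from `f` to `g`
  -- takes this value, and by convexity it stays in `A` and on the flat.
  cross : ∀ l E {f g} → OnFlat l E f → OnFlat l E g → ∀ i s₀ → cells (toℕ i) f s₀ < cells (toℕ i) g s₀ →
          ∃ λ h → OnFlat l E h × (∀ s → Near (component i h) (cells (toℕ i) g s₀) s₀ s)
  cross l E {f} {g} (bf , af , ff) (bg , ag , fg) i s₀ lt =
    let (t , hits) = hit-value em (coord f bf i) (coord g bg i) c (0≤seq (coord g bg i) s₀) (seq≤1 (coord g bg i) s₀) s₀
          (λ k s₀≤k → ℚ.≤-trans (≤upper (λ m → bf _) s₀≤k) (ℚ.≤-trans (ℚ.≤-reflexive (sym (/2^-suc (cells (toℕ i) f s₀) s₀))) (/2^-mono s₀ lt)) ,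
                      lower-mono (λ m → bg _) s₀≤k)
    in build t hits
    where
    c = cells (toℕ i) g s₀ /2^ s₀
    build : ∀ t → (λ k → mix (seqᵗ t k) (seqᵗ (coord f bf i) k) (seqᵗ (coord g bg i) k)) ≃ const c →
            ∃ λ h → OnFlat l E h × (∀ s → Near (component i h) (cells (toℕ i) g s₀) s₀ s)
    build t hits = finish (expand-point em z)
      where
      z : Fin n → UnitReal
      z i = real (mixᵗ t (coord f bf i) (coord g bg i))
      z∈A : _∈_ {Power 𝕀 n} z A
      z∈A = convex (point f bf) (point g bg) z (real t) (alive-in f bf af) (alive-in g bg ag)
        (λ i → Setoid.refl (RepresentedSpace.setoid 𝕀) {z i})
      finish : (∃ λ h → Binary h × (∀ i → Expands (component i h) (z i))) →
               ∃ λ h → OnFlat l E h × (∀ s → Near (component i h) (cells (toℕ i) g s₀) s₀ s)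
      finish (h , bh , ex) = h , (bh , in-alive h bh (∈-resp {z} {point h bh} (expand-≈ em z h bh ex) z∈A) ,
          λ s j j<l → expands-near (component (axis (E j)) h) (z (axis (E j))) (nth 1 (E j)) (nth 2 (E j)) (ex (axis (E j)))
            (mix-near (λ m → bf _) (λ m → bg _) t (nth 1 (E j)) (nth 2 (E j)) (λ s → ff s j j<l) (λ s → fg s j j<l)) s) ,
        expands-near (component i h) (z i) (cells (toℕ i) g s₀) s₀ (ex i) hits

  -- Both clauses are decidable, the second because only the first `s * n` digits of `f` matter at
  -- stage `s`.
  Refuted : ℕ → ℕ → (ℕ → ℕ) → Set
  Refuted s l E = (∃ λ j → j < l × axis (E j) ≡ axis (E l)) ⊎ (∀ f → Binary f → Alive s f → ¬ Flat (suc l) E s f)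

  Refuted-cong : ∀ {s l E E′} → (∀ j → j < suc l → E j ≡ E′ j) → Refuted s l E → Refuted s l E′
  Refuted-cong e (inj₁ (j , j<l , a)) = inj₁ (j , j<l ,
    trans (cong axis (sym (e j (ℕ.m<n⇒m<1+n j<l)))) (trans a (cong axis (e _ ℕ.≤-refl))))
  Refuted-cong {s} e (inj₂ h) = inj₂ λ f b al fl → h f b al (λ j j< → subst (λ z → Meets s z f) (sym (e j j<)) (fl j j<))

  near-mono : ∀ {d a e s s′} → Binary d → s ≤ s′ → Near d a e s′ → Near d a e s
  near-mono {d} {a} {e} {s} b = from-≤ (λ s′ → Near d a e s′ → Near d a e s) id λ s′ _ h near → h (near-parent {d} {a} {e} {s′} b near)

  -- g prints at each stage the least level whose current flat is refuted, or n.
  -- The current hyperplane of level j is given by the number of letters ≤ j so far.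
  module Process (g : Baire) (g≤n : ∀ s → g s ≤ n)
                 (fires : ∀ s → g s < n → Refuted s (g s) (λ j → below g (suc j) s))
                 (holds : ∀ s l → l < g s → ¬ Refuted s l (λ j → below g (suc j) s))
                 (inhabited : ∃ λ x → _∈_ {Power 𝕀 n} x A) where

    opaque
      recurs : ∃ λ m → InfinitelyOften (toSeq g (λ s → s≤s (g≤n s))) m ×
               (∀ l → l Fin.< m → ¬ InfinitelyOften (toSeq g (λ s → s≤s (g≤n s))) l)
      recurs = least-recurrent em _

    m : ℕ
    m = toℕ (proj₁ recurs)

    m≤n : m ≤ n
    m≤n = s≤s⁻¹ (Fin.toℕ<n (proj₁ recurs))

    often : ∀ N → ∃ λ s → N ≤ s × g s < suc m
    often N = let (s , N≤s , e) = proj₁ (proj₂ recurs) N in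
      s , N≤s , ℕ.≤-reflexive (cong suc (trans (sym (Fin.toℕ-fromℕ< _)) (cong toℕ e)))

    opaque
      rare : ∃ λ s₀ → ∀ s → s₀ ≤ s → m ≤ g s
      rare = let (N , h) = collect (λ j N → ∀ s → g s ≡ j → s < N) (λ M≤N k s e → ℕ.<-≤-trans (k s e) M≤N) m finite in
        N , λ s N≤s → ℕ.≮⇒≥ λ gs<m → ℕ.<⇒≱ (h (g s) gs<m s refl) N≤s
        where
        finite : ∀ j → j < m → ∃ λ N → ∀ s → g s ≡ j → s < N
        finite j j<m = let (N , h) = finitely-often em (toSeq g (λ s → s≤s (g≤n s))) l (proj₂ (proj₂ recurs) l (subst (_< m) (sym l≡) j<m)) in
          N , λ s e → h s (Fin.toℕ-injective (trans (Fin.toℕ-fromℕ< _) (trans e (sym l≡))))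
          where
          l : Fin (suc n)
          l = fromℕ< (ℕ.<-≤-trans j<m (ℕ.m≤n⇒m≤1+n m≤n))
          l≡ : toℕ l ≡ j
          l≡ = Fin.toℕ-fromℕ< _

    s₀ : ℕ
    s₀ = proj₁ rare

    c : ℕ → ℕ
    c j = below g (suc j) s₀

    stable : ∀ j s → j < m → s₀ ≤ s → below g (suc j) s ≡ c j
    stable j s j<m s₀≤s = below-const g (suc j) s₀≤s λ i s₀≤i _ → ℕ.≤-trans j<m (proj₂ rare i s₀≤i)

    unrefuted : ∀ l s → l < m → s₀ ≤ s → ¬ Refuted s l c
    unrefuted l s l<m s₀≤s r = holds s l (ℕ.<-≤-trans l<m (proj₂ rare s s₀≤s))
      (Refuted-cong (λ j j≤l → sym (stable j s (ℕ.≤-trans j≤l l<m) s₀≤s)) r)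

    distinct : ∀ j l → j < l → l < m → axis (c j) ≢ axis (c l)
    distinct j l j<l l<m e = unrefuted l s₀ l<m ℕ.≤-refl (inj₁ (j , j<l , e))

    opaque
      -- The last of the `m` final levels is never refuted after `s₀`, so the flat meets `A` at
      -- every stage; for `m = 0` it is `A` itself.
      on-flat : ∃ λ f → OnFlat m c f
      on-flat = let (f , on , _) = compact m c (λ s _ → s ≤ s) (λ _ _ → ℕ.≤-refl) (λ _ h → h) (λ s → inh m refl s) in f , on
        where
        inh : ∀ k → k ≡ m → ∀ s → ∃ λ f → Binary f × Alive s f × Flat m c s f × s ≤ s
        inh zero e s =
          let (x , x∈A) = inhabited
              (f , b , ex) = expand-point em x
          in f , b , in-alive f b (∈-resp {x} {point f b} (expand-≈ em x f b ex) x∈A) s ,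
             (λ j j<m → contradiction (subst (j <_) (sym e) j<m) λ ()) , ℕ.≤-refl
        inh (suc l) e s = dne em λ none → unrefuted l (s ⊔ s₀) (ℕ.≤-reflexive e) (ℕ.m≤n⊔m s s₀) (inj₂ λ f b al fl → none
          (f , b , (λ d → al (Dead-mono {p} {canonical f} (ℕ.m≤m⊔n s s₀) d)) ,
           (λ j j<m → near-mono {component (axis (c j)) f} {nth 1 (c j)} {nth 2 (c j)} (λ m → b _) (ℕ.m≤m⊔n s s₀) (fl j (subst (j <_) (sym e) j<m))) , ℕ.≤-refl))

    -- The counter of level `m` grows by at most one per stage and without bound, so it takes every
    -- later value and leaves it at a stage that prints `m`.
    reach : ∀ v → below g (suc m) s₀ ≤ v → ∃ λ s → s₀ ≤ s × g s ≡ m × below g (suc m) s ≡ v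
    reach v ≤v = let (N , v<) = below-unbounded g (suc m) often v in
      walk N (ℕ.<-≤-trans v< (below-mono g (suc m) (ℕ.m≤n+m N s₀)))
      where
      walk : ∀ k → v < below g (suc m) (s₀ + k) → ∃ λ s → s₀ ≤ s × g s ≡ m × below g (suc m) s ≡ v
      walk zero v< = contradiction ≤v (ℕ.<⇒≱ (subst (λ z → v < below g (suc m) z) (ℕ.+-identityʳ s₀) v<))
      walk (suc k) v< with v <? below g (suc m) (s₀ + k)
      ... | yes lt = walk k lt
      ... | no v≮ with g (s₀ + k) <? suc m
      ...   | no g≥ = contradiction (ℕ.<-≤-trans v< (ℕ.≤-reflexive (trans (cong (below g (suc m)) (ℕ.+-suc s₀ k))
                  (trans (cong (below g (suc m) (s₀ + k) +_) (below?-no (ℕ.≮⇒≥ g≥))) (ℕ.+-identityʳ _))))) v≮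
      ...   | yes g< = s₀ + k , ℕ.m≤m+n s₀ k , ℕ.≤-antisym (s≤s⁻¹ g<) (proj₂ rare _ (ℕ.m≤m+n s₀ k)) ,
                  ℕ.≤-antisym (ℕ.≮⇒≥ v≮) (s≤s⁻¹ (ℕ.≤-trans v< (ℕ.≤-reflexive (trans (cong (below g (suc m)) (ℕ.+-suc s₀ k))
                    (trans (cong (below g (suc m) (s₀ + k) +_) (below?-yes g<)) (ℕ.+-comm _ 1))))))

    -- Every hyperplane has arbitrarily large codes, so level `m` guesses this one after `s₀` and
    -- gives it up when `m` is printed. But neither reason for refutation applies: its axis is free,
    -- and `h` lies on it.
    no-hyperplane : ∀ i a e → (∀ j → j < m → axis (c j) ≢ i) → ¬ (∃ λ h → OnFlat m c h × (∀ s → Near (component i h) a e s))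
    no-hyperplane i a e free (h , (bh , ah , fh) , near) = cases (ℕ.m≤n⇒m<n∨m≡n m≤n)
      where
      -- In case `m = n`, a free axis besides the `n` distinct ones would be one too many.
      used : Fin (suc n) → Fin n
      used Fin.zero    = i
      used (Fin.suc j) = axis (c (toℕ j))
      clash : m ≡ n → ¬ (∃₂ λ j k → j Fin.< k × used j ≡ used k)
      clash m≡n (Fin.zero , Fin.suc k , _ , e) = free (toℕ k) (subst (toℕ k <_) (sym m≡n) (Fin.toℕ<n k)) (sym e)
      clash m≡n (Fin.suc j , Fin.suc k , s≤s j<k , e) = distinct (toℕ j) (toℕ k) j<k (subst (toℕ k <_) (sym m≡n) (Fin.toℕ<n k)) e
      J = below g (suc m) s₀
      -- The fourth entry pads the code, so that it is at least the counter at `s₀` and still to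
      -- come.
      t₂ = cons e (cons J 0)
      t₁ = cons a t₂
      v = cons (toℕ i) t₁
      J≤v : J ≤ v
      J≤v = ℕ.<⇒≤ (ℕ.<-trans (hd<cons J 0) (ℕ.<-trans (tl<cons e (cons J 0)) (ℕ.<-trans (tl<cons a t₂) (tl<cons (toℕ i) t₁))))
      reached = reach v J≤v
      s = proj₁ reached
      s₀≤s = proj₁ (proj₂ reached)
      gs≡m = proj₁ (proj₂ (proj₂ reached))
      E≡v : below g (suc m) s ≡ v
      E≡v = proj₂ (proj₂ (proj₂ reached))
      nth₁ : nth 1 v ≡ a
      nth₁ = trans (cong hd (drops-cons 0 (toℕ i) t₁)) (hd-cons a t₂)
      nth₂ : nth 2 v ≡ e
      nth₂ = trans (cong hd (trans (drops-cons 1 (toℕ i) t₁) (drops-cons 0 a t₂))) (hd-cons e (cons J 0))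
      axis≡ : axis v ≡ i
      axis≡ = Fin.toℕ-injective (trans (Fin.toℕ-fromℕ< _) (trans (cong (_% n) (hd-cons (toℕ i) t₁)) (m<n⇒m%n≡m (Fin.toℕ<n i))))
      meets : Meets s (below g (suc m) s) h
      meets = subst (λ z → Meets s z h) (sym E≡v) (transport axis≡ nth₁ nth₂)
        where
        transport : ∀ {i′ a′ e′} → i′ ≡ i → a′ ≡ a → e′ ≡ e → Near (component i′ h) a′ e′ s
        transport refl refl refl = near s
      refute : ¬ Refuted s (g s) (λ j → below g (suc j) s)
      refute r = refuted (subst (λ z → Refuted s z (λ j → below g (suc j) s)) gs≡m r)
        where
        refuted : ¬ Refuted s m (λ j → below g (suc j) s)
        flat : ∀ j → j < m ⊎ j ≡ m → Meets s (below g (suc j) s) h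
        flat j (inj₁ j<m)  = subst (λ z → Meets s z h) (sym (stable j s j<m s₀≤s)) (fh s j j<m)
        flat j (inj₂ refl) = meets
        refuted (inj₁ (j , j<m , eq)) = free j j<m (trans (cong axis (sym (stable j s j<m s₀≤s))) (trans eq (trans (cong axis E≡v) axis≡)))
        refuted (inj₂ none) = none h bh (ah s) λ j j≤m → flat j (ℕ.m<1+n⇒m<n∨m≡n j≤m)
      cases : m < n ⊎ m ≡ n → ⊥
      cases (inj₂ m≡n) = clash m≡n (Fin.pigeonhole ℕ.≤-refl used)
      cases (inj₁ m<n) = refute (fires s (subst (_< n) (sym gs≡m) m<n))

    -- On a used axis both points lie on the same hyperplane. On a free one, cells further apart
    -- would give, by `cross`, a hyperplane that meets the flat.
    unique : ∀ f f′ → OnFlat m c f → OnFlat m c f′ → ∀ i s → cells (toℕ i) f s ≤ suc (cells (toℕ i) f′ s)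
    unique f f′ on on′ i s = cases em
      where
      cases : Dec (∃ λ j → j < m × axis (c j) ≡ i) → cells (toℕ i) f s ≤ suc (cells (toℕ i) f′ s)
      cases (yes (j , j<m , refl)) = ℕ.*-cancelʳ-≤ _ _ (2 ^ nth 2 (c j)) {{ℕ.m^n≢0 2 (nth 2 (c j))}}
        (ℕ.≤-trans (proj₁ (proj₂ (proj₂ on) s j j<m)) (proj₂ (proj₂ (proj₂ on′) s j j<m)))
      cases (no free) = ℕ.≮⇒≥ λ lt → no-hyperplane i (cells (toℕ i) f s) s (λ j j<m e → free (j , j<m , e))
        (cross m c {f′} {f} on′ on i s (ℕ.<-trans ℕ.≤-refl lt))

    module _ {q} (sorts : Sorts g q) where

      q≤m : ∀ t → q t ≤ m
      q≤m t = let (N , t<) = below-unbounded g (suc m) often t in s≤s⁻¹ (proj₂ (sorts t (suc m)) N t<)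

      total : ∀ l N → l ≤ m → below g l N ≤ below g l s₀
      total l N l≤m = ℕ.≤-trans (below-mono g l (ℕ.m≤m⊔n N s₀))
        (ℕ.≤-reflexive (below-const g l (ℕ.m≤n⊔m N s₀) λ i s₀≤i _ → ℕ.≤-trans l≤m (proj₂ rare i s₀≤i)))

      attains : ∃ λ t → q t ≡ m
      attains = t , ℕ.≤-antisym (q≤m t) (ℕ.≮⇒≥ λ lt → let (N , t<) = proj₁ (sorts t m) lt in ℕ.<⇒≱ t< (total m N ℕ.≤-refl))
        where t = below g m s₀

      -- A letter above `j` at place `t` of the sorted sequence follows all letters up to `j`; so
      -- their number, which codes the final guess of level `j`, is already visible.
      exact : ∀ t j → j < q t → below q (suc j) t ≡ c j
      exact t j j<qt = trans (counts t) (ℕ.m≥n⇒m⊓n≡n (ℕ.≮⇒≥ λ t<c → ℕ.<⇒≱ (proj₂ (sorts t (suc j)) s₀ t<c) j<qt))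
        where
        j<m : suc j ≤ m
        j<m = ℕ.≤-trans j<qt (q≤m t)
        counts : ∀ t → below q (suc j) t ≡ t ⊓ c j
        counts zero = refl
        counts (suc t) with t <? c j
        ... | yes t<c = trans (cong₂ _+_ (trans (counts t) (ℕ.m≤n⇒m⊓n≡m (ℕ.<⇒≤ t<c))) (below?-yes (proj₂ (sorts t (suc j)) s₀ t<c)))
                          (trans (ℕ.+-comm t 1) (sym (ℕ.m≤n⇒m⊓n≡m t<c)))
        ... | no t≮c = trans (cong₂ _+_ (trans (counts t) (ℕ.m≥n⇒m⊓n≡n (ℕ.≮⇒≥ t≮c)))
                          (below?-no (ℕ.≮⇒≥ λ lt → let (N , t<) = proj₁ (sorts t (suc j)) lt in t≮c (ℕ.<-≤-trans t< (total (suc j) N j<m)))))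
                          (trans (ℕ.+-identityʳ (c j)) (sym (ℕ.m≥n⇒m⊓n≡n (ℕ.m≤n⇒m≤1+n (ℕ.≮⇒≥ t≮c)))))

      -- A certificate of precision `2^- r`, with `b i` in units of `2^- s`; the successor allows
      -- for the width of a cell.
      Close : ℕ → ℕ → ℕ → (ℕ → ℕ) → Set
      Close r t s b = ∀ f → Binary f → Alive s f → Flat (q t) (λ j → below q (suc j) t) s f →
                      ∀ i → i < n → suc (distance (cells i f s) (b i)) * 2 ^ r ≤ 2 ^ s

      private
        f∞ = proj₁ on-flat
        b∞ = proj₁ (proj₂ on-flat)

      solution : Fin n → UnitReal
      solution = point f∞ b∞

      solution∈A : _∈_ {Power 𝕀 n} solution A
      solution∈A = alive-in f∞ b∞ (proj₁ (proj₂ (proj₂ on-flat)))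

      -- Also for `q t < m` the solution lies on the first `q t` final hyperplanes, so a certificate
      -- can be trusted without knowing `m`.
      close-sound : ∀ r t s b → Close r t s b → ∀ i → (λ k → ∣ b (toℕ i) /2^ s -ℚ seq (solution i) k ∣) ≲ const (2^- r)
      close-sound r t s b close i = ≲-≤ _ _ s λ k s≤k → ∣∣≤
        (by-gap _ (0≤-+ (0≤-+ (0≤-+ (gap left) (gap (lower-mono bin s≤k))) (gap dist)) (ℚ.<⇒≤ (0<2^- s))) (e₁ B V D (lower bin k) (2^- s) (2^- r)))
        (by-gap _ (0≤-+ (0≤-+ (gap right) (gap (≤upper bin s≤k))) (gap dist)) (e₂ B V D (lower bin k) (2^- s) (2^- r)))
        where
        bin : Binary (component i f∞)
        bin m = b∞ _
        v = cells (toℕ i) f∞ s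
        d = distance v (b (toℕ i))
        B = b (toℕ i) /2^ s
        V = lower bin s
        D = d /2^ s
        near : suc d * 2 ^ r ≤ 2 ^ s
        near = close f∞ b∞ (proj₁ (proj₂ (proj₂ on-flat)) s) (λ j j<q → subst (λ z → Meets s z f∞) (sym (exact t j j<q))
          (proj₂ (proj₂ (proj₂ on-flat)) s j (ℕ.<-≤-trans j<q (q≤m t)))) (toℕ i) (Fin.toℕ<n i)
        dist : D +ℚ 2^- s ≤ℚ 2^- r
        dist = ℚ.≤-trans (ℚ.≤-reflexive (sym (/2^-suc d s))) (ℚ.≤-trans
          (/2^-≤ {suc d} {1} s r (ℕ.≤-trans near (ℕ.≤-reflexive (sym (ℕ.*-identityˡ (2 ^ s))))))
          (ℚ.≤-reflexive (trans (cong (_*ℚ 2^- r) ι-1) (ℚ.*-identityˡ (2^- r)))))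
        add : ∀ x y → (x + y) /2^ s ≡ x /2^ s +ℚ y /2^ s
        add x y = trans (cong (_*ℚ 2^- s) (ι-+ x y)) (ℚ.*-distribʳ-+ (2^- s) (ι x) (ι y))
        left : B ≤ℚ V +ℚ D
        left = ℚ.≤-trans (/2^-mono s (ℕ.≤-trans (ℕ.m≤n+m∸n (b (toℕ i)) v) (ℕ.+-monoʳ-≤ v (ℕ.m≤n+m _ (v ∸ b (toℕ i)))))) (ℚ.≤-reflexive (add v d))
        right : V ≤ℚ B +ℚ D
        right = ℚ.≤-trans (/2^-mono s (ℕ.≤-trans (ℕ.m≤n+m∸n v (b (toℕ i))) (ℕ.+-monoʳ-≤ (b (toℕ i)) (ℕ.m≤m+n (v ∸ b (toℕ i)) _)))) (ℚ.≤-reflexive (add (b (toℕ i)) d))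
        e₁ : ∀ B V D L t r → r ≡ (B -ℚ L) +ℚ (((V +ℚ D) -ℚ B) +ℚ (L -ℚ V) +ℚ (r -ℚ (D +ℚ t)) +ℚ t)
        e₁ = ring-∀ ℚ-ring
        e₂ : ∀ B V D L t r → r ≡ -ℚ (B -ℚ L) +ℚ (((B +ℚ D) -ℚ V) +ℚ ((V +ℚ t) -ℚ L) +ℚ (r -ℚ (D +ℚ t)))
        e₂ = ring-∀ ℚ-ring

      -- At a place with `q t = m` the flat is the final one. If no stage brought all its points
      -- close to `f∞`, compactness would give a point of the flat far from `f∞`, against `unique`.
      close-complete : ∀ r → ∃ λ t → ∃ λ s → ∃ λ b → Close r t s b
      close-complete r = dne em λ none →
        let (f , on , far) = compact m c Far (λ {s} {f} → parent {s} {f}) (λ {s} {f} {g} → local {s} {f} {g}) (λ s → fail s none) in settle f on (far (suc r))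
        where
        t = proj₁ attains
        Far : ℕ → Baire → Set
        Far s f = ∃ λ i → i < n × 2 ^ s < suc (distance (cells i f s) (cells i f∞ s)) * 2 ^ r
        parent : ∀ {s f} → Binary f → Far (suc s) f → Far s f
        parent {s} {f} b (i , i<n , far) = i , i<n , ℕ.*-cancelˡ-< 2 _ _ (ℕ.<-≤-trans far (ℕ.≤-trans
          (ℕ.*-monoˡ-≤ (2 ^ r) (distance-double (cells i f s) (cells i f∞ s) _ _ (b _) (b∞ _)))
          (ℕ.≤-reflexive (ℕ.*-assoc 2 (suc (distance (cells i f s) (cells i f∞ s))) (2 ^ r)))))
        local : ∀ {s f g} → f ~[ s * n ] g → Far s f → Far s g
        local {s} {f} {g} e (i , i<n , far) = i , i<n ,
          subst (λ z → 2 ^ s < suc (distance z (cells i f∞ s)) * 2 ^ r) (cells-local {f} {g} {i} s i<n e) far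
        fail : ∀ s → ¬ (∃ λ t → ∃ λ s → ∃ λ b → Close r t s b) → ∃ λ f → Binary f × Alive s f × Flat m c s f × Far s f
        fail s none = dne em λ no-f → none (t , s , (λ i → cells i f∞ s) , λ f b al fl i i<n → ℕ.≮⇒≥ λ far → no-f (f , b , al ,
          (λ j j<m → let j<q = subst (j <_) (sym (proj₂ attains)) j<m in subst (λ z → Meets s z f) (exact t j j<q) (fl j j<q)) , i , i<n , far))
        settle : ∀ f → OnFlat m c f → ¬ Far (suc r) f
        -- At depth `suc r` the cells differ by at most 1, and `2 * 2 ^ r` is `2 ^ suc r`.
        settle f on (i , i<n , far) = ℕ.<⇒≱ far (ℕ.*-monoˡ-≤ (2 ^ r) (s≤s (distance≤1
            (subst (λ z → cells z f (suc r) ≤ suc (cells z f∞ (suc r))) (Fin.toℕ-fromℕ< i<n) (unique f f∞ on (proj₂ on-flat) (fromℕ< i<n) (suc r)))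
            (subst (λ z → cells z f∞ (suc r) ≤ suc (cells z f (suc r))) (Fin.toℕ-fromℕ< i<n) (unique f∞ f (proj₂ on-flat) on (fromℕ< i<n) (suc r))))))

-- Tests on finite words as programs

bits : ℕ → Baire
bits W j = 1 ∸ (1 ∸ nth j W)

bits-binary : ∀ W → Binary (bits W)
bits-binary W j = s≤s (ℕ.m∸n≤m 1 (1 ∸ nth j W))

bits-code : ∀ {f} u → Binary f → bits (code (applyUpTo f u)) ~[ u ] f
bits-code {f} u b j j<u = trans (cong (λ z → 1 ∸ (1 ∸ z)) (nth-code f j j<u)) (clip (f j) (b j))
  where
  clip : ∀ x → x < 2 → 1 ∸ (1 ∸ x) ≡ x
  clip zero          _ = refl
  clip (suc zero)    _ = refl
  clip (suc (suc x)) (s≤s (s≤s ()))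

-- One more digit takes a code `c` to at most `2 * suc (2 * c)`, which is below `4 * suc c`. A sum
-- over codes below `4 ^ u` thus covers all binary words of length `u`.
code<4^ : ∀ {f} u → Binary f → code (applyUpTo f u) < 4 ^ u
code<4^ zero    b = s≤s z≤n
code<4^ {f} (suc u) b = ℕ.≤-trans (s≤s (ℕ.*-monoˡ-≤ (suc (2 * c)) (ℕ.^-monoʳ-≤ 2 (s≤s⁻¹ (b 0)))))
  (ℕ.≤-trans (ℕ.≤-trans (ℕ.n≤1+n _) (ℕ.≤-reflexive (lemma c))) (ℕ.*-monoʳ-≤ 4 (code<4^ u (λ n → b (suc n)))))
  where
  c = code (applyUpTo (λ i → f (suc i)) u)
  lemma : ∀ c → suc (suc (2 * suc (2 * c))) ≡ 4 * suc c
  lemma = solve-∀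

words-zero : ∀ u (F : Baire → ℕ) → (∀ f → Binary f → F f ≡ 0) → ∑ (4 ^ u) (λ W → F (bits W)) ≡ 0
words-zero u F h = ∑-zero (4 ^ u) λ W _ → h (bits W) (bits-binary W)

words-zero⁻ : ∀ u (F : Baire → ℕ) → (∀ f g → f ~[ u ] g → F f ≡ F g) → ∑ (4 ^ u) (λ W → F (bits W)) ≡ 0 →
              ∀ f → Binary f → F f ≡ 0
words-zero⁻ u F local z f b = trans (local f _ (~-sym (bits-code u b))) (∑-zero⁻ (4 ^ u) z _ (code<4^ u b))

bitsF : ∀ {n} → Fn n → Fn n → Fn n
bitsF j W = lit 1 ⊖ (lit 1 ⊖ nthF j W)

prefix : ℕ → ℕ → ℕ
prefix k V = code (applyUpTo (λ i → nth i V) k)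

prefix-code : ∀ v k s → k ≤ s → prefix k (code (applyUpTo v s)) ≡ code (applyUpTo v k)
prefix-code v k s k≤s = code-cong k λ i i<k → nth-code v i (ℕ.<-≤-trans i<k k≤s)

dead : Baire → ℕ → ℕ → ℕ
dead p s V = ∏ s λ N → ∏ (suc s) λ k → (2 ∸ p (cons N (prefix k V))) + ∑ k λ j → p (cons N (prefix j V))

deadF : Fn 2
deadF = as (∏F (var (# 0)) (∏F (sucF (var (# 1))) ((lit 2 ⊖ ask (var (# 0))) ⊕ ∑F (var (# 0)) (askʷ (var (# 0))))))
  (λ { p (s ∷ V ∷ []) → dead p s V }) λ { p (s ∷ V ∷ []) → refl }
  where
  ask : Fn 4 → Fn 4
  ask k = at (consF (var (# 1)) (takeF k (nthF (var (# 0)) (var (# 4)))))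
  askʷ : Fn 5 → Fn 5
  askʷ j = at (consF (var (# 2)) (takeF j (nthF (var (# 0)) (var (# 5)))))

dead-sound : ∀ p s v → dead p s (code (applyUpTo v s)) ≡ 0 → Dead p s v
dead-sound p s v z =
  let (N , N<s , z₁) = ∏-zero⁻ s z
      (k , k≤s , z₂) = ∏-zero⁻ (suc s) z₁
      V = code (applyUpTo v s)
      ask = λ k k≤s → cong (λ c → p (cons N c)) (prefix-code v k s k≤s)
  in N , N<s , k , k≤s ,
     subst (2 ≤_) (ask k (s≤s⁻¹ k≤s)) (ℕ.m∸n≡0⇒m≤n (ℕ.m+n≡0⇒m≡0 (2 ∸ p (cons N (prefix k V))) z₂)) ,
     λ j j<k → trans (sym (ask j (ℕ.<⇒≤ (ℕ.<-≤-trans j<k (s≤s⁻¹ k≤s)))))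
                     (∑-zero⁻ k (ℕ.m+n≡0⇒n≡0 (2 ∸ p (cons N (prefix k V))) z₂) j j<k)

dead-complete : ∀ p s v → Dead p s v → dead p s (code (applyUpTo v s)) ≡ 0
dead-complete p s v (N , N<s , k , k≤s , ans , nil) = ∏-zero s N N<s (∏-zero (suc s) k k≤s (cong₂ _+_
  (ℕ.m≤n⇒m∸n≡0 (subst (2 ≤_) (sym (ask k (s≤s⁻¹ k≤s))) ans))
  (∑-zero k λ j j<k → trans (ask j (ℕ.<⇒≤ (ℕ.<-≤-trans j<k (s≤s⁻¹ k≤s)))) (nil j j<k))))
  where
  ask : ∀ k → k ≤ s → p (cons N (prefix k (code (applyUpTo v s)))) ≡ p (code (N ∷ applyUpTo v k))
  ask k k≤s = cong (λ c → p (cons N c)) (prefix-code v k s k≤s)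

module CubeF (n′ : ℕ) where

  open Cube n′

  quotF remF : ∀ {k} → Fn k → Fn k
  quotF x = call (as (theF (sucF (var (# 0))) ((var (# 0) ⊗ lit n ⊖ var (# 1)) ⊕ (sucF (var (# 1)) ⊖ sucF (var (# 0)) ⊗ lit n)))
    (λ { _ (x ∷ []) → x / n }) λ { _ (x ∷ []) → quot x }) (x ∷ [])
    where
    quot : ∀ x → the (suc x) (λ q → (q * n ∸ x) + (suc x ∸ suc q * n)) ≡ x / n
    quot x = the-unique (suc x) (x / n) (s≤s (ℕ.≤-trans (ℕ.m≤m*n (x / n) n) le))
      (cong₂ _+_ (ℕ.m≤n⇒m∸n≡0 le) (ℕ.m≤n⇒m∸n≡0 lt)) λ j _ z → unique j
        (ℕ.m∸n≡0⇒m≤n (ℕ.m+n≡0⇒m≡0 (j * n ∸ x) z)) (ℕ.m∸n≡0⇒m≤n (ℕ.m+n≡0⇒n≡0 (j * n ∸ x) z))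
      where
      le : x / n * n ≤ x
      le = ℕ.≤-trans (ℕ.m≤n+m _ (x % n)) (ℕ.≤-reflexive (sym (m≡m%n+[m/n]*n x n)))
      lt : x < suc (x / n) * n
      lt = ℕ.≤-<-trans (ℕ.≤-reflexive (m≡m%n+[m/n]*n x n)) (ℕ.+-monoˡ-< (x / n * n) (m%n<n x n))
      unique : ∀ j → j * n ≤ x → x < suc j * n → j ≡ x / n
      unique j a b = ℕ.≤-antisym (s≤s⁻¹ (ℕ.*-cancelʳ-< _ j (suc (x / n)) (ℕ.≤-<-trans a lt)))
                                 (s≤s⁻¹ (ℕ.*-cancelʳ-< _ (x / n) (suc j) (ℕ.≤-<-trans le b)))
  remF x = call (as (var (# 0) ⊖ quotF (var (# 0)) ⊗ lit n) (λ { _ (x ∷ []) → x % n }) λ { _ (x ∷ []) → rem x }) (x ∷ [])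
    where
    rem : ∀ x → x ∸ x / n * n ≡ x % n
    rem x = trans (cong (_∸ x / n * n) (m≡m%n+[m/n]*n x n)) (ℕ.m+n∸n≡m (x % n) (x / n * n))

  cellsF : ∀ {k} → Fn k → Fn k → Fn k → Fn k
  cellsF i s W = call (as (prim (lit 0) (lit 2 ⊗ var (# 1) ⊕ bitsF (var (# 2) ⊕ var (# 0) ⊗ lit n) (var (# 3))))
    (λ { _ (s ∷ i ∷ W ∷ []) → cells i (bits W) s }) λ { _ (s ∷ i ∷ W ∷ []) → natrec-≡ (cells i (bits W)) refl (λ _ → refl) s })
    (s ∷ i ∷ W ∷ [])

  canonicalF : ∀ {k} → Fn k → Fn k → Fn k
  canonicalF N W = call (as (selectF (quotF (var (# 0))) (cellsF (remF (var (# 0))) (halfF (quotF (var (# 0)))) (var (# 1)))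
      (lit 2 ↑ halfF (quotF (var (# 0))) ⊖ lit 1))
    (λ { _ (N ∷ W ∷ []) → canonical (bits W) N }) λ { _ (N ∷ W ∷ []) → cong (select (N / n) (cells (N % n) (bits W) (half (N / n)))) (ℕ.pred[m∸n]≡m∸[1+n] (2 ^ half (N / n)) 0) })
    (N ∷ W ∷ [])

  -- Tests on a binary sequence f; e codes the list of hyperplanes.
  deadᵛ : Baire → ℕ → Baire → ℕ
  deadᵛ p s f = dead p s (code (applyUpTo (canonical f) s))

  meetsᵛ : ℕ → ℕ → Baire → ℕ
  meetsᵛ s c f = (v * 2 ^ nth 2 c ∸ nth 1 c * 2 ^ s) + (nth 1 c * 2 ^ s ∸ suc v * 2 ^ nth 2 c)
    where v = cells (nth 0 c % n) f s

  flatᵛ : ℕ → ℕ → ℕ → Baire → ℕ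
  flatᵛ l s e f = ∑ l λ j → meetsᵛ s (nth j e) f

  -- Zero if an axis is repeated, or if every word is dead or off the flat: the two clauses of
  -- `Refuted`.
  refutation : Baire → ℕ → ℕ → ℕ → ℕ
  refutation p s l e = ∏ l (λ j → distance (nth 0 (nth j e) % n) (nth 0 (nth l e) % n)) *
                       ∑ (4 ^ (s * n)) λ W → deadᵛ p s (bits W) * (1 ∸ flatᵛ (suc l) s e (bits W))

  closure : Baire → ℕ → ℕ → ℕ → ℕ → ℕ → ℕ
  closure p r l s e m = ∑ (4 ^ (s * n)) λ W → deadᵛ p s (bits W) * (1 ∸ flatᵛ l s e (bits W)) *
    ∑ n λ i → suc (distance (cells i (bits W) s) (nth (2 + i) m)) * 2 ^ r ∸ 2 ^ s

  opaque
    refutedᵛ : Baire → ℕ → ℕ → ℕ → ℕ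
    refutedᵛ = refutation

    refutedᵛ-def : ∀ p s l e → refutation p s l e ≡ refutedᵛ p s l e
    refutedᵛ-def p s l e = refl

    closeᵛ : Baire → ℕ → ℕ → ℕ → ℕ → ℕ → ℕ
    closeᵛ = closure

    closeᵛ-def : ∀ p r l s e m → closure p r l s e m ≡ closeᵛ p r l s e m
    closeᵛ-def p r l s e m = refl

  deadᵛF : ∀ {k} → Fn k → Fn k → Fn k
  deadᵛF s W = call (as (call deadF (var (# 0) ∷ takeF (var (# 0)) (canonicalF (var (# 0)) (var (# 2))) ∷ []))
    (λ { p (s ∷ W ∷ []) → deadᵛ p s (bits W) }) λ { p (s ∷ W ∷ []) → refl }) (s ∷ W ∷ [])

  meetsᵛF : ∀ {k} → Fn k → Fn k → Fn k → Fn k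
  meetsᵛF s c W = call (as
    ((cl ⊗ lit 2 ↑ nthF (lit 2) (var (# 1)) ⊖ nthF (lit 1) (var (# 1)) ⊗ lit 2 ↑ var (# 0)) ⊕
     (nthF (lit 1) (var (# 1)) ⊗ lit 2 ↑ var (# 0) ⊖ sucF cl ⊗ lit 2 ↑ nthF (lit 2) (var (# 1))))
    (λ { _ (s ∷ c ∷ W ∷ []) → meetsᵛ s c (bits W) }) λ { _ (s ∷ c ∷ W ∷ []) → refl }) (s ∷ c ∷ W ∷ [])
    where
    cl : Fn 3
    cl = cellsF (remF (nthF (lit 0) (var (# 1)))) (var (# 0)) (var (# 2))

  flatᵛF : ∀ {k} → Fn k → Fn k → Fn k → Fn k → Fn k
  flatᵛF l s e W = call (as (∑F (var (# 0)) (meetsᵛF (var (# 2)) (nthF (var (# 0)) (var (# 3))) (var (# 4))))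
    (λ { _ (l ∷ s ∷ e ∷ W ∷ []) → flatᵛ l s e (bits W) }) λ { _ (l ∷ s ∷ e ∷ W ∷ []) → refl }) (l ∷ s ∷ e ∷ W ∷ [])

  refutedᵛF : Fn 3
  refutedᵛF = as
    (∏F (var (# 1)) (distF (remF (nthF (lit 0) (nthF (var (# 0)) (var (# 3))))) (remF (nthF (lit 0) (nthF (var (# 2)) (var (# 3)))))) ⊗
     ∑F (lit 4 ↑ (var (# 0) ⊗ lit n)) (deadᵛF (var (# 1)) (var (# 0)) ⊗ (lit 1 ⊖ flatᵛF (sucF (var (# 2))) (var (# 1)) (var (# 3)) (var (# 0)))))
    (λ { p (s ∷ l ∷ e ∷ []) → refutedᵛ p s l e }) λ { p (s ∷ l ∷ e ∷ []) → refutedᵛ-def p s l e }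

  closeᵛF : Fn 5
  closeᵛF = as
    (∑F (lit 4 ↑ (var (# 2) ⊗ lit n)) (deadᵛF (var (# 3)) (var (# 0)) ⊗ (lit 1 ⊖ flatᵛF (var (# 2)) (var (# 3)) (var (# 4)) (var (# 0))) ⊗
      ∑F (lit n) (sucF (distF (cellsF (var (# 0)) (var (# 4)) (var (# 1))) (nthF (lit 2 ⊕ var (# 0)) (var (# 6)))) ⊗ lit 2 ↑ var (# 2) ⊖ lit 2 ↑ var (# 4))))
    (λ { p (r ∷ l ∷ s ∷ e ∷ m ∷ []) → closeᵛ p r l s e m }) λ { p (r ∷ l ∷ s ∷ e ∷ m ∷ []) → closeᵛ-def p r l s e m }

-- Pointwise equal oracles admit the same computations, and these are deterministic.
Fn-ext : ∀ {k} (F : Fn k) {p p′} xs → p ≗ p′ → fun F p xs ≡ fun F p′ xs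
Fn-ext F {p} {p′} xs e = ⇓-det (⇓-ext e (ok F p xs)) (ok F p′ xs)

Sorts-resp : ∀ {g h q r} → g ≗ h → q ≗ r → Sorts g q → Sorts h r
Sorts-resp {g} {h} e d s n l =
  (λ lt → let (N , k) = proj₁ (s n l) (subst (_< l) (sym (d n)) lt) in N , subst (n <_) (below-cong l N (λ i _ → e i)) k) ,
  λ N k → subst (_< l) (d n) (proj₂ (s n l) N (subst (n <_) (sym (below-cong l N (λ i _ → e i))) k))

∑-shift : ∀ k f → ∑ (suc k) f ≡ f 0 + ∑ k (λ i → f (suc i))
∑-shift zero    f = sym (ℕ.+-identityʳ (f 0))
∑-shift (suc k) f = trans (cong (_+ f (suc k)) (∑-shift k f)) (ℕ.+-assoc (f 0) (∑ k (λ i → f (suc i))) (f (suc k)))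

module Tests (em : ExcludedMiddle 0ℓ) (n′ : ℕ) {p : Baire} {A : Carrier (𝒜 (Power 𝕀 (suc n′)))}
             (pA : Name (𝒜 (Power 𝕀 (suc n′))) p A) (convex : Convex A) where

  open Cube n′
  open CubeF n′
  open Flats em n′ {p} {A} pA convex

  axis-toℕ : ∀ c → toℕ (axis c) ≡ nth 0 c % n
  axis-toℕ c = Fin.toℕ-fromℕ< (m%n<n (nth 0 c) n)

  deadᵛ-local : ∀ s f g → f ~[ s * n ] g → deadᵛ p s f ≡ deadᵛ p s g
  deadᵛ-local s f g e = cong (dead p s) (code-cong s (canonical-local s (~-mono (ℕ.m≤m*n s n) e)))

  meetsᵛ-local : ∀ s c f g → f ~[ s * n ] g → meetsᵛ s c f ≡ meetsᵛ s c g
  meetsᵛ-local s c f g e = cong (λ v → (v * 2 ^ nth 2 c ∸ nth 1 c * 2 ^ s) + (nth 1 c * 2 ^ s ∸ suc v * 2 ^ nth 2 c))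
    (cells-local {f} {g} {nth 0 c % n} s (m%n<n (nth 0 c) n) e)

  flatᵛ-local : ∀ l s e f g → f ~[ s * n ] g → flatᵛ l s e f ≡ flatᵛ l s e g
  flatᵛ-local l s e f g h = ∑-cong l λ j _ → meetsᵛ-local s (nth j e) f g h

  meets-zero : ∀ s c f → Meets s c f → meetsᵛ s c f ≡ 0
  meets-zero s c f m with subst (λ i → val (strand n i f) s * 2 ^ nth 2 c ≤ nth 1 c * 2 ^ s × nth 1 c * 2 ^ s ≤ suc (val (strand n i f) s) * 2 ^ nth 2 c) (axis-toℕ c) m
  ... | a , b = cong₂ _+_ (ℕ.m≤n⇒m∸n≡0 a) (ℕ.m≤n⇒m∸n≡0 b)

  meets-zero⁻ : ∀ s c f → meetsᵛ s c f ≡ 0 → Meets s c f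
  meets-zero⁻ s c f z = subst (λ i → val (strand n i f) s * 2 ^ nth 2 c ≤ nth 1 c * 2 ^ s × nth 1 c * 2 ^ s ≤ suc (val (strand n i f) s) * 2 ^ nth 2 c) (sym (axis-toℕ c))
    (ℕ.m∸n≡0⇒m≤n (ℕ.m+n≡0⇒m≡0 _ z) , ℕ.m∸n≡0⇒m≤n (ℕ.m+n≡0⇒n≡0 (cells (nth 0 c % n) f s * 2 ^ nth 2 c ∸ nth 1 c * 2 ^ s) z))

  module _ (e : ℕ) (E : ℕ → ℕ) (l : ℕ) (e≡ : ∀ j → j < l → nth j e ≡ E j) where

    flat-zero : ∀ s f → Flat l E s f → flatᵛ l s e f ≡ 0
    flat-zero s f fl = ∑-zero l λ j j<l → meets-zero s (nth j e) f (subst (λ z → Meets s z f) (sym (e≡ j j<l)) (fl j j<l))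

    flat-zero⁻ : ∀ s f → flatᵛ l s e f ≡ 0 → Flat l E s f
    flat-zero⁻ s f z j j<l = subst (λ z → Meets s z f) (e≡ j j<l) (meets-zero⁻ s (nth j e) f (∑-zero⁻ l z j j<l))

    -- The common form of both tests: each word is dead, or off the flat, or satisfies `F`.
    guarded : ∀ s (F : Baire → ℕ) → (∀ f g → f ~[ s * n ] g → F f ≡ F g) →
              ∑ (4 ^ (s * n)) (λ W → deadᵛ p s (bits W) * (1 ∸ flatᵛ l s e (bits W)) * F (bits W)) ≡ 0 →
              ∀ f → Binary f → Alive s f → Flat l E s f → F f ≡ 0
    guarded s F local z f b al fl = pick (words-zero⁻ (s * n) (λ f → deadᵛ p s f * (1 ∸ flatᵛ l s e f) * F f)
        (λ f g h → cong₂ _*_ (cong₂ _*_ (deadᵛ-local s f g h) (cong (1 ∸_) (flatᵛ-local l s e f g h))) (local f g h)) z f b)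
      where
      pick : deadᵛ p s f * (1 ∸ flatᵛ l s e f) * F f ≡ 0 → F f ≡ 0
      pick z = [ (λ z′ → [ (λ d → contradiction (dead-sound p s (canonical f) d) al) , (λ nf → contradiction (flat-zero s f fl) (not-zero⁻ nf)) ]′
          (*-zero⁻ (deadᵛ p s f) z′)) , id ]′ (*-zero⁻ (deadᵛ p s f * (1 ∸ flatᵛ l s e f)) z)

    guarded⁻ : ∀ s (F : Baire → ℕ) → (∀ f → Binary f → Alive s f → Flat l E s f → F f ≡ 0) →
               ∑ (4 ^ (s * n)) (λ W → deadᵛ p s (bits W) * (1 ∸ flatᵛ l s e (bits W)) * F (bits W)) ≡ 0
    guarded⁻ s F h = words-zero (s * n) (λ f → deadᵛ p s f * (1 ∸ flatᵛ l s e f) * F f) λ f b → put f b em em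
      where
      put : ∀ f → Binary f → Dec (Dead p s (canonical f)) → Dec (flatᵛ l s e f ≡ 0) → deadᵛ p s f * (1 ∸ flatᵛ l s e f) * F f ≡ 0
      put f b (yes d) _        = *-zero (inj₁ (*-zero (inj₁ (dead-complete p s (canonical f) d))))
      put f b (no al) (yes fl) = *-zero {deadᵛ p s f * (1 ∸ flatᵛ l s e f)} (inj₂ (h f b al (flat-zero⁻ s f fl)))
      put f b (no _)  (no nf)  = *-zero (inj₁ (*-zero {deadᵛ p s f} (inj₂ (not-zero nf))))

  module _ (e : ℕ) (E : ℕ → ℕ) (l s : ℕ) (e≡ : ∀ j → j < suc l → nth j e ≡ E j) where

    refuted-sound : refutedᵛ p s l e ≡ 0 → Refuted s l E
    refuted-sound z with *-zero⁻ (∏ l (λ j → distance (nth 0 (nth j e) % n) (nth 0 (nth l e) % n))) (trans (refutedᵛ-def p s l e) z)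
    ... | inj₁ z′ = let (j , j<l , d) = ∏-zero⁻ l z′ in inj₁ (j , j<l , Fin.toℕ-injective (trans (axis-toℕ (E j))
          (trans (cong (λ c → nth 0 c % n) (sym (e≡ j (ℕ.m<n⇒m<1+n j<l)))) (trans (distance-zero⁻ _ _ d)
          (trans (cong (λ c → nth 0 c % n) (e≡ l ℕ.≤-refl)) (sym (axis-toℕ (E l))))))))
    ... | inj₂ z′ = inj₂ λ f b al fl → contradiction
          (guarded e E (suc l) e≡ s (λ _ → 1) (λ _ _ _ → refl)
            (trans (∑-cong (4 ^ (s * n)) λ W _ → ℕ.*-identityʳ _) z′) f b al fl) λ ()

    refuted-complete : Refuted s l E → refutedᵛ p s l e ≡ 0
    refuted-complete (inj₁ (j , j<l , a)) = trans (sym (refutedᵛ-def p s l e)) (*-zero (inj₁ (∏-zero l j j<l (distance-zero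
      (trans (cong (λ c → nth 0 c % n) (e≡ j (ℕ.m<n⇒m<1+n j<l))) (trans (sym (axis-toℕ (E j))) (trans (cong toℕ a)
        (trans (axis-toℕ (E l)) (cong (λ c → nth 0 c % n) (sym (e≡ l ℕ.≤-refl)))))))))))
    refuted-complete (inj₂ h) = trans (sym (refutedᵛ-def p s l e)) (*-zero {∏ l (λ j → distance (nth 0 (nth j e) % n) (nth 0 (nth l e) % n))} (inj₂
      (trans (sym (∑-cong (4 ^ (s * n)) λ W _ → ℕ.*-identityʳ _))
        (guarded⁻ e E (suc l) e≡ s (λ _ → 1) λ f b al fl → ⊥-elim (h f b al fl)))))

  closeness : ℕ → ℕ → ℕ → Baire → ℕ
  closeness r s m f = ∑ n λ i → suc (distance (cells i f s) (nth (2 + i) m)) * 2 ^ r ∸ 2 ^ s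

  closeness-local : ∀ r s m f g → f ~[ s * n ] g → closeness r s m f ≡ closeness r s m g
  closeness-local r s m f g h = ∑-cong n λ i i<n →
    cong (λ v → suc (distance v (nth (2 + i) m)) * 2 ^ r ∸ 2 ^ s) (cells-local {f} {g} {i} s i<n h)

-- Reduction of convex choice to sorting

module Printer (n′ : ℕ) where

  open Cube n′
  open CubeF n′

  -- The counters of the levels, which are at the same time the codes of the current hyperplanes.
  levels : ℕ → ℕ → ℕ
  levels s h = code (applyUpTo (λ j → below (λ i → nth i h) (suc j) s) n)

  letter : Baire → ℕ → ℕ → ℕ
  letter p s h = first n λ l → refutedᵛ p s l (levels s h)

  -- The letters printed before stage s, latest first.
  history : Baire → ℕ → ℕ
  history p s = natrec 0 (λ s h → cons (letter p s h) h) s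

  printed : Baire → Baire
  printed p s = letter p s (history p s)

  letterF : ∀ {k} → Fn k → Fn k → Fn k
  letterF s h = call (as (firstF (lit n) (call refutedᵛF (var (# 1) ∷ var (# 0) ∷
      takeF (lit n) (∑F (var (# 2)) (lit 1 ⊖ (sucF (nthF (var (# 0)) (var (# 4))) ⊖ sucF (var (# 1))))) ∷ [])))
    (λ { p (s ∷ h ∷ []) → letter p s h }) λ { p (s ∷ h ∷ []) → refl }) (s ∷ h ∷ [])

  printedF : Fn 1
  printedF = as (letterF (var (# 0)) (call (prim (lit 0) (consF (letterF (var (# 0)) (var (# 1))) (var (# 1)))) (var (# 0) ∷ [])))
    (λ { p (s ∷ []) → printed p s }) λ { p (s ∷ []) → refl }

  history-below : ∀ p l s → below (λ i → nth i (history p s)) l s ≡ below (printed p) l s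
  history-below p l zero    = refl
  history-below p l (suc s) = trans (∑-shift s (λ i → below? (nth i (history p (suc s))) l))
    (trans (cong₂ _+_ (cong (λ x → below? x l) (hd-cons (printed p s) (history p s)))
      (trans (below-cong l s λ i _ → cong hd (drops-cons i (printed p s) (history p s))) (history-below p l s)))
      (ℕ.+-comm (below? (printed p s) l) (below (printed p) l s)))

  levels-nth : ∀ p s j → j < n → nth j (levels s (history p s)) ≡ below (printed p) (suc j) s
  levels-nth p s j j<n = trans (nth-code (λ j → below (λ i → nth i (history p s)) (suc j) s) j j<n) (history-below p (suc j) s)

  -- `m` lists a place of the sorted sequence, a stage, and one candidate numerator for each
  -- coordinate.
  check : Baire → ℕ → ℕ → ℕ
  check u m r = closeᵛ (evens u) r (odds u (nth 0 m)) (nth 1 m)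
    (code (applyUpTo (λ j → below (odds u) (suc j) (nth 0 m)) n)) m

  levels′F : Fn 2
  levels′F = as (takeF (lit n) countF) (λ { u (m ∷ r ∷ []) → code (applyUpTo (λ j → below (odds u) (suc j) (nth 0 m)) n) })
    λ { u (m ∷ r ∷ []) → refl }
    where
    countF : Fn 3
    countF = as (∑F (nthF (lit 0) (var (# 1))) (lit 1 ⊖ (sucF (call oddsF (var (# 0) ∷ [])) ⊖ sucF (var (# 1)))))
      (λ { u (j ∷ m ∷ r ∷ []) → below (odds u) (suc j) (nth 0 m) }) λ { u (j ∷ m ∷ r ∷ []) → refl }

  checkF : Fn 2
  checkF = as (call (rel-to evensF closeᵛF) (var (# 1) ∷ call oddsF (nthF (lit 0) (var (# 0)) ∷ []) ∷ nthF (lit 1) (var (# 0)) ∷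
    levels′F ∷ var (# 0) ∷ []))
    (λ { u (m ∷ r ∷ []) → check u m r }) λ { u (m ∷ r ∷ []) → refl }

  closeᵛ-ext : ∀ {p p′} → p ≗ p′ → ∀ r l s e m → closeᵛ p r l s e m ≡ closeᵛ p′ r l s e m
  closeᵛ-ext p≗ r l s e m = Fn-ext closeᵛF (r ∷ l ∷ s ∷ e ∷ m ∷ []) p≗

  outputF : Fn 2
  outputF = as (selectF (quotF (var (# 0))) (nthF (lit 2 ⊕ remF (var (# 0))) (var (# 1))) (lit 2 ↑ nthF (lit 1) (var (# 1)) ⊖ lit 1))
    (λ { _ (N ∷ m ∷ []) → select (N / n) (nth (2 + N % n) m) (2 ^ nth 1 m ∸ 1) }) λ { _ (N ∷ m ∷ []) → refl }

  precisionF : Fn 1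
  precisionF = as (halfF (quotF (var (# 0)))) (λ { _ (N ∷ []) → half (N / n) }) λ { _ (N ∷ []) → refl }

  -- Numerator and denominator of the `r`-th approximation, for all coordinates, come from one and
  -- the same search at precision `r`.
  answerF : Rec 1
  answerF = comp (prog outputF) (proj (# 0) ∷ comp (search checkF (var (# 0))) (prog precisionF ∷ []) ∷ [])

module _ (em : ExcludedMiddle 0ℓ) (n′ k : ℕ) (n≤k : suc n′ ≤ k) where

  open Cube n′
  open CubeF n′
  open Printer n′

  private
    module _ (p : Baire) (A : Carrier (𝒜 (Power 𝕀 n))) (pA : Name (𝒜 (Power 𝕀 n)) p A) (convex : Convex A)
             (inhabited : ∃ λ x → _∈_ {Power 𝕀 n} x A) where

      open Flats em n′ {p} {A} pA convex
      open Tests em n′ {p} {A} pA convex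

      g : Baire
      g = printed p

      E : ℕ → ℕ → ℕ
      E s j = below g (suc j) s

      levels≡ : ∀ s l → l < n → ∀ j → j < suc l → nth j (levels s (history p s)) ≡ E s j
      levels≡ s l l<n j j≤l = levels-nth p s j (ℕ.<-≤-trans j≤l l<n)

      spec : ∀ s → (g s ≡ n ⊎ (g s < n × refutedᵛ p s (g s) (levels s (history p s)) ≡ 0)) ×
                   (∀ l → l < g s → refutedᵛ p s l (levels s (history p s)) ≢ 0)
      spec s = first-spec n (λ l → refutedᵛ p s l (levels s (history p s)))

      g≤n : ∀ s → g s ≤ n
      g≤n s = [ ℕ.≤-reflexive , (λ (lt , _) → ℕ.<⇒≤ lt) ]′ (proj₁ (spec s))

      fires : ∀ s → g s < n → Refuted s (g s) (E s)
      fires s gs<n = case (proj₁ (spec s))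
        where
        case : (g s ≡ n ⊎ (g s < n × refutedᵛ p s (g s) (levels s (history p s)) ≡ 0)) → Refuted s (g s) (E s)
        case (inj₁ e)       = contradiction gs<n (ℕ.<-irrefl e)
        case (inj₂ (_ , z)) = refuted-sound (levels s (history p s)) (E s) (g s) s (levels≡ s (g s) gs<n) z

      holds : ∀ s l → l < g s → ¬ Refuted s l (E s)
      holds s l l<gs r = proj₂ (spec s) l l<gs
        (refuted-complete (levels s (history p s)) (E s) l s (levels≡ s l (ℕ.<-≤-trans l<gs (g≤n s))) r)

      open Process g g≤n fires holds inhabited

      module _ (q : Baire) (srt : Sorts g q) where

        u : Baire
        u = ⟨ p , q ⟩

        q′ : Baire
        q′ = odds u

        srt′ : Sorts g q′
        srt′ = Sorts-resp (λ _ → refl) (λ i → sym (⟨⟩-odd p q i)) srt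

        levels′ : ℕ → ℕ
        levels′ t = code (applyUpTo (λ j → below q′ (suc j) t) n)

        check≡ : ∀ m r → check u m r ≡ closeᵛ p r (q′ (nth 0 m)) (nth 1 m) (levels′ (nth 0 m)) m
        check≡ m r = closeᵛ-ext (⟨⟩-even p q) r (q′ (nth 0 m)) (nth 1 m) (levels′ (nth 0 m)) m

        levels′≡ : ∀ t j → j < q′ t → nth j (levels′ t) ≡ below q′ (suc j) t
        levels′≡ t j j<q = nth-code (λ j → below q′ (suc j) t) j (ℕ.<-≤-trans j<q (ℕ.≤-trans (q≤m srt′ t) m≤n))

        found : ∀ r → ∃ λ m → check u m r ≡ 0
        found r =
          let (t , s , b , close) = close-complete srt′ r
              M : ℕ → ℕ
              M = λ { 0 → t ; 1 → s ; (suc (suc i)) → b i }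
              m = code (applyUpTo M (2 + n))
              nth≡ : ∀ i → i < 2 + n → nth i m ≡ M i
              nth≡ = nth-code M
          in m , trans (check≡ m r) (encode r t s b close m (nth≡ 0 (s≤s z≤n)) (nth≡ 1 (s≤s (s≤s z≤n))) λ i i<n → nth≡ (2 + i) (s≤s (s≤s i<n)))
          where
          encode : ∀ r t s b → Close srt′ r t s b → ∀ m → nth 0 m ≡ t → nth 1 m ≡ s → (∀ i → i < n → nth (2 + i) m ≡ b i) →
                   closeᵛ p r (q′ (nth 0 m)) (nth 1 m) (levels′ (nth 0 m)) m ≡ 0
          encode r t s b close m refl refl b≡ = trans (sym (closeᵛ-def p r (q′ t) s (levels′ t) m)) (guarded⁻ (levels′ t) (λ j → below q′ (suc j) t) (q′ t) (levels′≡ t) s (closeness r s m)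
            λ f bf al fl → ∑-zero n λ i i<n → ℕ.m≤n⇒m∸n≡0
              (subst (λ z → suc (distance (cells i f s) z) * 2 ^ r ≤ 2 ^ s) (sym (b≡ i i<n)) (close f bf al fl i i<n)))

        opaque
          searched : ∀ r → ∃ λ m → check u m r ≡ 0 × u ⊨ search checkF (var (# 0)) [ r ∷ [] ]⇓ m
          searched r = search-⇓ checkF (var (# 0)) u (r ∷ []) (found r)

        result : ℕ → ℕ
        result r = proj₁ (searched r)

        output : Baire
        output N = fun outputF u (N ∷ result (half (N / n)) ∷ [])

        output-⇓ : ∀ N → u ⊨ answerF [ N ∷ [] ]⇓ output N
        output-⇓ N = comp (proj ∷ comp (ok precisionF u (N ∷ []) ∷ []) (proj₂ (proj₂ (searched (half (N / n))))) ∷ []) (ok outputF u _)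

        close-result : ∀ r → Close srt′ r (nth 0 (result r)) (nth 1 (result r)) (λ i → nth (2 + i) (result r))
        close-result r f bf al fl i i<n = ℕ.m∸n≡0⇒m≤n (∑-zero⁻ n
          (guarded (levels′ (nth 0 (result r))) (λ j → below q′ (suc j) (nth 0 (result r))) (q′ (nth 0 (result r))) (levels′≡ (nth 0 (result r)))
            (nth 1 (result r)) (closeness r (nth 1 (result r)) (result r)) (closeness-local r (nth 1 (result r)) (result r))
            (trans (closeᵛ-def p r (q′ (nth 0 (result r))) (nth 1 (result r)) (levels′ (nth 0 (result r))) (result r))
              (trans (sym (check≡ (result r) r)) (proj₁ (proj₂ (searched r))))) f bf al fl) i i<n)

        output-at : ∀ i r → i < n → output (i + (2 * r) * n) ≡ nth (2 + i) (result r) ×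
                                    output (i + suc (2 * r) * n) ≡ pred (2 ^ nth 1 (result r))
        output-at i r i<n =
          trans (entry (2 * r)) (trans (cong (λ h → select (2 * r) (nth (2 + i) (result h)) (2 ^ nth 1 (result h) ∸ 1)) (half-unique (2 * r) r (inj₁ refl))) (select-even r _ _)) ,
          trans (entry (suc (2 * r))) (trans (cong (λ h → select (suc (2 * r)) (nth (2 + i) (result h)) (2 ^ nth 1 (result h) ∸ 1)) (half-unique (suc (2 * r)) r (inj₂ refl)))
            (trans (select-odd r _ _) (sym (ℕ.pred[m∸n]≡m∸[1+n] (2 ^ nth 1 (result r)) 0))))
          where
          entry : ∀ N → output (i + N * n) ≡ select N (nth (2 + i) (result (half N))) (2 ^ nth 1 (result (half N)) ∸ 1)
          entry N = let (e , d) = quot-rem i N i<n in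
            cong₂ (λ i N → select N (nth (2 + i) (result (half N))) (2 ^ nth 1 (result (half N)) ∸ 1)) e d

        output-names : Name (Power 𝕀 n) output (solution srt′)
        output-names i r = subst (λ z → (λ k → ∣ z -ℚ seq (solution srt′ i) k ∣) ≲ const (2^- r)) (sym ratio≡)
          (close-sound srt′ r (nth 0 (result r)) (nth 1 (result r)) (λ i → nth (2 + i) (result r)) (close-result r) i)
          where
          at-r = output-at (toℕ i) r (Fin.toℕ<n i)
          ratio≡ : ratio (component i output) r ≡ nth (2 + toℕ i) (result r) /2^ nth 1 (result r)
          ratio≡ = trans (ℚ./-cong (cong ℤ.+_ (proj₁ at-r)) (cong suc (proj₂ at-r))) (/2^-/ (nth (2 + toℕ i) (result r)) (nth 1 (result r)))

        outcome : ∃ λ o → (∀ N → u ⊨ answerF [ N ∷ [] ]⇓ o N) × ∃ λ y → Name (Power 𝕀 n) o y × Convex A × _∈_ {Power 𝕀 n} y A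
        outcome = output , output-⇓ , solution srt′ , output-names , convex , solution∈A srt′

  XC≤Sort : XC n ≤W Sort (k + 1)
  XC≤Sort = computes (prog printedF) , computes answerF , computes-computable (prog printedF) , computes-computable answerF ,
    λ G G⊢ p A pA (x , convex , x∈A) →
      -- The letters run from 0 to `n`, which fits into `k + 1` symbols as `n ≤ k`.
      let g<  : ∀ s → printed p s < k + 1
          g< s = ℕ.≤-<-trans (ℕ.≤-trans (g≤n p A pA convex (x , x∈A) s) n≤k) (ℕ.≤-reflexive (ℕ.+-comm 1 k))
          y = toSeq (printed p) g<
          y≡ : ∀ s → printed p s ≡ toℕ (y s)
          y≡ s = sym (Fin.toℕ-fromℕ< (g< s))
          (q , g↦q , z , qz , srt) = G⊢ (printed p) y y≡ (Sort-total em y)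
          (o , o-ok , w , ow , cw , w∈A) = outcome p A pA convex (x , x∈A) q
            (Sorts-resp (λ s → sym (y≡ s)) (λ s → sym (qz s)) (Sort-sorts y z srt))
      in o , (⟨ p , q ⟩ , (q , (printed p , (λ s → ok printedF p (s ∷ [])) , g↦q) , λ _ → refl) , o-ok) , w , ow , cw , w∈A

-- Polynomials with rational coefficients

sumℚ : ℕ → (ℕ → ℚ) → ℚ
sumℚ zero    f = 0ℚ
sumℚ (suc m) f = sumℚ m f +ℚ f m

sum-cong : ∀ m {f g} → (∀ k → k < m → f k ≡ g k) → sumℚ m f ≡ sumℚ m g
sum-cong zero    h = refl
sum-cong (suc m) h = cong₂ _+ℚ_ (sum-cong m (λ k k<m → h k (ℕ.m<n⇒m<1+n k<m))) (h m ℕ.≤-refl)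

sum-mono : ∀ m {f g} → (∀ k → k < m → f k ≤ℚ g k) → sumℚ m f ≤ℚ sumℚ m g
sum-mono zero    h = ℚ.≤-refl
sum-mono (suc m) h = ℚ.+-mono-≤ (sum-mono m (λ k k<m → h k (ℕ.m<n⇒m<1+n k<m))) (h m ℕ.≤-refl)

sum-nonneg : ∀ m {f} → (∀ k → 0ℚ ≤ℚ f k) → 0ℚ ≤ℚ sumℚ m f
sum-nonneg zero    h = ℚ.≤-refl
sum-nonneg (suc m) h = 0≤-+ (sum-nonneg m h) (h m)

sum-linear : ∀ m a b f g → sumℚ m (λ k → a *ℚ f k +ℚ b *ℚ g k) ≡ a *ℚ sumℚ m f +ℚ b *ℚ sumℚ m g
sum-linear zero    a b f g = lemma a b
  where
  lemma : ∀ a b → 0ℚ ≡ a *ℚ 0ℚ +ℚ b *ℚ 0ℚ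
  lemma = ring-∀ ℚ-ring
sum-linear (suc m) a b f g = trans (cong (_+ℚ (a *ℚ f m +ℚ b *ℚ g m)) (sum-linear m a b f g)) (lemma a b (sumℚ m f) (sumℚ m g) (f m) (g m))
  where
  lemma : ∀ a b F G x y → (a *ℚ F +ℚ b *ℚ G) +ℚ (a *ℚ x +ℚ b *ℚ y) ≡ a *ℚ (F +ℚ x) +ℚ b *ℚ (G +ℚ y)
  lemma = ring-∀ ℚ-ring

sum-scale : ∀ m a f → sumℚ m (λ k → a *ℚ f k) ≡ a *ℚ sumℚ m f
sum-scale zero    a f = sym (ℚ.*-zeroʳ a)
sum-scale (suc m) a f = trans (cong (_+ℚ a *ℚ f m) (sum-scale m a f)) (sym (ℚ.*-distribˡ-+ a (sumℚ m f) (f m)))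

sum-∣∣ : ∀ m f → ∣ sumℚ m f ∣ ≤ℚ sumℚ m (λ k → ∣ f k ∣)
sum-∣∣ zero    f = ℚ.≤-refl
sum-∣∣ (suc m) f = ℚ.≤-trans (ℚ.∣p+q∣≤∣p∣+∣q∣ (sumℚ m f) (f m)) (ℚ.+-monoˡ-≤ ∣ f m ∣ (sum-∣∣ m f))

-- The polynomial `P` with the powers of its variable replaced by the entries of `Y`.
L : ℕ → (ℕ → ℚ) → (ℕ → ℚ) → ℚ
L m P Y = sumℚ m (λ k → P k *ℚ Y k)

L-linear : ∀ m a b P Q Y → L m (λ k → a *ℚ P k +ℚ b *ℚ Q k) Y ≡ a *ℚ L m P Y +ℚ b *ℚ L m Q Y
L-linear m a b P Q Y = trans (sum-cong m λ k _ → lemma a b (P k) (Q k) (Y k)) (sum-linear m a b (λ k → P k *ℚ Y k) (λ k → Q k *ℚ Y k))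
  where
  lemma : ∀ a b p q y → (a *ℚ p +ℚ b *ℚ q) *ℚ y ≡ a *ℚ (p *ℚ y) +ℚ b *ℚ (q *ℚ y)
  lemma = ring-∀ ℚ-ring

norm : ℕ → (ℕ → ℚ) → ℚ
norm m P = sumℚ m (λ k → ∣ P k ∣)

0≤norm : ∀ m P → 0ℚ ≤ℚ norm m P
0≤norm m P = sum-nonneg m λ k → ℚ.0≤∣p∣ (P k)

L-bound : ∀ m P Y B → (∀ k → k < m → ∣ Y k ∣ ≤ℚ B) → ∣ L m P Y ∣ ≤ℚ norm m P *ℚ B
L-bound m P Y B h = ℚ.≤-trans (sum-∣∣ m (λ k → P k *ℚ Y k)) (ℚ.≤-trans (sum-mono m λ k k<m → ℚ.≤-trans
    (ℚ.≤-reflexive (trans (ℚ.∣p*q∣≡∣p∣*∣q∣ (P k) (Y k)) (ℚ.*-comm ∣ P k ∣ ∣ Y k ∣))) (*-mono-≤ ∣ P k ∣ (ℚ.0≤∣p∣ (P k)) (h k k<m)))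
  (ℚ.≤-reflexive (trans (sum-scale m B (λ k → ∣ P k ∣)) (ℚ.*-comm B (norm m P)))))

norm-combine : ∀ m a b P Q → norm m (λ k → a *ℚ P k +ℚ b *ℚ Q k) ≤ℚ ∣ a ∣ *ℚ norm m P +ℚ ∣ b ∣ *ℚ norm m Q
norm-combine m a b P Q = ℚ.≤-trans (sum-mono m λ k _ → ℚ.≤-trans (ℚ.∣p+q∣≤∣p∣+∣q∣ (a *ℚ P k) (b *ℚ Q k))
    (ℚ.≤-reflexive (cong₂ _+ℚ_ (ℚ.∣p*q∣≡∣p∣*∣q∣ a (P k)) (ℚ.∣p*q∣≡∣p∣*∣q∣ b (Q k)))))
  (ℚ.≤-reflexive (sum-linear m ∣ a ∣ ∣ b ∣ (λ k → ∣ P k ∣) (λ k → ∣ Q k ∣)))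

pow : ℚ → ℕ → ℚ
pow x zero    = 1ℚ
pow x (suc k) = x *ℚ pow x k

pow-unit : ∀ {x} k → 0ℚ ≤ℚ x → x ≤ℚ 1ℚ → 0ℚ ≤ℚ pow x k × pow x k ≤ℚ 1ℚ
pow-unit zero    _   _   = ℚ.nonNegative⁻¹ 1ℚ , ℚ.≤-refl
pow-unit {x} (suc k) 0≤x x≤1 = let (a , b) = pow-unit k 0≤x x≤1 in
  0≤-* 0≤x a , by-gap _ (0≤-+ (gap x≤1) (0≤-* 0≤x (gap b))) (lemma x (pow x k))
  where
  lemma : ∀ x y → 1ℚ ≡ x *ℚ y +ℚ ((1ℚ -ℚ x) +ℚ x *ℚ (1ℚ -ℚ y))
  lemma = ring-∀ ℚ-ring

pow-mono : ∀ {x y} k → 0ℚ ≤ℚ x → x ≤ℚ y → pow x k ≤ℚ pow y k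
pow-mono zero    _   _   = ℚ.≤-refl
pow-mono {x} {y} (suc k) 0≤x x≤y = by-gap _ (0≤-+ (0≤-* (gap x≤y) (ℚ.≤-trans (nonneg k) (pow-mono k 0≤x x≤y))) (0≤-* 0≤x (gap (pow-mono k 0≤x x≤y))))
  (lemma x y (pow x k) (pow y k))
  where
  nonneg : ∀ k → 0ℚ ≤ℚ pow x k
  nonneg zero    = ℚ.nonNegative⁻¹ 1ℚ
  nonneg (suc k) = 0≤-* 0≤x (nonneg k)
  lemma : ∀ x y p q → y *ℚ q ≡ x *ℚ p +ℚ ((y -ℚ x) *ℚ q +ℚ x *ℚ (q -ℚ p))
  lemma = ring-∀ ℚ-ring

pow-lipschitz : ∀ {x u} k → 0ℚ ≤ℚ x → x ≤ℚ 1ℚ → 0ℚ ≤ℚ u → u ≤ℚ 1ℚ → ∣ pow x k -ℚ pow u k ∣ ≤ℚ ι k *ℚ ∣ x -ℚ u ∣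
pow-lipschitz {x} {u} zero _ _ _ _ = ℚ.≤-reflexive (trans (cong ∣_∣ (ℚ.+-inverseʳ 1ℚ)) (sym (trans (cong (_*ℚ ∣ x -ℚ u ∣) ι-0) (ℚ.*-zeroˡ ∣ x -ℚ u ∣))))
pow-lipschitz {x} {u} (suc k) 0≤x x≤1 0≤u u≤1 =
  ℚ.≤-trans (ℚ.≤-reflexive (cong ∣_∣ (lemma x u (pow x k) (pow u k))))
  (ℚ.≤-trans (ℚ.∣p+q∣≤∣p∣+∣q∣ (pow x k *ℚ (x -ℚ u)) (u *ℚ (pow x k -ℚ pow u k)))
  (ℚ.≤-trans (ℚ.+-mono-≤ (∣*∣≤ {pow x k} (ℚ.0≤∣p∣ (x -ℚ u)) (unit-∣∣ a b) ℚ.≤-refl)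
      (∣*∣≤ {u} (ℚ.≤-trans (ℚ.0≤∣p∣ (pow x k -ℚ pow u k)) ih) (unit-∣∣ 0≤u u≤1) ih))
    (ℚ.≤-reflexive (trans (lemma′ (ι k) ∣ x -ℚ u ∣) (cong (_*ℚ ∣ x -ℚ u ∣) (sym (ι-suc k)))))))
  where
  a = proj₁ (pow-unit k 0≤x x≤1)
  b = proj₂ (pow-unit k 0≤x x≤1)
  ih = pow-lipschitz k 0≤x x≤1 0≤u u≤1
  lemma : ∀ x u p q → x *ℚ p -ℚ u *ℚ q ≡ p *ℚ (x -ℚ u) +ℚ u *ℚ (p -ℚ q)
  lemma = ring-∀ ℚ-ring
  lemma′ : ∀ k d → d +ℚ k *ℚ d ≡ (1ℚ +ℚ k) *ℚ d
  lemma′ = ring-∀ ℚ-ring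

ev : ℕ → (ℕ → ℚ) → ℚ → ℚ
ev n P x = L (suc n) P (pow x)

ev-lipschitz : ∀ n P {x u} → 0ℚ ≤ℚ x → x ≤ℚ 1ℚ → 0ℚ ≤ℚ u → u ≤ℚ 1ℚ → ∣ ev n P x -ℚ ev n P u ∣ ≤ℚ norm (suc n) P *ℚ (ι n *ℚ ∣ x -ℚ u ∣)
ev-lipschitz n P {x} {u} 0≤x x≤1 0≤u u≤1 = ℚ.≤-trans
  (ℚ.≤-reflexive (cong ∣_∣ (trans (lemma₁ (ev n P x) (ev n P u)) (trans (sym (sum-linear (suc n) 1ℚ (-ℚ 1ℚ) (λ k → P k *ℚ pow x k) (λ k → P k *ℚ pow u k)))
    (sum-cong (suc n) λ k _ → lemma₂ (P k) (pow x k) (pow u k))))))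
  (L-bound (suc n) P (λ k → pow x k -ℚ pow u k) (ι n *ℚ ∣ x -ℚ u ∣) λ k k≤n →
    ℚ.≤-trans (pow-lipschitz k 0≤x x≤1 0≤u u≤1) (*-mono-≤ ∣ x -ℚ u ∣ (ℚ.0≤∣p∣ (x -ℚ u)) (ι-mono (s≤s⁻¹ k≤n))))
  where
  lemma₁ : ∀ a b → a -ℚ b ≡ 1ℚ *ℚ a +ℚ (-ℚ 1ℚ) *ℚ b
  lemma₁ = ring-∀ ℚ-ring
  lemma₂ : ∀ p a b → 1ℚ *ℚ (p *ℚ a) +ℚ (-ℚ 1ℚ) *ℚ (p *ℚ b) ≡ p *ℚ (a -ℚ b)
  lemma₂ = ring-∀ ℚ-ring

ev-bound : ∀ n P {x} → 0ℚ ≤ℚ x → x ≤ℚ 1ℚ → ∣ ev n P x ∣ ≤ℚ norm (suc n) P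
ev-bound n P {x} 0≤x x≤1 = ℚ.≤-trans (L-bound (suc n) P (pow x) 1ℚ λ k _ → let (a , b) = pow-unit k 0≤x x≤1 in unit-∣∣ a b)
  (ℚ.≤-reflexive (ℚ.*-identityʳ (norm (suc n) P)))

-- Multiplication of a polynomial by `x - u`.
shift-sub : ℚ → (ℕ → ℚ) → ℕ → ℚ
shift-sub u P zero    = -ℚ (u *ℚ P 0)
shift-sub u P (suc k) = P k -ℚ u *ℚ P (suc k)

monic : List ℚ → ℕ → ℚ
monic []       zero    = 1ℚ
monic []       (suc k) = 0ℚ
monic (u ∷ us)         = shift-sub u (monic us)

monic-degree : ∀ us k → List.length us < k → monic us k ≡ 0ℚ
monic-degree []       (suc k) _         = refl
monic-degree (u ∷ us) (suc k) (s≤s len<k) = trans (cong₂ (λ a b → a -ℚ u *ℚ b) (monic-degree us k len<k) (monic-degree us (suc k) (ℕ.m<n⇒m<1+n len<k))) (lemma u)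
  where
  lemma : ∀ u → 0ℚ -ℚ u *ℚ 0ℚ ≡ 0ℚ
  lemma = ring-∀ ℚ-ring

product : List ℚ → ℚ → ℚ
product []       x = 1ℚ
product (u ∷ us) x = (x -ℚ u) *ℚ product us x

-- Cutting off at degree `m` loses the leading term of the product, which is added back on the left;
-- for `monic` it vanishes by `monic-degree`.
ev-shift-sub : ∀ m u P x → ev m (shift-sub u P) x +ℚ P m *ℚ pow x (suc m) ≡ (x -ℚ u) *ℚ ev m P x
ev-shift-sub zero u P x = lemma u (P 0) x
  where
  lemma : ∀ u p x → (0ℚ +ℚ (-ℚ (u *ℚ p)) *ℚ 1ℚ) +ℚ p *ℚ (x *ℚ 1ℚ) ≡ (x -ℚ u) *ℚ (0ℚ +ℚ p *ℚ 1ℚ)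
  lemma = ring-∀ ℚ-ring
ev-shift-sub (suc m) u P x = trans (lemma₁ (ev m (shift-sub u P) x) u (P m) (P (suc m)) x (pow x m))
  (trans (cong (_+ℚ (P (suc m) *ℚ (x *ℚ (x *ℚ pow x m)) -ℚ u *ℚ P (suc m) *ℚ (x *ℚ pow x m))) (ev-shift-sub m u P x)) (lemma₂ (ev m P x) u (P (suc m)) x (pow x m)))
  where
  lemma₁ : ∀ e u p q x y → (e +ℚ (p -ℚ u *ℚ q) *ℚ (x *ℚ y)) +ℚ q *ℚ (x *ℚ (x *ℚ y)) ≡
           (e +ℚ p *ℚ (x *ℚ y)) +ℚ (q *ℚ (x *ℚ (x *ℚ y)) -ℚ u *ℚ q *ℚ (x *ℚ y))
  lemma₁ = ring-∀ ℚ-ring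
  lemma₂ : ∀ e u q x y → (x -ℚ u) *ℚ e +ℚ (q *ℚ (x *ℚ (x *ℚ y)) -ℚ u *ℚ q *ℚ (x *ℚ y)) ≡ (x -ℚ u) *ℚ (e +ℚ q *ℚ (x *ℚ y))
  lemma₂ = ring-∀ ℚ-ring

ev-monic : ∀ n us x → List.length us ≤ n → ev n (monic us) x ≡ product us x
ev-monic n [] x _ = one n
  where
  one : ∀ n → ev n (monic []) x ≡ 1ℚ
  one zero    = refl
  one (suc n) = trans (cong₂ _+ℚ_ (one n) (ℚ.*-zeroˡ (pow x (suc n)))) (ℚ.+-identityʳ 1ℚ)
ev-monic n (u ∷ us) x len≤n = trans (lemma (ev n (monic (u ∷ us)) x) (pow x (suc n)))
  (trans (cong (λ z → ev n (monic (u ∷ us)) x +ℚ z *ℚ pow x (suc n)) (sym (monic-degree us n len≤n)))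
    (trans (ev-shift-sub n u (monic us) x) (cong ((x -ℚ u) *ℚ_) (ev-monic n us x (ℕ.<⇒≤ len≤n)))))
  where
  lemma : ∀ a b → a ≡ a +ℚ 0ℚ *ℚ b
  lemma = ring-∀ ℚ-ring

norm-shift-sub : ∀ m u P → 0ℚ ≤ℚ u → u ≤ℚ 1ℚ → norm (suc m) (shift-sub u P) ≤ℚ norm m P +ℚ norm (suc m) P
norm-shift-sub zero u P 0≤u u≤1 = ℚ.+-monoʳ-≤ 0ℚ (ℚ.≤-trans
  (ℚ.≤-trans (ℚ.≤-reflexive (ℚ.∣-p∣≡∣p∣ (u *ℚ P 0))) (∣*∣≤ {u} (ℚ.0≤∣p∣ (P 0)) (unit-∣∣ 0≤u u≤1) ℚ.≤-refl)) (ℚ.≤-reflexive (sym (ℚ.+-identityˡ ∣ P 0 ∣))))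
norm-shift-sub (suc m) u P 0≤u u≤1 = ℚ.≤-trans (ℚ.+-mono-≤ (norm-shift-sub m u P 0≤u u≤1)
    (ℚ.≤-trans (ℚ.∣p+q∣≤∣p∣+∣q∣ (P m) (-ℚ (u *ℚ P (suc m)))) (ℚ.+-monoʳ-≤ ∣ P m ∣
      (ℚ.≤-trans (ℚ.≤-reflexive (ℚ.∣-p∣≡∣p∣ (u *ℚ P (suc m)))) (∣*∣≤ {u} (ℚ.0≤∣p∣ (P (suc m))) (unit-∣∣ 0≤u u≤1) ℚ.≤-refl)))))
  (ℚ.≤-reflexive (lemma (norm m P) ∣ P m ∣ ∣ P (suc m) ∣))
  where
  lemma : ∀ a p q → (a +ℚ (a +ℚ p)) +ℚ (p +ℚ q) ≡ (a +ℚ p) +ℚ (a +ℚ p +ℚ q)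
  lemma = ring-∀ ℚ-ring

-- A factor `x - u` with `u` in the unit interval at most doubles the sum of the absolute
-- coefficients.
norm-monic : ∀ n us → All (λ u → 0ℚ ≤ℚ u × u ≤ℚ 1ℚ) us → norm (suc n) (monic us) ≤ℚ ι (2 ^ List.length us)
norm-monic n [] [] = ℚ.≤-reflexive (trans (one n) (sym ι-1))
  where
  one : ∀ n → norm (suc n) (monic []) ≡ 1ℚ
  one zero    = refl
  one (suc n) = trans (ℚ.+-identityʳ _) (one n)
norm-monic n (u ∷ us) ((0≤u , u≤1) ∷ hs) = ℚ.≤-trans (norm-shift-sub n u (monic us) 0≤u u≤1) (ℚ.≤-trans
  (ℚ.+-mono-≤ (ℚ.≤-trans (by-gap {norm n (monic us)} ∣ monic us n ∣ (ℚ.0≤∣p∣ (monic us n)) refl) (norm-monic n us hs)) (norm-monic n us hs))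
  (ℚ.≤-reflexive (sym (ι-2* (2 ^ List.length us)))))

product-zero : ∀ us x → x ∈ᴸ us → product us x ≡ 0ℚ
product-zero (u ∷ us) .u (here refl) = trans (cong (_*ℚ product us u) (ℚ.+-inverseʳ u)) (ℚ.*-zeroˡ (product us u))
product-zero (u ∷ us) x (there x∈) = trans (cong ((x -ℚ u) *ℚ_) (product-zero us x x∈)) (ℚ.*-zeroʳ (x -ℚ u))

product-bound : ∀ us x δ → 0ℚ ≤ℚ δ → All (λ u → δ ≤ℚ ∣ x -ℚ u ∣) us → pow δ (List.length us) ≤ℚ ∣ product us x ∣
product-bound [] x δ _ [] = ℚ.≤-refl
product-bound (u ∷ us) x δ 0≤δ (h ∷ hs) = ℚ.≤-trans
  (by-gap _ (0≤-+ (0≤-* 0≤δ (gap ih)) (0≤-* (gap h) (ℚ.0≤∣p∣ (product us x)))) (lemma δ (pow δ (List.length us)) ∣ x -ℚ u ∣ ∣ product us x ∣))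
  (ℚ.≤-reflexive (sym (ℚ.∣p*q∣≡∣p∣*∣q∣ (x -ℚ u) (product us x))))
  where
  ih = product-bound us x δ 0≤δ hs
  lemma : ∀ δ p d q → d *ℚ q ≡ δ *ℚ p +ℚ (δ *ℚ (q -ℚ p) +ℚ (d -ℚ δ) *ℚ q)
  lemma = ring-∀ ℚ-ring

divide : ∀ C → 0ℚ <ℚ C → ∀ ε → 0ℚ <ℚ ε → ∃ λ δ → 0ℚ <ℚ δ × δ *ℚ C ≡ ε
divide C 0<C ε 0<ε = ε *ℚ (ℚ.1/ C) , 0<-* 0<ε (ℚ.positive⁻¹ (ℚ.1/ C) {{ℚ.1/pos⇒pos C}}) ,
  trans (ℚ.*-assoc ε (ℚ.1/ C) C) (trans (cong (ε *ℚ_) (ℚ.*-inverseˡ C)) (ℚ.*-identityʳ ε))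
  where
  instance
    C-positive : ℚ.Positive C
    C-positive = ℚ.positive 0<C
    C-nonZero : ℚ.NonZero C
    C-nonZero = ℚ.pos⇒nonZero C

≃-linear : ∀ x y x′ y′ a b → x ≃ y → x′ ≃ y′ → (λ n → a *ℚ x n +ℚ b *ℚ x′ n) ≃ (λ n → a *ℚ y n +ℚ b *ℚ y′ n)
≃-linear x y x′ y′ a b h h′ ε 0<ε =
  let C = ∣ a ∣ +ℚ ∣ b ∣ +ℚ 1ℚ
      0<C : 0ℚ <ℚ C
      0<C = ℚ.<-≤-trans (ℚ.positive⁻¹ 1ℚ) (by-gap (∣ a ∣ +ℚ ∣ b ∣) (0≤-+ (ℚ.0≤∣p∣ a) (ℚ.0≤∣p∣ b)) (ℚ.+-comm (∣ a ∣ +ℚ ∣ b ∣) 1ℚ))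
      (δ , 0<δ , δC≡ε) = divide C 0<C ε 0<ε
      (M , p) = h δ 0<δ ; (N , q) = h′ δ 0<δ
  in M ⊔ N , λ n le → ℚ.≤-trans (ℚ.≤-reflexive (cong ∣_∣ (lemma a b (x n) (y n) (x′ n) (y′ n))))
    (ℚ.≤-trans (ℚ.∣p+q∣≤∣p∣+∣q∣ (a *ℚ (x n -ℚ y n)) (b *ℚ (x′ n -ℚ y′ n)))
    (ℚ.≤-trans (ℚ.≤-reflexive (cong₂ _+ℚ_ (ℚ.∣p*q∣≡∣p∣*∣q∣ a (x n -ℚ y n)) (ℚ.∣p*q∣≡∣p∣*∣q∣ b (x′ n -ℚ y′ n))))
    (ℚ.≤-trans (by-gap _ (0≤-+ (0≤-+ (0≤-* (ℚ.0≤∣p∣ a) (gap (p n (ℕ.≤-trans (ℕ.m≤m⊔n M N) le)))) (0≤-* (ℚ.0≤∣p∣ b) (gap (q n (ℕ.≤-trans (ℕ.m≤n⊔m M N) le))))) (ℚ.<⇒≤ 0<δ))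
        (lemma′ (∣ a ∣) (∣ b ∣) (∣ x n -ℚ y n ∣) (∣ x′ n -ℚ y′ n ∣) δ))
      (ℚ.≤-trans (ℚ.≤-reflexive δC≡ε) (ℚ.≤-reflexive (sym (ℚ.+-identityˡ ε)))))))
  where
  lemma : ∀ a b x y x′ y′ → (a *ℚ x +ℚ b *ℚ x′) -ℚ (a *ℚ y +ℚ b *ℚ y′) ≡ a *ℚ (x -ℚ y) +ℚ b *ℚ (x′ -ℚ y′)
  lemma = ring-∀ ℚ-ring
  lemma′ : ∀ a b d d′ δ → δ *ℚ (a +ℚ b +ℚ 1ℚ) ≡ (a *ℚ d +ℚ b *ℚ d′) +ℚ (a *ℚ ((0ℚ +ℚ δ) -ℚ d) +ℚ b *ℚ ((0ℚ +ℚ δ) -ℚ d′) +ℚ δ)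
  lemma′ = ring-∀ ℚ-ring

L-≃ : ∀ m P (Y Y′ : ℕ → ℕ → ℚ) → (∀ k → (λ t → Y t k) ≃ (λ t → Y′ t k)) → (λ t → L m P (Y t)) ≃ (λ t → L m P (Y′ t))
L-≃ zero    P Y Y′ h ε 0<ε = 0 , λ _ _ → ℚ.≤-trans (ℚ.<⇒≤ 0<ε) (ℚ.≤-reflexive (sym (ℚ.+-identityˡ ε)))
L-≃ (suc m) P Y Y′ h ε 0<ε =
  let (N , p) = ≃-linear (λ t → L m P (Y t)) (λ t → L m P (Y′ t)) (λ t → Y t m) (λ t → Y′ t m) 1ℚ (P m) (L-≃ m P Y Y′ h) (h m) ε 0<ε in
  N , λ t N≤t → subst (λ z → ∣ z ∣ ≤ℚ 0ℚ +ℚ ε) (cong₂ _-ℚ_ (cong (_+ℚ P m *ℚ Y t m) (ℚ.*-identityˡ (L m P (Y t))))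
    (cong (_+ℚ P m *ℚ Y′ t m) (ℚ.*-identityˡ (L m P (Y′ t))))) (p t N≤t)

cauchy-linear : ∀ x y a b → IsCauchy x → IsCauchy y → IsCauchy (λ n → a *ℚ x n +ℚ b *ℚ y n)
cauchy-linear x y a b cx cy ε 0<ε =
  let C = ∣ a ∣ +ℚ ∣ b ∣ +ℚ 1ℚ
      0<C : 0ℚ <ℚ C
      0<C = ℚ.<-≤-trans (ℚ.positive⁻¹ 1ℚ) (by-gap (∣ a ∣ +ℚ ∣ b ∣) (0≤-+ (ℚ.0≤∣p∣ a) (ℚ.0≤∣p∣ b)) (ℚ.+-comm (∣ a ∣ +ℚ ∣ b ∣) 1ℚ))
      (δ , 0<δ , δC≡ε) = divide C 0<C ε 0<ε
      (M , p) = cx δ 0<δ ; (N , q) = cy δ 0<δ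
  in M ⊔ N , λ m n le le′ → ℚ.≤-<-trans (ℚ.≤-reflexive (cong ∣_∣ (lemma a b (x m) (x n) (y m) (y n))))
    (ℚ.≤-<-trans (ℚ.∣p+q∣≤∣p∣+∣q∣ (a *ℚ (x m -ℚ x n)) (b *ℚ (y m -ℚ y n)))
    (ℚ.≤-<-trans (ℚ.≤-reflexive (cong₂ _+ℚ_ (ℚ.∣p*q∣≡∣p∣*∣q∣ a (x m -ℚ x n)) (ℚ.∣p*q∣≡∣p∣*∣q∣ b (y m -ℚ y n))))
    (ℚ.≤-<-trans (by-gap _ (0≤-+ (0≤-* (ℚ.0≤∣p∣ a) (gap (ℚ.<⇒≤ (p m n (ℕ.≤-trans (ℕ.m≤m⊔n M N) le) (ℕ.≤-trans (ℕ.m≤m⊔n M N) le′)))))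
                                (0≤-* (ℚ.0≤∣p∣ b) (gap (ℚ.<⇒≤ (q m n (ℕ.≤-trans (ℕ.m≤n⊔m M N) le) (ℕ.≤-trans (ℕ.m≤n⊔m M N) le′))))))
        (lemma′ (∣ a ∣) (∣ b ∣) (∣ x m -ℚ x n ∣) (∣ y m -ℚ y n ∣) δ))
      (subst (δ *ℚ (∣ a ∣ +ℚ ∣ b ∣) <ℚ_) δC≡ε (ℚ.*-monoʳ-<-pos δ {{ℚ.positive 0<δ}}
        (subst (_<ℚ C) (ℚ.+-identityʳ (∣ a ∣ +ℚ ∣ b ∣)) (ℚ.+-monoʳ-< (∣ a ∣ +ℚ ∣ b ∣) (ℚ.positive⁻¹ 1ℚ))))))))
  where
  lemma : ∀ a b x x′ y y′ → (a *ℚ x +ℚ b *ℚ y) -ℚ (a *ℚ x′ +ℚ b *ℚ y′) ≡ a *ℚ (x -ℚ x′) +ℚ b *ℚ (y -ℚ y′)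
  lemma = ring-∀ ℚ-ring
  lemma′ : ∀ a b d d′ δ → δ *ℚ (a +ℚ b) ≡ (a *ℚ d +ℚ b *ℚ d′) +ℚ (a *ℚ (δ -ℚ d) +ℚ b *ℚ (δ -ℚ d′))
  lemma′ = ring-∀ ℚ-ring

cauchy-cong : ∀ {x y} → (∀ n → x n ≡ y n) → IsCauchy x → IsCauchy y
cauchy-cong e c ε 0<ε = let (N , p) = c ε 0<ε in
  N , λ m n le le′ → subst (_<ℚ ε) (cong₂ (λ a b → ∣ a -ℚ b ∣) (e m) (e n)) (p m n le le′)

L-cauchy : ∀ m P (Y : ℕ → ℕ → ℚ) → (∀ k → IsCauchy (λ t → Y t k)) → IsCauchy (λ t → L m P (Y t))
L-cauchy zero    P Y h = const-cauchy 0ℚ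
L-cauchy (suc m) P Y h = cauchy-cong (λ t → cong (_+ℚ P m *ℚ Y t m) (ℚ.*-identityˡ (L m P (Y t))))
  (cauchy-linear (λ t → L m P (Y t)) (λ t → Y t m) 1ℚ (P m) (L-cauchy m P Y h) (h m))

≲-linear : ∀ x y x′ y′ b → 0ℚ ≤ℚ b → x ≲ y → x′ ≲ y′ → (λ n → x n +ℚ b *ℚ x′ n) ≲ (λ n → y n +ℚ b *ℚ y′ n)
≲-linear x y x′ y′ b 0≤b h h′ ε 0<ε =
  let 0<C : 0ℚ <ℚ b +ℚ 1ℚ
      0<C = ℚ.<-≤-trans (ℚ.positive⁻¹ 1ℚ) (by-gap b 0≤b (ℚ.+-comm b 1ℚ))
      (δ , 0<δ , δC≡ε) = divide (b +ℚ 1ℚ) 0<C ε 0<ε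
      (M , p) = h δ 0<δ ; (N , q) = h′ δ 0<δ
  in M ⊔ N , λ n le → by-gap _ (0≤-+ (gap (p n (ℕ.≤-trans (ℕ.m≤m⊔n M N) le))) (0≤-* 0≤b (gap (q n (ℕ.≤-trans (ℕ.m≤n⊔m M N) le)))))
    (trans (cong (y n +ℚ b *ℚ y′ n +ℚ_) (sym δC≡ε)) (lemma (x n) (y n) (x′ n) (y′ n) b δ))
  where
  lemma : ∀ x y x′ y′ b δ → y +ℚ b *ℚ y′ +ℚ δ *ℚ (b +ℚ 1ℚ) ≡ x +ℚ b *ℚ x′ +ℚ (((y +ℚ δ) -ℚ x) +ℚ b *ℚ ((y′ +ℚ δ) -ℚ x′))
  lemma = ring-∀ ℚ-ring

2^-anti : ∀ {m n} → m ≤ n → 2^- n ≤ℚ 2^- m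
2^-anti {m} = from-≤ (λ n → 2^- n ≤ℚ 2^- m) ℚ.≤-refl λ n _ → ℚ.≤-trans (by-gap (2^- suc n) (ℚ.<⇒≤ (0<2^- (suc n))) (2^-suc n))

pow-* : ∀ x y k → pow (x *ℚ y) k ≡ pow x k *ℚ pow y k
pow-* x y zero    = refl
pow-* x y (suc k) = trans (cong (x *ℚ y *ℚ_) (pow-* x y k)) (lemma x y (pow x k) (pow y k))
  where
  lemma : ∀ x y p q → x *ℚ y *ℚ (p *ℚ q) ≡ x *ℚ p *ℚ (y *ℚ q)
  lemma = ring-∀ ℚ-ring

pow-+ : ∀ x j k → pow x (j + k) ≡ pow x j *ℚ pow x k
pow-+ x zero    k = sym (ℚ.*-identityˡ (pow x k))
pow-+ x (suc j) k = trans (cong (x *ℚ_) (pow-+ x j k)) (sym (ℚ.*-assoc x (pow x j) (pow x k)))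

pow-positive : ∀ {x} k → 0ℚ <ℚ x → 0ℚ <ℚ pow x k
pow-positive zero    _   = ℚ.positive⁻¹ 1ℚ
pow-positive (suc k) 0<x = 0<-* 0<x (pow-positive k 0<x)

pow-ι : ∀ a k → pow (ι a) k ≡ ι (a ^ k)
pow-ι a zero    = sym ι-1
pow-ι a (suc k) = trans (cong (ι a *ℚ_) (pow-ι a k)) (sym (ι-* a (a ^ k)))

ι-∑ : ∀ m {f g} → (∀ k → k < m → ι (f k) ≡ g k) → ι (∑ m f) ≡ sumℚ m g
ι-∑ zero    h = ι-0
ι-∑ (suc m) {f} h = trans (ι-+ (∑ m f) (f m)) (cong₂ _+ℚ_ (ι-∑ m (λ k k<m → h k (ℕ.m<n⇒m<1+n k<m))) (h m ℕ.≤-refl))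

-- The homogeneous form, `B ^ n` times the value at `X / B`; comparisons at dyadic points become
-- comparisons of natural numbers.
hom : ℕ → (ℕ → ℕ) → ℕ → ℕ → ℕ
hom n a X B = ∑ (suc n) λ k → a k * X ^ k * B ^ (n ∸ k)

hom-ev : ∀ n a X e → ι (hom n a X (2 ^ e)) ≡ pow (ι (2 ^ e)) n *ℚ ev n (λ k → ι (a k)) (X /2^ e)
hom-ev n a X e = trans (ι-∑ (suc n) λ k k<1+n → term k (s≤s⁻¹ k<1+n)) (sum-scale (suc n) (pow (ι (2 ^ e)) n) (λ k → ι (a k) *ℚ pow (X /2^ e) k))
  where
  B = 2 ^ e
  scaled : ι B *ℚ (X /2^ e) ≡ ι X
  scaled = trans (lemma (ι B) (ι X) (2^- e)) (trans (cong (_*ℚ ι X) (2^-ι e)) (ℚ.*-identityˡ (ι X)))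
    where
    lemma : ∀ b x t → b *ℚ (x *ℚ t) ≡ (t *ℚ b) *ℚ x
    lemma = ring-∀ ℚ-ring
  term : ∀ k → k ≤ n → ι (a k * X ^ k * B ^ (n ∸ k)) ≡ pow (ι B) n *ℚ (ι (a k) *ℚ pow (X /2^ e) k)
  term k k≤n = trans (ι-* (a k * X ^ k) (B ^ (n ∸ k))) (trans (cong₂ _*ℚ_ (trans (ι-* (a k) (X ^ k)) (cong (ι (a k) *ℚ_)
      (trans (sym (pow-ι X k)) (trans (cong (λ z → pow z k) (sym scaled)) (pow-* (ι B) (X /2^ e) k))))) (sym (pow-ι B (n ∸ k))))
    (trans (lemma (ι (a k)) (pow (ι B) k) (pow (X /2^ e) k) (pow (ι B) (n ∸ k)))
      (cong (_*ℚ (ι (a k) *ℚ pow (X /2^ e) k)) (trans (sym (pow-+ (ι B) k (n ∸ k))) (cong (pow (ι B)) (ℕ.m+[n∸m]≡n k≤n))))))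
    where
    lemma : ∀ a b x c → a *ℚ (b *ℚ x) *ℚ c ≡ (b *ℚ c) *ℚ (a *ℚ x)
    lemma = ring-∀ ℚ-ring

module _ (n : ℕ) (a b : ℕ → ℕ) (X X′ e : ℕ) where

  private
    scale-positive : 0ℚ <ℚ pow (ι (2 ^ e)) n
    scale-positive = pow-positive n (0<ι2^ e)

  hom-< : ev n (λ k → ι (a k)) (X /2^ e) <ℚ ev n (λ k → ι (b k)) (X′ /2^ e) → hom n a X (2 ^ e) < hom n b X′ (2 ^ e)
  hom-< lt = ℕ.≰⇒> λ le → ℚ.<-irrefl refl (ℚ.<-≤-trans lt (ℚ.*-cancelˡ-≤-pos (pow (ι (2 ^ e)) n) {{ℚ.positive scale-positive}}
    (ℚ.≤-trans (ℚ.≤-reflexive (sym (hom-ev n b X′ e))) (ℚ.≤-trans (ι-mono le) (ℚ.≤-reflexive (hom-ev n a X e))))))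

  hom-<⁻ : hom n a X (2 ^ e) < hom n b X′ (2 ^ e) → ev n (λ k → ι (a k)) (X /2^ e) <ℚ ev n (λ k → ι (b k)) (X′ /2^ e)
  hom-<⁻ lt = *-cancel-< (pow (ι (2 ^ e)) n) scale-positive (ℚ.≤-<-trans
    (ℚ.≤-reflexive (trans (ℚ.*-comm (ev n (λ k → ι (a k)) (X /2^ e)) (pow (ι (2 ^ e)) n)) (sym (hom-ev n a X e))))
    (ℚ.<-≤-trans (ι-mono-< lt) (ℚ.≤-reflexive (trans (hom-ev n b X′ e) (ℚ.*-comm (pow (ι (2 ^ e)) n) (ev n (λ k → ι (b k)) (X′ /2^ e)))))))

-- No coefficient is negative. For this reason integer polynomials are kept as differences of two
-- such polynomials: bounds at the ends of a cell then hold on the whole cell.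
ev-mono : ∀ n (a : ℕ → ℕ) {x y} → 0ℚ ≤ℚ x → x ≤ℚ y → ev n (λ k → ι (a k)) x ≤ℚ ev n (λ k → ι (a k)) y
ev-mono n a {x} {y} 0≤x x≤y = sum-mono (suc n) λ k _ →
  ℚ.*-monoˡ-≤-nonNeg (ι (a k)) {{ℚ.nonNegative (0≤ι (a k))}} (pow-mono k 0≤x x≤y)

difference : (ℕ → ℕ) → (ℕ → ℕ) → ℕ → ℚ
difference a b k = ι (a k) -ℚ ι (b k)

L-difference : ∀ m a b Y → L m (difference a b) Y ≡ L m (λ k → ι (a k)) Y -ℚ L m (λ k → ι (b k)) Y
L-difference m a b Y = trans (sum-cong m λ k _ → lemma (ι (a k)) (ι (b k)) (Y k))
  (trans (sum-linear m 1ℚ (-ℚ 1ℚ) (λ k → ι (a k) *ℚ Y k) (λ k → ι (b k) *ℚ Y k)) (lemma′ (L m (λ k → ι (a k)) Y) (L m (λ k → ι (b k)) Y)))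
  where
  lemma : ∀ a b y → (a -ℚ b) *ℚ y ≡ 1ℚ *ℚ (a *ℚ y) +ℚ (-ℚ 1ℚ) *ℚ (b *ℚ y)
  lemma = ring-∀ ℚ-ring
  lemma′ : ∀ a b → 1ℚ *ℚ a +ℚ (-ℚ 1ℚ) *ℚ b ≡ a -ℚ b
  lemma′ = ring-∀ ℚ-ring

-- A common denominator is a positive factor and does not affect signs.
clear : ∀ m (P : ℕ → ℚ) → ∃ λ d → ∃ λ a → ∃ λ b → ∀ k → k < m → difference a b k ≡ ι (suc d) *ℚ P k
clear zero    P = 0 , (λ _ → 0) , (λ _ → 0) , λ _ ()
clear (suc m) P = join (clear m P) (clear₁ (P m))
  where
  clear₁ : ∀ q → ∃ λ d → ∃₂ λ x y → ι x -ℚ ι y ≡ ι (suc d) *ℚ q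
  clear₁ q@(ℚ.mkℚ (ℤ.+ a) d _) = d , a , 0 , trans (cong (λ z → ι a -ℚ z) ι-0) (trans (lemma (ι a))
    (trans (sym (/-ι a d)) (trans (ℚ.*-comm ((ℤ.+ a) /ℚ suc d) (ι (suc d))) (cong (ι (suc d) *ℚ_) (ℚ.↥p/↧p≡p q)))))
    where
    lemma : ∀ x → x -ℚ 0ℚ ≡ x
    lemma = ring-∀ ℚ-ring
  clear₁ q@(ℚ.mkℚ -[1+ a ] d c) = d , 0 , suc a , trans (cong (λ z → z -ℚ ι (suc a)) ι-0) (trans (lemma (ι (suc a)))
    (trans (cong -ℚ_ (trans (sym (/-ι (suc a) d)) (trans (ℚ.*-comm ((ℤ.+ suc a) /ℚ suc d) (ι (suc d))) (cong (ι (suc d) *ℚ_) (ℚ.↥p/↧p≡p (ℚ.mkℚ (ℤ.+ suc a) d c))))))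
      (lemma′ (ι (suc d)) (ℚ.mkℚ (ℤ.+ suc a) d c))))
    where
    lemma : ∀ x → 0ℚ -ℚ x ≡ -ℚ x
    lemma = ring-∀ ℚ-ring
    lemma′ : ∀ x y → -ℚ (x *ℚ y) ≡ x *ℚ (-ℚ y)
    lemma′ = ring-∀ ℚ-ring
  join : (∃ λ d → ∃ λ a → ∃ λ b → ∀ k → k < m → difference a b k ≡ ι (suc d) *ℚ P k) →
         (∃ λ d → ∃₂ λ x y → ι x -ℚ ι y ≡ ι (suc d) *ℚ P m) →
         ∃ λ d → ∃ λ a → ∃ λ b → ∀ k → k < suc m → difference a b k ≡ ι (suc d) *ℚ P k
  join (d , a , b , h) (d′ , x , y , e) = d′ + d * suc d′ , pick a x , pick b y , λ k k<1+m → merged k (ℕ.m<1+n⇒m<n∨m≡n k<1+m)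
    where
    pick : (ℕ → ℕ) → ℕ → ℕ → ℕ
    pick a x k with k <? m
    ... | yes _ = suc d′ * a k
    ... | no  _ = suc d * x
    distrib : ∀ c a b → c *ℚ a -ℚ c *ℚ b ≡ c *ℚ (a -ℚ b)
    distrib = ring-∀ ℚ-ring
    swap : ∀ c d q → c *ℚ (d *ℚ q) ≡ (d *ℚ c) *ℚ q
    swap = ring-∀ ℚ-ring
    merged : ∀ k → k < m ⊎ k ≡ m → ι (pick a x k) -ℚ ι (pick b y k) ≡ ι (suc (d′ + d * suc d′)) *ℚ P k
    merged k c with k <? m
    merged k c           | yes k<m = trans (cong₂ _-ℚ_ (ι-* (suc d′) (a k)) (ι-* (suc d′) (b k))) (trans (distrib (ι (suc d′)) (ι (a k)) (ι (b k)))
      (trans (cong (ι (suc d′) *ℚ_) (h k k<m)) (trans (swap (ι (suc d′)) (ι (suc d)) (P k)) (cong (_*ℚ P k) (sym (ι-* (suc d) (suc d′)))))))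
    merged k (inj₁ k<m)  | no k≮m = contradiction k<m k≮m
    merged k (inj₂ refl) | no _   = trans (cong₂ _-ℚ_ (ι-* (suc d) x) (ι-* (suc d) y)) (trans (distrib (ι (suc d)) (ι x) (ι y))
      (trans (cong (ι (suc d) *ℚ_) e) (trans (sym (ℚ.*-assoc (ι (suc d)) (ι (suc d′)) (P m))) (cong (_*ℚ P m) (sym (ι-* (suc d) (suc d′)))))))

-- Binary sequences as reals: the digits in base 4.

node : Baire → Baire
node f = ⟨ (λ _ → 0) , f ⟩

node-binary : ∀ {f} → Binary f → Binary (node f)
node-binary {f} b m with halve m
... | k , inj₁ refl = subst (_< 2) (sym (⟨⟩-even (λ _ → 0) f k)) (s≤s z≤n)
... | k , inj₂ refl = subst (_< 2) (sym (⟨⟩-odd (λ _ → 0) f k)) (b k)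

node-~ : ∀ {f g} s → f ~[ s ] g → node f ~[ 2 * s ] node g
node-~ {f} {g} s e m m<2s with halve m
... | k , inj₁ refl = trans (⟨⟩-even (λ _ → 0) f k) (sym (⟨⟩-even (λ _ → 0) g k))
... | k , inj₂ refl = trans (⟨⟩-odd (λ _ → 0) f k) (trans (e k (ℕ.*-cancelˡ-< 2 k s (ℕ.<-trans ℕ.≤-refl m<2s))) (sym (⟨⟩-odd (λ _ → 0) g k)))

quad : Baire → ℕ → ℕ
quad f s = val (node f) (2 * s)

quad-suc : ∀ f s → quad f (suc s) ≡ 4 * quad f s + f s
quad-suc f s = trans (cong (val (node f)) (cong suc (ℕ.+-suc s (s + 0))))
  (trans (cong₂ (λ x y → 2 * (2 * quad f s + x) + y) (⟨⟩-even (λ _ → 0) f s) (⟨⟩-odd (λ _ → 0) f s)) (lemma (quad f s) (f s)))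
  where
  lemma : ∀ q x → 2 * (2 * q + 0) + x ≡ 4 * q + x
  lemma = solve-∀

module _ {f : Baire} (b : Binary f) where

  lo hi : ℕ → ℚ
  lo s = quad f s /2^ (2 * s)
  hi s = suc (quad f s) /2^ (2 * s)

  hi≡ : ∀ s → hi s ≡ lo s +ℚ 2^- (2 * s)
  hi≡ s = /2^-suc (quad f s) (2 * s)

  0≤lo : ∀ s → 0ℚ ≤ℚ lo s
  0≤lo s = 0≤/2^ (quad f s) (2 * s)

  lo≤hi : ∀ s → lo s ≤ℚ hi s
  lo≤hi s = /2^-mono (2 * s) (ℕ.n≤1+n (quad f s))

  hi≤1 : ∀ s → hi s ≤ℚ 1ℚ
  hi≤1 s = ℚ.≤-trans (ℚ.≤-reflexive (hi≡ s)) (ℚ.≤-trans (upper-anti (node-binary b) (z≤n {2 * s}))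
    (ℚ.≤-reflexive (trans (cong (λ z → z *ℚ 2^- 0 +ℚ 2^- 0) ι-0) refl)))

  lo≤1 : ∀ s → lo s ≤ℚ 1ℚ
  lo≤1 s = ℚ.≤-trans (lo≤hi s) (hi≤1 s)

  within-cell : ∀ {s t} → 2 * s ≤ t → lo s ≤ℚ lower (node-binary b) t × lower (node-binary b) t ≤ℚ hi s
  within-cell {s} {t} le = lower-mono (node-binary b) le , ℚ.≤-trans (≤upper (node-binary b) le) (ℚ.≤-reflexive (sym (hi≡ s)))

lo-close : ∀ {f g} (bf : Binary f) (bg : Binary g) {r s t} → f ~[ r ] g → r ≤ s → r ≤ t → ∣ lo bf s -ℚ lo bg t ∣ ≤ℚ 2^- (2 * r)
lo-close {f} {g} bf bg {r} {s} {t} e r≤s r≤t = ℚ.≤-trans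
  (between (proj₁ in-f) (proj₂ in-f) (subst (_≤ℚ lo bg t) (sym same) (proj₁ in-g)) (ℚ.≤-trans (proj₂ in-g) (ℚ.≤-reflexive (sym same-hi))))
  (ℚ.≤-reflexive (trans (cong (_-ℚ lo bf r) (hi≡ bf r)) (lemma (lo bf r) (2^- (2 * r)))))
  where
  in-f = within-cell bf {r} {2 * s} (ℕ.*-monoʳ-≤ 2 r≤s)
  in-g = within-cell bg {r} {2 * t} (ℕ.*-monoʳ-≤ 2 r≤t)
  same : lo bf r ≡ lo bg r
  same = cong (_/2^ (2 * r)) (val-cong (2 * r) (node-~ r e))
  same-hi : hi bf r ≡ hi bg r
  same-hi = cong (λ q → suc q /2^ (2 * r)) (val-cong (2 * r) (node-~ r e))
  lemma : ∀ l t → (l +ℚ t) -ℚ l ≡ t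
  lemma = ring-∀ ℚ-ring

-- At the first difference `f` has digit 0 and `g` digit 1. The next binary digit of `node f` is the
-- inserted 0, which keeps `f` in the lower half of its base 4 cell and leaves a gap of half a cell.
lo-apart : ∀ {f g} (bf : Binary f) (bg : Binary g) {m r₀ s} → f ~[ m ] g → f m < g m → m < r₀ → r₀ ≤ s →
           lo bf s +ℚ 2^- suc (2 * r₀) ≤ℚ lo bg s
lo-apart {f} {g} bf bg {m} {r₀} {s} e lt m<r₀ r₀≤s = ℚ.≤-trans
  (ℚ.+-mono-≤ below-f (2^-anti (s≤s (ℕ.*-monoʳ-≤ 2 m<r₀)))) (ℚ.≤-trans (ℚ.≤-reflexive sums) above-g)
  where
  Q = quad f m
  d = suc (2 * suc m)
  digits : ∀ {x y} → x < y → y < 2 → x ≡ 0 × y ≡ 1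
  digits {zero} {suc zero} _ _ = refl , refl
  digits {x} {suc (suc y)} _ (s≤s (s≤s ()))
  digits {suc x} {suc zero} (s≤s ()) _
  fm = proj₁ (digits lt (bg m))
  gm = proj₂ (digits lt (bg m))
  le : 2 * suc m ≤ 2 * s
  le = ℕ.*-monoʳ-≤ 2 (ℕ.≤-trans m<r₀ r₀≤s)
  quad-f : quad f (suc m) ≡ 4 * Q
  quad-f = trans (quad-suc f m) (trans (cong (4 * Q +_) fm) (ℕ.+-identityʳ (4 * Q)))
  quad-g : quad g (suc m) ≡ suc (4 * Q)
  quad-g = trans (quad-suc g m) (trans (cong₂ (λ q x → 4 * q + x) (sym (val-cong (2 * m) (node-~ m e))) gm) (ℕ.+-comm (4 * Q) 1))
  above-g : suc (4 * Q) /2^ (2 * suc m) ≤ℚ lo bg s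
  above-g = ℚ.≤-trans (ℚ.≤-reflexive (cong (_/2^ (2 * suc m)) (sym quad-g))) (lower-mono (node-binary bg) le)
  lower-d : lower (node-binary bf) d ≡ (4 * Q) /2^ (2 * suc m)
  lower-d = trans (cong (_/2^ d) (trans (cong₂ (λ q x → 2 * q + x) quad-f (⟨⟩-even (λ _ → 0) f (suc m))) (ℕ.+-identityʳ (2 * (4 * Q)))))
    (/2^-double (4 * Q) (2 * suc m))
  below-f : lo bf s ≤ℚ (4 * Q) /2^ (2 * suc m) +ℚ 2^- d
  below-f = ℚ.≤-trans (lower-suc (node-binary bf) (2 * s)) (ℚ.≤-trans (≤upper (node-binary bf) (s≤s le)) (ℚ.≤-reflexive (cong (_+ℚ 2^- d) lower-d)))
  sums : (4 * Q) /2^ (2 * suc m) +ℚ 2^- d +ℚ 2^- d ≡ suc (4 * Q) /2^ (2 * suc m)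
  sums = trans (ℚ.+-assoc ((4 * Q) /2^ (2 * suc m)) (2^- d) (2^- d))
    (trans (cong ((4 * Q) /2^ (2 * suc m) +ℚ_) (sym (2^-suc (2 * suc m)))) (sym (/2^-suc (4 * Q) (2 * suc m))))

difference-at : ∀ (x y : ℚ) {δ} → 0ℚ ≤ℚ δ → x +ℚ δ ≤ℚ y → δ ≤ℚ ∣ x -ℚ y ∣ × δ ≤ℚ ∣ y -ℚ x ∣
difference-at x y {δ} 0≤δ h = ℚ.≤-trans le (ℚ.≤-reflexive (∣-∣-sym y x)) , le
  where
  lemma : ∀ x y δ → y -ℚ x ≡ δ +ℚ (y -ℚ (x +ℚ δ))
  lemma = ring-∀ ℚ-ring
  le : δ ≤ℚ ∣ y -ℚ x ∣
  le = ℚ.≤-trans (by-gap (y -ℚ (x +ℚ δ)) (gap h) (lemma x y δ)) (≤∣∣ (y -ℚ x))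

-- Hulls on the moment curve

module Hull (em : ExcludedMiddle 0ℓ) (n′ : ℕ) (p : Baire) where

  n : ℕ
  n = suc n′

  index : ℕ → Fin n
  index k = fromℕ< (m%n<n k n)

  -- A point y of the cube is read as a vector of moments, standing for x, …, xⁿ.
  moments : (Fin n → UnitReal) → ℕ → ℕ → ℚ
  moments y t zero    = 1ℚ
  moments y t (suc k) = seq (y (index k)) t

  -- The affine function on the cube that restricts to `P` on the moment curve.
  Λ : (Fin n → UnitReal) → (ℕ → ℚ) → ℕ → ℚ
  Λ y P t = L (suc n) P (moments y t)

  Live : ℕ → Baire → Set
  Live s f = ¬ Dead p s f

  -- By monotonicity of a and b, the polynomial a - b is then negative on all cells of depth s that are alive and not excepted by E.
  Valid : (Baire → Set) → ℕ → (ℕ → ℕ) → (ℕ → ℕ) → Set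
  Valid E s a b = ∀ f → Binary f → Live s f → ¬ E f →
                  hom n a (suc (quad f s)) (2 ^ (2 * s)) < hom n b (quad f s) (2 ^ (2 * s))

  -- The dual description of the convex hull. `Valid` is decidable and positivity of `Λ` is
  -- semidecidable, so leaving the hull is semidecidable.
  InHull : (Fin n → UnitReal) → Set
  InHull y = ∀ a b s → Valid (λ _ → ⊥) s a b → Λ y (difference a b) ≲ const 0ℚ

  Λ-cauchy : ∀ y P → IsCauchy (Λ y P)
  Λ-cauchy y P = L-cauchy (suc n) P (moments y) λ { zero → const-cauchy 1ℚ ; (suc k) → UnitReal.cauchy (y (index k)) }

  ≃-refl : ∀ x → x ≃ x
  ≃-refl x ε 0<ε = 0 , λ k _ → ℚ.≤-trans (ℚ.≤-reflexive (cong ∣_∣ (ℚ.+-inverseʳ (x k))))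
    (ℚ.≤-trans (ℚ.<⇒≤ 0<ε) (ℚ.≤-reflexive (sym (ℚ.+-identityˡ ε))))

  InHull-resp : ∀ y y′ → (∀ i → seq (y i) ≃ seq (y′ i)) → InHull y → InHull y′
  InHull-resp y y′ e h a b s v = ≲-trans (Λ y′ (difference a b)) (Λ y (difference a b)) (const 0ℚ)
    (≃-≲ (Λ y′ (difference a b)) (Λ y (difference a b)) (≃-sym (Λ y (difference a b)) (Λ y′ (difference a b))
      (L-≃ (suc n) (difference a b) (moments y) (moments y′) λ { zero → ≃-refl (const 1ℚ) ; (suc k) → e (index k) })))
    (h a b s v)

  L-one : ∀ m Y → L (suc m) (monic []) Y ≡ Y 0
  L-one zero    Y = lemma (Y 0)
    where
    lemma : ∀ y → 0ℚ +ℚ 1ℚ *ℚ y ≡ y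
    lemma = ring-∀ ℚ-ring
  L-one (suc m) Y = trans (cong (_+ℚ 0ℚ *ℚ Y (suc m)) (L-one m Y)) (lemma (Y 0) (Y (suc m)))
    where
    lemma : ∀ x y → x +ℚ 0ℚ *ℚ y ≡ x
    lemma = ring-∀ ℚ-ring

  add-constant : (ℕ → ℚ) → ℚ → ℕ → ℚ
  add-constant P c k = 1ℚ *ℚ P k +ℚ c *ℚ monic [] k

  L-add-constant : ∀ P c Y → Y 0 ≡ 1ℚ → L (suc n) (add-constant P c) Y ≡ L (suc n) P Y +ℚ c
  L-add-constant P c Y e = trans (L-linear (suc n) 1ℚ c P (monic []) Y)
    (trans (cong₂ (λ a b → 1ℚ *ℚ a +ℚ c *ℚ b) {L (suc n) P Y} refl (trans (L-one n Y) e)) (lemma (L (suc n) P Y) c))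
    where
    lemma : ∀ x c → 1ℚ *ℚ x +ℚ c *ℚ 1ℚ ≡ x +ℚ c
    lemma = ring-∀ ℚ-ring

  L-scaled : ∀ {P Q} D Y → (∀ k → k < suc n → Q k ≡ D *ℚ P k) → L (suc n) Q Y ≡ D *ℚ L (suc n) P Y
  L-scaled {P} {Q} D Y h = trans (sum-cong (suc n) λ k k< → trans (cong (_*ℚ Y k) (h k k<)) (ℚ.*-assoc D (P k) (Y k)))
    (sum-scale (suc n) D (λ k → P k *ℚ Y k))

  -- The margin `ε` survives the clearing of denominators, and at a fine enough stage it outweighs
  -- the variation of `a` over a cell.
  realise : ∀ P ε → 0ℚ <ℚ ε → ∀ s₁ (E : Baire → Set) →
            (∀ f (b : Binary f) → Live s₁ f → ¬ E f → ∀ s → s₁ ≤ s → ev n P (lo b s) +ℚ ε ≤ℚ 0ℚ) →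
            ∃ λ d → ∃ λ a → ∃ λ b → ∃ λ s → s₁ ≤ s × Valid E s a b × (∀ k → k < suc n → difference a b k ≡ ι (suc d) *ℚ P k)
  realise P ε 0<ε s₁ E neg = finish (clear (suc n) P)
    where
    finish : (∃ λ d → ∃ λ a → ∃ λ b → ∀ k → k < suc n → difference a b k ≡ ι (suc d) *ℚ P k) →
             ∃ λ d → ∃ λ a → ∃ λ b → ∃ λ s → s₁ ≤ s × Valid E s a b × (∀ k → k < suc n → difference a b k ≡ ι (suc d) *ℚ P k)
    finish (d , a , b , h) = choose (divide R 0<R (ι (suc d) *ℚ ε) (0<-* (0<ι d) 0<ε))
      where
      ιa ιb : ℕ → ℚ
      ιa k = ι (a k)
      ιb k = ι (b k)
      -- The Lipschitz constant of `a`, plus 1 for strictness.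
      R : ℚ
      R = norm (suc n) ιa *ℚ ι n +ℚ 1ℚ
      0<R : 0ℚ <ℚ R
      0<R = ℚ.<-≤-trans (ℚ.positive⁻¹ 1ℚ) (by-gap (norm (suc n) ιa *ℚ ι n) (0≤-* (0≤norm (suc n) ιa) (0≤ι n)) (ℚ.+-comm (norm (suc n) ιa *ℚ ι n) 1ℚ))
      choose : (∃ λ δ → 0ℚ <ℚ δ × δ *ℚ R ≡ ι (suc d) *ℚ ε) →
               ∃ λ d → ∃ λ a → ∃ λ b → ∃ λ s → s₁ ≤ s × Valid E s a b × (∀ k → k < suc n → difference a b k ≡ ι (suc d) *ℚ P k)
      choose (δ , 0<δ , δR≡) = d , a , b , s , ℕ.m≤m⊔n s₁ (proj₁ small) , valid , h
        where
        small : ∃ λ N → 2^- N <ℚ δ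
        small = archimedes δ 0<δ
        s = s₁ ⊔ proj₁ small
        valid : Valid E s a b
        valid f bf live ¬e = hom-< n a b (suc (quad f s)) (quad f s) (2 * s) (ℚ.<-≤-trans
          (subst (_<ℚ ev n ιa (hi bf s) +ℚ δ) (ℚ.+-identityʳ (ev n ιa (hi bf s))) (ℚ.+-monoʳ-< (ev n ιa (hi bf s)) 0<δ))
          (by-gap _ (0≤-+ (0≤-+ (gap lip) (gap drop)) (0≤-* (0≤-* (0≤norm (suc n) ιa) (0≤ι n)) (gap width)))
            (lemma (ev n ιa (hi bf s)) (ev n ιa (lo bf s)) (ev n ιb (lo bf s)) (norm (suc n) ιa) (ι n) ∣ hi bf s -ℚ lo bf s ∣ δ)))
          where
          lip : ev n ιa (hi bf s) -ℚ ev n ιa (lo bf s) ≤ℚ norm (suc n) ιa *ℚ (ι n *ℚ ∣ hi bf s -ℚ lo bf s ∣)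
          lip = ℚ.≤-trans (≤∣∣ (ev n ιa (hi bf s) -ℚ ev n ιa (lo bf s)))
            (ev-lipschitz n ιa (ℚ.≤-trans (0≤lo bf s) (lo≤hi bf s)) (hi≤1 bf s) (0≤lo bf s) (lo≤1 bf s))
          width : ∣ hi bf s -ℚ lo bf s ∣ ≤ℚ δ
          width = ℚ.≤-trans (between (lo≤hi bf s) ℚ.≤-refl ℚ.≤-refl (lo≤hi bf s))
            (ℚ.≤-trans (ℚ.≤-reflexive (trans (cong (_-ℚ lo bf s) (hi≡ bf s)) (cancel (lo bf s) (2^- (2 * s)))))
              (ℚ.≤-trans (2^-anti (ℕ.≤-trans (ℕ.m≤n⊔m s₁ (proj₁ small)) (ℕ.m≤m+n s (s + 0)))) (ℚ.<⇒≤ (proj₂ small))))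
            where
            cancel : ∀ l t → (l +ℚ t) -ℚ l ≡ t
            cancel = ring-∀ ℚ-ring
          drop : (ev n ιa (lo bf s) -ℚ ev n ιb (lo bf s)) +ℚ δ *ℚ R ≤ℚ 0ℚ
          drop = ℚ.≤-trans (ℚ.≤-reflexive (trans (cong₂ _+ℚ_ (trans (sym (L-difference (suc n) a b (pow (lo bf s)))) (L-scaled {P} (ι (suc d)) (pow (lo bf s)) h)) δR≡)
              (sym (ℚ.*-distribˡ-+ (ι (suc d)) (ev n P (lo bf s)) ε))))
            (ℚ.≤-trans (ℚ.*-monoˡ-≤-nonNeg (ι (suc d)) {{ℚ.nonNegative (0≤ι (suc d))}}
                (neg f bf (λ dd → live (Dead-mono {p} {f} (ℕ.m≤m⊔n s₁ (proj₁ small)) dd)) ¬e s (ℕ.m≤m⊔n s₁ (proj₁ small))))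
              (ℚ.≤-reflexive (ℚ.*-zeroʳ (ι (suc d)))))
          lemma : ∀ ah al bl N n w δ → bl ≡ (ah +ℚ δ) +ℚ (((N *ℚ (n *ℚ w)) -ℚ (ah -ℚ al)) +ℚ (0ℚ -ℚ ((al -ℚ bl) +ℚ δ *ℚ (N *ℚ n +ℚ 1ℚ))) +ℚ (N *ℚ n) *ℚ (δ -ℚ w))
          lemma = ring-∀ ℚ-ring

  -- The hull condition is applied to `P - (c + δ)`, which is negative at the live nodes with margin
  -- `δ`.
  hull-bound : ∀ y → InHull y → ∀ P c s₁ → (∀ f (b : Binary f) → Live s₁ f → ∀ s → s₁ ≤ s → ev n P (lo b s) ≤ℚ c) →
               Λ y P ≲ const c
  hull-bound y y∈ P c s₁ h ε 0<ε = halved (halve-ε ε 0<ε)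
    where
    halved : (∃ λ δ → 0ℚ <ℚ δ × δ +ℚ δ ≡ ε) → ∃ λ N → ∀ t → N ≤ t → Λ y P t ≤ℚ c +ℚ ε
    halved (δ , 0<δ , e) = bound (realise Q δ 0<δ s₁ (λ _ → ⊥) λ f b live _ s s₁≤s →
        ℚ.≤-trans (ℚ.≤-reflexive (cong (_+ℚ δ) (L-add-constant P (-ℚ (c +ℚ δ)) (pow (lo b s)) refl)))
          (by-gap _ (gap (h f b live s s₁≤s)) (lemma (ev n P (lo b s)) c δ)))
      where
      Q = add-constant P (-ℚ (c +ℚ δ))
      lemma : ∀ x c δ → 0ℚ ≡ (x +ℚ (-ℚ (c +ℚ δ)) +ℚ δ) +ℚ (c -ℚ x)
      lemma = ring-∀ ℚ-ring
      bound : (∃ λ d → ∃ λ a → ∃ λ b → ∃ λ s → s₁ ≤ s × Valid (λ _ → ⊥) s a b × (∀ k → k < suc n → difference a b k ≡ ι (suc d) *ℚ Q k)) →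
              ∃ λ N → ∀ t → N ≤ t → Λ y P t ≤ℚ c +ℚ ε
      bound (d , a , b , s , _ , v , eq) =
        let (N , f) = y∈ a b s v (δ *ℚ ι (suc d)) (0<-* 0<δ (0<ι d)) in
        N , λ t N≤t → small t (*-cancel-≤ (ι (suc d)) (0<ι d) (ℚ.≤-trans
          (ℚ.≤-reflexive (trans (ℚ.*-comm (Λ y Q t) (ι (suc d))) (sym (L-scaled {Q} (ι (suc d)) (moments y t) eq))))
          (ℚ.≤-trans (f t N≤t) (ℚ.≤-reflexive (ℚ.+-identityˡ (δ *ℚ ι (suc d)))))))
        where
        small : ∀ t → Λ y Q t ≤ℚ δ → Λ y P t ≤ℚ c +ℚ ε
        small t le = by-gap _ (gap (ℚ.≤-trans (ℚ.≤-reflexive (sym (L-add-constant P (-ℚ (c +ℚ δ)) (moments y t) refl))) le))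
          (trans (cong (c +ℚ_) (sym e)) (lemma′ (Λ y P t) c δ))
          where
          lemma′ : ∀ x c δ → c +ℚ (δ +ℚ δ) ≡ x +ℚ (δ -ℚ (x +ℚ (-ℚ (c +ℚ δ))))
          lemma′ = ring-∀ ℚ-ring

  opaque
    power : Tame → ℕ → Tame
    power x zero    = constᵗ 1ℚ (ℚ.nonNegative⁻¹ 1ℚ) ℚ.≤-refl
    -- The mixture of 0 and `y` with weight `x` is the product of `x` and `y`.
    power x (suc k) = mixᵗ x (constᵗ 0ℚ ℚ.≤-refl (ℚ.nonNegative⁻¹ 1ℚ)) (power x k)

    power-pow : ∀ x k t → seqᵗ (power x k) t ≡ pow (seqᵗ x t) k
    power-pow x zero    t = refl
    power-pow x (suc k) t = trans (lemma (seqᵗ x t) (seqᵗ (power x k) t)) (cong (seqᵗ x t *ℚ_) (power-pow x k t))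
      where
      lemma : ∀ x y → (1ℚ -ℚ x) *ℚ 0ℚ +ℚ x *ℚ y ≡ x *ℚ y
      lemma = ring-∀ ℚ-ring

  power-index : ∀ (x : Tame) k t → k < n → seqᵗ (power x (suc (toℕ (index k)))) t ≡ pow (seqᵗ x t) (suc k)
  power-index x k t k<n = trans (power-pow x (suc (toℕ (index k))) t)
    (cong (λ j → pow (seqᵗ x t) (suc j)) (trans (Fin.toℕ-fromℕ< (m%n<n k n)) (m<n⇒m%n≡m k<n)))

  curve : ∀ f → Binary f → Fin n → UnitReal
  curve f b i = real (power (expansion {node f} (node-binary {f} b)) (suc (toℕ i)))

  -- On a cell, `a` is largest at the upper end and `c` smallest at the lower end, where `Valid`
  -- compares them.
  valid-nonpositive : ∀ {E a c s} → Valid E s a c → ∀ {f} (b : Binary f) → Live s f → ¬ E f → ∀ t → 2 * s ≤ t →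
                      ev n (difference a c) (lower {node f} (node-binary {f} b) t) ≤ℚ 0ℚ
  valid-nonpositive {E} {a} {c} {s} v {f} b live ¬e t le = ℚ.≤-trans (ℚ.≤-reflexive (L-difference (suc n) a c (pow x)))
    (chain (ev-mono n a (ℚ.≤-trans (0≤lo {f} b s) (proj₁ cell)) (proj₂ cell))
      (ℚ.<⇒≤ (hom-<⁻ n a c (suc (quad f s)) (quad f s) (2 * s) (v f b live ¬e))) (ev-mono n c (0≤lo {f} b s) (proj₁ cell)))
    where
    x = lower {node f} (node-binary {f} b) t
    cell = within-cell {f} b {s} {t} le
    chain : ∀ {ax ah cl cx} → ax ≤ℚ ah → ah ≤ℚ cl → cl ≤ℚ cx → ax -ℚ cx ≤ℚ 0ℚ
    chain {ax} {ah} {cl} {cx} p q r = by-gap _ (gap (ℚ.≤-trans p (ℚ.≤-trans q r))) (lemma ax cx)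
      where
      lemma : ∀ ax cx → 0ℚ ≡ (ax -ℚ cx) +ℚ (cx -ℚ ax)
      lemma = ring-∀ ℚ-ring

  curve-InHull : ∀ f (b : Binary f) → (∀ s → Live s f) → InHull (curve f b)
  curve-InHull f b live a c s v = ≲-≤ (Λ (curve f b) (difference a c)) (const 0ℚ) (2 * s) λ t le →
    ℚ.≤-trans (ℚ.≤-reflexive (sum-cong (suc n) λ k k< → cong (difference a c k *ℚ_) (at-curve t k k<)))
      (valid-nonpositive {λ _ → ⊥} {a} {c} {s} v {f} b (live s) id t le)
    where
    at-curve : ∀ t k → k < suc n → moments (curve f b) t k ≡ pow (lower {node f} (node-binary {f} b) t) k
    at-curve t zero    _         = refl
    at-curve t (suc k) (s≤s k<n) = power-index (expansion {node f} (node-binary {f} b)) k t k<n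

  -- `Λ` respects mixtures. The approximations of `t` may leave the unit interval by `δ`, so lower
  -- bounds on `Λ` at `x` and `y` are needed where a weight has the wrong sign.
  hull-convex : ∀ (x y z : Fin n → UnitReal) (t : UnitReal) → InHull x → InHull y →
                (∀ i → seq (z i) ≃ λ k → (1ℚ -ℚ seq t k) *ℚ seq (x i) k +ℚ seq t k *ℚ seq (y i) k) → InHull z
  hull-convex x y z t x∈ y∈ z≃ a b s v = ≲-trans (Λ z g) mixed (const 0ℚ) (≃-≲ (Λ z g) mixed close) nonpositive
    where
    g = difference a b
    G = norm (suc n) g
    mixed : ℕ → ℚ
    mixed k = (1ℚ -ℚ seq t k) *ℚ Λ x g k +ℚ seq t k *ℚ Λ y g k
    mixed-moments : ℕ → ℕ → ℚ
    mixed-moments k j = (1ℚ -ℚ seq t k) *ℚ moments x k j +ℚ seq t k *ℚ moments y k j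
    regroup : ∀ k → L (suc n) g (mixed-moments k) ≡ mixed k
    regroup k = trans (sum-cong (suc n) λ j _ → lemma (g j) (1ℚ -ℚ seq t k) (moments x k j) (seq t k) (moments y k j))
      (sum-linear (suc n) (1ℚ -ℚ seq t k) (seq t k) (λ j → g j *ℚ moments x k j) (λ j → g j *ℚ moments y k j))
      where
      lemma : ∀ g c x d y → g *ℚ (c *ℚ x +ℚ d *ℚ y) ≡ c *ℚ (g *ℚ x) +ℚ d *ℚ (g *ℚ y)
      lemma = ring-∀ ℚ-ring
    close : Λ z g ≃ mixed
    close ε 0<ε = let (N , f) = L-≃ (suc n) g (moments z) mixed-moments moment≃ ε 0<ε in
      N , λ k N≤k → subst (λ m → ∣ Λ z g k -ℚ m ∣ ≤ℚ 0ℚ +ℚ ε) (regroup k) (f k N≤k)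
      where
      moment≃ : ∀ j → (λ k → moments z k j) ≃ (λ k → mixed-moments k j)
      moment≃ zero    ε 0<ε = 0 , λ k _ → ℚ.≤-trans (ℚ.≤-reflexive (cong ∣_∣ (lemma (seq t k)))) (ℚ.≤-trans (ℚ.<⇒≤ 0<ε) (ℚ.≤-reflexive (sym (ℚ.+-identityˡ ε))))
        where
        lemma : ∀ t → 1ℚ -ℚ ((1ℚ -ℚ t) *ℚ 1ℚ +ℚ t *ℚ 1ℚ) ≡ 0ℚ
        lemma = ring-∀ ℚ-ring
      moment≃ (suc j) = z≃ (index j)
    two = 1ℚ +ℚ 1ℚ
    bounded : ∀ (w : Fin n → UnitReal) → ∃ λ N → ∀ k → N ≤ k → -ℚ (G *ℚ two) ≤ℚ Λ w g k
    bounded w = let (N , f) = collect (λ j N → ∀ k → N ≤ k → ∣ moments w k j ∣ ≤ℚ two) (λ m≤n h k le → h k (ℕ.≤-trans m≤n le)) (suc n) each in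
      N , λ k N≤k → flip (L-bound (suc n) g (moments w k) two (λ j j< → f j j< k N≤k))
      where
      each : ∀ j → j < suc n → ∃ λ N → ∀ k → N ≤ k → ∣ moments w k j ∣ ≤ℚ two
      each zero    _ = 0 , λ _ _ → by-gap 1ℚ (ℚ.nonNegative⁻¹ 1ℚ) refl
      each (suc j) _ = let (M , p) = UnitReal.0≲seq (w (index j)) 1ℚ (ℚ.positive⁻¹ 1ℚ) ; (N , q) = UnitReal.seq≲1 (w (index j)) 1ℚ (ℚ.positive⁻¹ 1ℚ) in
        M ⊔ N , λ k le → ∣∣≤ (q k (ℕ.≤-trans (ℕ.m≤n⊔m M N) le))
          (by-gap _ (0≤-+ (gap (p k (ℕ.≤-trans (ℕ.m≤m⊔n M N) le))) (ℚ.nonNegative⁻¹ 1ℚ)) (lemma (seq (w (index j)) k)))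
        where
        lemma : ∀ x → 1ℚ +ℚ 1ℚ ≡ -ℚ x +ℚ (((x +ℚ 1ℚ) -ℚ 0ℚ) +ℚ 1ℚ)
        lemma = ring-∀ ℚ-ring
      flip : ∀ {l B} → ∣ l ∣ ≤ℚ B → -ℚ B ≤ℚ l
      flip {l} {B} h = by-gap (B -ℚ (-ℚ l)) (gap (ℚ.≤-trans (-≤∣∣ l) h)) (lemma l B)
        where
        lemma : ∀ l B → l ≡ -ℚ B +ℚ (B -ℚ (-ℚ l))
        lemma = ring-∀ ℚ-ring
    nonpositive : mixed ≲ const 0ℚ
    nonpositive ε 0<ε = choose (divide R 0<R ε 0<ε)
      where
      B = G *ℚ two
      0≤B : 0ℚ ≤ℚ B
      0≤B = 0≤-* (0≤norm (suc n) g) (ℚ.nonNegative⁻¹ two)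
      -- The errors add up to `δ * (1 + 2 * δ) + 2 * δ * B`, at most `δ * R` for `δ ≤ 1`.
      R = 1ℚ +ℚ two +ℚ two *ℚ B
      0<R : 0ℚ <ℚ R
      0<R = ℚ.<-≤-trans (ℚ.positive⁻¹ 1ℚ) (by-gap (two +ℚ two *ℚ B) (0≤-+ (ℚ.nonNegative⁻¹ two) (0≤-* (ℚ.nonNegative⁻¹ two) 0≤B)) (ℚ.+-assoc 1ℚ two (two *ℚ B)))
      choose : (∃ λ δ → 0ℚ <ℚ δ × δ *ℚ R ≡ ε) → ∃ λ N → ∀ k → N ≤ k → mixed k ≤ℚ 0ℚ +ℚ ε
      choose (δ₀ , 0<δ₀ , δR≡) = pick (archimedes δ₀ 0<δ₀)
        where
        pick : (∃ λ N → 2^- N <ℚ δ₀) → ∃ λ N → ∀ k → N ≤ k → mixed k ≤ℚ 0ℚ +ℚ ε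
        pick (N₀ , δ<δ₀) =
          let δ = 2^- N₀
              0<δ = 0<2^- N₀
              (N₁ , p₁) = UnitReal.0≲seq t δ 0<δ ; (N₂ , p₂) = UnitReal.seq≲1 t δ 0<δ
              (N₃ , p₃) = x∈ a b s v δ 0<δ ; (N₄ , p₄) = y∈ a b s v δ 0<δ
              (N₅ , p₅) = bounded x ; (N₆ , p₆) = bounded y
          in (N₁ ⊔ N₂) ⊔ ((N₃ ⊔ N₄) ⊔ (N₅ ⊔ N₆)) , λ k le →
               let le₁ = ℕ.m⊔n≤o⇒m≤o (N₁ ⊔ N₂) _ le ; le₂ = ℕ.m⊔n≤o⇒n≤o (N₁ ⊔ N₂) _ le
                   le₃ = ℕ.m⊔n≤o⇒m≤o (N₃ ⊔ N₄) _ le₂ ; le₄ = ℕ.m⊔n≤o⇒n≤o (N₃ ⊔ N₄) _ le₂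
               in estimate δ (seq t k) (Λ x g k) (Λ y g k) (ℚ.<⇒≤ 0<δ) (ℚ.≤-trans (2^-anti (z≤n {N₀})) ℚ.≤-refl) (ℚ.<⇒≤ δ<δ₀)
                    (p₁ k (ℕ.m⊔n≤o⇒m≤o N₁ N₂ le₁)) (p₂ k (ℕ.m⊔n≤o⇒n≤o N₁ N₂ le₁))
                    (p₃ k (ℕ.m⊔n≤o⇒m≤o N₃ N₄ le₃)) (p₄ k (ℕ.m⊔n≤o⇒n≤o N₃ N₄ le₃))
                    (p₅ k (ℕ.m⊔n≤o⇒m≤o N₅ N₆ le₄)) (p₆ k (ℕ.m⊔n≤o⇒n≤o N₅ N₆ le₄))
          where
          estimate : ∀ δ τ X Y → 0ℚ ≤ℚ δ → δ ≤ℚ 1ℚ → δ ≤ℚ δ₀ → 0ℚ ≤ℚ τ +ℚ δ → τ ≤ℚ 1ℚ +ℚ δ → X ≤ℚ 0ℚ +ℚ δ → Y ≤ℚ 0ℚ +ℚ δ →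
                     -ℚ B ≤ℚ X → -ℚ B ≤ℚ Y → (1ℚ -ℚ τ) *ℚ X +ℚ τ *ℚ Y ≤ℚ 0ℚ +ℚ ε
          estimate δ τ X Y 0≤δ δ≤1 δ≤δ₀ hτ τh hX hY bX bY = by-gap _
            (0≤-+ (0≤-+ (0≤-+ (0≤-* (gap τh) (gap hX)) (0≤-* hτ (gap hY))) (0≤-+ (0≤-* 0≤δ (gap bX)) (0≤-* 0≤δ (gap bY))))
              (0≤-+ (0≤-* (gap δ≤δ₀) (ℚ.<⇒≤ 0<R)) (0≤-* (0≤-* (ℚ.nonNegative⁻¹ two) 0≤δ) (gap δ≤1))))
            (trans (cong (0ℚ +ℚ_) (sym δR≡)) (lemma δ δ₀ τ X Y B))
            where
            lemma : ∀ δ δ₀ τ X Y B → 0ℚ +ℚ δ₀ *ℚ (1ℚ +ℚ (1ℚ +ℚ 1ℚ) +ℚ (1ℚ +ℚ 1ℚ) *ℚ B) ≡ ((1ℚ -ℚ τ) *ℚ X +ℚ τ *ℚ Y) +ℚ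
              ((((1ℚ +ℚ δ) -ℚ τ) *ℚ ((0ℚ +ℚ δ) -ℚ X) +ℚ (τ +ℚ δ) *ℚ ((0ℚ +ℚ δ) -ℚ Y)) +ℚ (δ *ℚ (X -ℚ (-ℚ B)) +ℚ δ *ℚ (Y -ℚ (-ℚ B))) +ℚ
               ((δ₀ -ℚ δ) *ℚ (1ℚ +ℚ (1ℚ +ℚ 1ℚ) +ℚ (1ℚ +ℚ 1ℚ) *ℚ B) +ℚ ((1ℚ +ℚ 1ℚ) *ℚ δ) *ℚ (1ℚ -ℚ δ)))
            lemma = ring-∀ ℚ-ring

  -- Evidence that `y` carries weight in the cylinder of `w`: a polynomial that is negative on the
  -- live nodes outside and positive at `y`.
  Certified : (Fin n → UnitReal) → ℕ → Baire → Set
  Certified y ρ w = ∃ λ a → ∃ λ b → ∃ λ s → ∃ λ η →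
    ρ ≤ s × Valid (λ f → f ~[ ρ ] w) s a b × 0ℚ <ℚ η × const η ≲ Λ y (difference a b)

-- Lagrange polynomials and remainders

norm-scale : ∀ m σ P → norm m (λ k → σ *ℚ P k) ≡ ∣ σ ∣ *ℚ norm m P
norm-scale m σ P = trans (sum-cong m λ k _ → ℚ.∣p*q∣≡∣p∣*∣q∣ σ (P k)) (sum-scale m ∣ σ ∣ (λ k → ∣ P k ∣))

others : ℕ → ℕ → (ℕ → ℚ) → List ℚ
others zero    i u = []
others (suc N) i u with N ℕ.≟ i
... | yes _ = others N i u
... | no  _ = u N ∷ others N i u

others-length : ∀ N i u → List.length (others N i u) ≤ N
others-length zero    i u = z≤n
others-length (suc N) i u with N ℕ.≟ i
... | yes _ = ℕ.m≤n⇒m≤1+n (others-length N i u)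
... | no  _ = s≤s (others-length N i u)

others-length< : ∀ N i u → i < N → List.length (others N i u) < N
others-length< (suc N) i u i<1+N with N ℕ.≟ i
... | yes _ = s≤s (others-length N i u)
... | no ne = s≤s (others-length< N i u (ℕ.≤∧≢⇒< (s≤s⁻¹ i<1+N) (λ e → ne (sym e))))

others-∈ : ∀ N i u j → j < N → j ≢ i → u j ∈ᴸ others N i u
others-∈ (suc N) i u j j<1+N j≢i with N ℕ.≟ i | ℕ.m<1+n⇒m<n∨m≡n j<1+N
... | yes refl | inj₂ refl = contradiction refl j≢i
... | yes _    | inj₁ j<N  = others-∈ N i u j j<N j≢i
... | no _     | inj₂ refl = here refl
... | no _     | inj₁ j<N  = there (others-∈ N i u j j<N j≢i)

others-all : ∀ {Q : ℚ → Set} N i u → (∀ j → j < N → j ≢ i → Q (u j)) → All Q (others N i u)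
others-all zero    i u h = []
others-all (suc N) i u h with N ℕ.≟ i
... | yes _ = others-all N i u (λ j j<N → h j (ℕ.m<n⇒m<1+n j<N))
... | no ne = h N ℕ.≤-refl ne ∷ others-all N i u (λ j j<N → h j (ℕ.m<n⇒m<1+n j<N))

pow-anti : ∀ {x} j k → 0ℚ ≤ℚ x → x ≤ℚ 1ℚ → j ≤ k → pow x k ≤ℚ pow x j
pow-anti {x} j k 0≤x x≤1 j≤k = ℚ.≤-trans (ℚ.≤-reflexive (trans (cong (pow x) (sym (ℕ.m+[n∸m]≡n j≤k))) (pow-+ x j (k ∸ j))))
  (by-gap _ (0≤-* (proj₁ (pow-unit j 0≤x x≤1)) (gap (proj₂ (pow-unit (k ∸ j) 0≤x x≤1)))) (lemma (pow x j) (pow x (k ∸ j))))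
  where
  lemma : ∀ a b → a ≡ a *ℚ b +ℚ a *ℚ (1ℚ -ℚ b)
  lemma = ring-∀ ℚ-ring

-- Up to the scale of their values at the nodes, the P i are the Lagrange basis for the nodes u i, i < N.
module Lagrange (n N : ℕ) (N≤ : N ≤ suc n) (u : ℕ → ℚ) (0≤u : ∀ i → 0ℚ ≤ℚ u i) (u≤1 : ∀ i → u i ≤ℚ 1ℚ)
                (δ : ℚ) (0≤δ : 0ℚ ≤ℚ δ) (δ≤1 : δ ≤ℚ 1ℚ)
                (apart : ∀ i j → i < N → j < N → i ≢ j → δ ≤ℚ ∣ u i -ℚ u j ∣) where

  θ : ℚ
  θ = pow δ n

  us : ℕ → List ℚ
  us i = others N i u

  us-length : ∀ i → i < N → List.length (us i) ≤ n
  us-length i i<N = s≤s⁻¹ (ℕ.<-≤-trans (others-length< N i u i<N) N≤)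

  sign : ℚ → ℚ
  sign d with ℚ.≤-total 0ℚ d
  ... | inj₁ _ = 1ℚ
  ... | inj₂ _ = -ℚ 1ℚ

  sign-∣∣ : ∀ d → ∣ sign d ∣ ≡ 1ℚ × sign d *ℚ d ≡ ∣ d ∣
  sign-∣∣ d with ℚ.≤-total 0ℚ d
  ... | inj₁ 0≤d = refl , trans (ℚ.*-identityˡ d) (sym (ℚ.0≤p⇒∣p∣≡p 0≤d))
  ... | inj₂ d≤0 = refl , trans (lemma d) (trans (sym (ℚ.0≤p⇒∣p∣≡p (ℚ.neg-antimono-≤ d≤0))) (ℚ.∣-p∣≡∣p∣ d))
    where
    lemma : ∀ d → (-ℚ 1ℚ) *ℚ d ≡ -ℚ d
    lemma = ring-∀ ℚ-ring

  σ : ℕ → ℚ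
  σ i = sign (product (us i) (u i))

  -- The sign makes the value at the own node positive; the value is not normalised to 1, which
  -- keeps the coefficients bounded by `2 ^ n`.
  P : ℕ → ℕ → ℚ
  P i k = σ i *ℚ monic (us i) k

  ev-P : ∀ i x → i < N → ev n (P i) x ≡ σ i *ℚ product (us i) x
  ev-P i x i<N = trans (trans (sum-cong (suc n) λ k _ → ℚ.*-assoc (σ i) (monic (us i) k) (pow x k)) (sum-scale (suc n) (σ i) (λ k → monic (us i) k *ℚ pow x k))) (cong (σ i *ℚ_) (ev-monic n (us i) x (us-length i i<N)))

  -- A product of at most `n` factors, each at least `δ ≤ 1` in absolute value.
  P-self : ∀ i → i < N → θ ≤ℚ ev n (P i) (u i)
  P-self i i<N = ℚ.≤-trans (pow-anti (List.length (us i)) n 0≤δ δ≤1 (us-length i i<N)) (ℚ.≤-trans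
    (product-bound (us i) (u i) δ 0≤δ (others-all N i u λ j j<N j≢i → apart i j i<N j<N (λ e → j≢i (sym e))))
    (ℚ.≤-reflexive (sym (trans (ev-P i (u i) i<N) (proj₂ (sign-∣∣ (product (us i) (u i))))))))

  P-other : ∀ i j → i < N → j < N → j ≢ i → ev n (P i) (u j) ≡ 0ℚ
  P-other i j i<N j<N j≢i = trans (ev-P i (u j) i<N) (trans (cong (σ i *ℚ_) (product-zero (us i) (u j) (others-∈ N i u j j<N j≢i))) (ℚ.*-zeroʳ (σ i)))

  P-nonneg : ∀ i j → i < N → j < N → 0ℚ ≤ℚ ev n (P i) (u j)
  P-nonneg i j i<N j<N with j ℕ.≟ i
  ... | yes refl = ℚ.≤-trans (proj₁ (pow-unit n 0≤δ δ≤1)) (P-self i i<N)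
  ... | no  j≢i  = ℚ.≤-reflexive (sym (P-other i j i<N j<N j≢i))

  norm-P : ∀ i → i < N → norm (suc n) (P i) ≤ℚ ι (2 ^ n)
  norm-P i i<N = ℚ.≤-trans (ℚ.≤-reflexive (trans (norm-scale (suc n) (σ i) (monic (us i)))
      (trans (cong (_*ℚ norm (suc n) (monic (us i))) (proj₁ (sign-∣∣ (product (us i) (u i))))) (ℚ.*-identityˡ (norm (suc n) (monic (us i)))))))
    (ℚ.≤-trans (norm-monic n (us i) (others-all N i u λ j _ _ → 0≤u j , u≤1 j)) (ι-mono (ℕ.^-monoʳ-≤ 2 (us-length i i<N))))

  module Combination (c : ℕ → ℚ) (λ₀ : ℚ) (0≤c : ∀ i → 0ℚ ≤ℚ c i) (c≤λ : ∀ i → c i ≤ℚ λ₀) where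

    comb : ℕ → ℕ → ℚ
    comb zero    k = 0ℚ
    comb (suc i) k = 1ℚ *ℚ comb i k +ℚ c i *ℚ P i k

    L-comb : ∀ i Y → L (suc n) (comb (suc i)) Y ≡ L (suc n) (comb i) Y +ℚ c i *ℚ L (suc n) (P i) Y
    L-comb i Y = trans (L-linear (suc n) 1ℚ (c i) (comb i) (P i) Y) (cong (_+ℚ c i *ℚ L (suc n) (P i) Y) (ℚ.*-identityˡ (L (suc n) (comb i) Y)))

    L-zero : ∀ m Y → L m (comb 0) Y ≡ 0ℚ
    L-zero zero    Y = refl
    L-zero (suc m) Y = trans (cong₂ _+ℚ_ (L-zero m Y) (ℚ.*-zeroˡ (Y m))) (ℚ.+-identityʳ 0ℚ)

    comb-nonneg : ∀ i j → i ≤ N → j < N → 0ℚ ≤ℚ ev n (comb i) (u j)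
    comb-nonneg zero    j _ _ = ℚ.≤-reflexive (sym (L-zero (suc n) (pow (u j))))
    comb-nonneg (suc i) j i<N j<N = ℚ.≤-trans (0≤-+ (comb-nonneg i j (ℕ.<⇒≤ i<N) j<N) (0≤-* (0≤c i) (P-nonneg i j i<N j<N)))
      (ℚ.≤-reflexive (sym (L-comb i (pow (u j)))))

    comb-at : ∀ i j → i ≤ N → j < i → c j *ℚ θ ≤ℚ ev n (comb i) (u j)
    comb-at (suc i) j i<N j<1+i = ℚ.≤-trans (split (ℕ.m<1+n⇒m<n∨m≡n j<1+i)) (ℚ.≤-reflexive (sym (L-comb i (pow (u j)))))
      where
      split : j < i ⊎ j ≡ i → c j *ℚ θ ≤ℚ ev n (comb i) (u j) +ℚ c i *ℚ ev n (P i) (u j)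
      split (inj₁ j<i)  = ℚ.≤-trans (comb-at i j (ℕ.<⇒≤ i<N) j<i)
        (by-gap _ (0≤-* (0≤c i) (P-nonneg i j i<N (ℕ.<-trans j<i i<N))) refl)
      split (inj₂ refl) = by-gap _ (0≤-+ (comb-nonneg i i (ℕ.<⇒≤ i<N) i<N) (0≤-* (0≤c i) (gap (P-self i i<N)))) (lemma (c i) θ (ev n (comb i) (u i)) (ev n (P i) (u i)))
        where
        lemma : ∀ c θ a e → a +ℚ c *ℚ e ≡ c *ℚ θ +ℚ (a +ℚ c *ℚ (e -ℚ θ))
        lemma = ring-∀ ℚ-ring

    norm-comb : ∀ i → i ≤ N → norm (suc n) (comb i) ≤ℚ ι i *ℚ (λ₀ *ℚ ι (2 ^ n))
    norm-comb zero _ = ℚ.≤-reflexive (trans (zeros (suc n)) (sym (trans (cong (_*ℚ (λ₀ *ℚ ι (2 ^ n))) ι-0) (ℚ.*-zeroˡ (λ₀ *ℚ ι (2 ^ n))))))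
      where
      zeros : ∀ m → norm m (comb 0) ≡ 0ℚ
      zeros zero    = refl
      zeros (suc m) = trans (cong (_+ℚ 0ℚ) (zeros m)) (ℚ.+-identityʳ 0ℚ)
    norm-comb (suc i) i<N = ℚ.≤-trans (norm-combine (suc n) 1ℚ (c i) (comb i) (P i)) (ℚ.≤-trans
      (ℚ.≤-reflexive (cong (λ z → 1ℚ *ℚ A +ℚ z *ℚ B) (ℚ.0≤p⇒∣p∣≡p (0≤c i))))
      (by-gap _ (0≤-+ (0≤-+ (gap (norm-comb i (ℕ.<⇒≤ i<N))) (0≤-* (gap (c≤λ i)) (0≤ι (2 ^ n)))) (0≤-* (0≤c i) (gap (norm-P i i<N))))
        (trans (cong (_*ℚ (λ₀ *ℚ ι (2 ^ n))) (ι-suc i)) (lemma (ι i) λ₀ (ι (2 ^ n)) (c i) A B))))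
      where
      A B : ℚ
      A = norm (suc n) (comb i)
      B = norm (suc n) (P i)
      lemma : ∀ i l M c a b → (1ℚ +ℚ i) *ℚ (l *ℚ M) ≡ (1ℚ *ℚ a +ℚ c *ℚ b) +ℚ ((i *ℚ (l *ℚ M) -ℚ a) +ℚ (l -ℚ c) *ℚ M +ℚ c *ℚ (M -ℚ b))
      lemma = ring-∀ ℚ-ring

    limit-comb : ∀ (Y : ℕ → ℕ → ℚ) κ → 0ℚ ≤ℚ κ → (∀ i → i < N → c i ≡ 0ℚ ⊎ (λ t → L (suc n) (P i) (Y t)) ≲ const κ) →
                 ∀ i → i ≤ N → (λ t → L (suc n) (comb i) (Y t)) ≲ const (ι i *ℚ (λ₀ *ℚ κ))
    limit-comb Y κ 0≤κ hyp zero _ = ≲-≤ (λ t → L (suc n) (comb 0) (Y t)) (const (ι 0 *ℚ (λ₀ *ℚ κ))) 0 λ t _ → ℚ.≤-reflexive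
      (trans (L-zero (suc n) (Y t)) (sym (trans (cong (_*ℚ (λ₀ *ℚ κ)) ι-0) (ℚ.*-zeroˡ (λ₀ *ℚ κ)))))
    limit-comb Y κ 0≤κ hyp (suc i) i<N = ≲-trans (X (suc i)) (const (B i +ℚ c i *ℚ κ)) (const (B (suc i)))
      (unfold (step (hyp i i<N)))
      (≲-≤ (const (B i +ℚ c i *ℚ κ)) (const (B (suc i))) 0 λ _ _ →
        by-gap ((λ₀ -ℚ c i) *ℚ κ) (0≤-* (gap (c≤λ i)) 0≤κ) (trans (cong (_*ℚ (λ₀ *ℚ κ)) (ι-suc i)) (lemma (ι i) λ₀ κ (c i))))
      where
      X : ℕ → ℕ → ℚ
      X j t = L (suc n) (comb j) (Y t)
      B : ℕ → ℚ
      B j = ι j *ℚ (λ₀ *ℚ κ)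
      Z : ℕ → ℚ
      Z t = L (suc n) (P i) (Y t)
      ih : X i ≲ const (B i)
      ih = limit-comb Y κ 0≤κ hyp i (ℕ.<⇒≤ i<N)
      lemma : ∀ i l κ c → (1ℚ +ℚ i) *ℚ (l *ℚ κ) ≡ (i *ℚ (l *ℚ κ) +ℚ c *ℚ κ) +ℚ (l -ℚ c) *ℚ κ
      lemma = ring-∀ ℚ-ring
      unfold : (λ t → X i t +ℚ c i *ℚ Z t) ≲ const (B i +ℚ c i *ℚ κ) → X (suc i) ≲ const (B i +ℚ c i *ℚ κ)
      unfold le ε 0<ε = let (K , f) = le ε 0<ε in K , λ t K≤t → ℚ.≤-trans (ℚ.≤-reflexive (L-comb i (Y t))) (f t K≤t)
      vanish : ∀ x z → c i ≡ 0ℚ → x +ℚ c i *ℚ z ≡ x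
      vanish x z e = trans (cong (λ d → x +ℚ d *ℚ z) e) (trans (cong (x +ℚ_) (ℚ.*-zeroˡ z)) (ℚ.+-identityʳ x))
      step : c i ≡ 0ℚ ⊎ Z ≲ const κ → (λ t → X i t +ℚ c i *ℚ Z t) ≲ const (B i +ℚ c i *ℚ κ)
      step (inj₂ le) = ≲-linear (X i) (const (B i)) Z (const κ) (c i) (0≤c i) ih le
      step (inj₁ e) ε 0<ε = let (K , f) = ih ε 0<ε in K , λ t K≤t →
        ℚ.≤-trans (ℚ.≤-reflexive (vanish (X i t) (Z t) e)) (ℚ.≤-trans (f t K≤t) (ℚ.≤-reflexive (cong (_+ℚ ε) (sym (vanish (B i) κ e)))))

  -- Subtracting large multiples of P j at the nodes where f may be positive leaves a polynomial that is nonpositive at all nodes.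
  module Remainder (f : ℕ → ℚ) (λ₀ : ℚ) (0≤λ₀ : 0ℚ ≤ℚ λ₀) (λθ : λ₀ *ℚ θ ≡ norm (suc n) f +ℚ 1ℚ)
                   (c : ℕ → ℚ) (c-cases : ∀ i → c i ≡ λ₀ ⊎ c i ≡ 0ℚ) (f≤0 : ∀ i → i < N → c i ≡ λ₀ ⊎ ev n f (u i) ≤ℚ 0ℚ) where

    0≤c : ∀ i → 0ℚ ≤ℚ c i
    0≤c i with c-cases i
    ... | inj₁ e = ℚ.≤-trans 0≤λ₀ (ℚ.≤-reflexive (sym e))
    ... | inj₂ e = ℚ.≤-reflexive (sym e)

    c≤λ : ∀ i → c i ≤ℚ λ₀
    c≤λ i with c-cases i
    ... | inj₁ e = ℚ.≤-reflexive e
    ... | inj₂ e = ℚ.≤-trans (ℚ.≤-reflexive e) 0≤λ₀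

    open Combination c λ₀ 0≤c c≤λ public

    remainder : ℕ → ℚ
    remainder k = 1ℚ *ℚ f k +ℚ (-ℚ 1ℚ) *ℚ comb N k

    L-remainder : ∀ Y → L (suc n) f Y ≡ L (suc n) remainder Y +ℚ L (suc n) (comb N) Y
    L-remainder Y = trans (lemma (L (suc n) f Y) (L (suc n) (comb N) Y)) (cong (_+ℚ L (suc n) (comb N) Y) (sym (L-linear (suc n) 1ℚ (-ℚ 1ℚ) f (comb N) Y)))
      where
      lemma : ∀ x y → x ≡ (1ℚ *ℚ x +ℚ (-ℚ 1ℚ) *ℚ y) +ℚ y
      lemma = ring-∀ ℚ-ring

    norm-remainder : norm (suc n) remainder ≤ℚ norm (suc n) f +ℚ ι N *ℚ (λ₀ *ℚ ι (2 ^ n))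
    norm-remainder = ℚ.≤-trans (norm-combine (suc n) 1ℚ (-ℚ 1ℚ) f (comb N)) (ℚ.+-mono-≤
      (ℚ.≤-reflexive (ℚ.*-identityˡ (norm (suc n) f)))
      (ℚ.≤-trans (ℚ.≤-reflexive (ℚ.*-identityˡ (norm (suc n) (comb N)))) (norm-comb N ℕ.≤-refl)))

    remainder-nonpositive : ∀ j → j < N → ev n remainder (u j) ≤ℚ 0ℚ
    remainder-nonpositive j j<N = rearrange (L-remainder (pow (u j))) (dominated (f≤0 j j<N))
      where
      dominated : c j ≡ λ₀ ⊎ ev n f (u j) ≤ℚ 0ℚ → ev n f (u j) ≤ℚ ev n (comb N) (u j)
      dominated (inj₂ le) = ℚ.≤-trans le (comb-nonneg N j ℕ.≤-refl j<N)
      -- Here `λ₀ * θ` exceeds the norm of `f`, and so all its values on the unit interval.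
      dominated (inj₁ e) = ℚ.≤-trans (≤∣∣ (ev n f (u j))) (ℚ.≤-trans (ev-bound n f (0≤u j) (u≤1 j))
        (ℚ.≤-trans (by-gap 1ℚ (ℚ.nonNegative⁻¹ 1ℚ) (trans (cong (_*ℚ θ) e) λθ)) (comb-at N j ℕ.≤-refl j<N)))
      rearrange : ∀ {x y z} → x ≡ y +ℚ z → x ≤ℚ z → y ≤ℚ 0ℚ
      rearrange {x} {y} {z} e le = by-gap (z -ℚ x) (gap le) (trans (lemma y z) (cong (λ w → y +ℚ (z -ℚ w)) (sym e)))
        where
        lemma : ∀ y z → 0ℚ ≡ y +ℚ (z -ℚ (y +ℚ z))
        lemma = ring-∀ ℚ-ring

positive-+1 : ∀ x → 0ℚ ≤ℚ x → 0ℚ <ℚ x +ℚ 1ℚ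
positive-+1 x 0≤x = ℚ.<-≤-trans (ℚ.positive⁻¹ 1ℚ) (by-gap x 0≤x (ℚ.+-comm x 1ℚ))

≲-affine : ∀ (x : ℕ → ℚ) a c D → 0ℚ <ℚ D → const a ≲ x → const (D *ℚ (a +ℚ c)) ≲ λ t → D *ℚ (x t +ℚ c)
≲-affine x a c D 0<D h ε 0<ε = shrink (divide D 0<D ε 0<ε)
  where
  shrink : (∃ λ δ → 0ℚ <ℚ δ × δ *ℚ D ≡ ε) → ∃ λ N → ∀ t → N ≤ t → D *ℚ (a +ℚ c) ≤ℚ D *ℚ (x t +ℚ c) +ℚ ε
  shrink (δ , 0<δ , e) = let (N , f) = h δ 0<δ in N , λ t N≤t →
    by-gap _ (0≤-* (ℚ.<⇒≤ 0<D) (gap (f t N≤t))) (trans (cong (D *ℚ (x t +ℚ c) +ℚ_) (sym e)) (lemma D (x t) a c δ))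
    where
    lemma : ∀ D x a c δ → D *ℚ (x +ℚ c) +ℚ δ *ℚ D ≡ D *ℚ (a +ℚ c) +ℚ D *ℚ (x +ℚ δ -ℚ a)
    lemma = ring-∀ ℚ-ring

-- Refining a certificate by one digit

module Points (em : ExcludedMiddle 0ℓ) (n′ : ℕ) (p : Baire) where

  open Hull em n′ p

  module _ (N : ℕ) (N≤ : N ≤ suc n) (α : ℕ → Baire) (αb : ∀ i → Binary (α i))
           (alive : ∀ i → i < N → ∀ s → Live s (α i))
           (cover : ∀ f → Binary f → (∀ s → Live s f) → ∃ λ i → i < N × f ≗ α i)
           (distinct : ∀ i j → i < N → j < N → α i ≗ α j → i ≡ j) where

    separation : ∃ λ r₀ → ∀ i → i < N → ∀ j → j < N → i ≢ j → ∃ λ m → m < r₀ × α i m ≢ α j m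
    separation = collect (λ i r → ∀ j → j < N → i ≢ j → ∃ λ m → m < r × α i m ≢ α j m)
        (λ r≤r′ h j j< ne → let (m , m< , d) = h j j< ne in m , ℕ.<-≤-trans m< r≤r′ , d) N
        λ i i<N → collect (λ j r → i ≢ j → ∃ λ m → m < r × α i m ≢ α j m)
          (λ r≤r′ h ne → let (m , m< , d) = h ne in m , ℕ.<-≤-trans m< r≤r′ , d) N
          λ j j<N → pair i j i<N j<N em
      where
      pair : ∀ i j → i < N → j < N → Dec (i ≡ j) → ∃ λ r → i ≢ j → ∃ λ m → m < r × α i m ≢ α j m
      pair i j _ _ (yes e) = 0 , λ ne → contradiction e ne
      pair i j i< j< (no ne) = let (m , d) = ¬∀ em (λ e → ne (distinct i j i< j< e)) in suc m , λ _ → m , ℕ.≤-refl , d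

    r₀ : ℕ
    r₀ = proj₁ separation

    apart : ∀ i j → i < N → j < N → i ≢ j → ∀ s → r₀ ≤ s → 2^- suc (2 * r₀) ≤ℚ ∣ lo {α i} (αb i) s -ℚ lo {α j} (αb j) s ∣
    apart i j i< j< ne s r₀≤s = order (least-witness em (λ m → α i m ≢ α j m) (_ , proj₂ (proj₂ sep)))
      where
      sep = proj₂ separation i i< j j< ne
      0≤δ = ℚ.<⇒≤ (0<2^- (suc (2 * r₀)))
      order : (∃ λ m → α i m ≢ α j m × (∀ k → k < m → ¬ α i k ≢ α j k)) → 2^- suc (2 * r₀) ≤ℚ ∣ lo {α i} (αb i) s -ℚ lo {α j} (αb j) s ∣
      order (m , d , agree) = cases (ℕ.<-cmp (α i m) (α j m))
        where
        same : α i ~[ m ] α j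
        same k k<m = dne em (agree k k<m)
        m<r₀ : m < r₀
        m<r₀ = ℕ.≤-<-trans (ℕ.≮⇒≥ λ lt → proj₂ (proj₂ sep) (same _ lt)) (proj₁ (proj₂ sep))
        cases : _ → 2^- suc (2 * r₀) ≤ℚ ∣ lo {α i} (αb i) s -ℚ lo {α j} (αb j) s ∣
        cases (tri< lt _ _) = proj₁ (difference-at (lo {α i} (αb i) s) (lo {α j} (αb j) s) 0≤δ (lo-apart {α i} {α j} (αb i) (αb j) same lt m<r₀ r₀≤s))
        cases (tri≈ _ e _)  = contradiction e d
        cases (tri> _ _ gt) = proj₂ (difference-at (lo {α j} (αb j) s) (lo {α i} (αb i) s) 0≤δ (lo-apart {α j} {α i} (αb j) (αb i) (~-sym same) gt m<r₀ r₀≤s))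

    -- Otherwise compactness would give a sequence alive at every stage and different from all `α i`
    -- within `r` digits, against `cover`.
    near-points : ∀ r s₀ → ∃ λ s₁ → s₀ ≤ s₁ × (∀ f → Binary f → Live s₁ f → ∃ λ i → i < N × f ~[ r ] α i)
    near-points r s₀ = dne em λ none →
      let (f , b , t) = kőnig em (λ s f → Live (s₀ + s) f × (∀ i → i < N → ¬ f ~[ r ] α i)) (λ s → (s₀ + s) ⊔ r)
            (λ {s} {f} _ (l , far) → (λ d → l (Dead-mono {p} {f} (ℕ.+-monoʳ-≤ s₀ (ℕ.n≤1+n s)) d)) , far)
            (λ {s} {f} {g} e (l , far) → (λ d → l (Dead-local {p} {g} {f} {s₀ + s} (~-sym (~-mono (ℕ.m≤m⊔n (s₀ + s) r) e)) d)) ,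
              λ i i<N e′ → far i i<N (~-trans (~-mono (ℕ.m≤n⊔m (s₀ + s) r) e) e′))
            (λ s → dne em λ none′ → none (s₀ + s , ℕ.m≤m+n s₀ s , λ f b l → dne em λ far → none′ (f , b , l , λ i i<N e → far (i , i<N , e))))
          (i , i<N , e) = cover f b (λ s d → proj₁ (t s) (Dead-mono {p} {f} (ℕ.m≤n+m s s₀) d))
      in proj₂ (t 0) i i<N (λ m _ → e m)

    -- `δ` bounds the distances of the nodes from below, `M` the norms of the Lagrange polynomials
    -- from above; both are fixed before the mesh is chosen.
    δ M : ℚ
    δ = 2^- suc (2 * r₀)
    M = ι (2 ^ n)

    0<δ : 0ℚ <ℚ δ
    0<δ = 0<2^- (suc (2 * r₀))

    δ≤1 : δ ≤ℚ 1ℚ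
    δ≤1 = ℚ.≤-trans (2^-anti (z≤n {suc (2 * r₀)})) ℚ.≤-refl

    module Nodes (r : ℕ) (r₀≤r : r₀ ≤ r) where

      u : ℕ → ℚ
      u i = lo {α i} (αb i) r

      open Lagrange n N N≤ u (λ i → 0≤lo {α i} (αb i) r) (λ i → lo≤1 {α i} (αb i) r) δ (ℚ.<⇒≤ 0<δ) δ≤1
        (λ i j i< j< ne → apart i j i< j< ne r r₀≤r) public

      h : ℚ
      h = 2^- (2 * r)

      near-value : ∀ Q j {f} (b : Binary f) s → r ≤ s → f ~[ r ] α j → ev n Q (lo {f} b s) ≤ℚ ev n Q (u j) +ℚ norm (suc n) Q *ℚ (ι n *ℚ h)
      near-value Q j {f} b s r≤s e = estimate
          (ev-lipschitz n Q {lo {f} b s} {u j} (0≤lo {f} b s) (lo≤1 {f} b s) (0≤lo {α j} (αb j) r) (lo≤1 {α j} (αb j) r))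
          (lo-close {f} {α j} b (αb j) {r} {s} {r} e r≤s ℕ.≤-refl) (0≤norm (suc n) Q) (0≤ι n)
        where
        estimate : ∀ {x y N n d h} → ∣ x -ℚ y ∣ ≤ℚ N *ℚ (n *ℚ d) → d ≤ℚ h → 0ℚ ≤ℚ N → 0ℚ ≤ℚ n → x ≤ℚ y +ℚ N *ℚ (n *ℚ h)
        estimate {x} {y} {N} {n} {d} {h} le d≤h 0≤N 0≤n = by-gap _
          (0≤-+ (gap (ℚ.≤-trans (≤∣∣ (x -ℚ y)) le)) (0≤-* 0≤N (0≤-* 0≤n (gap d≤h)))) (lemma x y N n d h)
          where
          lemma : ∀ x y N n d h → y +ℚ N *ℚ (n *ℚ h) ≡ x +ℚ ((N *ℚ (n *ℚ d) -ℚ (x -ℚ y)) +ℚ N *ℚ (n *ℚ (h -ℚ d)))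
          lemma = ring-∀ ℚ-ring

    -- The given polynomial is a combination of Lagrange polynomials of nodes in the cylinder of
    -- `w`, plus a remainder that is nonpositive at all nodes and hence almost so at `y`. One of
    -- these Lagrange polynomials is therefore positive at `y`, and it vanishes at the other nodes.
    module Refine (y : Fin n → UnitReal) (y∈ : InHull y) (ρ : ℕ) (w : Baire) (a b : ℕ → ℕ) (s₀ : ℕ)
                  (v : Valid (λ f → f ~[ ρ ] w) s₀ a b)
                  (η : ℚ) (0<η : 0ℚ <ℚ η) (η≤ : const η ≲ Λ y (difference a b)) where

      private
        f : ℕ → ℚ
        f = difference a b
        F : ℚ
        F = norm (suc n) f

      module _ (λ₀ : ℚ) (0<λ₀ : 0ℚ <ℚ λ₀) (λθ : λ₀ *ℚ pow δ n ≡ F +ℚ 1ℚ) where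

        -- If no P i had a large value at y, then η would be at most C₀ times the mesh of the nodes.
        C₀ : ℚ
        C₀ = (F +ℚ ι N *ℚ (λ₀ *ℚ M)) *ℚ ι n +ℚ ι N *ℚ (λ₀ *ℚ ((1ℚ +ℚ 1ℚ +ℚ 1ℚ) *ℚ (M *ℚ ι n))) +ℚ 1ℚ

        module _ (r : ℕ) (r₀≤r : r₀ ≤ r) (s₀≤r : s₀ ≤ r) (ρ<r : suc ρ ≤ r) (small : C₀ *ℚ 2^- (2 * r) <ℚ η) where

          open Nodes r r₀≤r

          private
            -- `ε` bounds the variation of a Lagrange polynomial around a node. Subtracting `2ε`
            -- leaves more than nothing of a value `3ε` at `y`, namely `ε`, and makes the polynomial
            -- at most `-ε` near the other nodes.
            ε κ : ℚ
            ε = M *ℚ (ι n *ℚ h)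
            κ = ε +ℚ ε +ℚ ε

            0<h : 0ℚ <ℚ h
            0<h = 0<2^- (2 * r)

            0<ε : 0ℚ <ℚ ε
            0<ε = 0<-* (0<ι2^ n) (0<-* (0<ι n′) 0<h)

          close : ℕ → Set
          close i = α i ~[ ρ ] w

          choose : ∀ {A : Set} → Dec A → ℚ
          choose (yes _) = λ₀
          choose (no _)  = 0ℚ

          choose-cases : ∀ {A : Set} (d : Dec A) → choose d ≡ λ₀ ⊎ choose d ≡ 0ℚ
          choose-cases (yes _) = inj₁ refl
          choose-cases (no _)  = inj₂ refl

          choose-if : ∀ {A B : Set} (d : Dec A) → (¬ A → B) → choose d ≡ λ₀ ⊎ B
          choose-if (yes _) _ = inj₁ refl
          choose-if (no ¬a) g = inj₂ (g ¬a)

          choose-else : ∀ {A B : Set} (d : Dec A) → (A → B) → choose d ≡ 0ℚ ⊎ B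
          choose-else (yes x) g = inj₂ (g x)
          choose-else (no _)  _ = inj₁ refl

          c : ℕ → ℚ
          c i = choose (em {close i})

          open Remainder f λ₀ (ℚ.<⇒≤ 0<λ₀) λθ c (λ i → choose-cases (em {close i}))
            (λ i i<N → choose-if (em {close i}) λ far →
              valid-nonpositive {λ g → g ~[ ρ ] w} {a} {b} {s₀} v {α i} (αb i) (alive i i<N s₀) far (2 * r) (ℕ.*-monoʳ-≤ 2 s₀≤r))

          remainder-small : Λ y remainder ≲ const (norm (suc n) remainder *ℚ (ι n *ℚ h))
          remainder-small = let (s₁ , r≤s₁ , near) = near-points r r in
            hull-bound y y∈ remainder (norm (suc n) remainder *ℚ (ι n *ℚ h)) s₁ λ g bg live s s₁≤s →
              let (i , i<N , e) = near g bg live in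
              ℚ.≤-trans (near-value remainder i {g} bg s (ℕ.≤-trans r≤s₁ s₁≤s) e)
                (drop (remainder-nonpositive i i<N))
            where
            drop : ∀ {x y} → x ≤ℚ 0ℚ → x +ℚ y ≤ℚ y
            drop {x} {y} le = ℚ.≤-trans (ℚ.+-monoˡ-≤ y le) (ℚ.≤-reflexive (ℚ.+-identityˡ y))

          some-large : ∃ λ i → i < N × close i × ¬ Λ y (P i) ≲ const κ
          some-large = dne em λ none → ℚ.<-irrefl refl (ℚ.≤-<-trans (total none) small)
            where
            B K : ℚ
            B = norm (suc n) remainder *ℚ (ι n *ℚ h)
            K = ι N *ℚ (λ₀ *ℚ κ)
            module _ (none : ¬ (∃ λ i → i < N × close i × ¬ Λ y (P i) ≲ const κ)) where
              combined : Λ y (comb N) ≲ const K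
              combined = limit-comb (moments y) κ (ℚ.<⇒≤ (0≤3 0<ε)) (λ i i<N → choose-else (em {close i}) λ ci →
                dne em λ large → none (i , i<N , ci , large)) N ℕ.≤-refl
                where
                0≤3 : ∀ {ε} → 0ℚ <ℚ ε → 0ℚ <ℚ ε +ℚ ε +ℚ ε
                0≤3 p = ℚ.+-mono-< (ℚ.+-mono-< p p) p
              summed : Λ y f ≲ const (B +ℚ K)
              summed = ≲-sum (Λ y remainder) (Λ y (comb N)) (Λ y f) B K remainder-small combined (λ t → L-remainder (moments y t))
              total : η ≤ℚ C₀ *ℚ h
              total = ℚ.≤-trans (const-≲ η (B +ℚ K) (≲-trans (const η) (Λ y f) (const (B +ℚ K)) η≤ summed))
                (estimate {norm (suc n) remainder} {F} {ι N} {λ₀} {M} {ι n} {h} norm-remainder (0≤-* (0≤ι n) (ℚ.<⇒≤ 0<h)) (ℚ.<⇒≤ 0<h))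
                where
                estimate : ∀ {R F N λ₀ M n h} → R ≤ℚ F +ℚ N *ℚ (λ₀ *ℚ M) → 0ℚ ≤ℚ n *ℚ h → 0ℚ ≤ℚ h →
                           R *ℚ (n *ℚ h) +ℚ N *ℚ (λ₀ *ℚ (M *ℚ (n *ℚ h) +ℚ M *ℚ (n *ℚ h) +ℚ M *ℚ (n *ℚ h))) ≤ℚ
                           ((F +ℚ N *ℚ (λ₀ *ℚ M)) *ℚ n +ℚ N *ℚ (λ₀ *ℚ ((1ℚ +ℚ 1ℚ +ℚ 1ℚ) *ℚ (M *ℚ n))) +ℚ 1ℚ) *ℚ h
                estimate {R} {F} {N} {λ₀} {M} {n} {h} le 0≤nh 0≤h = by-gap _ (0≤-+ (0≤-* (gap le) 0≤nh) 0≤h) (lemma R F N λ₀ M n h)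
                  where
                  lemma : ∀ R F N l M n h → ((F +ℚ N *ℚ (l *ℚ M)) *ℚ n +ℚ N *ℚ (l *ℚ ((1ℚ +ℚ 1ℚ +ℚ 1ℚ) *ℚ (M *ℚ n))) +ℚ 1ℚ) *ℚ h ≡
                    R *ℚ (n *ℚ h) +ℚ N *ℚ (l *ℚ (M *ℚ (n *ℚ h) +ℚ M *ℚ (n *ℚ h) +ℚ M *ℚ (n *ℚ h))) +ℚ ((F +ℚ N *ℚ (l *ℚ M) -ℚ R) *ℚ (n *ℚ h) +ℚ h)
                  lemma = ring-∀ ℚ-ring

          certify : ∀ i → i < N → ¬ Λ y (P i) ≲ const κ → Certified y (suc ρ) (α i)
          certify i i<N large = finish (realise Q ε 0<ε s₁ (λ g → g ~[ suc ρ ] α i) negative)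
            where
            c₂ : ℚ
            c₂ = -ℚ (ε +ℚ ε)
            Q = add-constant (P i) c₂
            near = near-points r r
            s₁ = proj₁ near
            r≤s₁ = proj₁ (proj₂ near)
            bound : ∀ {x e N B m} → x ≤ℚ e +ℚ N *ℚ m → e ≡ 0ℚ → N ≤ℚ B → 0ℚ ≤ℚ m → x +ℚ (-ℚ (B *ℚ m +ℚ B *ℚ m)) +ℚ B *ℚ m ≤ℚ 0ℚ
            bound {x} {e} {N} {B} {m} le refl N≤B 0≤m = by-gap _ (0≤-+ (gap le) (0≤-* (gap N≤B) 0≤m)) (lemma x N B m)
              where
              lemma : ∀ x N B m → 0ℚ ≡ (x +ℚ (-ℚ (B *ℚ m +ℚ B *ℚ m)) +ℚ B *ℚ m) +ℚ ((0ℚ +ℚ N *ℚ m -ℚ x) +ℚ (B -ℚ N) *ℚ m)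
              lemma = ring-∀ ℚ-ring
            negative : ∀ g (bg : Binary g) → Live s₁ g → ¬ g ~[ suc ρ ] α i → ∀ s → s₁ ≤ s → ev n Q (lo {g} bg s) +ℚ ε ≤ℚ 0ℚ
            negative g bg live far s s₁≤s = at-node (proj₂ (proj₂ near) g bg live)
              where
              at-node : (∃ λ j → j < N × g ~[ r ] α j) → ev n Q (lo {g} bg s) +ℚ ε ≤ℚ 0ℚ
              at-node (j , j<N , e) = ℚ.≤-trans
                (ℚ.≤-reflexive (cong (_+ℚ ε) (L-add-constant (P i) c₂ (pow (lo {g} bg s)) refl)))
                (bound (near-value (P i) j {g} bg s (ℕ.≤-trans r≤s₁ s₁≤s) e)
                  -- For `j = i` the sequence `g` would be excepted, since `suc ρ ≤ r`.
                  (P-other i j i<N j<N λ j≡i → far (~-mono ρ<r (subst (λ k → g ~[ r ] α k) j≡i e)))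
                  (norm-P i i<N) (0≤-* (0≤ι n) (ℚ.<⇒≤ 0<h)))
            finish : (∃ λ d → ∃ λ a → ∃ λ b → ∃ λ s → s₁ ≤ s × Valid (λ g → g ~[ suc ρ ] α i) s a b × (∀ k → k < suc n → difference a b k ≡ ι (suc d) *ℚ Q k)) →
                     Certified y (suc ρ) (α i)
            finish (d , a′ , b′ , s , s₁≤s , v′ , e) = a′ , b′ , s , ι (suc d) *ℚ (κ +ℚ c₂) ,
              ℕ.≤-trans ρ<r (ℕ.≤-trans r≤s₁ s₁≤s) , v′ , 0<-* (0<ι d) (ℚ.<-≤-trans 0<ε (ℚ.≤-reflexive (remaining ε))) ,
              ≲-trans (const (ι (suc d) *ℚ (κ +ℚ c₂))) (λ t → ι (suc d) *ℚ (Λ y (P i) t +ℚ c₂)) (Λ y (difference a′ b′))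
                (≲-affine (Λ y (P i)) κ c₂ (ι (suc d)) (0<ι d) (≲-total em (Λ y (P i)) (const κ) (Λ-cauchy y (P i)) (const-cauchy κ) large))
                (≲-≤ (λ t → ι (suc d) *ℚ (Λ y (P i) t +ℚ c₂)) (Λ y (difference a′ b′)) 0 λ t _ → ℚ.≤-reflexive (sym
                  (trans (L-scaled {Q} {difference a′ b′} (ι (suc d)) (moments y t) e) (cong (ι (suc d) *ℚ_) (L-add-constant (P i) c₂ (moments y t) refl)))))
              where
              remaining : ∀ ε → ε ≡ (ε +ℚ ε +ℚ ε) +ℚ (-ℚ (ε +ℚ ε))
              remaining = ring-∀ ℚ-ring

          refined : ∃ λ i → i < N × α i ~[ ρ ] w × Certified y (suc ρ) (α i)
          refined = let (i , i<N , ci , large) = some-large in i , i<N , ci , certify i i<N large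

    opaque
      -- `λ₀` and `C₀` depend on `δ` but not on the mesh, so the mesh can be chosen afterwards,
      -- below `η / C₀`.
      refine : ∀ y → InHull y → ∀ ρ w → Certified y ρ w → ∃ λ i → i < N × α i ~[ ρ ] w × Certified y (suc ρ) (α i)
      refine y y∈ ρ w (a , b , s₀ , η , _ , v , 0<η , η≤) = scaled (divide (pow δ n) (pow-positive n 0<δ) (norm (suc n) (difference a b) +ℚ 1ℚ)
          (positive-+1 (norm (suc n) (difference a b)) (0≤norm (suc n) (difference a b))))
        where
        scaled : (∃ λ λ₀ → 0ℚ <ℚ λ₀ × λ₀ *ℚ pow δ n ≡ norm (suc n) (difference a b) +ℚ 1ℚ) → ∃ λ i → i < N × α i ~[ ρ ] w × Certified y (suc ρ) (α i)
        scaled (λ₀ , 0<λ₀ , λθ) = meshed (divide C₁ 0<C₁ η 0<η)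
          where
          C₁ : ℚ
          C₁ = Refine.C₀ y y∈ ρ w a b s₀ v η 0<η η≤ λ₀ 0<λ₀ λθ
          0≤M : 0ℚ ≤ℚ M
          0≤M = 0≤ι (2 ^ n)
          0<C₁ : 0ℚ <ℚ C₁
          0<C₁ = positive-+1 ((norm (suc n) (difference a b) +ℚ ι N *ℚ (λ₀ *ℚ M)) *ℚ ι n +ℚ ι N *ℚ (λ₀ *ℚ ((1ℚ +ℚ 1ℚ +ℚ 1ℚ) *ℚ (M *ℚ ι n)))) (0≤-+
            (0≤-* (0≤-+ (0≤norm (suc n) (difference a b)) (0≤-* (0≤ι N) (0≤-* (ℚ.<⇒≤ 0<λ₀) 0≤M))) (0≤ι n))
            (0≤-* (0≤ι N) (0≤-* (ℚ.<⇒≤ 0<λ₀) (0≤-* (ℚ.nonNegative⁻¹ (1ℚ +ℚ 1ℚ +ℚ 1ℚ)) (0≤-* 0≤M (0≤ι n))))))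
          meshed : (∃ λ h₀ → 0ℚ <ℚ h₀ × h₀ *ℚ C₁ ≡ η) → ∃ λ i → i < N × α i ~[ ρ ] w × Certified y (suc ρ) (α i)
          meshed (h₀ , 0<h₀ , e) = deep (archimedes h₀ 0<h₀)
            where
            deep : (∃ λ T → 2^- T <ℚ h₀) → ∃ λ i → i < N × α i ~[ ρ ] w × Certified y (suc ρ) (α i)
            deep (T , lt) = Refine.refined y y∈ ρ w a b s₀ v η 0<η η≤ λ₀ 0<λ₀ λθ r
                (ℕ.m⊔n≤o⇒m≤o r₀ s₀ (ℕ.m≤m⊔n (r₀ ⊔ s₀) (suc ρ ⊔ T))) (ℕ.m⊔n≤o⇒n≤o r₀ s₀ (ℕ.m≤m⊔n (r₀ ⊔ s₀) (suc ρ ⊔ T)))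
                (ℕ.m⊔n≤o⇒m≤o (suc ρ) T (ℕ.m≤n⊔m (r₀ ⊔ s₀) (suc ρ ⊔ T)))
                (ℚ.<-≤-trans (ℚ.*-monoʳ-<-pos C₁ {{ℚ.positive 0<C₁}} (ℚ.≤-<-trans (2^-anti T≤2r) lt)) (ℚ.≤-reflexive (trans (ℚ.*-comm C₁ h₀) e)))
              where
              r : ℕ
              r = (r₀ ⊔ s₀) ⊔ (suc ρ ⊔ T)
              T≤2r : T ≤ 2 * r
              T≤2r = ℕ.≤-trans (ℕ.m⊔n≤o⇒n≤o (suc ρ) T (ℕ.m≤n⊔m (r₀ ⊔ s₀) (suc ρ ⊔ T))) (ℕ.m≤m+n r (r + 0))

-- Evaluating a polynomial on approximate moments

L-minus : ∀ m P Y Z → L m P Y -ℚ L m P Z ≡ L m P (λ k → Y k -ℚ Z k)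
L-minus m P Y Z = trans (lemma (L m P Y) (L m P Z)) (trans (sym (sum-linear m 1ℚ (-ℚ 1ℚ) (λ k → P k *ℚ Y k) (λ k → P k *ℚ Z k)))
  (sum-cong m λ k _ → lemma′ (P k) (Y k) (Z k)))
  where
  lemma : ∀ x y → x -ℚ y ≡ 1ℚ *ℚ x +ℚ (-ℚ 1ℚ) *ℚ y
  lemma = ring-∀ ℚ-ring
  lemma′ : ∀ p y z → 1ℚ *ℚ (p *ℚ y) +ℚ (-ℚ 1ℚ) *ℚ (p *ℚ z) ≡ p *ℚ (y -ℚ z)
  lemma′ = ring-∀ ℚ-ring

ratio-close : ∀ N D V e → distance (N * 2 ^ e) (V * suc D) ≤ suc D → ∣ (ℤ.+ N) /ℚ suc D -ℚ V /2^ e ∣ ≤ℚ 2^- e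
ratio-close N D V e h = ∣∣≤
  (clear-≤ (x -ℚ V /2^ e) (2^- e) (N * 2 ^ e) (V * suc D + suc D)
    (trans (expand₁ x (ι V) (2^- e) d B) (cong₂ _-ℚ_ (trans (cong (_*ℚ B) xd) (sym (ι-* N (2 ^ e)))) (trans (cong (_*ℚ (ι V *ℚ d)) tB) (trans (ℚ.*-identityˡ (ι V *ℚ d)) (sym (ι-* V (suc D)))))))
    (trans (expand₂ (2^- e) d B) (trans (cong (_*ℚ d) tB) (ℚ.*-identityˡ d)))
    (ℚ.≤-reflexive (ι-+ (V * suc D) (suc D))) (over (N * 2 ^ e) (V * suc D) (ℕ.m+n≤o⇒m≤o (N * 2 ^ e ∸ V * suc D) h)))
  (clear-≤ (-ℚ (x -ℚ V /2^ e)) (2^- e) (V * suc D) (N * 2 ^ e + suc D)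
    (trans (expand₃ x (ι V) (2^- e) d B) (cong₂ _-ℚ_ (trans (cong (_*ℚ (ι V *ℚ d)) tB) (trans (ℚ.*-identityˡ (ι V *ℚ d)) (sym (ι-* V (suc D))))) (trans (cong (_*ℚ B) xd) (sym (ι-* N (2 ^ e))))))
    (trans (expand₂ (2^- e) d B) (trans (cong (_*ℚ d) tB) (ℚ.*-identityˡ d)))
    (ℚ.≤-reflexive (ι-+ (N * 2 ^ e) (suc D))) (over (V * suc D) (N * 2 ^ e) (ℕ.m+n≤o⇒n≤o (N * 2 ^ e ∸ V * suc D) h)))
  where
  x = (ℤ.+ N) /ℚ suc D
  d = ι (suc D)
  B = ι (2 ^ e)
  xd : x *ℚ d ≡ ι N
  xd = /-ι N D
  tB : 2^- e *ℚ B ≡ 1ℚ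
  tB = 2^-ι e
  over : ∀ m k → m ∸ k ≤ suc D → m ≤ k + suc D
  over m k le = ℕ.≤-trans (ℕ.m≤n+m∸n m k) (ℕ.+-monoʳ-≤ k le)
  expand₁ : ∀ x V t d B → (x -ℚ V *ℚ t) *ℚ (d *ℚ B) ≡ (x *ℚ d) *ℚ B -ℚ (t *ℚ B) *ℚ (V *ℚ d)
  expand₁ = ring-∀ ℚ-ring
  expand₂ : ∀ t d B → t *ℚ (d *ℚ B) ≡ (t *ℚ B) *ℚ d
  expand₂ = ring-∀ ℚ-ring
  expand₃ : ∀ x V t d B → (-ℚ (x -ℚ V *ℚ t)) *ℚ (d *ℚ B) ≡ (t *ℚ B) *ℚ (V *ℚ d) -ℚ (x *ℚ d) *ℚ B
  expand₃ = ring-∀ ℚ-ring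
  clear-≤ : ∀ l t m k {w} → l *ℚ (d *ℚ B) ≡ ι m -ℚ w → t *ℚ (d *ℚ B) ≡ d → ι k ≤ℚ w +ℚ d → m ≤ k → l ≤ℚ t
  clear-≤ l t m k {w} e₁ e₂ k≤ m≤k = *-cancel-≤ (d *ℚ B) (0<-* (0<ι D) (0<ι2^ e)) (ℚ.≤-trans (ℚ.≤-reflexive e₁)
    (ℚ.≤-trans (by-gap _ (gap (ℚ.≤-trans (ι-mono m≤k) k≤)) (lemma (ι m) w d)) (ℚ.≤-reflexive (sym e₂))))
    where
    lemma : ∀ m w d → d ≡ (m -ℚ w) +ℚ (w +ℚ d -ℚ m)
    lemma = ring-∀ ℚ-ring

positive-limit : ExcludedMiddle 0ℓ → ∀ x → IsCauchy x → ¬ x ≲ const 0ℚ → ∃ λ η → 0ℚ <ℚ η × const η ≲ x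
positive-limit em x cx h =
  let (ε , 0<ε , f) = ≲-fails em x (const 0ℚ) h ; (δ , 0<δ , e) = halve-ε ε 0<ε in
  δ , 0<δ , ≲-total em x (const δ) cx (const-cauchy δ) λ le →
    let (N , g) = le δ 0<δ ; (t , N≤t , lt) = f N in
    ℚ.<-irrefl refl (ℚ.<-≤-trans lt (ℚ.≤-trans (g t N≤t) (ℚ.≤-reflexive (trans e (sym (ℚ.+-identityˡ ε))))))

module Approximation (em : ExcludedMiddle 0ℓ) (n′ : ℕ) (p : Baire) where

  open Hull em n′ p

  numerator denominator : Baire → ℕ → ℕ → ℕ
  numerator Q e k = Q (k + (2 * e) * n)
  denominator Q e k = suc (Q (k + suc (2 * e) * n))

  -- V lists the moments in units of 2^-e.
  Approximates : (ℕ → ℕ) → ℕ → Baire → Set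
  Approximates V e Q = V 0 ≡ 2 ^ e ×
    (∀ k → k < n → distance (numerator Q e k * 2 ^ e) (V (suc k) * denominator Q e k) ≤ denominator Q e k)

  dot total : (ℕ → ℕ) → (ℕ → ℕ) → ℕ
  dot a V = ∑ (suc n) λ k → a k * V k
  total a b = ∑ (suc n) λ k → a k + b k

  module _ (Q : Baire) (y : Fin n → UnitReal) (Qy : Name (Power 𝕀 n) Q y) (a b V : ℕ → ℕ) (e : ℕ) (approx : Approximates V e Q) where

    private
      t x z S : ℚ
      t = 2^- e
      x = ι (dot a V)
      z = ι (dot b V)
      S = ι (total a b)
      W : ℕ → ℚ
      W k = V k /2^ e

    -- The name is within `2^- e` of `y`, and `V` within `2^- e` of the name.
    moment-close : ∀ ε → 0ℚ <ℚ ε → ∀ k → k < suc n → ∃ λ T → ∀ τ → T ≤ τ → ∣ moments y τ k -ℚ W k ∣ ≤ℚ t +ℚ t +ℚ ε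
    moment-close ε 0<ε zero _ = 0 , λ _ _ → ℚ.≤-trans
      (ℚ.≤-reflexive (cong ∣_∣ (trans (cong (λ w → 1ℚ -ℚ w) (trans (cong (_/2^ e) (proj₁ approx)) (trans (ℚ.*-comm (ι (2 ^ e)) (2^- e)) (2^-ι e)))) (ℚ.+-inverseʳ 1ℚ))))
      (0≤-+ (0≤-+ (ℚ.<⇒≤ (0<2^- e)) (ℚ.<⇒≤ (0<2^- e))) (ℚ.<⇒≤ 0<ε))
    moment-close ε 0<ε (suc k) (s≤s k<n) = let (T , f) = Qy (index k) e ε 0<ε in T , λ τ T≤τ →
      combine {(ℤ.+ numerator Q e k) /ℚ denominator Q e k} {seq (y (index k)) τ} {W (suc k)} (subst (λ i → ∣ (ℤ.+ numerator Q e i) /ℚ denominator Q e i -ℚ seq (y (index k)) τ ∣ ≤ℚ t +ℚ ε) index≡ (f τ T≤τ))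
        (ratio-close (numerator Q e k) (Q (k + suc (2 * e) * n)) (V (suc k)) e (proj₂ approx k k<n))
      where
      index≡ : toℕ (index k) ≡ k
      index≡ = trans (Fin.toℕ-fromℕ< (m%n<n k n)) (m<n⇒m%n≡m k<n)
      combine : ∀ {r y w} → ∣ r -ℚ y ∣ ≤ℚ t +ℚ ε → ∣ r -ℚ w ∣ ≤ℚ t → ∣ y -ℚ w ∣ ≤ℚ t +ℚ t +ℚ ε
      combine {r} {y} {w} h h′ = ℚ.≤-trans (triangle y r w) (ℚ.≤-trans (ℚ.+-mono-≤ (ℚ.≤-trans (ℚ.≤-reflexive (∣-∣-sym y r)) h) h′) (ℚ.≤-reflexive (lemma t ε)))
        where
        lemma : ∀ t ε → (t +ℚ ε) +ℚ t ≡ t +ℚ t +ℚ ε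
        lemma = ring-∀ ℚ-ring

    norm≤S : norm (suc n) (difference a b) ≤ℚ S
    norm≤S = ℚ.≤-trans (sum-mono (suc n) λ k _ → ∣∣≤ {difference a b k} {ι (a k) +ℚ ι (b k)} (left {ι (a k)} (0≤ι (b k))) (right {ι (a k)} {ι (b k)} (0≤ι (a k))))
      (ℚ.≤-reflexive (sym (ι-∑ (suc n) λ k _ → ι-+ (a k) (b k))))
      where
      left : ∀ {a b} → 0ℚ ≤ℚ b → a -ℚ b ≤ℚ a +ℚ b
      left {a} {b} 0≤b = by-gap (b +ℚ b) (0≤-+ 0≤b 0≤b) (lemma a b)
        where
        lemma : ∀ a b → a +ℚ b ≡ (a -ℚ b) +ℚ (b +ℚ b)
        lemma = ring-∀ ℚ-ring
      right : ∀ {a b} → 0ℚ ≤ℚ a → -ℚ (a -ℚ b) ≤ℚ a +ℚ b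
      right {a} {b} 0≤a = by-gap (a +ℚ a) (0≤-+ 0≤a 0≤a) (lemma a b)
        where
        lemma : ∀ a b → a +ℚ b ≡ (-ℚ (a -ℚ b)) +ℚ (a +ℚ a)
        lemma = ring-∀ ℚ-ring

    L-dot : ∀ (c : ℕ → ℕ) → L (suc n) (λ k → ι (c k)) W ≡ t *ℚ ι (dot c V)
    L-dot c = trans (sum-cong (suc n) λ k _ → lemma (ι (c k)) (ι (V k)) t) (trans (sum-scale (suc n) t (λ k → ι (c k) *ℚ ι (V k)))
      (cong (t *ℚ_) (sym (ι-∑ (suc n) λ k _ → ι-* (c k) (V k)))))
      where
      lemma : ∀ c v t → c *ℚ (v *ℚ t) ≡ t *ℚ (c *ℚ v)
      lemma = ring-∀ ℚ-ring

    value-close : ∀ ε → 0ℚ <ℚ ε → ∃ λ T → ∀ τ → T ≤ τ → ∣ Λ y (difference a b) τ -ℚ (t *ℚ x -ℚ t *ℚ z) ∣ ≤ℚ S *ℚ (t +ℚ t +ℚ ε)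
    value-close ε 0<ε = let (T , f) = collect (λ k T → ∀ τ → T ≤ τ → ∣ moments y τ k -ℚ W k ∣ ≤ℚ t +ℚ t +ℚ ε)
                                        (λ m≤n h τ le → h τ (ℕ.≤-trans m≤n le)) (suc n) (moment-close ε 0<ε) in
      T , λ τ T≤τ → ℚ.≤-trans
        (ℚ.≤-reflexive (cong ∣_∣ (trans (cong (λ w → Λ y (difference a b) τ -ℚ w) (sym value)) (L-minus (suc n) (difference a b) (moments y τ) W))))
        (ℚ.≤-trans (L-bound (suc n) (difference a b) (λ k → moments y τ k -ℚ W k) (t +ℚ t +ℚ ε) λ k k< → f k k< τ T≤τ)
          (ℚ.*-monoʳ-≤-nonNeg (t +ℚ t +ℚ ε) {{ℚ.nonNegative (0≤-+ (0≤-+ (ℚ.<⇒≤ (0<2^- e)) (ℚ.<⇒≤ (0<2^- e))) (ℚ.<⇒≤ 0<ε))}} norm≤S))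
      where
      value : L (suc n) (difference a b) W ≡ t *ℚ x -ℚ t *ℚ z
      value = trans (L-difference (suc n) a b W) (cong₂ _-ℚ_ (L-dot a) (L-dot b))

    private
      0≤S : 0ℚ ≤ℚ S
      0≤S = 0≤ι (total a b)

    -- An error of `2 * 2^- e` in every moment changes the value by at most `2 * total a b` units of
    -- `2^- e`; an integer excess beyond that is at least one unit.
    value-positive : dot b V + 2 * total a b < dot a V → const t ≲ Λ y (difference a b)
    value-positive lt ε 0<ε = choose (divide (S +ℚ 1ℚ) (positive-+1 S 0≤S) ε 0<ε)
      where
      x≥ : 1ℚ +ℚ (z +ℚ (S +ℚ S)) ≤ℚ x
      x≥ = ℚ.≤-trans (ℚ.≤-reflexive (sym (trans (ι-suc (dot b V + 2 * total a b)) (cong (1ℚ +ℚ_) (trans (ι-+ (dot b V) (2 * total a b)) (cong (z +ℚ_) (ι-2* (total a b)))))))) (ι-mono lt)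
      estimate : ∀ {l δ} → 0ℚ ≤ℚ δ → δ *ℚ (S +ℚ 1ℚ) ≡ ε → ∣ l -ℚ (t *ℚ x -ℚ t *ℚ z) ∣ ≤ℚ S *ℚ (t +ℚ t +ℚ δ) → t ≤ℚ l +ℚ ε
      estimate {l} {δ} 0≤δ e₁ h = by-gap _ (0≤-+ (0≤-+ (gap (ℚ.≤-trans (-≤∣∣ (l -ℚ (t *ℚ x -ℚ t *ℚ z))) h)) (0≤-* (ℚ.<⇒≤ (0<2^- e)) (gap x≥))) 0≤δ)
        (trans (cong (l +ℚ_) (sym e₁)) (lemma l t x z S δ))
        where
        lemma : ∀ l t x z S δ → l +ℚ δ *ℚ (S +ℚ 1ℚ) ≡ t +ℚ ((S *ℚ (t +ℚ t +ℚ δ) -ℚ (-ℚ (l -ℚ (t *ℚ x -ℚ t *ℚ z)))) +ℚ t *ℚ (x -ℚ (1ℚ +ℚ (z +ℚ (S +ℚ S)))) +ℚ δ)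
        lemma = ring-∀ ℚ-ring
      choose : (∃ λ δ → 0ℚ <ℚ δ × δ *ℚ (S +ℚ 1ℚ) ≡ ε) → ∃ λ T → ∀ τ → T ≤ τ → t ≤ℚ Λ y (difference a b) τ +ℚ ε
      choose (δ , 0<δ , e) = let (T , f) = value-close δ 0<δ in T , λ τ T≤τ → estimate {Λ y (difference a b) τ} (ℚ.<⇒≤ 0<δ) e (f τ T≤τ)

    value-small : dot a V ≤ dot b V + 2 * total a b → Λ y (difference a b) ≲ const (t *ℚ (S +ℚ S +ℚ S +ℚ S))
    value-small le ε 0<ε = choose (divide (S +ℚ 1ℚ) (positive-+1 S 0≤S) ε 0<ε)
      where
      x≤ : x ≤ℚ z +ℚ (S +ℚ S)
      x≤ = ℚ.≤-trans (ι-mono le) (ℚ.≤-reflexive (trans (ι-+ (dot b V) (2 * total a b)) (cong (z +ℚ_) (ι-2* (total a b)))))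
      estimate : ∀ {l δ} → 0ℚ ≤ℚ δ → δ *ℚ (S +ℚ 1ℚ) ≡ ε → ∣ l -ℚ (t *ℚ x -ℚ t *ℚ z) ∣ ≤ℚ S *ℚ (t +ℚ t +ℚ δ) → l ≤ℚ t *ℚ (S +ℚ S +ℚ S +ℚ S) +ℚ ε
      estimate {l} {δ} 0≤δ e₁ h = by-gap _ (0≤-+ (0≤-+ (gap (ℚ.≤-trans (≤∣∣ (l -ℚ (t *ℚ x -ℚ t *ℚ z))) h)) (0≤-* (ℚ.<⇒≤ (0<2^- e)) (gap x≤))) 0≤δ)
        (trans (cong (t *ℚ (S +ℚ S +ℚ S +ℚ S) +ℚ_) (sym e₁)) (lemma l t x z S δ))
        where
        lemma : ∀ l t x z S δ → t *ℚ (S +ℚ S +ℚ S +ℚ S) +ℚ δ *ℚ (S +ℚ 1ℚ) ≡ l +ℚ ((S *ℚ (t +ℚ t +ℚ δ) -ℚ (l -ℚ (t *ℚ x -ℚ t *ℚ z))) +ℚ t *ℚ ((z +ℚ (S +ℚ S)) -ℚ x) +ℚ δ)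
        lemma = ring-∀ ℚ-ring
      choose : (∃ λ δ → 0ℚ <ℚ δ × δ *ℚ (S +ℚ 1ℚ) ≡ ε) → ∃ λ T → ∀ τ → T ≤ τ → Λ y (difference a b) τ ≤ℚ t *ℚ (S +ℚ S +ℚ S +ℚ S) +ℚ ε
      choose (δ , 0<δ , e) = let (T , f) = value-close δ 0<δ in T , λ τ T≤τ → estimate {Λ y (difference a b) τ} (ℚ.<⇒≤ 0<δ) e (f τ T≤τ)

  approximation : ∀ Q e → ∃ λ V → Approximates V e Q
  approximation Q e = (λ { zero → 2 ^ e ; (suc k) → numerator Q e k * 2 ^ e / denominator Q e k }) , refl , λ k _ →
    quotient-close (numerator Q e k * 2 ^ e) (Q (k + suc (2 * e) * n))
    where
    quotient-close : ∀ x D → distance x (x / suc D * suc D) ≤ suc D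
    quotient-close x D = ℕ.≤-trans (ℕ.≤-reflexive (trans (cong₂ _+_ (trans (cong (_∸ x / suc D * suc D) (m≡m%n+[m/n]*n x (suc D))) (ℕ.m+n∸n≡m (x % suc D) (x / suc D * suc D)))
        (ℕ.m≤n⇒m∸n≡0 (ℕ.≤-trans (ℕ.m≤n+m (x / suc D * suc D) (x % suc D)) (ℕ.≤-reflexive (sym (m≡m%n+[m/n]*n x (suc D))))))) (ℕ.+-identityʳ (x % suc D))))
      (ℕ.<⇒≤ (m%n<n x (suc D)))

  -- A failed test bounds the value at `y` by `4 * total a b` units of `2^- e`, which is below `η`
  -- for large `e`.
  precise : ∀ Q y → Name (Power 𝕀 n) Q y → ∀ a b η → 0ℚ <ℚ η → const η ≲ Λ y (difference a b) →
            ∃ λ e → ∀ V → Approximates V e Q → dot b V + 2 * total a b < dot a V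
  precise Q y Qy a b η 0<η η≤ = scaled (divide (C₀ +ℚ 1ℚ) (positive-+1 C₀ 0≤C₀) η 0<η)
    where
    S C₀ : ℚ
    S = ι (total a b)
    C₀ = S +ℚ S +ℚ S +ℚ S
    0≤C₀ : 0ℚ ≤ℚ C₀
    0≤C₀ = 0≤-+ (0≤-+ (0≤-+ (0≤ι (total a b)) (0≤ι (total a b))) (0≤ι (total a b))) (0≤ι (total a b))
    scaled : (∃ λ δ → 0ℚ <ℚ δ × δ *ℚ (C₀ +ℚ 1ℚ) ≡ η) → ∃ λ e → ∀ V → Approximates V e Q → dot b V + 2 * total a b < dot a V
    scaled (δ , 0<δ , eq) = let (e , small) = archimedes δ 0<δ in e , λ V approx → ℕ.≰⇒> λ le →
      exceeds e small (const-≲ η (2^- e *ℚ C₀) (≲-trans (const η) (Λ y (difference a b)) (const (2^- e *ℚ C₀)) η≤ (value-small Q y Qy a b V e approx le)))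
      where
      exceeds : ∀ e → 2^- e <ℚ δ → ¬ η ≤ℚ 2^- e *ℚ C₀
      exceeds e small le = ℚ.<-irrefl refl (ℚ.<-≤-trans (ℚ.≤-<-trans le (ℚ.≤-<-trans
        (by-gap (2^- e) (ℚ.<⇒≤ (0<2^- e)) (lemma (2^- e) C₀)) (ℚ.*-monoˡ-<-pos (C₀ +ℚ 1ℚ) {{ℚ.positive (positive-+1 C₀ 0≤C₀)}} small))) (ℚ.≤-reflexive eq))
        where
        lemma : ∀ t c → t *ℚ (c +ℚ 1ℚ) ≡ t *ℚ c +ℚ t
        lemma = ring-∀ ℚ-ring

-- Tests coded by numbers

agree : ℕ → ℕ → Baire → ℕ
agree ρ W f = ∑ ρ λ j → distance (f j) (nth (ρ ∸ suc j) W)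

-- A number m codes a test: the stage, the precision, and for each degree the two coefficients and the approximate moment.
module HullF (n′ : ℕ) where

  n : ℕ
  n = suc n′

  stageᶜ precisionᶜ lengthᶜ : ℕ → ℕ
  stageᶜ m = nth 1 m
  precisionᶜ m = nth 2 m
  -- Entries `2e` and `2e + 1` of all `n` coordinates lie within this prefix.
  lengthᶜ m = (2 + 2 * precisionᶜ m) * n

  plus minus moment : ℕ → ℕ → ℕ
  plus m k = nth (3 + 3 * k) m
  minus m k = nth (4 + 3 * k) m
  moment m k = nth (5 + 3 * k) m

  quadF : ∀ {k} → Fn k → Fn k → Fn k
  quadF s W = call (as (prim (lit 0) (lit 4 ⊗ var (# 1) ⊕ bitsF (var (# 0)) (var (# 2))))
    (λ { _ (s ∷ W ∷ []) → quad (bits W) s }) λ { _ (s ∷ W ∷ []) → natrec-≡ (quad (bits W)) refl (quad-suc (bits W)) s }) (s ∷ W ∷ [])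

  homF : ∀ {k} → Fn (suc k) → Fn k → Fn k → Fn k
  homF c X B = ∑F (lit (suc n)) (c ⊗ wk X ↑ var (# 0) ⊗ wk B ↑ (lit n ⊖ var (# 0)))

  plusF minusF momentF : ∀ {k} → Fn k → Fn k → Fn k
  plusF m k = nthF (lit 3 ⊕ lit 3 ⊗ k) m
  minusF m k = nthF (lit 4 ⊕ lit 3 ⊗ k) m
  momentF m k = nthF (lit 5 ⊕ lit 3 ⊗ k) m

  negative : ℕ → ℕ → Baire → ℕ
  negative s m f = suc (hom n (plus m) (suc (quad f s)) (2 ^ (2 * s))) ∸ hom n (minus m) (quad f s) (2 ^ (2 * s))

  negativeF : Fn 3
  negativeF = as
    (sucF (homF (plusF (var (# 2)) (var (# 0))) (sucF (quadF (var (# 0)) (var (# 2)))) (lit 2 ↑ (lit 2 ⊗ var (# 0)))) ⊖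
     homF (minusF (var (# 2)) (var (# 0))) (quadF (var (# 0)) (var (# 2))) (lit 2 ↑ (lit 2 ⊗ var (# 0))))
    (λ { _ (s ∷ m ∷ X ∷ []) → negative s m (bits X) }) λ { _ (s ∷ m ∷ X ∷ []) → refl }

  -- With `z = 1` nothing is excepted, with `z = 0` the sequences that begin with the word of `W`;
  -- so one test serves both the hull and the descent.
  validity : Baire → ℕ → ℕ → ℕ → ℕ → ℕ → ℕ
  validity p s m z ρ W = ∑ (4 ^ s) λ X → dead p s (code (applyUpTo (bits X) s)) * (z + agree ρ W (bits X)) * negative s m (bits X)

  validityF : Fn 5
  validityF = as
    (∑F (lit 4 ↑ var (# 0)) (call deadF (var (# 1) ∷ takeF (var (# 1)) (bitsF (var (# 0)) (var (# 1))) ∷ []) ⊗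
      (var (# 3) ⊕ ∑F (var (# 4)) (distF (bitsF (var (# 0)) (var (# 1))) (nthF (var (# 5) ⊖ sucF (var (# 0))) (var (# 6))))) ⊗
      call negativeF (var (# 1) ∷ var (# 2) ∷ var (# 0) ∷ [])))
    (λ { p (s ∷ m ∷ z ∷ ρ ∷ W ∷ []) → validity p s m z ρ W }) λ { p (s ∷ m ∷ z ∷ ρ ∷ W ∷ []) → refl }

  -- v codes a prefix of the name of a point of the cube.
  certificate : ℕ → ℕ → ℕ → ℕ
  certificate e m v = distance (moment m 0) (2 ^ e) +
    (∑ n (λ k → distance (nth (k + (2 * e) * n) v * 2 ^ e) (moment m (suc k) * suc (nth (k + suc (2 * e) * n) v)) ∸ suc (nth (k + suc (2 * e) * n) v))) +
    (suc (∑ (suc n) (λ k → minus m k * moment m k) + 2 * ∑ (suc n) (λ k → plus m k + minus m k)) ∸ ∑ (suc n) (λ k → plus m k * moment m k))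

  certificateF : Fn 3
  certificateF = as
    (distF (momentF (var (# 1)) (lit 0)) (lit 2 ↑ var (# 0)) ⊕
     ∑F (lit n) (distF (nthF (var (# 0) ⊕ (lit 2 ⊗ var (# 1)) ⊗ lit n) (var (# 3)) ⊗ lit 2 ↑ var (# 1)) (momentF (var (# 2)) (sucF (var (# 0))) ⊗ den) ⊖ den) ⊕
     (sucF (∑F (lit (suc n)) (minusF (var (# 2)) (var (# 0)) ⊗ momentF (var (# 2)) (var (# 0))) ⊕
       lit 2 ⊗ ∑F (lit (suc n)) (plusF (var (# 2)) (var (# 0)) ⊕ minusF (var (# 2)) (var (# 0)))) ⊖
      ∑F (lit (suc n)) (plusF (var (# 2)) (var (# 0)) ⊗ momentF (var (# 2)) (var (# 0)))))
    (λ { _ (e ∷ m ∷ v ∷ []) → certificate e m v }) λ { _ (e ∷ m ∷ v ∷ []) → refl }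
    where
    den : Fn 4
    den = sucF (nthF (var (# 0) ⊕ sucF (lit 2 ⊗ var (# 1)) ⊗ lit n) (var (# 3)))

  opaque
    test : Baire → ℕ → ℕ → ℕ → ℕ → ℕ → ℕ
    test p m z ρ W v = (ρ ∸ stageᶜ m) + certificate (precisionᶜ m) m v + validity p (stageᶜ m) m z ρ W

    test-def : ∀ p m z ρ W v → (ρ ∸ stageᶜ m) + certificate (precisionᶜ m) m v + validity p (stageᶜ m) m z ρ W ≡ test p m z ρ W v
    test-def p m z ρ W v = refl

  testF : Fn 5
  testF = as ((var (# 2) ⊖ nthF (lit 1) (var (# 0))) ⊕ call certificateF (nthF (lit 2) (var (# 0)) ∷ var (# 0) ∷ var (# 4) ∷ []) ⊕
      call validityF (nthF (lit 1) (var (# 0)) ∷ var (# 0) ∷ var (# 1) ∷ var (# 2) ∷ var (# 3) ∷ []))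
    (λ { p (m ∷ z ∷ ρ ∷ W ∷ v ∷ []) → test p m z ρ W v }) λ { p (m ∷ z ∷ ρ ∷ W ∷ v ∷ []) → test-def p m z ρ W v }

  lengthF : ∀ {k} → Fn k → Fn k
  lengthF m = (lit 2 ⊕ lit 2 ⊗ nthF (lit 2) m) ⊗ lit n

  -- An associate of the open complement of the hull.
  separates : Baire → ℕ → ℕ
  -- The first factor is 0, asking for more digits, until the prefix has the length that the test
  -- needs.
  separates p x = (1 ∸ (1 ∸ drops (lengthᶜ (hd x) ∸ 1) (tl x))) * suc (1 ∸ test p (hd x) 1 0 0 (tl x))

  separatesF : Fn 1
  separatesF = as
    ((lit 1 ⊖ (lit 1 ⊖ dropsF (lengthF (hdF (var (# 0))) ⊖ lit 1) (tlF (var (# 0))))) ⊗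
      sucF (lit 1 ⊖ call testF (hdF (var (# 0)) ∷ lit 1 ∷ lit 0 ∷ lit 0 ∷ tlF (var (# 0)) ∷ [])))
    (λ { p (x ∷ []) → separates p x }) λ { p (x ∷ []) → refl }

  -- The first entry of a test proposes the next digit; words are kept reversed, so that they grow
  -- by `cons`.
  extend : ℕ → ℕ → ℕ
  extend m W = cons (bits m 0) W

  extendF : Fn 3
  extendF = as (consF (bitsF (lit 0) (var (# 0))) (var (# 2))) (λ { _ (m ∷ ρ ∷ W ∷ []) → extend m W }) λ { _ (m ∷ ρ ∷ W ∷ []) → refl }

  check : Baire → ℕ → ℕ → ℕ → ℕ
  check u m ρ W = test (evens u) m 0 (suc ρ) (extend m W) (code (applyUpTo (odds u) (lengthᶜ m)))

  checkF : Fn 3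
  checkF = as (call (rel-to evensF testF) (var (# 0) ∷ lit 0 ∷ sucF (var (# 1)) ∷ extendF ∷ prefixF ∷ []))
    (λ { u (m ∷ ρ ∷ W ∷ []) → check u m ρ W }) λ { u (m ∷ ρ ∷ W ∷ []) → refl }
    where
    prefixF : Fn 3
    prefixF = as (takeF (lengthF (var (# 0))) (call oddsF (var (# 0) ∷ []))) (λ { u (m ∷ ρ ∷ W ∷ []) → code (applyUpTo (odds u) (lengthᶜ m)) })
      λ { u (m ∷ ρ ∷ W ∷ []) → refl }

  historyF : Rec 1
  historyF = prec zero (search checkF extendF)

  answerF : Rec 1
  answerF = comp (prog (hdF (var (# 0)))) (comp historyF (prog (sucF (var (# 0))) ∷ []) ∷ [])

interleave₃ : (ℕ → ℕ) → (ℕ → ℕ) → (ℕ → ℕ) → ℕ → ℕ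
interleave₃ a b c zero                = a 0
interleave₃ a b c (suc zero)          = b 0
interleave₃ a b c (suc (suc zero))    = c 0
interleave₃ a b c (suc (suc (suc i))) = interleave₃ (a ∘ suc) (b ∘ suc) (c ∘ suc) i

interleave₃-at : ∀ a b c k → interleave₃ a b c (3 * k) ≡ a k × interleave₃ a b c (1 + 3 * k) ≡ b k × interleave₃ a b c (2 + 3 * k) ≡ c k
interleave₃-at a b c zero    = refl , refl , refl
interleave₃-at a b c (suc k) = subst (λ i → interleave₃ a b c i ≡ a (suc k) × interleave₃ a b c (1 + i) ≡ b (suc k) × interleave₃ a b c (2 + i) ≡ c (suc k))
  (sym (ℕ.*-suc 3 k)) (interleave₃-at (a ∘ suc) (b ∘ suc) (c ∘ suc) k)

-- The word whose reversal is coded by W.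
word : ℕ → ℕ → Baire
word ρ W j = nth (ρ ∸ suc j) W

agree-zero : ∀ ρ W f → f ~[ ρ ] word ρ W → agree ρ W f ≡ 0
agree-zero ρ W f e = ∑-zero ρ λ j j<ρ → distance-zero (e j j<ρ)

agree-zero⁻ : ∀ ρ W f → agree ρ W f ≡ 0 → f ~[ ρ ] word ρ W
agree-zero⁻ ρ W f z j j<ρ = distance-zero⁻ (f j) (word ρ W j) (∑-zero⁻ ρ z j j<ρ)

word-cons : ∀ ρ β W j → j < ρ → word (suc ρ) (cons β W) j ≡ word ρ W j
word-cons ρ β W j j<ρ = trans (cong (λ i → nth i (cons β W)) (ℕ.+-∸-assoc 1 j<ρ)) (cong hd (drops-cons (ρ ∸ suc j) β W))

word-last : ∀ ρ β W → word (suc ρ) (cons β W) ρ ≡ β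
word-last ρ β W = trans (cong (λ i → nth i (cons β W)) (ℕ.n∸n≡0 ρ)) (hd-cons β W)

module TestSpec (em : ExcludedMiddle 0ℓ) (n′ : ℕ) (p : Baire) where

  open Hull em n′ p hiding (n)
  open Approximation em n′ p
  open HullF n′

  Valid-weaken : ∀ {E E′ : Baire → Set} {s a b} → (∀ f → Binary f → Live s f → E f → E′ f) → Valid E s a b → Valid E′ s a b
  Valid-weaken sub v f bf live ¬e = v f bf live λ e → ¬e (sub f bf live e)

  hom-cong : ∀ {a a′} X B → (∀ k → k < suc n → a k ≡ a′ k) → hom n a X B ≡ hom n a′ X B
  hom-cong X B e = ∑-cong (suc n) λ k k< → cong (λ c → c * X ^ k * B ^ (n ∸ k)) (e k k<)

  Valid-cong : ∀ {E s a a′ b b′} → (∀ k → k < suc n → a k ≡ a′ k) → (∀ k → k < suc n → b k ≡ b′ k) → Valid E s a b → Valid E s a′ b′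
  Valid-cong {E} {s} {a} {a′} {b} {b′} ea eb v f bf live ¬e = subst (_< hom n b′ (quad f s) (2 ^ (2 * s))) (hom-cong {a} {a′} (suc (quad f s)) (2 ^ (2 * s)) ea)
    (subst (hom n a (suc (quad f s)) (2 ^ (2 * s)) <_) (hom-cong {b} {b′} (quad f s) (2 ^ (2 * s)) eb) (v f bf live ¬e))

  entry< : ∀ e k → k < n → k + (2 * e) * n < (2 + 2 * e) * n × k + suc (2 * e) * n < (2 + 2 * e) * n
  entry< e k k<n = ℕ.<-≤-trans (ℕ.+-monoˡ-< ((2 * e) * n) k<n) (ℕ.m≤n+m (n + (2 * e) * n) n) , ℕ.+-monoˡ-< (suc (2 * e) * n) k<n

  Approximates-resp : ∀ {V V′ Q Q′} e → (∀ k → k < suc n → V k ≡ V′ k) → Q ~[ (2 + 2 * e) * n ] Q′ → Approximates V e Q → Approximates V′ e Q′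
  Approximates-resp {V} {V′} {Q} {Q′} e eV eQ (v₀ , h) = trans (sym (eV 0 (s≤s z≤n))) v₀ , λ k k<n → let (lt , lt′) = entry< e k k<n in
    moved (eQ _ lt) (cong suc (eQ _ lt′)) (eV (suc k) (s≤s k<n)) (h k k<n)
    where
    moved : ∀ {N N′ D D′ v v′} → N ≡ N′ → D ≡ D′ → v ≡ v′ → distance (N * 2 ^ e) (v * D) ≤ D → distance (N′ * 2 ^ e) (v′ * D′) ≤ D′
    moved refl refl refl h = h

  Excepted : ℕ → ℕ → ℕ → Baire → Set
  Excepted z ρ W f = z + agree ρ W f ≡ 0

  private
    counted : ℕ → ℕ → ℕ → ℕ → ℕ → Baire → ℕ
    counted s m z ρ W f = dead p s (code (applyUpTo f s)) * (z + agree ρ W f) * negative s m f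

    counted-local : ∀ s m z ρ W → ρ ≤ s → ∀ f g → f ~[ s ] g → counted s m z ρ W f ≡ counted s m z ρ W g
    counted-local s m z ρ W ρ≤s f g e = cong₂ _*_ (cong₂ _*_ (cong (dead p s) (code-cong s e))
        (cong (z +_) (∑-cong ρ λ j j<ρ → cong (λ x → distance x (word ρ W j)) (e j (ℕ.<-≤-trans j<ρ ρ≤s)))))
      (cong (λ q → suc (hom n (plus m) (suc q) (2 ^ (2 * s))) ∸ hom n (minus m) q (2 ^ (2 * s))) (val-cong (2 * s) (node-~ s e)))

  -- By `ρ ≤ s` the exception is visible in the first `s` digits, so the words of length `s` decide
  -- the matter.
  validity-sound : ∀ s m z ρ W → ρ ≤ s → validity p s m z ρ W ≡ 0 → Valid (Excepted z ρ W) s (plus m) (minus m)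
  validity-sound s m z ρ W ρ≤s zero≡ f bf live ¬e = pick (words-zero⁻ s (counted s m z ρ W) (counted-local s m z ρ W ρ≤s) zero≡ f bf)
    where
    pick : counted s m z ρ W f ≡ 0 → hom n (plus m) (suc (quad f s)) (2 ^ (2 * s)) < hom n (minus m) (quad f s) (2 ^ (2 * s))
    pick e = [ (λ e′ → [ (λ d → contradiction (dead-sound p s f d) live) , (λ x → contradiction x ¬e) ]′
        (*-zero⁻ (dead p s (code (applyUpTo f s))) e′)) , ℕ.m∸n≡0⇒m≤n ]′ (*-zero⁻ (dead p s (code (applyUpTo f s)) * (z + agree ρ W f)) e)

  validity-complete : ∀ s m z ρ W → Valid (Excepted z ρ W) s (plus m) (minus m) → validity p s m z ρ W ≡ 0
  validity-complete s m z ρ W v = words-zero s (counted s m z ρ W) λ f bf → put f bf em em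
    where
    put : ∀ f → Binary f → Dec (Dead p s f) → Dec (Excepted z ρ W f) → counted s m z ρ W f ≡ 0
    put f bf (yes d) _       = *-zero (inj₁ (*-zero (inj₁ (dead-complete p s f d))))
    put f bf (no _)  (yes x) = *-zero (inj₁ (*-zero {dead p s (code (applyUpTo f s))} (inj₂ x)))
    put f bf (no l)  (no ¬x) = *-zero {dead p s (code (applyUpTo f s)) * (z + agree ρ W f)} (inj₂ (ℕ.m≤n⇒m∸n≡0 (v f bf l ¬x)))

  Exceeds : (ℕ → ℕ) → (ℕ → ℕ) → (ℕ → ℕ) → Set
  Exceeds a b V = dot b V + 2 * total a b < dot a V

  certificate-sound : ∀ m v → certificate (precisionᶜ m) m v ≡ 0 → Approximates (moment m) (precisionᶜ m) (λ i → nth i v) × Exceeds (plus m) (minus m) (moment m)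
  certificate-sound m v e = (distance-zero⁻ (moment m 0) (2 ^ precisionᶜ m) (ℕ.m+n≡0⇒m≡0 X (ℕ.m+n≡0⇒m≡0 (X + Y) e)) ,
      λ k k<n → ℕ.m∸n≡0⇒m≤n (∑-zero⁻ n (ℕ.m+n≡0⇒n≡0 X (ℕ.m+n≡0⇒m≡0 (X + Y) e)) k k<n)) ,
    ℕ.m∸n≡0⇒m≤n (ℕ.m+n≡0⇒n≡0 (X + Y) e)
    where
    X Y : ℕ
    X = distance (moment m 0) (2 ^ precisionᶜ m)
    Y = ∑ n λ k → distance (numerator (λ i → nth i v) (precisionᶜ m) k * 2 ^ precisionᶜ m) (moment m (suc k) * denominator (λ i → nth i v) (precisionᶜ m) k) ∸ denominator (λ i → nth i v) (precisionᶜ m) k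

  certificate-complete : ∀ m v → Approximates (moment m) (precisionᶜ m) (λ i → nth i v) → Exceeds (plus m) (minus m) (moment m) → certificate (precisionᶜ m) m v ≡ 0
  certificate-complete m v (v₀ , h) lt = cong₂ _+_ (cong₂ _+_ (distance-zero v₀) (∑-zero n λ k k<n → ℕ.m≤n⇒m∸n≡0 (h k k<n))) (ℕ.m≤n⇒m∸n≡0 lt)

  test-sound : ∀ m z ρ W v → test p m z ρ W v ≡ 0 →
               ρ ≤ stageᶜ m × (Approximates (moment m) (precisionᶜ m) (λ i → nth i v) × Exceeds (plus m) (minus m) (moment m)) ×
               Valid (Excepted z ρ W) (stageᶜ m) (plus m) (minus m)
  test-sound m z ρ W v e = ρ≤s , certificate-sound m v (ℕ.m+n≡0⇒n≡0 (ρ ∸ stageᶜ m) e₁) ,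
    validity-sound (stageᶜ m) m z ρ W ρ≤s (ℕ.m+n≡0⇒n≡0 ((ρ ∸ stageᶜ m) + certificate (precisionᶜ m) m v) e₀)
    where
    e₀ = trans (test-def p m z ρ W v) e
    e₁ = ℕ.m+n≡0⇒m≡0 ((ρ ∸ stageᶜ m) + certificate (precisionᶜ m) m v) e₀
    ρ≤s : ρ ≤ stageᶜ m
    ρ≤s = ℕ.m∸n≡0⇒m≤n (ℕ.m+n≡0⇒m≡0 (ρ ∸ stageᶜ m) e₁)

  -- The prefix `v` is quantified last, because the length that has to be read is determined by `m`.
  test-complete : ∀ z ρ W β s e a b V Q → β < 2 → ρ ≤ s → Valid (Excepted z ρ W) s a b → Approximates V e Q → Exceeds a b V →
                  ∃ λ m → bits m 0 ≡ β × (∀ v → (λ i → nth i v) ~[ lengthᶜ m ] Q → test p m z ρ W v ≡ 0)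
  test-complete z ρ W β s e a b V Q β<2 ρ≤s valid approx exceeds = m , bit≡ , λ v v≡ → trans (sym (test-def p m z ρ W v)) (cong₂ _+_ (cong₂ _+_
      (ℕ.m≤n⇒m∸n≡0 (ℕ.≤-trans ρ≤s (ℕ.≤-reflexive (sym (nth≡ 1 (s≤s (s≤s z≤n)))))))
      (certificate-complete m v
        (subst (λ e → Approximates (moment m) e (λ i → nth i v)) (sym precision≡)
          (Approximates-resp {V} {moment m} {Q} {λ i → nth i v} e (λ k k< → sym (proj₂ (proj₂ (coefficients k k<))))
            (~-sym (subst (λ e → (λ i → nth i v) ~[ (2 + 2 * e) * n ] Q) precision≡ v≡)) approx))
        exceeds′))
      (validity-complete (stageᶜ m) m z ρ W (subst (λ s → Valid (Excepted z ρ W) s (plus m) (minus m)) (sym (nth≡ 1 (s≤s (s≤s z≤n))))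
        (Valid-cong {Excepted z ρ W} {s} {a} {plus m} {b} {minus m} (λ k k< → sym (proj₁ (coefficients k k<))) (λ k k< → sym (proj₁ (proj₂ (coefficients k k<)))) valid))))
    where
    M : ℕ → ℕ
    M zero                = β
    M (suc zero)          = s
    M (suc (suc zero))    = e
    M (suc (suc (suc i))) = interleave₃ a b V i
    m : ℕ
    m = code (applyUpTo M (3 + 3 * suc n))
    nth≡ : ∀ i → i < 3 + 3 * suc n → nth i m ≡ M i
    nth≡ = nth-code M
    precision≡ : precisionᶜ m ≡ e
    precision≡ = nth≡ 2 (s≤s (s≤s (s≤s z≤n)))
    bit≡ : bits m 0 ≡ β
    bit≡ = trans (cong (λ z → 1 ∸ (1 ∸ z)) (nth≡ 0 (s≤s z≤n))) (clip β β<2)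
      where
      clip : ∀ x → x < 2 → 1 ∸ (1 ∸ x) ≡ x
      clip zero          _ = refl
      clip (suc zero)    _ = refl
      clip (suc (suc x)) (s≤s (s≤s ()))
    coefficients : ∀ k → k < suc n → plus m k ≡ a k × minus m k ≡ b k × moment m k ≡ V k
    coefficients k k< = let (ea , eb , ec) = interleave₃-at a b V k in
      trans (nth≡ (3 + 3 * k) (inside 0 (s≤s z≤n))) ea , trans (nth≡ (4 + 3 * k) (inside 1 (s≤s (s≤s z≤n)))) eb , trans (nth≡ (5 + 3 * k) (inside 2 (s≤s (s≤s (s≤s z≤n))))) ec
      where
      inside : ∀ d → d < 3 → 3 + (d + 3 * k) < 3 + 3 * suc n
      inside d d<3 = ℕ.+-monoʳ-< 3 (ℕ.<-≤-trans (ℕ.+-monoˡ-< (3 * k) d<3) (ℕ.≤-trans (ℕ.≤-reflexive (sym (ℕ.*-suc 3 k))) (ℕ.*-monoʳ-≤ 3 k<)))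
    exceeds′ : Exceeds (plus m) (minus m) (moment m)
    exceeds′ = ≡.subst₂ _<_
      (cong₂ (λ x y → x + 2 * y) (∑-cong (suc n) λ k k< → let (_ , eb , ec) = coefficients k k< in sym (cong₂ _*_ eb ec))
        (∑-cong (suc n) λ k k< → let (ea , eb , _) = coefficients k k< in sym (cong₂ _+_ ea eb)))
      (∑-cong (suc n) λ k k< → let (ea , _ , ec) = coefficients k k< in sym (cong₂ _*_ ea ec)) exceeds

-- The hull as a closed set, and the descent from its points

module HullSet (em : ExcludedMiddle 0ℓ) (n′ : ℕ) (p : Baire) where

  open Hull em n′ p hiding (n)
  open Approximation em n′ p
  open HullF n′
  open TestSpec em n′ p

  certify : ∀ Q y → Name (Power 𝕀 n) Q y → ∀ a b η → 0ℚ <ℚ η → const η ≲ Λ y (difference a b) →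
            ∃ λ e → ∃ λ V → Approximates V e Q × Exceeds a b V
  certify Q y Qy a b η 0<η η≤ =
    let (e , f) = precise Q y Qy a b η 0<η η≤ ; (V , approx) = approximation Q e in e , V , approx , f V approx

  separates-cons : ∀ m c → separates p (cons m c) ≡ (1 ∸ (1 ∸ drops (lengthᶜ m ∸ 1) c)) * suc (1 ∸ test p m 1 0 0 c)
  separates-cons m c = cong₂ (λ m c → (1 ∸ (1 ∸ drops (lengthᶜ m ∸ 1) c)) * suc (1 ∸ test p m 1 0 0 c)) (hd-cons m c) (tl-cons m c)

  module _ (q : Baire) (y : Fin n → UnitReal) (qy : Name (Power 𝕀 n) q y) where

    prefixᶜ : ℕ → ℕ
    prefixᶜ m = code (applyUpTo q (lengthᶜ m))

    verdict : Baire
    verdict m = 1 ∸ test p m 1 0 0 (prefixᶜ m)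

    verdict-graph : graph (associate (separates p)) q verdict
    verdict-graph m = lengthᶜ m , answered , λ k k< → trans (separates-cons m (code (applyUpTo q k)))
        (*-zero (inj₁ (trans (cong (λ d → 1 ∸ (1 ∸ d)) (drops-short q (lengthᶜ m ∸ 1) k (s≤s⁻¹ k<))) refl)))
      where
      answered : separates p (cons m (prefixᶜ m)) ≡ suc (verdict m)
      answered = trans (separates-cons m (prefixᶜ m)) (trans (cong (λ d → (1 ∸ d) * suc (verdict m))
        (not-zero (drops-long q (lengthᶜ m ∸ 1) (lengthᶜ m) ℕ.≤-refl))) (ℕ.*-identityˡ (suc (verdict m))))

    verdict-sound : (∃ λ m → verdict m ≢ 0) → ¬ InHull y
    verdict-sound (m , ne) y∈ = refute (test-sound m 1 0 0 (prefixᶜ m) (passes (test p m 1 0 0 (prefixᶜ m)) ne))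
      where
      passes : ∀ t → 1 ∸ t ≢ 0 → t ≡ 0
      passes zero    _ = refl
      passes (suc t) h = contradiction (ℕ.0∸n≡0 t) h
      refute : _ → ⊥
      refute (_ , (approx , exceeds) , v) = ℚ.<-irrefl refl (ℚ.<-≤-trans (0<2^- (precisionᶜ m))
        (const-≲ (2^- precisionᶜ m) 0ℚ (≲-trans (const (2^- precisionᶜ m)) (Λ y (difference (plus m) (minus m))) (const 0ℚ)
          (value-positive q y qy (plus m) (minus m) (moment m) (precisionᶜ m)
            (Approximates-resp {moment m} {moment m} {λ i → nth i (prefixᶜ m)} {q} (precisionᶜ m) (λ _ _ → refl) (λ i i< → nth-code q i i<) approx) exceeds)
          (y∈ (plus m) (minus m) (stageᶜ m) (Valid-weaken {Excepted 1 0 0} {λ _ → ⊥} {stageᶜ m} {plus m} {minus m} (λ _ _ _ ()) v)))))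

    verdict-complete : ¬ InHull y → ∃ λ m → verdict m ≢ 0
    verdict-complete y∉ = tests (¬∀ em y∉)
      where
      accepted : ∀ a b s → Valid (λ _ → ⊥) s a b → (∃ λ η → 0ℚ <ℚ η × const η ≲ Λ y (difference a b)) → ∃ λ m → verdict m ≢ 0
      accepted a b s v (η , 0<η , η≤) = coded (certify q y qy a b η 0<η η≤)
        where
        coded : (∃ λ e → ∃ λ V → Approximates V e q × Exceeds a b V) → ∃ λ m → verdict m ≢ 0
        coded (e , V , approx , exceeds) = conclude (test-complete 1 0 0 0 s e a b V q (s≤s z≤n) z≤n
            (Valid-weaken {λ _ → ⊥} {Excepted 1 0 0} {s} {a} {b} (λ _ _ _ ()) v) approx exceeds)
          where
          conclude : (∃ λ m → bits m 0 ≡ 0 × (∀ v → (λ i → nth i v) ~[ lengthᶜ m ] q → test p m 1 0 0 v ≡ 0)) → ∃ λ m → verdict m ≢ 0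
          conclude (m , _ , passes) = m , λ z → contradiction (trans (sym z) (cong (1 ∸_) (passes (prefixᶜ m) (λ i i< → nth-code q i i<)))) λ ()
      tests : (∃ λ a → ¬ (∀ b s → Valid (λ _ → ⊥) s a b → Λ y (difference a b) ≲ const 0ℚ)) → ∃ λ m → verdict m ≢ 0
      tests (a , h₁) = tests₂ (¬∀ em h₁)
        where
        tests₂ : (∃ λ b → ¬ (∀ s → Valid (λ _ → ⊥) s a b → Λ y (difference a b) ≲ const 0ℚ)) → ∃ λ m → verdict m ≢ 0
        tests₂ (b , h₂) = tests₃ (¬∀ em h₂)
          where
          tests₃ : (∃ λ s → ¬ (Valid (λ _ → ⊥) s a b → Λ y (difference a b) ≲ const 0ℚ)) → ∃ λ m → verdict m ≢ 0
          tests₃ (s , h₃) = accepted a b s (proj₁ (¬→ em h₃)) (positive-limit em (Λ y (difference a b)) (Λ-cauchy y (difference a b)) (proj₂ (¬→ em h₃)))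

  -- The open complement is described by the negation of `InHull`, whence the double negations.
  hull-set : ∃ λ B → Name (𝒜 (Power 𝕀 n)) (separates p) B × (∀ y → _∈_ {Power 𝕀 n} y B → ¬ ¬ InHull y) × (∀ y → ¬ ¬ InHull y → _∈_ {Power 𝕀 n} y B)
  hull-set = closed em (Power 𝕀 n) (λ y → ¬ InHull y)
    (λ {x} {y} e x∉ y∈ → x∉ (InHull-resp y x (λ i → ≃-sym (seq (x i)) (seq (y i)) (e i)) y∈)) (separates p)
    λ q y qy → verdict q y qy , verdict-graph q y qy , verdict-sound q y qy , verdict-complete q y qy

  module Descent (N : ℕ) (N≤ : N ≤ suc n) (α : ℕ → Baire) (αb : ∀ i → Binary (α i))
                 (alive : ∀ i → i < N → ∀ s → Live s (α i))
                 (cover : ∀ f → Binary f → (∀ s → Live s f) → ∃ λ i → i < N × f ≗ α i)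
                 (distinct : ∀ i j → i < N → j < N → α i ≗ α j → i ≡ j)
                 (q : Baire) (y : Fin n → UnitReal) (qy : Name (Power 𝕀 n) q y) (y∈ : InHull y) where

    u : Baire
    u = ⟨ p , q ⟩

    qy′ : Name (Power 𝕀 n) (odds u) y
    qy′ = RepresentedSpace.Name-resp (Power 𝕀 n) {q} {odds u} {y} {y} (λ i → sym (⟨⟩-odd p q i)) (λ i → ≃-refl (seq (y i))) qy

    test-ext : ∀ {p p′} → p ≗ p′ → ∀ m z ρ W v → test p m z ρ W v ≡ test p′ m z ρ W v
    test-ext e m z ρ W v = Fn-ext testF (m ∷ z ∷ ρ ∷ W ∷ v ∷ []) e

    check≡ : ∀ m ρ W → check u m ρ W ≡ test p m 0 (suc ρ) (extend m W) (code (applyUpTo (odds u) (lengthᶜ m)))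
    check≡ m ρ W = test-ext (⟨⟩-even p q) m 0 (suc ρ) (extend m W) (code (applyUpTo (odds u) (lengthᶜ m)))

    found : ∀ ρ W → Certified y ρ (word ρ W) → ∃ λ m → check u m ρ W ≡ 0
    found ρ W cert = next (Points.refine em n′ p N N≤ α αb alive cover distinct y y∈ ρ (word ρ W) cert)
      where
      next : (∃ λ i → i < N × α i ~[ ρ ] word ρ W × Certified y (suc ρ) (α i)) → ∃ λ m → check u m ρ W ≡ 0
      next (i , _ , e , a , b , s , η , ρ<s , v , 0<η , η≤) =
        let (pr , V , approx , exceeds) = certify (odds u) y qy′ a b η 0<η η≤
            (m , bit , ok) = test-complete 0 (suc ρ) (cons (α i ρ) W) (α i ρ) s pr a b V (odds u) (αb i ρ) ρ<s
              (Valid-weaken {λ f → f ~[ suc ρ ] α i} {Excepted 0 (suc ρ) (cons (α i ρ) W)} {s} {a} {b}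
                (λ f _ _ f~ → agree-zero (suc ρ) (cons (α i ρ) W) f (~-trans f~ branch)) v) approx exceeds
        in m , trans (check≡ m ρ W) (subst (λ β → test p m 0 (suc ρ) (cons β W) (code (applyUpTo (odds u) (lengthᶜ m))) ≡ 0) (sym bit)
             (ok (code (applyUpTo (odds u) (lengthᶜ m))) (λ j j< → nth-code (odds u) j j<)))
        where
        branch : α i ~[ suc ρ ] word (suc ρ) (cons (α i ρ) W)
        branch j j<1+ρ = split (ℕ.m<1+n⇒m<n∨m≡n j<1+ρ)
          where
          split : j < ρ ⊎ j ≡ ρ → α i j ≡ word (suc ρ) (cons (α i ρ) W) j
          split (inj₁ j<ρ)  = trans (e j j<ρ) (sym (word-cons ρ (α i ρ) W j j<ρ))
          split (inj₂ refl) = sym (word-last ρ (α i ρ) W)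

    State : ℕ → Set
    State ρ = ∃ λ W → u ⊨ historyF [ ρ ∷ [] ]⇓ W × Certified y ρ (word ρ W)

    opaque
      -- The test found need not be the one whose existence `refine` shows, nor its digit that of
      -- the same node; what is carried on is the certificate contained in its success.
      step : ∀ ρ (S : State ρ) → ∃ λ m → u ⊨ historyF [ suc ρ ∷ [] ]⇓ extend m (proj₁ S) × Certified y (suc ρ) (word (suc ρ) (extend m (proj₁ S)))
      step ρ (W , run , cert) =
        let (m , z , found-m) = search-⇓ checkF extendF u (ρ ∷ W ∷ []) (found ρ W cert)
            (ρ<s , (approx , exceeds) , v) = test-sound m 0 (suc ρ) (extend m W) (code (applyUpTo (odds u) (lengthᶜ m))) (trans (sym (check≡ m ρ W)) z)
        in m , precₛ run found-m , plus m , minus m , stageᶜ m , 2^- precisionᶜ m , ρ<s ,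
           Valid-weaken {Excepted 0 (suc ρ) (extend m W)} {λ f → f ~[ suc ρ ] word (suc ρ) (extend m W)} {stageᶜ m} {plus m} {minus m}
             (λ f _ _ e → agree-zero⁻ (suc ρ) (extend m W) f e) v ,
           0<2^- (precisionᶜ m) ,
           value-positive (odds u) y qy′ (plus m) (minus m) (moment m) (precisionᶜ m)
             (Approximates-resp {moment m} {moment m} {λ i → nth i (code (applyUpTo (odds u) (lengthᶜ m)))} {odds u} (precisionᶜ m) (λ _ _ → refl)
               (λ i i< → nth-code (odds u) i i<) approx) exceeds

    -- The test 1 > 0, with every sequence excepted.
    start : Certified y 0 (word 0 0)
    start = one , (λ _ → 0) , 0 , 1ℚ , z≤n , (λ f _ _ ¬e → contradiction (λ _ ()) ¬e) , ℚ.positive⁻¹ 1ℚ ,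
      ≲-≤ (const 1ℚ) (Λ y (difference one (λ _ → 0))) 0 λ t _ → ℚ.≤-reflexive (sym
        (trans (sum-cong (suc n) λ { zero _ → cong (_*ℚ 1ℚ) unit ; (suc k) _ → cong (_*ℚ moments y t (suc k)) null }) (L-one n (moments y t))))
      where
      one : ℕ → ℕ
      one zero    = 1
      one (suc _) = 0
      unit : ι 1 -ℚ ι 0 ≡ 1ℚ
      unit = cong₂ _-ℚ_ ι-1 ι-0
      null : ι 0 -ℚ ι 0 ≡ 0ℚ
      null = ℚ.+-inverseʳ (ι 0)

    state : ∀ ρ → State ρ
    state zero    = 0 , prec₀ zero , start
    state (suc ρ) = let (m , run , cert) = step ρ (state ρ) in extend m (proj₁ (state ρ)) , run , cert

    output : Baire
    output ρ = hd (proj₁ (state (suc ρ)))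

    bit : ℕ → ℕ
    bit ρ = bits (proj₁ (step ρ (state ρ))) 0

    output≡ : ∀ ρ → output ρ ≡ bit ρ
    output≡ ρ = hd-cons (bit ρ) (proj₁ (state ρ))

    output-binary : Binary output
    output-binary ρ = subst (_< 2) (sym (output≡ ρ)) (bits-binary (proj₁ (step ρ (state ρ))) 0)

    output-⇓ : ∀ ρ → u ⊨ answerF [ ρ ∷ [] ]⇓ output ρ
    output-⇓ ρ = comp (comp (ok (sucF (var (# 0))) u (ρ ∷ []) ∷ []) (proj₁ (proj₂ (state (suc ρ)))) ∷ []) (ok (hdF (var (# 0))) u (proj₁ (state (suc ρ)) ∷ []))

    output-word : ∀ ρ → output ~[ ρ ] word ρ (proj₁ (state ρ))
    output-word (suc ρ) j j<1+ρ = split (ℕ.m<1+n⇒m<n∨m≡n j<1+ρ)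
      where
      split : j < ρ ⊎ j ≡ ρ → output j ≡ word (suc ρ) (proj₁ (state (suc ρ))) j
      split (inj₁ j<ρ)  = trans (output-word ρ j j<ρ) (sym (word-cons ρ (bit ρ) (proj₁ (state ρ)) j j<ρ))
      split (inj₂ refl) = trans (output≡ ρ) (sym (word-last ρ (bit ρ) (proj₁ (state ρ))))

    -- If the output left the closed set, some test without exceptions would be violated at y.
    output-alive : ∀ s → Live s output
    output-alive s d = refute (proj₂ (proj₂ (state s)))
      where
      refute : Certified y s (word s (proj₁ (state s))) → ⊥
      refute (a , b , s′ , η , s≤s′ , v , 0<η , η≤) = ℚ.<-irrefl refl (ℚ.<-≤-trans 0<η (const-≲ η 0ℚ
        (≲-trans (const η) (Λ y (difference a b)) (const 0ℚ) η≤ (y∈ a b s′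
          (Valid-weaken {λ f → f ~[ s ] word s (proj₁ (state s))} {λ _ → ⊥} {s′} {a} {b}
            (λ f _ live e → live (Dead-mono {p} {f} s≤s′ (Dead-local {p} {output} {f} (~-trans (output-word s) (~-sym e)) d))) v)))))

-- Finite choice below convex choice, and the equivalence

module _ (em : ExcludedMiddle 0ℓ) (i n′ : ℕ) (i≤n : i ≤ suc n′) where

  open HullF n′

  private
    module _ (p : Baire) (A : Carrier (𝒜 (Seq 2))) (pA : Name (𝒜 (Seq 2)) p A) (M : ℕ) (M≤ : suc M ≤ i + 1)
             (card : HasCardinality (RepresentedSpace.setoid (Seq 2)) (λ x → _∈_ {Seq 2} x A) (suc M)) where

      open Hull em n′ p hiding (n)
      open HullSet em n′ p

      -- Reducing the index modulo the number of points makes the listing total.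
      member : ℕ → Carrier (Seq 2)
      member k = proj₁ (Bijection.to card (fromℕ< (m%n<n k (suc M))))

      member∈ : ∀ k → _∈_ {Seq 2} (member k) A
      member∈ k = proj₂ (Bijection.to card (fromℕ< (m%n<n k (suc M))))

      α : ℕ → Baire
      α k j = toℕ (member k j)

      α-binary : ∀ k → Binary (α k)
      α-binary k j = Fin.toℕ<n (member k j)

      α-alive : ∀ k → k < suc M → ∀ s → Live s (α k)
      α-alive k _ = member-alive {Seq 2} {p} {A} pA {α k} {member k} (λ _ → refl) (member∈ k)

      live-member : ∀ f (b : Binary f) → (∀ s → Live s f) → _∈_ {Seq 2} (toSeq f b) A
      live-member f b live = dne em λ x∉A →
        let (s , d) = nonmember-dead {Seq 2} {p} {A} pA {f} {toSeq f b} (λ j → sym (Fin.toℕ-fromℕ< (b j))) x∉A in live s d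

      α-cover : ∀ f → Binary f → (∀ s → Live s f) → ∃ λ k → k < suc M × f ≗ α k
      α-cover f b live =
        let (k , h) = Bijection.surjective card (toSeq f b , live-member f b live)
            k≡ : fromℕ< (m%n<n (toℕ k) (suc M)) ≡ k
            k≡ = Fin.toℕ-injective (trans (Fin.toℕ-fromℕ< (m%n<n (toℕ k) (suc M))) (m<n⇒m%n≡m (Fin.toℕ<n k)))
        in toℕ k , Fin.toℕ<n k , λ j → trans (sym (Fin.toℕ-fromℕ< (b j))) (cong toℕ (sym (h k≡ j)))

      α-distinct : ∀ k l → k < suc M → l < suc M → α k ≗ α l → k ≡ l
      α-distinct k l k< l< e = trans (sym (m<n⇒m%n≡m k<)) (trans (sym (Fin.toℕ-fromℕ< (m%n<n k (suc M))))
        (trans (cong toℕ (Bijection.injective card (λ j → Fin.toℕ-injective (e j)))) (trans (Fin.toℕ-fromℕ< (m%n<n l (suc M))) (m<n⇒m%n≡m l<))))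

      -- Polynomials of degree `n` interpolate at `n + 1` nodes, and this is where `i ≤ n` enters.
      M≤n : suc M ≤ suc n
      M≤n = ℕ.≤-trans M≤ (ℕ.≤-trans (ℕ.≤-reflexive (ℕ.+-comm i 1)) (s≤s i≤n))

      hull : Carrier (𝒜 (Power 𝕀 n))
      hull = proj₁ hull-set

      hull-name : Name (𝒜 (Power 𝕀 n)) (separates p) hull
      hull-name = proj₁ (proj₂ hull-set)

      hull-member : ∀ y → InHull y → _∈_ {Power 𝕀 n} y hull
      hull-member y y∈ = proj₂ (proj₂ (proj₂ hull-set)) y λ y∉ → y∉ y∈

      hull-member⁻ : ∀ y → _∈_ {Power 𝕀 n} y hull → InHull y
      hull-member⁻ y y∈ = dne em (proj₁ (proj₂ (proj₂ hull-set)) y y∈)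

      hull-Convex : Convex hull
      hull-Convex x y z t x∈ y∈ z≃ = hull-member z (hull-convex x y z t (hull-member⁻ x x∈) (hull-member⁻ y y∈) z≃)

      inhabited : ∃ λ y → Convex hull × _∈_ {Power 𝕀 n} y hull
      inhabited = curve (α 0) (α-binary 0) , hull-Convex , hull-member (curve (α 0) (α-binary 0)) (curve-InHull (α 0) (α-binary 0) (α-alive 0 (s≤s z≤n)))

      outcome : ∀ q y → Name (Power 𝕀 n) q y → _∈_ {Power 𝕀 n} y hull →
                ∃ λ o → (∀ k → ⟨ p , q ⟩ ⊨ answerF [ k ∷ [] ]⇓ o k) × ∃ λ x → Name (Seq 2) o x × _∈_ {Seq 2} x A
      outcome q y qy y∈ = output , output-⇓ , toSeq output output-binary , (λ j → sym (Fin.toℕ-fromℕ< (output-binary j))) ,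
        live-member output output-binary output-alive
        where open Descent (suc M) M≤n α α-binary α-alive α-cover α-distinct q y qy (hull-member⁻ y y∈)

  C♯≤XC : C♯≤ (i + 1) ≤W XC n
  C♯≤XC = computes (prog separatesF) , computes answerF , computes-computable (prog separatesF) , computes-computable answerF ,
    λ { G G⊢ p A pA (x , (suc M , _ , M≤ , card) , x∈A) →
      let (q , g↦q , y , qy , _ , y∈) = G⊢ (separates p) (hull p A pA M M≤ card) (hull-name p A pA M M≤ card) (inhabited p A pA M M≤ card)
          (o , o-ok , w , ow , w∈A) = outcome p A pA M M≤ card q y qy y∈
      in o , (⟨ p , q ⟩ , (q , (separates p , (λ s → ok separatesF p (s ∷ [])) , g↦q) , λ _ → refl) , o-ok) ,
         w , ow , (suc M , s≤s z≤n , M≤ , card) , w∈A }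

mainTheorem1 : ExcludedMiddle 0ℓ →
  ∀ (i j k : ℕ) → 1 ≤ i → 1 ≤ j → 1 ≤ k →
  (C♯≤ (i + 1) ≤W XC j × XC j ≤W Sort (k + 1)) ⇔ (i ≤ j × j ≤ k)
mainTheorem1 em i (suc n′) k _ _ _ = mk⇔
  (λ (f , g) →
    -- Convex choice in dimension `j` always reduces to sorting of `j + 1` symbols, too few for
    -- `i + 1` points.
    ℕ.≮⇒≥ (λ j<i → C♯≰Sort em (ℕ.+-monoˡ-< 1 j<i)
      (≤W-trans {f = C♯≤ (i + 1)} {g = XC (suc n′)} {h = Sort (suc n′ + 1)} f (XC≤Sort em n′ (suc n′) ℕ.≤-refl))) ,
    -- Choice on `j + 1` points always reduces to convex choice in dimension `j`, so `k + 1` symbols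
    -- would be too few.
    ℕ.≮⇒≥ (λ k<j → C♯≰Sort em (ℕ.+-monoˡ-< 1 k<j)
      (≤W-trans {f = C♯≤ (suc n′ + 1)} {g = XC (suc n′)} {h = Sort (k + 1)} (C♯≤XC em (suc n′) n′ ℕ.≤-refl) g)))
  (λ (i≤j , j≤k) → C♯≤XC em i n′ i≤j , XC≤Sort em n′ k j≤k)
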